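{- For $1\le j\le L$ let $\mathcal{K}_j\subseteq\mathbb{Z}^+$ be finite and let $h_j(u)=\sum_{r\in\mathcal{K}_j\cup\{0\}}c_{j,r}u^r\in\mathbb{F}_q[t][u]$ be supported on $\mathcal{K}_j$; let $\mathcal{K}=\mathcal{K}_1\cup\dots\cup\mathcal{K}_L$. Suppose the system satisfies Condition $(\star)$: for every $g\in\mathbb{F}_q[t]\setminus\{0\}$ there exists $m_g\in\mathbb{F}_q[t]$ with $h_i(m_g)\equiv0\pmod g$ for all $1\le i\le L$. Suppose also that the maximal $\mathcal{K}^*$-portion of $(h_j)_{j=1}^L$ is linearly independent. Let $(r_x)_{x\in\mathbb{F}_q[t]\setminus\{0\}}\subseteq\mathbb{F}_q[t]$ be a sequence associated to the system, i.e. such that for all $m,y\in\mathbb{F}_q[t]\setminus\{0\}$: $r_y\in\mathbb{G}_{\deg y}$, $r_{my}\equiv r_y\pmod y$, and $h_j(r_y)\equiv 0\pmod y$ for $1\le j\le L$. Then there exist $\theta=\theta(\mathcal{K},q,\max_{1\le j\le L}\deg h_j)>0$, $\sigma=\sigma(h_1,\dots,h_L)>0$ and $N_0=N_0(\mathcal{K},q,\theta,\sigma,h_1,\dots,h_L)\in\mathbb{Z}^+$ such that for every integer $N>N_0$ the following holds: given any nonzero $d\in\mathbb{F}_q[t]$ with $\deg d<\lfloor\sigma N\rfloor$ and any $\beta_1,\dots,\beta_L\in\mathbb{K}_\infty$, there exists $n\in\mathbb{G}_N$ with $n\equiv r_d\pmod d$ and $$\operatorname{ord}\{\beta_1h_1(n)+\dots+\beta_Lh_L(n)\}\le-\theta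 N.$$
   Context: $\mathbb{F}_q$ is the finite field with $q$ elements, $p$ its characteristic. $\mathbb{K}=\mathbb{F}_q(t)$ and $\mathbb{K}_\infty=\mathbb{F}_q((1/t))$ is the field of formal Laurent series $\alpha=\sum_{i=-\infty}^n a_it^i$. For $\alpha\neq0$ with leading coefficient $a_n\ne0$, $\operatorname{ord}\alpha=n$; $\operatorname{ord}0=-\infty$. The fractional part is $\{\alpha\}=\sum_{i\le -1}a_it^i$. $\mathbb{G}_N$ is the set of polynomials in $\mathbb{F}_q[t]$ of degree less than $N$ (including $0$). For $j,r\in\mathbb{Z}^+$ write $j\preceq_p r$ if $p\nmid\binom{r}{j}$; this is a partial order. For $\mathcal{K}\subseteq\mathbb{Z}^+$, an element $k\in\mathcal{K}$ is maximal in $\mathcal{K}$ if there is no $r\in\mathcal{K}$, $r\neq k$, with $k\preceq_p r$. $\mathcal{S}(\mathcal{K})=\{j\in\mathbb{Z}^+: j\preceq_p r\text{ for some } r\in\mathcal{K}\}$ and $\mathcal{K}^*=\{k\in\mathcal{K}: p\nmid k\text{ and } p^vk\notin\mathcal{S}(\mathcal{K})\text{ for every } v\in\mathbb{Z}^+\}$. A polynomial is supported on $\mathcal{K}$ if it equals $\sum_{r\in\mathcal{K}\cup\{0\}}\alpha_ru^r$ with $\alpha_r\ne0$ for all $r\in\mathcal{K}$. The maximal $\mathcal{K}^*$-portion of $h_j$ is $h_j^{\max}(u)=\sum_{r\in\mathcal{K}_j\cap\mathcal{K}^*,\ r\text{ maximal in }\mathcal{K}}c_{j,r}u^r$, and the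 maximal $\mathcal{K}^*$-portion of $(h_j)_{j=1}^L$ is linearly independent if $h_1^{\max},\dots,h_L^{\max}$ are linearly independent over $\mathbb{K}$. -}

module Defs where

open import Level using (0ℓ)
open import Data.Nat as ℕ using (ℕ; zero; suc; _≤_; _<_; _∸_; _⊔_)
open import Data.Nat.Divisibility using (_∣_)
open import Data.Nat.Combinatorics using (_C_)
open import Data.Integer as ℤ using (ℤ; +_)
open import Data.Fin using (Fin)
import Data.Rational
import Data.Nat.Primality
open import Data.List using (List; foldr)
open import Data.List.Membership.Propositional using (_∈_; _∉_)
open import Data.Product using (Σ; ∃; _×_)
import Data.Vec.Functional as VF
open import Relation.Nullary using (¬_)
open import Relation.Binary.PropositionalEquality using (_≡_; _≢_)
open import Function.Bundles using (_↔_)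
open import Algebra.Core using (Op₁; Op₂)
open import Algebra.Structures using (IsCommutativeRing)

-- The partial order ⪯_p on ℤ⁺ and the sets S(𝒦), 𝒦*, maximality.
-- Finite subsets of ℤ⁺ are represented by lists (membership _∈_).

_⪯[_]_ : ℕ → ℕ → ℕ → Set
j ⪯[ p ] r = ¬ (p ∣ (r C j))

IsMaximalIn : ℕ → List ℕ → ℕ → Set
IsMaximalIn p 𝒦 k = k ∈ 𝒦 × (∀ r → r ∈ 𝒦 → r ≢ k → ¬ (k ⪯[ p ] r))

InS : ℕ → List ℕ → ℕ → Set
InS p 𝒦 j = 1 ≤ j × Σ ℕ (λ r → r ∈ 𝒦 × j ⪯[ p ] r)

InStar : ℕ → List ℕ → ℕ → Set
InStar p 𝒦 k = k ∈ 𝒦 × ¬ (p ∣ k) × (∀ v → 1 ≤ v → ¬ InS p 𝒦 ((p ℕ.^ v) ℕ.* k))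

maxL : List ℕ → ℕ
maxL = foldr _⊔_ 0

record FiniteField (q : ℕ) : Set₁ where
  field
    Carrier : Set
    _+_ _*_ : Op₂ Carrier
    -_      : Op₁ Carrier
    0# 1#   : Carrier
    isCommutativeRing : IsCommutativeRing _≡_ _+_ _*_ -_ 0# 1#
    0≢1     : 0# ≢ 1#
    inverse : ∀ x → x ≢ 0# → Σ Carrier (λ y → x * y ≡ 1#)
    enum    : Carrier ↔ Fin q

module Over {q : ℕ} (𝔽 : FiniteField q) where
  open FiniteField 𝔽

  _·1 : ℕ → Carrier
  zero ·1 = 0#
  suc n ·1 = 1# + (n ·1)

  IsCharacteristic : ℕ → Set
  IsCharacteristic p = Data.Nat.Primality.Prime p × (p ·1 ≡ 0#)

  sumTo : ℕ → (ℕ → Carrier) → Carrier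
  sumTo zero f = 0#
  sumTo (suc n) f = sumTo n f + f n

  -- Coefficient functions of polynomials in 𝔽_q[t]  (coefficient of t^i)
  PolyFn : Set
  PolyFn = ℕ → Carrier

  _≈ᶠ_ : PolyFn → PolyFn → Set
  a ≈ᶠ b = ∀ i → a i ≡ b i

  0ᶠ 1ᶠ : PolyFn
  0ᶠ i = 0#
  1ᶠ zero = 1#
  1ᶠ (suc i) = 0#

  _+ᶠ_ _-ᶠ_ _*ᶠ_ : PolyFn → PolyFn → PolyFn
  (a +ᶠ b) i = a i + b i
  (a -ᶠ b) i = a i + (- b i)
  (a *ᶠ b) i = sumTo (suc i) (λ k → a k * b (i ∸ k))

  _^ᶠ_ : PolyFn → ℕ → PolyFn
  a ^ᶠ zero = 1ᶠ
  a ^ᶠ suc n = a *ᶠ (a ^ᶠ n)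

  record Poly : Set where
    field
      coeff  : PolyFn
      bound  : ℕ
      vanish : ∀ i → bound ≤ i → coeff i ≡ 0#
  open Poly public

  _≈_ : Poly → Poly → Set
  a ≈ b = coeff a ≈ᶠ coeff b

  NonZero : Poly → Set
  NonZero a = ¬ (coeff a ≈ᶠ 0ᶠ)

  IsDeg : Poly → ℕ → Set
  IsDeg a k = coeff a k ≢ 0# × (∀ i → k < i → coeff a i ≡ 0#)

  InG : Poly → ℤ → Set
  InG a M = ∀ i → M ℤ.≤ + i → coeff a i ≡ 0#

  CongMod : PolyFn → PolyFn → Poly → Set
  CongMod a b g = Σ Poly (λ c → (a -ᶠ b) ≈ᶠ (coeff c *ᶠ coeff g))

  -- Polynomials in 𝔽_q[t][u]: given by coefficients c r ∈ 𝔽_q[t] of u^r,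
  -- with c r = 0 for r > B.  Evaluation at m ∈ 𝔽_q[t]:
  evalU : ℕ → (ℕ → Poly) → Poly → PolyFn
  evalU B c m i = sumTo (suc B) (λ r → (coeff (c r) *ᶠ (coeff m ^ᶠ r)) i)

  -- a bound on the t-degree (+1) of evalU B c m
  evalBound : ℕ → (ℕ → Poly) → Poly → ℕ
  evalBound B c m = sumTo' (suc B)
    where
      sumTo' : ℕ → ℕ
      sumTo' zero = 0
      sumTo' (suc r) = sumTo' r ℕ.+ (bound (c r) ℕ.+ r ℕ.* bound m)

  SupportedOn : (ℕ → Poly) → List ℕ → Set
  SupportedOn c 𝒦ⱼ =
      (∀ r → r ∈ 𝒦ⱼ → 1 ≤ r)
    × (∀ r → r ∈ 𝒦ⱼ → NonZero (c r))
    × (∀ r → r ≢ 0 → r ∉ 𝒦ⱼ → c r ≈ 0ⁿ)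
    where
      0ⁿ : Poly
      0ⁿ = record { coeff = 0ᶠ ; bound = 0 ; vanish = λ _ _ → _≡_.refl }

  -- The field 𝕂 = 𝔽_q(t) as fractions num/den (den ≠ 0)
  Frac : Set
  Frac = PolyFn × PolyFn

  0ᴷ : Frac
  0ᴷ = 0ᶠ Data.Product., 1ᶠ

  _+ᴷ_ : Frac → Frac → Frac
  (a Data.Product., b) +ᴷ (c Data.Product., d) =
    ((a *ᶠ d) +ᶠ (c *ᶠ b)) Data.Product., (b *ᶠ d)

  _·ᴷ_ : Frac → PolyFn → Frac
  (a Data.Product., b) ·ᴷ e = (a *ᶠ e) Data.Product., b

  IsZeroᴷ : Frac → Set
  IsZeroᴷ x = Data.Product.proj₁ x ≈ᶠ 0ᶠ

  -- linear independence over 𝕂 of L polynomials in 𝕂[u], given by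
  -- their 𝔽_q[t]-coefficients e j r (coefficient of u^r in the j-th one)
  LinIndepOverK : (L : ℕ) → (Fin L → ℕ → Poly) → Set
  LinIndepOverK L e =
    (a b : Fin L → Poly) → (∀ j → NonZero (b j)) →
    (∀ r → IsZeroᴷ (VF.foldr _+ᴷ_ 0ᴷ
               (λ j → (coeff (a j) Data.Product., coeff (b j)) ·ᴷ coeff (e j r)))) →
    ∀ j → coeff (a j) ≈ᶠ 0ᶠ

  IsMaxPortion : ℕ → (𝒦 : List ℕ) → (L : ℕ) → (Fin L → List ℕ) →
                 (Fin L → ℕ → Poly) → (Fin L → ℕ → Poly) → Set
  IsMaxPortion p 𝒦 L 𝒦s c e = ∀ j r →
      ((r ∈ 𝒦s j × InStar p 𝒦 r × IsMaximalIn p 𝒦 r) → e j r ≈ c j r)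
    × (¬ (r ∈ 𝒦s j × InStar p 𝒦 r × IsMaximalIn p 𝒦 r) → coeff (e j r) ≈ᶠ 0ᶠ)

  -- 𝕂_∞ = 𝔽_q((1/t)): coefficient of t^i, vanishing above some top
  record Laurent : Set where
    field
      lcoeff : ℤ → Carrier
      top    : ℤ
      lvanish : ∀ i → top ℤ.< i → lcoeff i ≡ 0#
  open Laurent public

  -- coefficients of β · P for P ∈ 𝔽_q[t] with coefficients vanishing from index B
  mulLP : Laurent → PolyFn → ℕ → (ℤ → Carrier)
  mulLP β P B i = sumTo B (λ k → P k * lcoeff β (i ℤ.- + k))

  -- ord {α} ≤ x : all coefficients of the fractional part at t^i with i > x vanish
  FracOrdLe : (ℤ → Carrier) → Data.Rational.ℚ → Set
  FracOrdLe α x = ∀ i → i ℤ.< ℤ.0ℤ → x Data.Rational.< (i Data.Rational./ 1) → α i ≡ 0#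

  sumFin : {L : ℕ} → (Fin L → Carrier) → Carrier
  sumFin f = VF.foldr _+_ 0# f

{-# OPTIONS --safe #-}

-- Write the coefficient of t^(-1-i) in Σ β_j h_j(n) as a linear functional of t^i (h_j(n))_j.  Suppose that no
-- n = r_d + d y with y of degree < N₁ makes the first M coefficients vanish.  Averaging over the multipliers
-- m ∈ 𝔾_M gives a nonzero m for which the coefficient of t^(-1) in m Σ β_j h_j(r_d + d y), composed with an
-- additive map 𝔽_q → 𝔽_p, is a biased function of y.
--
-- Bias is a statement about counting, and van der Corput differencing is a Cauchy-Schwarz inequality for the
-- positive definite kernel κ, so no characters are needed.  Differencing down to degree one shows that the
-- polarised top-degree form is degenerate at a dense set of tuples.  This set is a group in each coordinate, so
-- by the pigeonhole principle it contains a tuple of nonzero polynomials z_i of small degree together with the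
-- box of all (t^(b_i) z_i)_i.  The operators z_i ↦ t z_i and x ↦ t x act on a monomial Π z_i^(p^σ_i) x^(p^v)
-- through t^(p^σ_i) and t^(p^v), so a polynomial in them isolates a single exponent prime to p: a multiple g of
-- small degree annihilates every coefficient of top degree.  On a progression x = r + g y, with y short, the
-- degree (the base-p digit sum of the exponents) drops.  By induction the coefficient of every exponent that is
-- maximal in 𝒦 and lies in 𝒦* is annihilated by a nonzero polynomial of small degree, since such an exponent
-- receives no contribution from the others.
--
-- Linear independence of the maximal portion turns this into a single W of small degree such that every β_j is
-- close to a fraction with denominator W.  Then n = r_(W d) works, because W d divides h_j(n).

module Submission where

open import Defs
open import Level using (0ℓ)
open import Data.Nat using (ℕ; zero; suc; _≤_; _<_; z≤n; s≤s)
import Data.Nat as ℕ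
import Data.Nat.Properties as ℕ
open import Data.Nat.Primality using (Prime)
open import Data.Integer using (ℤ; 0ℤ; 1ℤ)
import Data.Integer as ℤ
import Data.Integer.Properties as ℤ
open import Data.Integer.Tactic.RingSolver using (solve-∀)
open import Data.Fin using (Fin)
import Data.Fin as Fin
import Data.Fin.Properties as Fin
open import Data.List using (List; []; _∷_; length)
open import Data.List.Membership.Propositional using (_∈_; _∉_)
open import Data.List.Relation.Unary.Any using (here; there)
import Data.Vec.Functional
open import Data.Product using (Σ; _×_; _,_; proj₁; proj₂)
open import Data.Sum using (_⊎_; inj₁; inj₂)
open import Algebra.Bundles using (CommutativeRing; AbelianGroup)
open import Algebra.Structures using (IsAbelianGroup; IsCommutativeMonoid)
import Algebra.Properties.AbelianGroup as GroupP
import Algebra.Properties.CommutativeMonoid.Mult as Mult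
import Algebra.Properties.CommutativeSemiring.Exp as Exp
import Algebra.Properties.Ring as RingP
open import Relation.Nullary using (¬_; Dec; yes; no; contradiction)
open import Relation.Nullary.Decidable using (¬?; _×-dec_; map′; decidable-stable)
open import Relation.Binary.Definitions using (tri<; tri≈; tri>)
open import Relation.Binary.PropositionalEquality
  using (_≡_; _≢_; refl; sym; trans; cong; cong₂; subst; subst₂; isEquivalence)

-- Every loss must be linear in the bias exponent c. In the application c is the number M of
-- coefficients that have to vanish, itself a fixed fraction of N, so a bound quadratic in c would
-- already be useless. Hence the explicit constants carried through the induction, which do not
-- depend on the coefficients of the polynomials. The obstacle peculiar to characteristic p is that
-- x ^ (p * i) is a Frobenius twist of x ^ i: both have the same degree, their polarised forms have
-- monomials of the same shape, and values cannot separate the two coefficients. Twists are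
-- therefore folded into the exponent prime to p, which in general spoils the coefficient found
-- there. Membership in 𝒦* ensures that nothing is folded into k, and maximality that under x = r +
-- g y nothing but k itself feeds into k. Folding would destroy the second condition on its own; the
-- predicate `Good` treats all twists p^v k at once and survives both operations. So the induction
-- on the degree can follow one coefficient, multiplied by powers of g, down to the degree where it
-- is annihilated.

module Binomials where
  open import Data.Nat
  open import Data.Nat.Properties
  open import Data.Nat.DivMod
  open import Data.Nat.Divisibility
  open import Data.Nat.Primality using (Prime; euclidsLemma; prime⇒nonZero; prime⇒nonTrivial)
  open import Data.Nat.Combinatorics using (_C_; nCk+nC[k+1]≡[n+1]C[k+1]; k>n⇒nCk≡0; nCn≡1)
  open import Data.Nat.Induction using (<-rec)

  -- Pascal's rule in place of factorials, so that congruences modulo p can be proved by induction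
  -- along the rule.
  bin : ℕ → ℕ → ℕ
  bin n zero = 1
  bin zero (suc k) = 0
  bin (suc n) (suc k) = bin n k + bin n (suc k)

  bin≡C : ∀ n k → bin n k ≡ n C k
  bin≡C zero zero = refl
  bin≡C (suc n) zero = refl
  bin≡C zero (suc k) = sym (k>n⇒nCk≡0 (s≤s (z≤n {k})))
  bin≡C (suc n) (suc k) = trans (cong₂ _+_ (bin≡C n k) (bin≡C n (suc k))) (nCk+nC[k+1]≡[n+1]C[k+1] n k)

  bin-> : ∀ {n k} → n < k → bin n k ≡ 0
  bin-> {n} {k} n<k = trans (bin≡C n k) (k>n⇒nCk≡0 n<k)

  bin-diag : ∀ n → bin n n ≡ 1
  bin-diag n = trans (bin≡C n n) (nCn≡1 n)

  bin-pred : ∀ n → bin (suc n) n ≡ suc n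
  bin-pred zero = refl
  bin-pred (suc n) = trans (cong₂ _+_ (bin-pred n) (bin-diag (suc n))) (+-comm (suc n) 1)

  absorption : ∀ n k → suc k * bin (suc n) (suc k) ≡ suc n * bin n k
  absorption zero zero = refl
  absorption zero (suc k) = *-zeroʳ (suc (suc k))
  absorption (suc n) zero = trans (*-identityˡ (suc (bin (suc n) 1)))
    (cong suc (trans (sym (*-identityˡ (bin (suc n) 1))) (absorption n zero)))
  absorption (suc n) (suc k) = begin
    suc (suc k) * (bin (suc n) (suc k) + bin (suc n) (suc (suc k)))
      ≡⟨ *-distribˡ-+ (suc (suc k)) (bin (suc n) (suc k)) _ ⟩
    bin (suc n) (suc k) + suc k * bin (suc n) (suc k) + suc (suc k) * bin (suc n) (suc (suc k))
      ≡⟨ cong₂ _+_ (cong (bin (suc n) (suc k) +_) (absorption n k)) (absorption n (suc k)) ⟩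
    bin (suc n) (suc k) + suc n * bin n k + suc n * bin n (suc k)
      ≡⟨ +-assoc (bin (suc n) (suc k)) _ _ ⟩
    bin (suc n) (suc k) + (suc n * bin n k + suc n * bin n (suc k))
      ≡⟨ cong (bin (suc n) (suc k) +_) (*-distribˡ-+ (suc n) (bin n k) _) ⟨
    suc (suc n) * bin (suc n) (suc k) ∎
    where open Relation.Binary.PropositionalEquality.≡-Reasoning

  bin-trinomial : ∀ n k i → i ≤ k → bin n k * bin k i ≡ bin n i * bin (n ∸ i) (k ∸ i)
  bin-trinomial n k zero _ = trans (*-identityʳ _) (sym (*-identityˡ _))
  bin-trinomial zero (suc k) (suc i) _ = refl
  bin-trinomial (suc n) (suc k) (suc i) (s≤s i≤k) = *-cancelˡ-≡ _ _ (suc i) (begin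
    suc i * (bin (suc n) (suc k) * bin (suc k) (suc i))
      ≡⟨ swap (suc i) (bin (suc n) (suc k)) (bin (suc k) (suc i)) ⟩
    bin (suc n) (suc k) * (suc i * bin (suc k) (suc i))
      ≡⟨ cong (bin (suc n) (suc k) *_) (absorption k i) ⟩
    bin (suc n) (suc k) * (suc k * bin k i)
      ≡⟨ *-assoc (bin (suc n) (suc k)) (suc k) (bin k i) ⟨
    bin (suc n) (suc k) * suc k * bin k i
      ≡⟨ cong (_* bin k i) (trans (*-comm (bin (suc n) (suc k)) (suc k)) (absorption n k)) ⟩
    suc n * bin n k * bin k i
      ≡⟨ *-assoc (suc n) (bin n k) (bin k i) ⟩
    suc n * (bin n k * bin k i)
      ≡⟨ cong (suc n *_) (bin-trinomial n k i i≤k) ⟩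
    suc n * (bin n i * bin (n ∸ i) (k ∸ i))
      ≡⟨ *-assoc (suc n) (bin n i) _ ⟨
    suc n * bin n i * bin (n ∸ i) (k ∸ i)
      ≡⟨ cong (_* bin (n ∸ i) (k ∸ i)) (absorption n i) ⟨
    suc i * bin (suc n) (suc i) * bin (n ∸ i) (k ∸ i)
      ≡⟨ *-assoc (suc i) (bin (suc n) (suc i)) _ ⟩
    suc i * (bin (suc n) (suc i) * bin (n ∸ i) (k ∸ i)) ∎)
    where
    open Relation.Binary.PropositionalEquality.≡-Reasoning
    swap : ∀ a b c → a * (b * c) ≡ b * (a * c)
    swap a b c = trans (sym (*-assoc a b c)) (trans (cong (_* c) (*-comm a b)) (*-assoc b a c))

  -- Lucas' theorem and base-p digit sums.

  module Lucas (p : ℕ) (p-prime : Prime p) where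

    instance
      p≢0 : NonZero p
      p≢0 = prime⇒nonZero p-prime

    1<p : 1 < p
    1<p = nonTrivial⇒n>1 p {{prime⇒nonTrivial p-prime}}

    infix 4 _≋_
    _≋_ : ℕ → ℕ → Set
    a ≋ b = a % p ≡ b % p

    +-cong : ∀ {a b c d} → a ≋ b → c ≋ d → a + c ≋ b + d
    +-cong {a} {b} {c} {d} e f = trans (%-distribˡ-+ a c p) (trans (cong₂ (λ x y → (x + y) % p) e f) (sym (%-distribˡ-+ b d p)))

    *-cong : ∀ {a b c d} → a ≋ b → c ≋ d → a * c ≋ b * d
    *-cong {a} {b} {c} {d} e f = trans (%-distribˡ-* a c p) (trans (cong₂ (λ x y → (x * y) % p) e f) (sym (%-distribˡ-* b d p)))

    0%p : 0 % p ≡ 0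
    0%p = m<n⇒m%n≡m (<-trans (s≤s z≤n) 1<p)

    ≋0⇒∣ : ∀ {a} → a ≋ 0 → p ∣ a
    ≋0⇒∣ {a} e = m%n≡0⇒n∣m a p (trans e 0%p)

    ∣⇒≋0 : ∀ {a} → p ∣ a → a ≋ 0
    ∣⇒≋0 {a} d = trans (n∣m⇒m%n≡0 a p d) (sym 0%p)

    ≋⇒∣ : ∀ {a b} → a ≋ b → p ∣ b → p ∣ a
    ≋⇒∣ e d = ≋0⇒∣ (trans e (∣⇒≋0 d))

    ∤-small : ∀ {a} → 0 < a → a < p → ¬ (p ∣ a)
    ∤-small {suc a} _ a<p d = <⇒≱ a<p (∣⇒≤ d)

    ∤-* : ∀ {a b} → ¬ (p ∣ a) → ¬ (p ∣ b) → ¬ (p ∣ a * b)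
    ∤-* {a} {b} na nb d with euclidsLemma a b p-prime d
    ... | inj₁ x = na x
    ... | inj₂ y = nb y

    -- By `absorption` p divides k * bin p k, and p is prime to k.
    bin-p : ∀ k → 0 < k → k < p → bin p k ≋ 0
    bin-p (suc k) _ k<p = ∣⇒≋0 (aux p refl)
      where
      aux : ∀ m → m ≡ p → p ∣ bin m (suc k)
      aux zero _ = p ∣0
      aux (suc m) e with euclidsLemma (suc k) (bin (suc m) (suc k)) p-prime
                           (subst (_∣ suc k * bin (suc m) (suc k)) e
                             (subst (suc m ∣_) (sym (absorption m k)) (m∣m*n (bin m k))))
      ... | inj₁ x = contradiction x (∤-small (s≤s z≤n) k<p)
      ... | inj₂ y = y

    -- Comparison of coefficients in (1 + X)^(n + p) ≡ (1 + X)^n (1 + X^p): below X^p here, and from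
    -- X^p on in `bin-+p`.
    bin-+p-low : ∀ n k → k < p → bin (n + p) k ≋ bin n k
    bin-+p-low zero zero _ = refl
    bin-+p-low zero (suc k) k<p = bin-p (suc k) (s≤s z≤n) k<p
    bin-+p-low (suc n) zero _ = refl
    bin-+p-low (suc n) (suc k) k<p =
      +-cong (bin-+p-low n k (<-trans (n<1+n k) k<p)) (bin-+p-low n (suc k) k<p)

    bin-+p : ∀ n k → bin (n + p) (k + p) ≋ bin n k + bin n (k + p)
    bin-+p zero zero = cong (_% p) (trans (bin-diag p) (sym (cong suc (bin-> {0} {p} (<-trans (s≤s z≤n) 1<p)))))
    bin-+p zero (suc k) = cong (_% p) (bin-> {p} {suc k + p} (s≤s (m≤n+m p k)))
    bin-+p (suc n) zero = aux p refl
      where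
      aux : ∀ m → m ≡ p → bin (suc n + p) m ≋ 1 + bin (suc n) m
      aux zero e = contradiction (subst (1 <_) (sym e) 1<p) (λ ())
      aux (suc m) e = trans
        (+-cong (bin-+p-low n m (subst (m <_) e (n<1+n m)))
                (trans (cong (λ z → bin (n + p) z % p) e) (trans (bin-+p n zero) (cong (λ z → suc (bin n z) % p) (sym e)))))
        (cong (_% p) (+-suc (bin n m) (bin n (suc m))))
    bin-+p (suc n) (suc k) = trans
      (+-cong (bin-+p n k) (bin-+p n (suc k)))
      (cong (_% p) (rearr (bin n k) (bin n (k + p)) (bin n (suc k)) (bin n (suc k + p))))
      where
      rearr : ∀ a b c d → a + b + (c + d) ≡ a + c + (b + d)
      rearr a b c d = trans (+-assoc a b (c + d)) (trans (cong (a +_) (trans (sym (+-assoc b c d)) (trans (cong (_+ d) (+-comm b c)) (+-assoc c b d)))) (sym (+-assoc a c (b + d))))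

    lucas : ∀ a b c d → a < p → c < p → bin (a + b * p) (c + d * p) ≋ bin a c * bin b d
    lucas a zero c zero _ _ = cong (_% p) (trans (cong₂ bin (+-identityʳ a) (+-identityʳ c)) (sym (*-identityʳ _)))
    lucas a zero c (suc d) a<p _ = cong (_% p)
      (trans (bin-> {a + 0} {c + suc d * p} (subst (_< c + suc d * p) (sym (+-identityʳ a)) (<-≤-trans a<p (≤-trans (m≤m+n p (d * p)) (m≤n+m _ c)))))
             (sym (*-zeroʳ (bin a c))))
    lucas a (suc b) c zero a<p c<p = trans
      (trans (cong (λ z → bin z (c + 0) % p) (shift a b))
        (trans (cong (λ z → bin (a + b * p + p) z % p) (+-identityʳ c)) (bin-+p-low (a + b * p) c c<p)))
      (trans (cong (λ z → bin (a + b * p) z % p) (sym (+-identityʳ c))) (lucas a b c zero a<p c<p))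
      where
      shift : ∀ a b → a + suc b * p ≡ a + b * p + p
      shift a b = trans (cong (a +_) (+-comm p (b * p))) (sym (+-assoc a (b * p) p))
    lucas a (suc b) c (suc d) a<p c<p = trans
      (cong₂ (λ z w → bin z w % p) (shift a b) (shift c d))
      (trans (bin-+p (a + b * p) (c + d * p))
        (trans (+-cong (lucas a b c d a<p c<p)
                  (trans (cong (λ z → bin (a + b * p) z % p) (sym (shift c d))) (lucas a b c (suc d) a<p c<p)))
               (cong (_% p) (sym (*-distribˡ-+ (bin a c) (bin b d) (bin b (suc d)))))))
      where
      shift : ∀ a b → a + suc b * p ≡ a + b * p + p
      shift a b = trans (cong (a +_) (+-comm p (b * p))) (sym (+-assoc a (b * p) p))

    infix 4 _≼_
    _≼_ : ℕ → ℕ → Set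
    j ≼ r = ¬ (p ∣ bin r j)

    ≼⇒≤ : ∀ {j r} → j ≼ r → j ≤ r
    ≼⇒≤ {j} {r} h with j ≤? r
    ... | yes le = le
    ... | no nle = contradiction (subst (p ∣_) (sym (bin-> (≰⇒> nle))) (p ∣0)) h

    -- If p divided bin r i, it would divide bin r j * bin j i by the trinomial identity.
    ≼-trans : ∀ {i j r} → i ≼ j → j ≼ r → i ≼ r
    ≼-trans {i} {j} {r} h k d = ∤-* k h (subst (p ∣_) (sym (bin-trinomial r j i (≼⇒≤ h))) (∣m⇒∣m*n (bin (r ∸ i) (j ∸ i)) d))

    ≼-refl : ∀ {i} → i ≼ i
    ≼-refl {i} d = ∤-small (s≤s z≤n) 1<p (subst (p ∣_) (bin-diag i) d)

    split : ∀ n → n ≡ n % p + n / p * p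
    split n = m≡m%n+[m/n]*n n p

    lucas′ : ∀ n k → bin n k ≋ bin (n % p) (k % p) * bin (n / p) (k / p)
    lucas′ n k = trans (cong₂ (λ x y → bin x y % p) (split n) (split k))
      (lucas (n % p) (n / p) (k % p) (k / p) (m%n<n n p) (m%n<n k p))

    ≼-digit : ∀ {k n} → k ≼ n → (k % p ≤ n % p) × (k / p ≼ n / p)
    ≼-digit {k} {n} h = ≼⇒≤ {k % p} {n % p} (λ d → h (≋⇒∣ (lucas′ n k) (∣m⇒∣m*n _ d)))
                      , λ d → h (≋⇒∣ (lucas′ n k) (∣n⇒∣m*n (bin (n % p) (k % p)) d))

    ≼-*p : ∀ {i j} → i ≼ j → i * p ≼ j * p
    ≼-*p {i} {j} h d = h (subst (p ∣_) (+-identityʳ _) (≋⇒∣ (sym (lucas 0 j 0 i (<-trans (s≤s z≤n) 1<p) (<-trans (s≤s z≤n) 1<p))) d))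

    dsF : ℕ → ℕ → ℕ
    dsF zero n = 0
    dsF (suc f) n = n % p + dsF f (n / p)

    n/p<n : ∀ n .{{_ : NonZero n}} → n / p < n
    n/p<n n = m/n<m n p 1<p

    n/p≤ : ∀ {n f} → n ≤ suc f → n / p ≤ f
    n/p≤ {zero} {f} _ = subst (_≤ f) (sym (0/n≡0 p)) z≤n
    n/p≤ {suc n} {f} le = s≤s⁻¹ (≤-trans (n/p<n (suc n)) le)

    dsF-0 : ∀ f → dsF f 0 ≡ 0
    dsF-0 zero = refl
    dsF-0 (suc f) = trans (cong₂ _+_ 0%p (cong (dsF f) (0/n≡0 p))) (dsF-0 f)

    dsF-fuel : ∀ f g n → n ≤ f → n ≤ g → dsF f n ≡ dsF g n
    dsF-fuel zero g zero _ _ = sym (dsF-0 g)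
    dsF-fuel (suc f) zero zero _ _ = dsF-0 (suc f)
    dsF-fuel (suc f) (suc g) n a b = cong (n % p +_) (dsF-fuel f g (n / p) (n/p≤ a) (n/p≤ b))

    -- The sum of the base-p digits: the degree of x ↦ x ^ n as a polynomial map over 𝔽_p.
    ds : ℕ → ℕ
    ds n = dsF n n

    ds-step : ∀ n → ds n ≡ n % p + ds (n / p)
    ds-step zero = trans (dsF-fuel 0 1 0 z≤n z≤n) (cong (0 % p +_) (cong₂ dsF (sym (0/n≡0 p)) refl))
    ds-step (suc n) = cong (suc n % p +_) (dsF-fuel n (suc n / p) (suc n / p) (n/p≤ ≤-refl) ≤-refl)

    ds-digits : ∀ a b → a < p → ds (a + b * p) ≡ a + ds b
    ds-digits a b a<p = trans (ds-step (a + b * p)) (cong₂ (λ x y → x + ds y)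
      (trans ([m+kn]%n≡m%n a b p) (m<n⇒m%n≡m a<p))
      (trans (+-distrib-/-∣ʳ a (n∣m*n b)) (trans (cong₂ _+_ (m<n⇒m/n≡0 a<p) (m*n/n≡m b p)) refl)))

    ds-*p : ∀ b → ds (b * p) ≡ ds b
    ds-*p b = ds-digits 0 b (<-trans (s≤s z≤n) 1<p)

    -- By Lucas no digit of i exceeds the corresponding digit of the sum, so the subtraction that
    -- yields r needs no borrowing and works digit by digit.
    ds-+ : ∀ {i} r → i ≼ i + r → ds (i + r) ≡ ds i + ds r
    ds-+ {i} r = <-rec (λ n → ∀ i r → n ≡ i + r → i ≼ n → ds n ≡ ds i + ds r) step (i + r) i r refl
      where
      open Relation.Binary.PropositionalEquality.≡-Reasoning
      step : ∀ n → (∀ {m} → m < n → ∀ i r → m ≡ i + r → i ≼ m → ds m ≡ ds i + ds r) →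
             ∀ i r → n ≡ i + r → i ≼ n → ds n ≡ ds i + ds r
      step zero _ zero zero _ _ = refl
      step n@(suc _) rec i r e h = begin
        ds n                                        ≡⟨ ds-step n ⟩
        n % p + ds (n / p)                          ≡⟨ cong₂ _+_ eqm (rec (n/p<n n) (i / p) c eqd (proj₂ dig)) ⟩
        (i % p + a) + (ds (i / p) + ds c)           ≡⟨ rearr (i % p) a (ds (i / p)) (ds c) ⟩
        (i % p + ds (i / p)) + (a + ds c)           ≡⟨ cong₂ _+_ (ds-step i) (ds-digits a c a<p) ⟨
        ds i + ds (a + c * p)                       ≡⟨ cong (λ z → ds i + ds z) req ⟨
        ds i + ds r ∎
        where
        dig = ≼-digit {i} {n} h
        a = n % p ∸ i % p
        c = n / p ∸ i / p
        eqm : n % p ≡ i % p + a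
        eqm = sym (m+[n∸m]≡n (proj₁ dig))
        eqd : n / p ≡ i / p + c
        eqd = sym (m+[n∸m]≡n (≼⇒≤ {i / p} {n / p} (proj₂ dig)))
        a<p : a < p
        a<p = ≤-<-trans (m∸n≤m (n % p) (i % p)) (m%n<n n p)
        rearr : ∀ a b c d → a + b + (c + d) ≡ a + c + (b + d)
        rearr a b c d = trans (+-assoc a b (c + d)) (trans (cong (a +_) (trans (sym (+-assoc b c d)) (trans (cong (_+ d) (+-comm b c)) (+-assoc c b d)))) (sym (+-assoc a c (b + d))))
        req : r ≡ a + c * p
        req = +-cancelˡ-≡ i r (a + c * p) (begin
          i + r                                     ≡⟨ e ⟨
          n                                         ≡⟨ split n ⟩
          n % p + n / p * p                         ≡⟨ cong₂ (λ x y → x + y * p) eqm eqd ⟩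
          i % p + a + (i / p + c) * p               ≡⟨ cong (i % p + a +_) (*-distribʳ-+ p (i / p) c) ⟩
          i % p + a + (i / p * p + c * p)           ≡⟨ rearr (i % p) a (i / p * p) (c * p) ⟩
          i % p + i / p * p + (a + c * p)           ≡⟨ cong (_+ (a + c * p)) (split i) ⟨
          i + (a + c * p) ∎)

    ds≡0 : ∀ n → ds n ≡ 0 → n ≡ 0
    ds≡0 = <-rec (λ n → ds n ≡ 0 → n ≡ 0) step
      where
      step : ∀ n → (∀ {m} → m < n → ds m ≡ 0 → m ≡ 0) → ds n ≡ 0 → n ≡ 0
      step zero _ _ = refl
      step n@(suc _) rec e = trans (split n) (cong₂ (λ x y → x + y * p)
        (m+n≡0⇒m≡0 (n % p) e′) (rec (n/p<n n) (m+n≡0⇒n≡0 (n % p) e′)))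
        where e′ = trans (sym (ds-step n)) e

    ds≡1 : ∀ n → ds n ≡ 1 → Σ ℕ λ v → n ≡ p ^ v
    ds≡1 = <-rec (λ n → ds n ≡ 1 → Σ ℕ λ v → n ≡ p ^ v) step
      where
      step : ∀ n → (∀ {m} → m < n → ds m ≡ 1 → Σ ℕ λ v → m ≡ p ^ v) → ds n ≡ 1 → Σ ℕ λ v → n ≡ p ^ v
      step zero _ ()
      step n@(suc _) rec e with n % p in eq | trans (sym (ds-step n)) e
      ... | zero | e′ = let (v , h) = rec (n/p<n n) e′ in
            suc v , trans (split n) (trans (cong₂ (λ x y → x + y * p) eq h) (*-comm (p ^ v) p))
      ... | suc zero | e′ = 0 , trans (split n) (cong₂ (λ x y → x + y * p) eq (ds≡0 (n / p) (suc-injective e′)))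

    ds-1 : ds 1 ≡ 1
    ds-1 = trans (ds-step 1) (cong₂ _+_ (m<n⇒m%n≡m 1<p) (trans (cong ds (m<n⇒m/n≡0 1<p)) refl))

    ds-p^ : ∀ v → ds (p ^ v) ≡ 1
    ds-p^ zero = ds-1
    ds-p^ (suc v) = trans (cong ds (*-comm p (p ^ v))) (trans (ds-*p (p ^ v)) (ds-p^ v))

    ds-pos : ∀ {n} → 1 ≤ n → 1 ≤ ds n
    ds-pos {n} 1≤n with ds n in eq
    ... | zero = contradiction (subst (1 ≤_) (ds≡0 n eq) 1≤n) (λ ())
    ... | suc _ = s≤s z≤n

    ds≤ : ∀ n → ds n ≤ n
    ds≤ = <-rec (λ n → ds n ≤ n) step
      where
      step : ∀ n → (∀ {m} → m < n → ds m ≤ m) → ds n ≤ n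
      step zero _ = z≤n
      step n@(suc _) rec = subst₂ _≤_ (sym (ds-step n)) (sym (split n))
        (+-monoʳ-≤ (n % p) (≤-trans (rec (n/p<n n)) (m≤m*n (n / p) p)))

    -- The lowest nonzero digit is lowered by one; modulo p the binomial coefficient is then that
    -- digit, a unit.
    remove-digit : ∀ n → 1 ≤ n → Σ ℕ λ v → Σ ℕ λ n′ → (n ≡ n′ + p ^ v) × n′ ≼ n
    remove-digit = <-rec _ step
      where
      step : ∀ n → (∀ {m} → m < n → 1 ≤ m → Σ ℕ λ v → Σ ℕ λ n′ → (m ≡ n′ + p ^ v) × n′ ≼ m) →
             1 ≤ n → Σ ℕ λ v → Σ ℕ λ n′ → (n ≡ n′ + p ^ v) × n′ ≼ n
      step n@(suc n-1) rec _ with n % p in eq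
      ... | suc a = 0 , a + n / p * p
            , trans (split n) (trans (cong (_+ n / p * p) eq) (+-comm 1 (a + n / p * p)))
            , λ d → ∤-small (s≤s z≤n) sa<p (subst (p ∣_) (trans (cong₂ _*_ (bin-pred a) (bin-diag (n / p))) (*-identityʳ (suc a)))
                 (≋⇒∣ (sym (trans (cong (λ z → bin z (a + n / p * p) % p) (trans (split n) (cong (_+ n / p * p) eq)))
                       (lucas (suc a) (n / p) a (n / p) sa<p (<-trans (n<1+n a) sa<p)))) d))
        where
        sa<p : suc a < p
        sa<p = subst (_< p) eq (m%n<n n p)
      ... | zero with n / p in eqd | rec (n/p<n n)
      ...   | zero | _ = contradiction (trans (split n) (cong₂ (λ x y → x + y * p) eq eqd)) (λ ())
      ...   | suc c | r with r (s≤s z≤n)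
      ...     | v , n′ , e , h = suc v , n′ * p
                , trans nn (trans (cong (_* p) e) (trans (*-distribʳ-+ p n′ (p ^ v)) (cong (n′ * p +_) (*-comm (p ^ v) p))))
                , subst (n′ * p ≼_) (sym nn) (≼-*p {n′} {suc c} h)
        where
        nn : n ≡ suc c * p
        nn = trans (split n) (cong₂ (λ x y → x + y * p) eq eqd)

    -- The unit removed comes from the higher digits if there are any, and otherwise from a last
    -- digit that is at least two. Either way the last digit stays nonzero.
    remove-digit-free : ∀ n → ¬ (p ∣ n) → 2 ≤ ds n → Σ ℕ λ v → Σ ℕ λ n′ → (n ≡ n′ + p ^ v) × n′ ≼ n × ¬ (p ∣ n′)
    remove-digit-free n p∤n 2≤ with n / p in eqd
    ... | zero with n % p in eq | trans (split n) (cong₂ (λ x y → x + y * p) {x = n % p} refl eqd)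
    ...   | zero | e = contradiction (subst (p ∣_) (sym e) (p ∣0)) p∤n
    ...   | suc zero | e = contradiction (subst (2 ≤_) (trans (cong ds e) ds-1) 2≤) λ { (s≤s ()) }
    ...   | suc (suc a) | e = 0 , suc a , trans n≡ (+-comm 1 (suc a))
            , (λ d → ∤-small (s≤s z≤n) ssa<p (subst (p ∣_) (trans (cong (λ z → bin z (suc a)) n≡) (bin-pred (suc a))) d))
            , ∤-small (s≤s z≤n) (<-trans (n<1+n _) ssa<p)
      where
      n≡ : n ≡ suc (suc a)
      n≡ = trans e (+-identityʳ _)
      ssa<p : suc (suc a) < p
      ssa<p = subst (_< p) eq (m%n<n n p)
    remove-digit-free n p∤n 2≤ | suc c with remove-digit (suc c) (s≤s z≤n)
    ... | v , c′ , e , h = suc v , n % p + c′ * p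
        , trans n≡ (trans (cong (λ z → n % p + z * p) e) (trans (cong (n % p +_) (trans (*-distribʳ-+ p c′ (p ^ v)) (cong (c′ * p +_) (*-comm (p ^ v) p)))) (sym (+-assoc (n % p) (c′ * p) _))))
        , (λ d → h (subst (p ∣_) (trans (cong (_* bin (suc c) c′) (bin-diag (n % p))) (*-identityˡ _))
              (≋⇒∣ (sym (trans (cong (λ z → bin z (n % p + c′ * p) % p) n≡) (lucas (n % p) (suc c) (n % p) c′ (m%n<n n p) (m%n<n n p)))) d)))
        , λ d → p∤n (subst (p ∣_) (sym n≡) (∣m∣n⇒∣m+n (∣m+n∣m⇒∣n (subst (p ∣_) (+-comm (n % p) (c′ * p)) d) (n∣m*n c′)) (n∣m*n (suc c))))
      where
      n≡ : n ≡ n % p + suc c * p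
      n≡ = trans (split n) (cong (λ z → n % p + z * p) eqd)

open Binomials

-- Integer sums over lists: Cauchy-Schwarz and averaging.

module IntegerSums where
  open import Data.Integer using (+_)
  open import Data.List using (map; _++_; cartesianProductWith)

  ≤-substˡ : ∀ {a b c} → a ≡ b → a ℤ.≤ c → b ℤ.≤ c
  ≤-substˡ refl le = le

  *-monoˡ : ∀ {a b} c → 0ℤ ℤ.≤ c → a ℤ.≤ b → c ℤ.* a ℤ.≤ c ℤ.* b
  *-monoˡ c 0≤c = ℤ.*-monoˡ-≤-nonNeg c {{ℤ.nonNegative 0≤c}}

  *-nonneg : ∀ {a b} → 0ℤ ℤ.≤ a → 0ℤ ℤ.≤ b → 0ℤ ℤ.≤ a ℤ.* b
  *-nonneg {a} {b} 0≤a 0≤b = subst (ℤ._≤ a ℤ.* b) (ℤ.*-zeroʳ a) (*-monoˡ a 0≤a 0≤b)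

  *-pos : ∀ {a b} → 0ℤ ℤ.< a → 0ℤ ℤ.< b → 0ℤ ℤ.< a ℤ.* b
  *-pos {a} {b} 0<a 0<b = subst (ℤ._< a ℤ.* b) (ℤ.*-zeroʳ a) (ℤ.*-monoˡ-<-pos a {{ℤ.positive 0<a}} 0<b)

  *-cancelˡ : ∀ {a b} c → 0ℤ ℤ.< c → c ℤ.* a ℤ.≤ c ℤ.* b → a ℤ.≤ b
  *-cancelˡ {a} {b} c 0<c = ℤ.*-cancelˡ-≤-pos a b c {{ℤ.positive 0<c}}

  +-cancelʳ : ∀ c a b → a ℤ.+ c ℤ.≤ b ℤ.+ c → a ℤ.≤ b
  +-cancelʳ c a b le = subst₂ ℤ._≤_ (back a c) (back b c) (ℤ.+-monoˡ-≤ (ℤ.- c) le)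
    where
    back : ∀ a c → a ℤ.+ c ℤ.+ ℤ.- c ≡ a
    back = solve-∀

  0≤ⁿ : ∀ n → 0ℤ ℤ.≤ + n
  0≤ⁿ n = ℤ.+≤+ ℕ.z≤n

  sq≥0 : ∀ a → 0ℤ ℤ.≤ a ℤ.* a
  sq≥0 (+ n) = *-nonneg (0≤ⁿ n) (0≤ⁿ n)
  sq≥0 ℤ.-[1+ n ] = 0≤ⁿ _

  𝟙 : ∀ {a} {P : Set a} → Dec P → ℤ
  𝟙 (yes _) = 1ℤ
  𝟙 (no _) = 0ℤ

  𝟙-nonneg : ∀ {a} {P : Set a} (d : Dec P) → 0ℤ ℤ.≤ 𝟙 d
  𝟙-nonneg (yes _) = 0≤ⁿ 1
  𝟙-nonneg (no _) = 0≤ⁿ 0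

  𝟙-≤1 : ∀ {a} {P : Set a} (d : Dec P) → 𝟙 d ℤ.≤ 1ℤ
  𝟙-≤1 (yes _) = ℤ.≤-refl
  𝟙-≤1 (no _) = 0≤ⁿ 1

  𝟙-mono : ∀ {a b} {P : Set a} {Q : Set b} → (P → Q) → (d : Dec P) (e : Dec Q) → 𝟙 d ℤ.≤ 𝟙 e
  𝟙-mono f (yes x) (yes y) = ℤ.≤-refl
  𝟙-mono f (yes x) (no ny) = contradiction (f x) ny
  𝟙-mono f (no _) e = 𝟙-nonneg e

  𝟙-cong : ∀ {a b} {P : Set a} {Q : Set b} → (P → Q) → (Q → P) → (d : Dec P) (e : Dec Q) → 𝟙 d ≡ 𝟙 e
  𝟙-cong f g d e = ℤ.≤-antisym (𝟙-mono f d e) (𝟙-mono g e d)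

  𝟙-yes : ∀ {a} {P : Set a} → P → (d : Dec P) → 𝟙 d ≡ 1ℤ
  𝟙-yes x (yes _) = refl
  𝟙-yes x (no n) = contradiction x n

  𝟙-no : ∀ {a} {P : Set a} → ¬ P → (d : Dec P) → 𝟙 d ≡ 0ℤ
  𝟙-no n (yes x) = contradiction x n
  𝟙-no n (no _) = refl

  module _ {A : Set} where

    ∑ : List A → (A → ℤ) → ℤ
    ∑ [] f = 0ℤ
    ∑ (x ∷ l) f = f x ℤ.+ ∑ l f

    ∑-cong : ∀ l {f g} → (∀ x → f x ≡ g x) → ∑ l f ≡ ∑ l g
    ∑-cong [] e = refl
    ∑-cong (x ∷ l) e = cong₂ ℤ._+_ (e x) (∑-cong l e)

    ∑-mono∈ : ∀ l {f g} → (∀ x → x ∈ l → f x ℤ.≤ g x) → ∑ l f ℤ.≤ ∑ l g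
    ∑-mono∈ [] e = ℤ.≤-refl
    ∑-mono∈ (x ∷ l) e = ℤ.+-mono-≤ (e x (here refl)) (∑-mono∈ l (λ y y∈ → e y (there y∈)))

    ∑-mono : ∀ l {f g} → (∀ x → f x ℤ.≤ g x) → ∑ l f ℤ.≤ ∑ l g
    ∑-mono l e = ∑-mono∈ l (λ x _ → e x)

    ∑-+ : ∀ l f g → ∑ l (λ x → f x ℤ.+ g x) ≡ ∑ l f ℤ.+ ∑ l g
    ∑-+ [] f g = refl
    ∑-+ (x ∷ l) f g = trans (cong (ℤ._+_ (f x ℤ.+ g x)) (∑-+ l f g)) (rearr (f x) (g x) (∑ l f) (∑ l g))
      where
      rearr : ∀ a b c d → a ℤ.+ b ℤ.+ (c ℤ.+ d) ≡ a ℤ.+ c ℤ.+ (b ℤ.+ d)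
      rearr = solve-∀

    ∑-*ˡ : ∀ l c f → ∑ l (λ x → c ℤ.* f x) ≡ c ℤ.* ∑ l f
    ∑-*ˡ [] c f = sym (ℤ.*-zeroʳ c)
    ∑-*ˡ (x ∷ l) c f = trans (cong (ℤ._+_ (c ℤ.* f x)) (∑-*ˡ l c f)) (sym (ℤ.*-distribˡ-+ c (f x) (∑ l f)))

    ∑-*ʳ : ∀ l f c → ∑ l (λ x → f x ℤ.* c) ≡ ∑ l f ℤ.* c
    ∑-*ʳ l f c = trans (∑-cong l (λ x → ℤ.*-comm (f x) c)) (trans (∑-*ˡ l c f) (ℤ.*-comm c (∑ l f)))

    ∑-const : ∀ l c → ∑ l (λ _ → c) ≡ + length l ℤ.* c
    ∑-const [] c = sym (ℤ.*-zeroˡ c)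
    ∑-const (x ∷ l) c = trans (cong (ℤ._+_ (c)) (∑-const l c)) (sym (ℤ.suc-* (+ length l) c))

    ∑-0 : ∀ l → ∑ l (λ _ → 0ℤ) ≡ 0ℤ
    ∑-0 l = trans (∑-const l 0ℤ) (ℤ.*-zeroʳ (+ length l))

    ∑-nonneg : ∀ l {f} → (∀ x → 0ℤ ℤ.≤ f x) → 0ℤ ℤ.≤ ∑ l f
    ∑-nonneg l {f} h = subst (ℤ._≤ ∑ l f) (∑-0 l) (∑-mono l h)

    ∑-++ : ∀ l m f → ∑ (l ++ m) f ≡ ∑ l f ℤ.+ ∑ m f
    ∑-++ [] m f = sym (ℤ.+-identityˡ _)
    ∑-++ (x ∷ l) m f = trans (cong (ℤ._+_ (f x)) (∑-++ l m f)) (sym (ℤ.+-assoc (f x) (∑ l f) (∑ m f)))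

  ∑-cong∈ : ∀ {A : Set} (l : List A) {f g : A → ℤ} → (∀ x → x ∈ l → f x ≡ g x) → ∑ l f ≡ ∑ l g
  ∑-cong∈ l e = ℤ.≤-antisym (∑-mono∈ l (λ x m → ℤ.≤-reflexive (e x m))) (∑-mono∈ l (λ x m → ℤ.≤-reflexive (sym (e x m))))

  ∈⇒≤∑ : ∀ {A : Set} (l : List A) f {x} → (∀ y → 0ℤ ℤ.≤ f y) → x ∈ l → f x ℤ.≤ ∑ l f
  ∈⇒≤∑ (y ∷ l) f nn (here refl) = ≤-substˡ (ℤ.+-identityʳ (f y)) (ℤ.+-monoʳ-≤ (f y) (∑-nonneg l nn))
  ∈⇒≤∑ (y ∷ l) f nn (there m) = ℤ.≤-trans (∈⇒≤∑ l f nn m) (subst (ℤ._≤ (f y ℤ.+ ∑ l f)) (ℤ.+-identityˡ _) (ℤ.+-monoˡ-≤ (∑ l f) (nn y)))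

  ∑-map : ∀ {A B : Set} (g : A → B) l f → ∑ (map g l) f ≡ ∑ l (λ x → f (g x))
  ∑-map g [] f = refl
  ∑-map g (x ∷ l) f = cong (ℤ._+_ (f (g x))) (∑-map g l f)

  ∑-cart : ∀ {A B D : Set} (g : A → B → D) l m f →
           ∑ (cartesianProductWith g l m) f ≡ ∑ l (λ x → ∑ m (λ y → f (g x y)))
  ∑-cart g [] m f = refl
  ∑-cart g (x ∷ l) m f = trans (∑-++ (map (g x) m) (cartesianProductWith g l m) f)
    (cong₂ ℤ._+_ (∑-map (g x) m f) (∑-cart g l m f))

  ∑-swap : ∀ {A B : Set} (l : List A) (m : List B) (f : A → B → ℤ) →
           ∑ l (λ x → ∑ m (λ y → f x y)) ≡ ∑ m (λ y → ∑ l (λ x → f x y))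
  ∑-swap [] m f = sym (∑-0 m)
  ∑-swap (x ∷ l) m f = trans (cong (ℤ._+_ (∑ m (f x))) (∑-swap l m f))
    (sym (∑-+ m (f x) (λ y → ∑ l (λ x → f x y))))

  ∑-∑-* : ∀ {A B : Set} (l : List A) (m : List B) f g →
          ∑ l (λ x → ∑ m (λ y → f x ℤ.* g y)) ≡ ∑ l f ℤ.* ∑ m g
  ∑-∑-* l m f g = trans (∑-cong l (λ x → ∑-*ˡ m (f x) g)) (∑-*ʳ l f (∑ m g))

  -- From 0 ≤ Σ_x Σ_y (f x - f y)².
  cauchy-schwarz : ∀ {A : Set} (l : List A) f →
                   ∑ l f ℤ.* ∑ l f ℤ.≤ + length l ℤ.* ∑ l (λ x → f x ℤ.* f x)
  cauchy-schwarz l f = *-cancelˡ (+ 2) (ℤ.+<+ (ℕ.s≤s ℕ.z≤n))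
    (ℤ.0≤i-j⇒j≤i (subst (0ℤ ℤ.≤_) eq (∑-nonneg l (λ x → ∑-nonneg l (λ y → sq≥0 (f x ℤ.- f y))))))
    where
    n = + length l
    S = ∑ l f
    T = ∑ l (λ x → f x ℤ.* f x)
    expand : ∀ a b → (a ℤ.- b) ℤ.* (a ℤ.- b) ≡ a ℤ.* a ℤ.+ (b ℤ.* b ℤ.+ (ℤ.- (+ 2) ℤ.* a) ℤ.* b)
    expand = solve-∀
    inner : ∀ x → ∑ l (λ y → (f x ℤ.- f y) ℤ.* (f x ℤ.- f y)) ≡ n ℤ.* (f x ℤ.* f x) ℤ.+ (T ℤ.+ (ℤ.- (+ 2) ℤ.* S) ℤ.* f x)
    inner x = trans (∑-cong l (λ y → expand (f x) (f y)))
      (trans (∑-+ l _ _) (cong₂ ℤ._+_ (∑-const l _) (trans (∑-+ l _ _) (cong (ℤ._+_ (T))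
        (trans (∑-*ˡ l (ℤ.- (+ 2) ℤ.* f x) f) (rot (f x) S))))))
      where
      rot : ∀ a b → (ℤ.- (+ 2) ℤ.* a) ℤ.* b ≡ (ℤ.- (+ 2) ℤ.* b) ℤ.* a
      rot = solve-∀
    eq : ∑ l (λ x → ∑ l (λ y → (f x ℤ.- f y) ℤ.* (f x ℤ.- f y))) ≡ + 2 ℤ.* (n ℤ.* T) ℤ.- + 2 ℤ.* (S ℤ.* S)
    eq = trans (∑-cong l inner) (trans (∑-+ l _ _) (trans (cong₂ ℤ._+_ (∑-*ˡ l n _)
           (trans (∑-+ l _ _) (cong₂ ℤ._+_ (∑-const l T) (∑-*ˡ l (ℤ.- (+ 2) ℤ.* S) f)))) (fin n T S)))
      where
      fin : ∀ n T S → n ℤ.* T ℤ.+ (n ℤ.* T ℤ.+ (ℤ.- (+ 2) ℤ.* S) ℤ.* S) ≡ + 2 ℤ.* (n ℤ.* T) ℤ.- + 2 ℤ.* (S ℤ.* S)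
      fin = solve-∀

  ∑-find : ∀ {A : Set} {P : A → Set} → (∀ x → Dec (P x)) → (l : List A) →
           Dec (Σ A λ x → x ∈ l × P x)
  ∑-find P? [] = no λ { (_ , () , _) }
  ∑-find P? (x ∷ l) with P? x
  ... | yes px = yes (x , here refl , px)
  ... | no npx with ∑-find P? l
  ...   | yes (y , y∈ , py) = yes (y , there y∈ , py)
  ...   | no n = no λ { (y , here refl , py) → npx py ; (y , there y∈ , py) → n (y , y∈ , py) }

  𝟙-× : ∀ {P Q : Set} (d : Dec P) (e : Dec Q) → 𝟙 (d ×-dec e) ≡ 𝟙 d ℤ.* 𝟙 e
  𝟙-× (yes _) (yes _) = refl
  𝟙-× (yes _) (no _) = refl
  𝟙-× (no _) (yes _) = refl
  𝟙-× (no _) (no _) = refl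

  𝟙-∑>0 : ∀ {A : Set} {P : A → Set} (P? : ∀ x → Dec (P x)) (l : List A) → 0ℤ ℤ.< ∑ l (λ x → 𝟙 (P? x)) → Σ A λ x → x ∈ l × P x
  𝟙-∑>0 P? l pos with ∑-find P? l
  ... | yes r = r
  ... | no none = contradiction (ℤ.<-≤-trans pos (ℤ.≤-trans (∑-mono∈ l (λ x m → ℤ.≤-reflexive (𝟙-no (λ px → none (x , m , px)) (P? x)))) (ℤ.≤-reflexive (∑-0 l)))) (ℤ.<-irrefl refl)

  -- An average is at most the maximum; the length is multiplied out so that no division occurs. If
  -- every term failed, each would satisfy length l * w x ≤ P - 1.
  pigeonhole : ∀ {A : Set} (l : List A) (w : A → ℤ) P → 0ℤ ℤ.< P → P ℤ.≤ ∑ l w →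
               Σ A λ x → x ∈ l × P ℤ.≤ + length l ℤ.* w x
  pigeonhole [] w P 0<P P≤ = contradiction (ℤ.<-≤-trans 0<P P≤) (ℤ.<-irrefl refl)
  pigeonhole l@(_ ∷ _) w P 0<P P≤ with ∑-find (λ x → P ℤ.≤? + length l ℤ.* w x) l
  ... | yes r = r
  ... | no none = contradiction chain (ℤ.<-irrefl refl)
    where
    n = + length l
    0<n : 0ℤ ℤ.< n
    0<n = ℤ.+<+ (ℕ.s≤s ℕ.z≤n)
    each : ∀ x → x ∈ l → n ℤ.* w x ℤ.≤ ℤ.pred P
    each x x∈ = ℤ.i<j⇒i≤pred[j] (ℤ.≰⇒> (λ h → none (x , x∈ , h)))
    chain : n ℤ.* P ℤ.< n ℤ.* P
    chain = ℤ.≤-<-trans (*-monoˡ n (ℤ.<⇒≤ 0<n) P≤)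
      (ℤ.≤-<-trans (subst₂ ℤ._≤_ (∑-*ˡ l n w) (∑-const l (ℤ.pred P)) (∑-mono∈ l each))
        (ℤ.*-monoˡ-<-pos n {{ℤ.positive 0<n}} (ℤ.i≤pred[j]⇒i<j ℤ.≤-refl)))

  -- In q U Σ w, which is at least 2 * length l * W, the unpopular terms account for at most length
  -- l * W. The popular ones make up the rest, each contributing at most q U V W.
  popular : ∀ {A : Set} (l : List A) (w : A → ℤ) (q U V W : ℤ) →
            + 2 ℤ.≤ q → 0ℤ ℤ.≤ U → 0ℤ ℤ.≤ V → 0ℤ ℤ.< W →
            (∀ x → x ∈ l → w x ℤ.≤ V ℤ.* W) →
            + length l ℤ.* W ℤ.≤ U ℤ.* ∑ l w →
            + length l ℤ.≤ q ℤ.* U ℤ.* V ℤ.* ∑ l (λ x → 𝟙 (W ℤ.≤? q ℤ.* U ℤ.* w x))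
  popular l w q U V W 2≤q 0≤U 0≤V 0<W bd big = *-cancelˡ W 0<W
    (+-cancelʳ (n ℤ.* W) _ _ (subst₂ ℤ._≤_ refl eq₂ (ℤ.≤-trans lower upper)))
    where
    n = + length l
    0≤q : 0ℤ ℤ.≤ q
    0≤q = ℤ.≤-trans (0≤ⁿ 2) 2≤q
    cnt = ∑ l (λ x → 𝟙 (W ℤ.≤? q ℤ.* U ℤ.* w x))
    X = q ℤ.* U ℤ.* V ℤ.* W
    lower : W ℤ.* n ℤ.+ n ℤ.* W ℤ.≤ q ℤ.* U ℤ.* ∑ l w
    lower = subst₂ ℤ._≤_ (dbl n W) (sym (ℤ.*-assoc q U _))
      (ℤ.≤-trans (subst₂ ℤ._≤_ (ℤ.*-comm (n ℤ.* W) (+ 2)) (ℤ.*-comm (n ℤ.* W) q) (*-monoˡ (n ℤ.* W) (*-nonneg (0≤ⁿ (length l)) (ℤ.<⇒≤ 0<W)) 2≤q)) (*-monoˡ q 0≤q big))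
      where
      dbl : ∀ n W → + 2 ℤ.* (n ℤ.* W) ≡ W ℤ.* n ℤ.+ n ℤ.* W
      dbl = solve-∀
    each : ∀ x → x ∈ l → q ℤ.* U ℤ.* w x ℤ.≤ X ℤ.* 𝟙 (W ℤ.≤? q ℤ.* U ℤ.* w x) ℤ.+ W
    each x x∈ with W ℤ.≤? q ℤ.* U ℤ.* w x
    ... | yes _ = ℤ.≤-trans (subst (q ℤ.* U ℤ.* w x ℤ.≤_) (assoc′ q U V W) (*-monoˡ (q ℤ.* U) (*-nonneg 0≤q 0≤U) (bd x x∈)))
                   (subst₂ ℤ._≤_ (ℤ.+-identityʳ _) refl (ℤ.+-monoʳ-≤ (X ℤ.* 1ℤ) (ℤ.<⇒≤ 0<W)))
      where
      assoc′ : ∀ q U V W → q ℤ.* U ℤ.* (V ℤ.* W) ≡ q ℤ.* U ℤ.* V ℤ.* W ℤ.* 1ℤ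
      assoc′ = solve-∀
    ... | no nle = subst (q ℤ.* U ℤ.* w x ℤ.≤_) (sym (trans (cong (ℤ._+ W) (ℤ.*-zeroʳ X)) (ℤ.+-identityˡ W))) (ℤ.<⇒≤ (ℤ.≰⇒> nle))
    upper : q ℤ.* U ℤ.* ∑ l w ℤ.≤ X ℤ.* cnt ℤ.+ n ℤ.* W
    upper = subst₂ ℤ._≤_ (∑-*ˡ l (q ℤ.* U) w)
      (trans (∑-+ l _ _) (cong₂ ℤ._+_ (∑-*ˡ l X _) (∑-const l W))) (∑-mono∈ l each)
    eq₂ : X ℤ.* cnt ℤ.+ n ℤ.* W ≡ W ℤ.* (q ℤ.* U ℤ.* V ℤ.* cnt) ℤ.+ n ℤ.* W
    eq₂ = shuffle q U V W cnt (n ℤ.* W)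
      where
      shuffle : ∀ q U V W c m → q ℤ.* U ℤ.* V ℤ.* W ℤ.* c ℤ.+ m ≡ W ℤ.* (q ℤ.* U ℤ.* V ℤ.* c) ℤ.+ m
      shuffle = solve-∀

open IntegerSums

-- Sums over initial segments of ℕ in a commutative monoid.

module FinSum {A : Set} {_∙_ : A → A → A} {ε : A} (isCM : IsCommutativeMonoid _≡_ _∙_ ε) where
  open import Data.Nat
  open import Data.Nat.Properties

  open IsCommutativeMonoid isCM using (assoc; comm; identityˡ; identityʳ)

  sum : ℕ → (ℕ → A) → A
  sum zero f = ε
  sum (suc n) f = sum n f ∙ f n

  sum-cong< : ∀ n {f g} → (∀ i → i < n → f i ≡ g i) → sum n f ≡ sum n g
  sum-cong< zero e = refl
  sum-cong< (suc n) e = cong₂ _∙_ (sum-cong< n (λ i i<n → e i (<-trans i<n (n<1+n n)))) (e n (n<1+n n))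

  sum-cong : ∀ n {f g} → (∀ i → f i ≡ g i) → sum n f ≡ sum n g
  sum-cong n e = sum-cong< n (λ i _ → e i)

  sum-ε : ∀ n {f} → (∀ i → i < n → f i ≡ ε) → sum n f ≡ ε
  sum-ε zero e = refl
  sum-ε (suc n) e = trans (cong₂ _∙_ (sum-ε n (λ i i<n → e i (<-trans i<n (n<1+n n)))) (e n (n<1+n n))) (identityˡ ε)

  interchange : ∀ a b c d → (a ∙ b) ∙ (c ∙ d) ≡ (a ∙ c) ∙ (b ∙ d)
  interchange a b c d = trans (assoc a b (c ∙ d)) (trans (cong (a ∙_) (trans (sym (assoc b c d)) (trans (cong (_∙ d) (comm b c)) (assoc c b d)))) (sym (assoc a c (b ∙ d))))

  sum-∙ : ∀ n f g → sum n (λ i → f i ∙ g i) ≡ sum n f ∙ sum n g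
  sum-∙ zero f g = sym (identityˡ ε)
  sum-∙ (suc n) f g = trans (cong (_∙ (f n ∙ g n)) (sum-∙ n f g)) (interchange (sum n f) (sum n g) (f n) (g n))

  sum-swap : ∀ m n (f : ℕ → ℕ → A) → sum m (λ i → sum n (λ j → f i j)) ≡ sum n (λ j → sum m (λ i → f i j))
  sum-swap zero n f = sym (sum-ε n (λ _ _ → refl))
  sum-swap (suc m) n f = trans (cong (_∙ sum n (f m)) (sum-swap m n f)) (sym (sum-∙ n (λ j → sum m (λ i → f i j)) (f m)))

  sum-head : ∀ n f → sum (suc n) f ≡ f 0 ∙ sum n (λ i → f (suc i))
  sum-head zero f = trans (identityˡ (f 0)) (sym (identityʳ (f 0)))
  sum-head (suc n) f = trans (cong (_∙ f (suc n)) (sum-head n f)) (assoc (f 0) _ (f (suc n)))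

  sum-extend : ∀ m n f → (∀ i → m ≤ i → f i ≡ ε) → m ≤ n → sum n f ≡ sum m f
  sum-extend m n f z m≤n = trans (cong (λ k → sum k f) (sym (m+[n∸m]≡n m≤n))) (go (n ∸ m))
    where
    go : ∀ d → sum (m + d) f ≡ sum m f
    go zero = cong (λ k → sum k f) (+-identityʳ m)
    go (suc d) = trans (cong (λ k → sum k f) (+-suc m d))
      (trans (cong₂ _∙_ (go d) (z (m + d) (m≤m+n m d))) (identityʳ _))

  sum-single : ∀ n a (f : ℕ → A) → (a < n ⊎ f a ≡ ε) → (∀ i → i < n → i ≢ a → f i ≡ ε) → sum n f ≡ f a
  sum-single zero a f (inj₂ e) z = sym e
  sum-single (suc n) a f d z with n ≟ a
  ... | yes refl = trans (cong (_∙ f n) (sum-ε n (λ i i<n → z i (<-trans i<n (n<1+n n)) (<⇒≢ i<n)))) (identityˡ _)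
  ... | no n≢a = trans (cong₂ _∙_ (sum-single n a f (lower d) (λ i i<n → z i (<-trans i<n (n<1+n n)))) (z n (n<1+n n) n≢a)) (identityʳ _)
    where
    lower : a < suc n ⊎ f a ≡ ε → a < n ⊎ f a ≡ ε
    lower (inj₁ a<) = inj₁ (≤∧≢⇒< (s≤s⁻¹ a<) (λ e → n≢a (sym e)))
    lower (inj₂ e) = inj₂ e

  [_]_ : ∀ {P : Set} → Dec P → A → A
  [ yes _ ] a = a
  [ no _ ] a = ε

  sum-δ : ∀ n a (f : ℕ → A) → (a < n ⊎ f a ≡ ε) → sum n (λ i → [ i ≟ a ] f i) ≡ f a
  sum-δ n a f d = trans (sum-single n a (λ i → [ i ≟ a ] f i) (h d) off) at
    where
    at : [ a ≟ a ] f a ≡ f a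
    at with a ≟ a
    ... | yes _ = refl
    ... | no n = contradiction refl n
    h : a < n ⊎ f a ≡ ε → a < n ⊎ [ a ≟ a ] f a ≡ ε
    h (inj₁ x) = inj₁ x
    h (inj₂ y) = inj₂ (trans at y)
    off : ∀ i → i < n → i ≢ a → [ i ≟ a ] f i ≡ ε
    off i _ i≢a with i ≟ a
    ... | yes e = contradiction e i≢a
    ... | no _ = refl

-- The interface between the counting argument and 𝔽_q[t].

module Framework where
  open import Data.Nat
  open import Data.Nat.Properties
  open import Data.Integer using (+_)
  open import Data.Nat.Divisibility using (_∣_)
  open import Data.Nat.Primality using (Prime)

  bundle : {A : Set} {add : A → A → A} {ε : A} {neg : A → A} → IsAbelianGroup _≡_ add ε neg → AbelianGroup 0ℓ 0ℓ
  bundle h = record { isAbelianGroup = h }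

  -- A group of prime order, with κ = p [ a = 0 ] - 1 in place of the sum of its nontrivial characters.
  record Target (p : ℕ) : Set₁ where
    field
      𝔸 : Set
      _+ᴬ_ : 𝔸 → 𝔸 → 𝔸
      0ᴬ : 𝔸
      -ᴬ_ : 𝔸 → 𝔸
      isAbelianGroup : IsAbelianGroup _≡_ _+ᴬ_ 0ᴬ -ᴬ_
      _≟ᴬ_ : (a b : 𝔸) → Dec (a ≡ b)
    infixl 6 _+ᴬ_
    infix 8 -ᴬ_
    abelianGroup : AbelianGroup 0ℓ 0ℓ
    abelianGroup = bundle isAbelianGroup
    open Mult (AbelianGroup.commutativeMonoid abelianGroup) public using () renaming (_×_ to _·_)
    κ : 𝔸 → ℤ
    κ a = + p ℤ.* 𝟙 (a ≟ᴬ 0ᴬ) ℤ.- 1ℤ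
    field
      torsion : ∀ a → p · a ≡ 0ᴬ
      torsion-free : ∀ {n a} → ¬ (p ∣ n) → n · a ≡ 0ᴬ → a ≡ 0ᴬ
      -- A nonzero u generates the group, and nontrivial characters cancel over the whole group.
      κ-sum : ∀ {u} → u ≢ 0ᴬ → ∀ w → FinSum.sum ℤ.+-0-isCommutativeMonoid p (λ i → κ (w +ᴬ i · u)) ≡ 0ℤ
      -- Hence κ is positive definite, which is all that differencing needs.
      points : List 𝔸
      κ-gram : ∀ a b → ∑ points (λ c → κ (a +ᴬ -ᴬ c) ℤ.* κ (b +ᴬ -ᴬ c)) ≡ + p ℤ.* κ (a +ᴬ -ᴬ b)
      0∈points : 0ᴬ ∈ points

  -- What counting uses of 𝔽_q[t]. Degrees are only ever bounded, through `G`, and polynomials only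
  -- ever enumerated, through `Gs`; `Gs-zero` and `Gs-shift` together say that `Gs n` meets every
  -- class of `G n` exactly once.
  record Setting (q p : ℕ) : Set₁ where
    field
      p-prime : Prime p
      p≤q : p ≤ q
      R : CommutativeRing 0ℓ 0ℓ
    open CommutativeRing R public using () renaming
      ( Carrier to ℛ; _≈_ to _≃_; _+_ to _⊕_; _*_ to _⊗_; -_ to ⊖_; _-_ to _⊝_; 0# to 𝟎; 1# to 𝟏)
    open Exp (CommutativeRing.commutativeSemiring R) public using () renaming (_^_ to _↑_)
    field
      t : ℛ
      _≃0? : ∀ x → Dec (x ≃ 𝟎)
      domain : ∀ {x y} → ¬ x ≃ 𝟎 → ¬ y ≃ 𝟎 → ¬ x ⊗ y ≃ 𝟎
      𝟏≄𝟎 : ¬ 𝟏 ≃ 𝟎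
      t-powers : ∀ {a b} → a ≢ b → ¬ (t ↑ a) ⊝ (t ↑ b) ≃ 𝟎
      -- G n x: the polynomial x has degree less than n.
      G : ℕ → ℛ → Set
      G-cong : ∀ {n x y} → x ≃ y → G n x → G n y
      G-mono : ∀ {m n x} → m ≤ n → G m x → G n x
      G-⊕ : ∀ {n x y} → G n x → G n y → G n (x ⊕ y)
      G-⊖ : ∀ {n x} → G n x → G n (⊖ x)
      G-⊗ : ∀ {m n x y} → G m x → G n y → G (m + n) (x ⊗ y)
      G-𝟏 : G 1 𝟏
      G-t : ∀ {n x} → G n x → G (suc n) (t ⊗ x)
      Gs : ℕ → List ℛ
      Gs-length : ∀ n → length (Gs n) ≡ q ^ n
      Gs-G : ∀ n x → x ∈ Gs n → G n x
      Gs-complete : ∀ n x → G n x → Σ ℛ λ y → y ∈ Gs n × x ≃ y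
      Gs-shift : ∀ n z → G n z → (f : ℛ → ℤ) → (∀ {x y} → x ≃ y → f x ≡ f y) →
                 ∑ (Gs n) (λ x → f (x ⊕ z)) ≡ ∑ (Gs n) f
      Gs-zero : ∀ n → ∑ (Gs n) (λ x → 𝟙 (x ≃0?)) ≡ 1ℤ
      target : Target p
    open Target target public

open Framework

module RangeSums where
  open import Data.Integer using (+_)

  open FinSum ℤ.+-0-isCommutativeMonoid public using () renaming
    (sum to sumℤ; sum-cong to sumℤ-cong; sum-single to sumℤ-single; sum-∙ to sumℤ-+)

  sumℤ-∑ : ∀ {A : Set} m (l : List A) (f : ℕ → A → ℤ) → sumℤ m (λ i → ∑ l (f i)) ≡ ∑ l (λ x → sumℤ m (λ i → f i x))
  sumℤ-∑ zero l f = sym (∑-0 l)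
  sumℤ-∑ (suc m) l f = trans (cong (ℤ._+ ∑ l (f m)) (sumℤ-∑ m l f)) (sym (∑-+ l _ (f m)))

  sumℤ-const : ∀ m c → sumℤ m (λ _ → c) ≡ + m ℤ.* c
  sumℤ-const zero c = sym (ℤ.*-zeroˡ c)
  sumℤ-const (suc m) c = trans (cong (ℤ._+ c) (sumℤ-const m c)) (trans (ℤ.+-comm _ c) (sym (ℤ.suc-* (+ m) c)))

open RangeSums

-- Additive maps into a p-torsion group and their Frobenius twists.

module AdditiveMaps (p : ℕ) (p-prime : Prime p) (R : CommutativeRing 0ℓ 0ℓ)
  {𝔸 : Set} {add : 𝔸 → 𝔸 → 𝔸} {0ᴬ : 𝔸} {neg : 𝔸 → 𝔸} (isAbelianGroup : IsAbelianGroup _≡_ add 0ᴬ neg)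
  (torsion : ∀ a → Mult._×_ (AbelianGroup.commutativeMonoid (bundle isAbelianGroup)) p a ≡ 0ᴬ) where
  open import Data.Nat
  open import Data.Nat.Properties
  open import Data.Nat.Divisibility
  open import Data.Nat.Primality using (Prime)

  private
    infixl 6 _+ᴬ_
    infix 8 -ᴬ_
    _+ᴬ_ : 𝔸 → 𝔸 → 𝔸
    _+ᴬ_ = add
    -ᴬ_ : 𝔸 → 𝔸
    -ᴬ_ = neg

  open CommutativeRing R using () renaming
    ( Carrier to ℛ; _≈_ to _≃_; _+_ to _⊕_; _*_ to _⊗_; -_ to ⊖_; _-_ to _⊝_; 0# to 𝟎; 1# to 𝟏)
  open Exp (CommutativeRing.commutativeSemiring R) using () renaming (_^_ to _↑_)
  open Mult (AbelianGroup.commutativeMonoid (bundle isAbelianGroup)) using () renaming (_×_ to _·_)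
  open Lucas p p-prime public
  module R = CommutativeRing R
  module ℛ^ = Exp R.commutativeSemiring
  module A = IsAbelianGroup isAbelianGroup
  abelian : AbelianGroup 0ℓ 0ℓ
  abelian = bundle isAbelianGroup
  module A× = Mult (AbelianGroup.commutativeMonoid abelian)
  module AG = GroupP abelian
  open FinSum A.isCommutativeMonoid public

  ≡⇒≃ : ∀ {x y} → x ≡ y → x ≃ y
  ≡⇒≃ refl = R.refl

  record Hom : Set where
    field
      fun : ℛ → 𝔸
      cong-fun : ∀ {x y} → x ≃ y → fun x ≡ fun y
      homo : ∀ x y → fun (x ⊕ y) ≡ fun x +ᴬ fun y
  open Hom public

  infix 4 _≗_
  _≗_ : Hom → Hom → Set
  μ ≗ ν = ∀ x → fun μ x ≡ fun ν x

  0ᴴ : Hom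
  0ᴴ = record { fun = λ _ → 0ᴬ ; cong-fun = λ _ → refl ; homo = λ _ _ → sym (A.identityˡ 0ᴬ) }

  fun-𝟎 : ∀ μ → fun μ 𝟎 ≡ 0ᴬ
  fun-𝟎 μ = AG.identityˡ-unique (fun μ 𝟎) (fun μ 𝟎)
    (trans (sym (homo μ 𝟎 𝟎)) (cong-fun μ (R.+-identityˡ 𝟎)))

  fun-0 : ∀ μ {x} → x ≃ 𝟎 → fun μ x ≡ 0ᴬ
  fun-0 μ e = trans (cong-fun μ e) (fun-𝟎 μ)

  fun-⊖ : ∀ μ x → fun μ (⊖ x) ≡ -ᴬ fun μ x
  fun-⊖ μ x = AG.inverseʳ-unique (fun μ x) (fun μ (⊖ x))
    (trans (sym (homo μ x (⊖ x))) (fun-0 μ (R.-‿inverseʳ x)))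

  infixl 7 _∙_
  _∙_ : Hom → ℛ → Hom
  μ ∙ r = record
    { fun = λ x → fun μ (r ⊗ x)
    ; cong-fun = λ e → cong-fun μ (R.*-congˡ e)
    ; homo = λ x y → trans (cong-fun μ (R.distribˡ r x y)) (homo μ (r ⊗ x) (r ⊗ y)) }

  infixl 6 _+ᴴ_
  _+ᴴ_ : Hom → Hom → Hom
  μ +ᴴ ν = record
    { fun = λ x → fun μ x +ᴬ fun ν x
    ; cong-fun = λ e → cong₂ _+ᴬ_ (cong-fun μ e) (cong-fun ν e)
    ; homo = λ x y → trans (cong₂ _+ᴬ_ (homo μ x y) (homo ν x y)) (interchange (fun μ x) (fun μ y) (fun ν x) (fun ν y)) }

  -ᴴ_ : Hom → Hom
  -ᴴ μ = record
    { fun = λ x → -ᴬ fun μ x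
    ; cong-fun = λ e → cong -ᴬ_ (cong-fun μ e)
    ; homo = λ x y → trans (cong -ᴬ_ (homo μ x y)) (sym (AG.⁻¹-∙-comm (fun μ x) (fun μ y))) }

  infixr 7 _·ᴴ_
  _·ᴴ_ : ℕ → Hom → Hom
  n ·ᴴ μ = record
    { fun = λ x → n · fun μ x
    ; cong-fun = λ e → cong (n ·_) (cong-fun μ e)
    ; homo = λ x y → trans (cong (n ·_) (homo μ x y)) (A×.×-distrib-+ (fun μ x) (fun μ y) n) }

  sumᴴ : ℕ → (ℕ → Hom) → Hom
  sumᴴ n μ = record
    { fun = λ x → sum n (λ i → fun (μ i) x)
    ; cong-fun = λ e → sum-cong n (λ i → cong-fun (μ i) e)
    ; homo = λ x y → trans (sum-cong n (λ i → homo (μ i) x y)) (sum-∙ n _ _) }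

  ·-0 : ∀ n → n · 0ᴬ ≡ 0ᴬ
  ·-0 zero = refl
  ·-0 (suc n) = trans (A.identityˡ _) (·-0 n)

  ∣⇒·≡0 : ∀ {n} a → p ∣ n → n · a ≡ 0ᴬ
  ∣⇒·≡0 a (divides k refl) = trans (sym (A×.×-assocˡ a k p)) (trans (cong (k ·_) (torsion a)) (·-0 k))

  sum-· : ∀ n c f → sum n (λ i → c · f i) ≡ c · sum n f
  sum-· zero c f = sym (·-0 c)
  sum-· (suc n) c f = trans (cong (_+ᴬ c · f n) (sum-· n c f)) (sym (A×.×-distrib-+ (sum n f) (f n) c))

  𝟏↑ : ∀ n → 𝟏 ↑ n ≃ 𝟏
  𝟏↑ zero = R.refl
  𝟏↑ (suc n) = R.trans (R.*-identityˡ _) (𝟏↑ n)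

  -- Stated after μ has been applied, because characteristic p enters through the torsion of 𝔸. The
  -- sum may run to any K above n, so that all exponents of a family share one range.
  binomial : ∀ (μ : Hom) n K → n < K → ∀ x y →
             fun μ ((x ⊕ y) ↑ n) ≡ sum K (λ i → bin n i · fun μ (x ↑ (n ∸ i) ⊗ y ↑ i))
  binomial μ zero (suc K) _ x y = sym (trans (sum-single (suc K) 0 _ (inj₁ (s≤s z≤n)) off)
      (trans (A.identityʳ _) (cong-fun μ (R.*-identityˡ 𝟏))))
    where
    off : ∀ i → i < suc K → i ≢ 0 → bin 0 i · fun μ (x ↑ (0 ∸ i) ⊗ y ↑ i) ≡ 0ᴬ
    off zero _ e = contradiction refl e
    off (suc i) _ _ = refl
  binomial μ (suc n) (suc K) (s≤s n<K) x y = begin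
    fun μ ((x ⊕ y) ↑ suc n)
      ≡⟨ cong-fun μ (R.distribʳ ((x ⊕ y) ↑ n) x y) ⟩
    fun μ (x ⊗ (x ⊕ y) ↑ n ⊕ y ⊗ (x ⊕ y) ↑ n)
      ≡⟨ homo μ _ _ ⟩
    fun (μ ∙ x) ((x ⊕ y) ↑ n) +ᴬ fun (μ ∙ y) ((x ⊕ y) ↑ n)
      ≡⟨ cong₂ _+ᴬ_ (trans (binomial (μ ∙ x) n (suc K) (<-trans n<K (n<1+n K)) x y)
                      (trans (sum-head K _) (cong₂ _+ᴬ_ (cong (1 ·_) (cong-fun μ (assoc0))) (sum-cong K fixx))))
                    (trans (binomial (μ ∙ y) n K n<K x y) (sum-cong K fixy)) ⟩
    (T 0 +ᴬ sum K (λ i → bin n (suc i) · m i)) +ᴬ sum K (λ i → bin n i · m i)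
      ≡⟨ A.assoc (T 0) _ _ ⟩
    T 0 +ᴬ (sum K (λ i → bin n (suc i) · m i) +ᴬ sum K (λ i → bin n i · m i))
      ≡⟨ cong (T 0 +ᴬ_) (trans (A.comm _ _) (trans (sym (sum-∙ K _ _)) (sum-cong K (λ i → sym (A×.×-homo-+ (m i) (bin n i) (bin n (suc i))))))) ⟩
    T 0 +ᴬ sum K (λ i → T (suc i))
      ≡⟨ sum-head K T ⟨
    sum (suc K) T ∎
    where
    open Relation.Binary.PropositionalEquality.≡-Reasoning
    m : ℕ → 𝔸
    m i = fun μ (x ↑ (n ∸ i) ⊗ y ↑ suc i)
    T : ℕ → 𝔸
    T i = bin (suc n) i · fun μ (x ↑ (suc n ∸ i) ⊗ y ↑ i)
    assoc0 : x ⊗ (x ↑ n ⊗ 𝟏) ≃ x ↑ suc n ⊗ 𝟏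
    assoc0 = R.sym (R.*-assoc x (x ↑ n) 𝟏)
    fixy : ∀ i → bin n i · fun (μ ∙ y) (x ↑ (n ∸ i) ⊗ y ↑ i) ≡ bin n i · m i
    fixy i = cong (bin n i ·_) (cong-fun μ (R.trans (R.sym (R.*-assoc y (x ↑ (n ∸ i)) (y ↑ i)))
      (R.trans (R.*-congʳ (R.*-comm y _)) (R.*-assoc (x ↑ (n ∸ i)) y (y ↑ i)))))
    fixx : ∀ i → bin n (suc i) · fun (μ ∙ x) (x ↑ (n ∸ suc i) ⊗ y ↑ suc i) ≡ bin n (suc i) · m i
    fixx i with suc i ≤? n
    ... | yes le = cong (bin n (suc i) ·_) (cong-fun μ (R.trans (R.sym (R.*-assoc x _ _))
          (R.*-congʳ (≡⇒≃ (cong (x ↑_) (sym (+-∸-assoc 1 le)))))))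
    ... | no nle = trans (cong (_· fun (μ ∙ x) (x ↑ (n ∸ suc i) ⊗ y ↑ suc i)) (bin-> (≰⇒> nle))) (sym (cong (_· m i) (bin-> (≰⇒> nle))))

  -- The middle binomial coefficients are multiples of p and die in 𝔸.
  frobenius : ∀ μ x y → fun μ ((x ⊕ y) ↑ p) ≡ fun μ (x ↑ p) +ᴬ fun μ (y ↑ p)
  frobenius μ x y = trans (binomial μ p (suc p) (n<1+n p) x y)
    (aux p refl)
    where
    F : ℕ → ℕ → 𝔸
    F n i = bin n i · fun μ (x ↑ (n ∸ i) ⊗ y ↑ i)
    last : F p p ≡ fun μ (y ↑ p)
    last = trans (cong (_· fun μ (x ↑ (p ∸ p) ⊗ y ↑ p)) (bin-diag p)) (trans (A.identityʳ _)
      (cong-fun μ (R.trans (R.*-congʳ (≡⇒≃ (cong (x ↑_) (n∸n≡0 p)))) (R.*-identityˡ _))))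
    aux : ∀ n → n ≡ p → sum (suc p) (F p) ≡ fun μ (x ↑ p) +ᴬ fun μ (y ↑ p)
    aux zero e = contradiction (subst (1 <_) (sym e) 1<p) (λ ())
    aux (suc n) e = cong₂ _+ᴬ_
      (trans (cong (λ k → sum k (F p)) (sym e)) (trans (sum-head n (F p)) (trans (cong₂ _+ᴬ_
        (trans (A.identityʳ _) (cong-fun μ (R.*-identityʳ _)))
        (sum-ε n (λ i i<n → ∣⇒·≡0 _ (≋0⇒∣ (bin-p (suc i) (s≤s z≤n) (subst (suc i <_) e (s≤s i<n)))))))
        (A.identityʳ _))))
      last

  ↑-p^suc : ∀ x v → (x ↑ (p ^ v)) ↑ p ≃ x ↑ (p ^ suc v)
  ↑-p^suc x v = R.trans (ℛ^.^-assocʳ x (p ^ v) p) (≡⇒≃ (cong (x ↑_) (*-comm (p ^ v) p)))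

  ↑-cong : ∀ n {x y} → x ≃ y → x ↑ n ≃ y ↑ n
  ↑-cong n e = ℛ^.^-congˡ n e

  mutual
    Fr₁ : Hom → Hom
    Fr₁ μ = record { fun = λ x → fun μ (x ↑ p) ; cong-fun = λ e → cong-fun μ (↑-cong p e) ; homo = frobenius μ }

    frobenius^ : ∀ v μ x y → fun μ ((x ⊕ y) ↑ (p ^ v)) ≡ fun μ (x ↑ (p ^ v)) +ᴬ fun μ (y ↑ (p ^ v))
    frobenius^ zero μ x y = trans (cong-fun μ (R.*-identityʳ _)) (trans (homo μ x y)
      (cong₂ _+ᴬ_ (cong-fun μ (R.sym (R.*-identityʳ x))) (cong-fun μ (R.sym (R.*-identityʳ y)))))
    frobenius^ (suc v) μ x y = trans (cong-fun μ (R.sym (↑-p^suc (x ⊕ y) v)))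
      (trans (frobenius^ v (Fr₁ μ) x y) (cong₂ _+ᴬ_ (cong-fun μ (↑-p^suc x v)) (cong-fun μ (↑-p^suc y v))))

  Fr : ℕ → Hom → Hom
  Fr v μ = record { fun = λ x → fun μ (x ↑ (p ^ v)) ; cong-fun = λ e → cong-fun μ (↑-cong (p ^ v) e) ; homo = frobenius^ v μ }

  n<p^n : ∀ v → v < p ^ v
  n<p^n zero = s≤s z≤n
  n<p^n (suc v) = ≤-trans (≤-reflexive (+-comm 1 (suc v)))
    (≤-trans (+-mono-≤ (n<p^n v) (≤-trans (s≤s z≤n) (n<p^n v)))
      (≤-trans (≤-reflexive (cong (p ^ v +_) (sym (+-identityʳ (p ^ v))))) (*-monoˡ-≤ (p ^ v) 1<p)))

  p^v>0 : ∀ v → 1 ≤ p ^ v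
  p^v>0 v = ≤-trans (s≤s z≤n) (n<p^n v)

module Functionals {q p : ℕ} (S : Setting q p) where
  open Setting S public
  open AdditiveMaps p p-prime R isAbelianGroup torsion public

-- Polynomial maps as families of additive maps: substitution and normal form.

module Families {q p : ℕ} (S : Setting q p) where
  open import Data.Nat
  open import Data.Nat.Properties
  open import Data.Nat.Divisibility

  open Functionals S public

  Family : Set
  Family = ℕ → Hom

  module Bounded (K : ℕ) where

    -- A family Λ encodes the polynomial map x ↦ Σ_{j<K} Λ_j(x ^ j).
    ev : Family → ℛ → 𝔸
    ev Λ x = sum K (λ j → fun (Λ j) (x ↑ j))

    ev-cong : ∀ Λ {x y} → x ≃ y → ev Λ x ≡ ev Λ y
    ev-cong Λ e = sum-cong K (λ j → cong-fun (Λ j) (↑-cong j e))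

    Bnd : Family → Set
    Bnd Λ = ∀ j → K ≤ j → Λ j ≗ 0ᴴ

    -- True for k ∈ 𝒦* maximal in 𝒦; then only the exponent k contributes to the coefficient of x ^ k
    -- after a substitution x = r + g y, even if x ^ (p ^ v * k) is counted as a Frobenius twist of x ^ k.
    Good : Family → ℕ → Set
    Good Λ k = ∀ j v → p ^ v * k ≼ j → j ≢ k → Λ j ≗ 0ᴴ

    Deg : Family → ℕ → Set
    Deg Λ s = ∀ j → s < ds j → Λ j ≗ 0ᴴ

    Free : Family → Set
    Free Λ = ∀ j → 1 ≤ j → p ∣ j → Λ j ≗ 0ᴴ

    -- Coefficients of the expansion of the polynomial map in y at x = r + g y.
    res : ℛ → ℛ → Family → Family
    res r g Λ i = sumᴴ K (λ j → bin j i ·ᴴ (Λ j ∙ (r ↑ (j ∸ i) ⊗ g ↑ i)))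

    ev-res : ∀ Λ r g y → ev Λ (r ⊕ g ⊗ y) ≡ ev (res r g Λ) y
    ev-res Λ r g y = trans
      (sum-cong< K (λ j j<K → binomial (Λ j) j K j<K r (g ⊗ y)))
      (trans (sum-swap K K _) (sum-cong K (λ i → sum-cong K (λ j → cong (bin j i ·_) (cong-fun (Λ j)
        (R.trans (R.*-congˡ (ℛ^.^-distrib-* g y i)) (R.sym (R.*-assoc (r ↑ (j ∸ i)) (g ↑ i) (y ↑ i)))))))))

    term0 : ∀ (Λ : Family) r g i j x → (p ∣ bin j i ⊎ Λ j ≗ 0ᴴ) → fun (bin j i ·ᴴ (Λ j ∙ (r ↑ (j ∸ i) ⊗ g ↑ i))) x ≡ 0ᴬ
    term0 Λ r g i j x (inj₁ d) = ∣⇒·≡0 _ d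
    term0 Λ r g i j x (inj₂ z) = trans (cong (bin j i ·_) (z _)) (·-0 (bin j i))

    term-diag : ∀ (Λ : Family) r g i x → fun (bin i i ·ᴴ (Λ i ∙ (r ↑ (i ∸ i) ⊗ g ↑ i))) x ≡ fun (Λ i ∙ (g ↑ i)) x
    term-diag Λ r g i x = trans (cong (_· fun (Λ i ∙ (r ↑ (i ∸ i) ⊗ g ↑ i)) x) (bin-diag i)) (trans (A.identityʳ _)
      (cong-fun (Λ i) (R.*-congʳ (R.trans (R.*-congʳ (≡⇒≃ (cong (r ↑_) (n∸n≡0 i)))) (R.*-identityˡ _)))))

    res-Bnd : ∀ Λ r g → Bnd (res r g Λ)
    res-Bnd Λ r g i K≤i x = sum-ε K (λ j j<K → term0 Λ r g i j x
      (inj₁ (subst (p ∣_) (sym (bin-> (<-≤-trans j<K K≤i))) (p ∣0))))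

    ≼? : ∀ i j → (p ∣ bin j i) ⊎ (i ≼ j)
    ≼? i j with p ∣? bin j i
    ... | yes d = inj₁ d
    ... | no n = inj₂ n

    ≼-ds : ∀ {i j} → i ≼ j → ds j ≡ ds i + ds (j ∸ i)
    ≼-ds {i} {j} h = trans (cong ds (sym e)) (ds-+ {i} (j ∸ i) (subst (i ≼_) (sym e) h))
      where e = m+[n∸m]≡n (≼⇒≤ {i} {j} h)

    ≼-ds≡ : ∀ {i j} → i ≼ j → ds j ≤ ds i → j ≡ i
    ≼-ds≡ {i} {j} h le = trans (sym (m+[n∸m]≡n (≼⇒≤ {i} {j} h))) (trans (cong (i +_) (ds≡0 (j ∸ i) z)) (+-identityʳ i))
      where
      z : ds (j ∸ i) ≡ 0
      z = n≤0⇒n≡0 (+-cancelˡ-≤ (ds i) _ _ (subst₂ _≤_ (≼-ds {i} {j} h) (sym (+-identityʳ (ds i))) le))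

    k≤p^v*k : ∀ v k → k ≤ p ^ v * k
    k≤p^v*k v k = subst (_≤ p ^ v * k) (*-identityˡ k) (*-monoˡ-≤ k (p^v>0 v))

    res-only : ∀ Λ r g i x → Bnd Λ → (∀ j → i ≼ j → j ≢ i → Λ j ≗ 0ᴴ) → fun (res r g Λ i) x ≡ fun (Λ i ∙ (g ↑ i)) x
    res-only Λ r g i x bnd h = trans (sum-single K i _ inside off) (term-diag Λ r g i x)
      where
      inside : i < K ⊎ _
      inside with i <? K
      ... | yes l = inj₁ l
      ... | no nl = inj₂ (term0 Λ r g i i x (inj₂ (bnd i (≮⇒≥ nl))))
      off : ∀ j → j < K → j ≢ i → fun (bin j i ·ᴴ (Λ j ∙ (r ↑ (j ∸ i) ⊗ g ↑ i))) x ≡ 0ᴬ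
      off j _ j≢i with ≼? i j
      ... | inj₁ d = term0 Λ r g i j x (inj₁ d)
      ... | inj₂ l = term0 Λ r g i j x (inj₂ (h j l j≢i))

    res-good : ∀ Λ r g k → Bnd Λ → Good Λ k → res r g Λ k ≗ (Λ k ∙ (g ↑ k))
    res-good Λ r g k bnd gd x = res-only Λ r g k x bnd (λ j k≼j → gd j 0 (subst (_≼ j) (sym (*-identityˡ k)) k≼j))

    -- An exponent j that feeds into i satisfies p^v k ≼ i ≼ j, so its coefficient vanishes unless j
    -- = k. But then i ≤ k ≤ p^v k ≤ i, against i ≢ k.
    res-Good : ∀ Λ r g k → Good Λ k → Good (res r g Λ) k
    res-Good Λ r g k gd i v l i≢k x = sum-ε K go
      where
      go : ∀ j → j < K → _
      go j _ with ≼? i j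
      ... | inj₁ d = term0 Λ r g i j x (inj₁ d)
      ... | inj₂ i≼j with j ≟ k
      ...   | no j≢k = term0 Λ r g i j x (inj₂ (gd j v (≼-trans {p ^ v * k} {i} {j} l i≼j) j≢k))
      ...   | yes refl = contradiction (≤-antisym (≼⇒≤ {i} {j} i≼j) (≤-trans (k≤p^v*k v k) (≼⇒≤ {p ^ v * k} {i} l))) i≢k

    res-Deg : ∀ Λ r g s → Deg Λ s → Deg (res r g Λ) s
    res-Deg Λ r g s dg i s<i x = sum-ε K go
      where
      go : ∀ j → j < K → _
      go j _ with ≼? i j
      ... | inj₁ d = term0 Λ r g i j x (inj₁ d)
      ... | inj₂ i≼j = term0 Λ r g i j x (inj₂ (dg j (<-≤-trans s<i (subst (ds i ≤_) (sym (≼-ds {i} {j} i≼j)) (m≤m+n (ds i) _)))))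

    -- Moves the exponent i * p to i, since x ^ (i * p) = (x ^ i) ^ p.
    move : ℕ → Family → Family
    move i Λ l with l ≟ i
    ... | yes _ = Λ l +ᴴ Fr₁ (Λ (i * p))
    ... | no _ with l ≟ i * p
    ...   | yes _ = 0ᴴ
    ...   | no _ = Λ l

    module _ (i : ℕ) (1≤i : 1 ≤ i) (Λ : Family) where
      i<ip : i < i * p
      i<ip = subst (_< i * p) (*-identityʳ i) (*-monoʳ-< i {{>-nonZero 1≤i}} 1<p)

      move-i : move i Λ i ≗ (Λ i +ᴴ Fr₁ (Λ (i * p)))
      move-i x with i ≟ i
      ... | yes _ = refl
      ... | no n = contradiction refl n

      move-ip : move i Λ (i * p) ≗ 0ᴴ
      move-ip x with i * p ≟ i
      ... | yes e = contradiction e (λ e → <⇒≢ i<ip (sym e))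
      ... | no _ with i * p ≟ i * p
      ...   | yes _ = refl
      ...   | no n = contradiction refl n

      move-other : ∀ l → l ≢ i → l ≢ i * p → move i Λ l ≗ Λ l
      move-other l l≢i l≢ip x with l ≟ i
      ... | yes e = contradiction e l≢i
      ... | no _ with l ≟ i * p
      ...   | yes e = contradiction e l≢ip
      ...   | no _ = refl

      move-case : ∀ l → (l ≡ i ⊎ l ≡ i * p) ⊎ (l ≢ i × l ≢ i * p)
      move-case l with l ≟ i | l ≟ i * p
      ... | yes e | _ = inj₁ (inj₁ e)
      ... | no _ | yes e = inj₁ (inj₂ e)
      ... | no a | no b = inj₂ (a , b)

      move-ev : i * p < K → ∀ x → ev (move i Λ) x ≡ ev Λ x
      -- The sums agree term by term once w, the value carried by the exponent i * p, is added at
      -- index i * p on the left and at index i on the right.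
      move-ev ip<K x = AG.∙-cancelʳ w _ _ (begin
        ev (move i Λ) x +ᴬ w
          ≡⟨ cong (ev (move i Λ) x +ᴬ_) (sum-δ K (i * p) (λ _ → w) (inj₁ ip<K)) ⟨
        ev (move i Λ) x +ᴬ sum K (λ l → [ l ≟ i * p ] w)
          ≡⟨ sum-∙ K _ _ ⟨
        sum K (λ l → fun (move i Λ l) (x ↑ l) +ᴬ [ l ≟ i * p ] w)
          ≡⟨ sum-cong K pt ⟩
        sum K (λ l → fun (Λ l) (x ↑ l) +ᴬ [ l ≟ i ] w)
          ≡⟨ sum-∙ K _ _ ⟩
        ev Λ x +ᴬ sum K (λ l → [ l ≟ i ] w)
          ≡⟨ cong (ev Λ x +ᴬ_) (sum-δ K i (λ _ → w) (inj₁ (<-trans i<ip ip<K))) ⟩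
        ev Λ x +ᴬ w ∎)
        where
        open Relation.Binary.PropositionalEquality.≡-Reasoning
        w : 𝔸
        w = fun (Λ (i * p)) (x ↑ (i * p))
        wi : fun (Fr₁ (Λ (i * p))) (x ↑ i) ≡ w
        wi = cong-fun (Λ (i * p)) (ℛ^.^-assocʳ x i p)
        pt : ∀ l → fun (move i Λ l) (x ↑ l) +ᴬ [ l ≟ i * p ] w ≡ fun (Λ l) (x ↑ l) +ᴬ [ l ≟ i ] w
        pt l with l ≟ i
        ... | yes refl with l ≟ l * p
        ...   | yes e = contradiction e (<⇒≢ i<ip)
        ...   | no _ = trans (A.identityʳ _) (cong (fun (Λ l) (x ↑ l) +ᴬ_) wi)
        pt l | no _ with l ≟ i * p
        ...   | yes refl = A.comm 0ᴬ w
        ...   | no _ = refl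

      move-Bnd : i * p < K → Bnd Λ → Bnd (move i Λ)
      move-Bnd ip<K bnd j K≤j x = trans (move-other j (λ e → <⇒≱ (<-trans i<ip ip<K) (subst (K ≤_) e K≤j))
        (λ e → <⇒≱ ip<K (subst (K ≤_) e K≤j)) x) (bnd j K≤j x)

      zero-pair : ∀ {a b} → a ≡ 0ᴬ → b ≡ 0ᴬ → a +ᴬ b ≡ 0ᴬ
      zero-pair refl refl = A.identityˡ 0ᴬ

      move-Deg : ∀ s → Deg Λ s → Deg (move i Λ) s
      move-Deg s dg j s<j x with move-case j
      ... | inj₁ (inj₁ refl) = trans (move-i x) (zero-pair (dg j s<j x) (dg (i * p) (subst (s <_) (sym (ds-*p i)) s<j) _))
      ... | inj₁ (inj₂ refl) = move-ip x
      ... | inj₂ (a , b) = trans (move-other j a b x) (dg j s<j x)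

      shift≼ : ∀ {v k} → p ^ v * k ≼ i → p ^ suc v * k ≼ i * p
      shift≼ {v} {k} l = subst (_≼ i * p) (trans (*-comm (p ^ v * k) p) (sym (*-assoc p (p ^ v) k))) (≼-*p {p ^ v * k} {i} l)

      ≢-shift : ∀ {v k} → p ^ v * k ≼ i → i * p ≢ k
      ≢-shift {v} {k} l e = <⇒≱ i<ip (subst (_≤ i) (sym e) (≤-trans (k≤p^v*k v k) (≼⇒≤ {p ^ v * k} {i} l)))

      -- If p^v k ≼ i then p^(v+1) k ≼ i * p, so whatever arrives at i was zero already. This is the
      -- reason for the quantifier over v in `Good`.
      move-Good : ∀ k → Good Λ k → Good (move i Λ) k
      move-Good k gd j v l j≢k x with move-case j
      ... | inj₁ (inj₁ refl) = trans (move-i x) (zero-pair (gd j v l j≢k x)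
              (gd (i * p) (suc v) (shift≼ {v} {k} l) (≢-shift {v} {k} l) _))
      ... | inj₁ (inj₂ refl) = move-ip x
      ... | inj₂ (a , b) = trans (move-other j a b x) (gd j v l j≢k x)

      -- Only k * p could be folded into k, and `Good` with v = 1 makes its coefficient zero.
      move-good : ∀ k → ¬ (p ∣ k) → Good Λ k → move i Λ k ≗ Λ k
      move-good k p∤k gd x with move-case k
      ... | inj₁ (inj₁ refl) = trans (move-i x) (trans (cong (fun (Λ i) x +ᴬ_)
              (gd (i * p) 1 (shift≼ {0} {i} l) (≢-shift {0} {i} l) _)) (A.identityʳ _))
        where
        l : p ^ 0 * i ≼ i
        l = subst (_≼ i) (sym (*-identityˡ i)) (≼-refl {i})
      ... | inj₁ (inj₂ refl) = contradiction (n∣m*n i) p∤k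
      ... | inj₂ (a , b) = move-other k a b x

    record Normal (Λ : Family) (n : ℕ) : Set where
      field
        fam : Family
        same : ∀ x → ev fam x ≡ ev Λ x
        bnd : Bnd fam
        free : ∀ j → 1 ≤ j → n ≤ j → p ∣ j → fam j ≗ 0ᴴ
        good : ∀ k → ¬ (p ∣ k) → Good Λ k → Good fam k × (fam k ≗ Λ k)
        deg : ∀ s → Deg Λ s → Deg fam s

    private
      -- Exponents are treated from the largest downwards: a move adds only to a smaller exponent,
      -- whose turn is still to come.
      normal-down : ∀ d Λ → Bnd Λ → d ≤ K → Normal Λ (K ∸ d)
      normal-down zero Λ b _ = record { fam = Λ ; same = λ _ → refl ; bnd = b ; free = λ j _ K≤j _ → b j K≤j
        ; good = λ k _ g → g , λ _ → refl ; deg = λ s h → h }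
      normal-down (suc d) Λ b sd≤K with normal-down d Λ b (≤-trans (n≤1+n d) sd≤K) | K ∸ suc d in eq | p ∣? (K ∸ suc d)
      -- Exponent 0 carries the constant term and is left alone.
      ... | N | zero | _ = record { Normal N ; free = λ { j 1≤j _ → Normal.free N j 1≤j (≤-trans (≤-reflexive top) 1≤j) } }
        where
        top : K ∸ d ≡ 1
        top = trans (+-∸-assoc 1 {K} {suc d} sd≤K) (cong suc eq)
      ... | N | suc m | no p∤ = record { Normal N ; free = free′ }
        where
        top : K ∸ d ≡ suc (suc m)
        top = trans (+-∸-assoc 1 {K} {suc d} sd≤K) (cong suc eq)
        free′ : ∀ j → 1 ≤ j → suc m ≤ j → p ∣ j → Normal.fam N j ≗ 0ᴴ
        free′ j 1≤j m≤j p∣j with suc m ≟ j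
        ... | yes refl = contradiction p∣j p∤
        ... | no ne = Normal.free N j 1≤j (subst (_≤ j) (sym top) (≤∧≢⇒< m≤j ne)) p∣j
      ... | N | suc m | yes p∣ with p∣
      ...   | divides zero ()
      ...   | divides i@(suc _) e = record
              { fam = move i Λ′
              ; same = λ x → trans (move-ev i (s≤s z≤n) Λ′ ip<K x) (Normal.same N x)
              ; bnd = move-Bnd i (s≤s z≤n) Λ′ ip<K (Normal.bnd N)
              ; free = free′
              ; good = λ k p∤k gd → let (g , eqk) = Normal.good N k p∤k gd in
                  move-Good i (s≤s z≤n) Λ′ k g , λ x → trans (move-good i (s≤s z≤n) Λ′ k p∤k g x) (eqk x)
              ; deg = λ s dg → move-Deg i (s≤s z≤n) Λ′ s (Normal.deg N s dg) }
        where
        Λ′ = Normal.fam N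
        top : K ∸ d ≡ suc (suc m)
        top = trans (+-∸-assoc 1 {K} {suc d} sd≤K) (cong suc eq)
        ip<K : i * p < K
        ip<K = subst (_< K) e (≤-trans (≤-reflexive (sym top)) (m∸n≤m K d))
        free′ : ∀ j → 1 ≤ j → suc m ≤ j → p ∣ j → move i Λ′ j ≗ 0ᴴ
        free′ j 1≤j m≤j p∣j x with suc m ≟ j
        ... | yes refl = subst (λ z → fun (move i Λ′ z) x ≡ 0ᴬ) (sym e) (move-ip i (s≤s z≤n) Λ′ x)
        ... | no ne = trans (move-other i (s≤s z≤n) Λ′ j
                (λ j≡i → <⇒≱ (i<ip i (s≤s z≤n) Λ′) (subst₂ _≤_ e j≡i m≤j)) (λ j≡ip → ne (trans e (sym j≡ip))) x)
              (Normal.free N j 1≤j (subst (_≤ j) (sym top) (≤∧≢⇒< m≤j ne)) p∣j x)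

    normalise : ∀ Λ → Bnd Λ → Normal Λ 0
    normalise Λ b = subst (Normal Λ) (n∸n≡0 K) (normal-down K Λ b ≤-refl)

-- Differencing, polarisation and the isolation of one exponent.

module Polarisation {q p : ℕ} (S : Setting q p) (K : ℕ) where
  open import Data.Nat
  open import Data.Nat.Properties
  open import Data.Nat.Divisibility
  open import Data.Nat.ListAction using () renaming (sum to sumℕ)
  open import Data.List using (map; upTo; cartesianProduct)
  open import Data.List.Membership.Propositional.Properties using (∈-cartesianProduct⁺; ∈-upTo⁺)
  open import Data.Vec using (Vec; []; _∷_; zipWith)
  open import Data.Vec.Relation.Unary.All using (All; []; _∷_)

  open Families S public
  open Bounded K public

  p^-injective : ∀ {v w} → p ^ v ≡ p ^ w → v ≡ w
  p^-injective {v} {w} e with <-cmp v w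
  ... | tri< l _ _ = contradiction e (<⇒≢ (^-monoʳ-< p 1<p l))
  ... | tri≈ _ e′ _ = e′
  ... | tri> _ _ g = contradiction (sym e) (<⇒≢ (^-monoʳ-< p 1<p g))

  m<m+p^v : ∀ m v → m < m + p ^ v
  m<m+p^v m v = subst (_≤ m + p ^ v) (+-comm m 1) (+-monoʳ-≤ m (p^v>0 v))

  -- The increments 0 and p^v are the numbers of digit sum at most one, which are all that degree
  -- considerations leave below. As v < p^v, the range K is long enough for v too.
  sum-p-powers : ∀ a (f : ℕ → 𝔸) → (∀ j → j ≢ a → (∀ v → j ≢ a + p ^ v) → f j ≡ 0ᴬ) → (∀ j → K ≤ j → f j ≡ 0ᴬ) →
         sum K f ≡ f a +ᴬ sum K (λ v → f (a + p ^ v))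
  sum-p-powers a f off out = trans (sum-cong< K pt) (trans (sum-∙ K _ _) (cong₂ _+ᴬ_ (sum-δ K a f (inside a))
      (trans (sum-swap K K _) (sum-cong K (λ v → sum-δ K (a + p ^ v) f (inside (a + p ^ v)))))))
    where
    inside : ∀ j → j < K ⊎ f j ≡ 0ᴬ
    inside j with j <? K
    ... | yes l = inj₁ l
    ... | no nl = inj₂ (out j (≮⇒≥ nl))
    []-no : ∀ {P : Set} (d : Dec P) {b} → ¬ P → [ d ] b ≡ 0ᴬ
    []-no (yes x) n = contradiction x n
    []-no (no _) n = refl
    []-yes : ∀ {P : Set} (d : Dec P) {b} → P → [ d ] b ≡ b
    []-yes (yes _) _ = refl
    []-yes (no n) x = contradiction x n
    pt : ∀ j → j < K → f j ≡ [ j ≟ a ] f j +ᴬ sum K (λ v → [ j ≟ a + p ^ v ] f j)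
    pt j j<K with j ≟ a
    ... | yes refl = sym (trans (cong (f j +ᴬ_) (sum-ε K (λ v _ → []-no (j ≟ j + p ^ v) (<⇒≢ (m<m+p^v j v))))) (A.identityʳ _))
    ... | no j≢a with anyUpTo? (λ v → j ≟ a + p ^ v) K
    ...   | yes (v , v<K , e) = sym (trans (A.identityˡ _) (trans (sum-single K v _ (inj₁ v<K)
              (λ w _ w≢v → []-no (j ≟ a + p ^ w) (λ e′ → w≢v (p^-injective (+-cancelˡ-≡ a _ _ (trans (sym e′) e))))))
              ([]-yes (j ≟ a + p ^ v) e)))
    ...   | no none = trans (off j j≢a (λ v e → none (v , bound v e , e)))
              (sym (trans (A.identityˡ _) (sum-ε K (λ v v<K → []-no (j ≟ a + p ^ v) (λ e → none (v , v<K , e))))))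
      where
      bound : ∀ v → j ≡ a + p ^ v → v < K
      bound v e = <-trans (n<p^n v) (≤-<-trans (subst (p ^ v ≤_) (sym e) (m≤n+m _ a)) j<K)

  d : ℛ → Family → Family
  d h Λ i = res h 𝟏 Λ i +ᴴ (-ᴴ Λ i)

  cancel-middle : ∀ a b → (a +ᴬ -ᴬ b) +ᴬ b ≡ a
  cancel-middle a b = trans (A.assoc a _ b) (trans (cong (a +ᴬ_) (A.inverseˡ b)) (A.identityʳ a))

  cancel-+ : ∀ a b → (a +ᴬ b) +ᴬ -ᴬ a ≡ b
  cancel-+ a b = trans (cong (_+ᴬ -ᴬ a) (A.comm a b)) (trans (A.assoc b a _) (trans (cong (b +ᴬ_) (A.inverseʳ a)) (A.identityʳ b)))

  ev-d : ∀ Λ h x → ev (d h Λ) x ≡ ev Λ (x ⊕ h) +ᴬ -ᴬ ev Λ x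
  ev-d Λ h x = AG.∙-cancelʳ (ev Λ x) _ _ (trans (trans (sym (sum-∙ K _ _))
      (sum-cong K (λ i → cancel-middle (fun (res h 𝟏 Λ i) (x ↑ i)) (fun (Λ i) (x ↑ i)))))
    (trans (sym (ev-res Λ h 𝟏 x)) (trans (ev-cong Λ (R.trans (R.+-congˡ (R.*-identityˡ x)) (R.+-comm h x)))
      (sym (cancel-middle (ev Λ (x ⊕ h)) (ev Λ x))))))

  sub-zero : ∀ {a b} → a ≡ 0ᴬ → b ≡ 0ᴬ → a +ᴬ -ᴬ b ≡ 0ᴬ
  sub-zero refl refl = A.inverseʳ 0ᴬ

  d-Bnd : ∀ h Λ → Bnd Λ → Bnd (d h Λ)
  d-Bnd h Λ b j K≤j x = sub-zero (res-Bnd Λ h 𝟏 j K≤j x) (b j K≤j x)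

  res-𝟏 : ∀ (Λ : Family) i x → fun (Λ i ∙ (𝟏 ↑ i)) x ≡ fun (Λ i) x
  res-𝟏 Λ i x = cong-fun (Λ i) (R.trans (R.*-congʳ (𝟏↑ i)) (R.*-identityˡ x))

  -- Only exponents of larger digit sum could feed into one of top degree, so the shift by h does
  -- not change the coefficient there and the difference cancels.
  d-Deg : ∀ h Λ n → Bnd Λ → Deg Λ (suc n) → Deg (d h Λ) n
  d-Deg h Λ n b dg i n<i x = trans (cong (_+ᴬ -ᴬ fun (Λ i) x) (trans (res-only Λ h 𝟏 i x b other) (res-𝟏 Λ i x))) (A.inverseʳ _)
    where
    other : ∀ j → i ≼ j → j ≢ i → Λ j ≗ 0ᴴ
    other j i≼j j≢i with suc n <? ds j
    ... | yes l = dg j l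
    ... | no nl = contradiction (≼-ds≡ {i} {j} i≼j (≤-trans (≮⇒≥ nl) n<i)) j≢i

  -- The derivative in direction h: the exponent i + p^v loses one unit of one digit, and h ^ (p^v)
  -- takes it up.
  lin : Family → ℛ → Family
  lin M h i = sumᴴ K (λ v → bin (i + p ^ v) i ·ᴴ (M (i + p ^ v) ∙ (h ↑ (p ^ v))))

  -- M is compared with Λ in degree n only and never truncated, so that in the end it can be the
  -- original family. This is safe: where digits carry in i + p^v, the binomial coefficient in `lin`
  -- is divisible by p, so in degree n `lin` reads degree n + 1 only.
  Agree : ℕ → Family → Family → Set
  Agree n Λ M = Deg Λ n × (∀ i → ds i ≡ n → Λ i ≗ M i)

  d-Agree : ∀ h Λ M n → Bnd Λ → Agree (suc n) Λ M → Agree n (d h Λ) (lin M h)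
  d-Agree h Λ M n b (dg , ag) = d-Deg h Λ n b dg , λ i e x →
      trans (cong (_+ᴬ -ᴬ fun (Λ i) x) (trans (sum-p-powers i (f i x) (off i e x) (out i x))
              (cong (_+ᴬ sum K (λ v → f i x (i + p ^ v))) (trans (term-diag Λ h 𝟏 i x) (res-𝟏 Λ i x)))))
        (trans (cancel-+ (fun (Λ i) x) _) (sum-cong K (λ v → term i e x v)))
    where
    f : ℕ → ℛ → ℕ → 𝔸
    f i x j = fun (bin j i ·ᴴ (Λ j ∙ (h ↑ (j ∸ i) ⊗ 𝟏 ↑ i))) x
    off : ∀ i → ds i ≡ n → ∀ x j → j ≢ i → (∀ v → j ≢ i + p ^ v) → f i x j ≡ 0ᴬ
    off i e x j j≢i nv with ≼? i j
    ... | inj₁ dv = term0 Λ h 𝟏 i j x (inj₁ dv)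
    ... | inj₂ l with ds (j ∸ i) in eq | ≼-ds {i} {j} l
    ...   | zero | e′ = contradiction (≼-ds≡ {i} {j} l (≤-reflexive (trans e′ (+-identityʳ _)))) j≢i
    ...   | suc zero | _ = let (v , e″) = ds≡1 (j ∸ i) eq in
              contradiction (trans (sym (m+[n∸m]≡n (≼⇒≤ {i} {j} l))) (cong (i +_) e″)) (nv v)
    ...   | suc (suc m) | e′ = term0 Λ h 𝟏 i j x (inj₂ (dg j (subst (suc n <_) (sym (trans e′ (cong (_+ suc (suc m)) e)))
              (subst (_≤ n + suc (suc m)) (+-comm n 2) (+-monoʳ-≤ n (s≤s (s≤s z≤n)))))))
    out : ∀ i x j → K ≤ j → f i x j ≡ 0ᴬ
    out i x j K≤j = term0 Λ h 𝟏 i j x (inj₂ (b j K≤j))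
    term : ∀ i → ds i ≡ n → ∀ x v → f i x (i + p ^ v) ≡ fun (bin (i + p ^ v) i ·ᴴ (M (i + p ^ v) ∙ (h ↑ (p ^ v)))) x
    term i e x v with ≼? i (i + p ^ v)
    ... | inj₁ dv = trans (∣⇒·≡0 _ dv) (sym (∣⇒·≡0 _ dv))
    ... | inj₂ l = cong (bin (i + p ^ v) i ·_) (trans (cong-fun (Λ (i + p ^ v)) (R.*-congʳ
            (R.trans (R.*-congˡ (𝟏↑ i)) (R.trans (R.*-identityʳ _) (≡⇒≃ (cong (h ↑_) (m+n∸m≡n i (p ^ v))))))))
            (ag (i + p ^ v) (trans (ds-+ {i} (p ^ v) l) (trans (cong₂ _+_ e (ds-p^ v)) (+-comm n 1))) _))

  lins : ∀ {n} → Family → Vec ℛ n → Family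
  lins M [] = M
  lins M (h ∷ hs) = lins (lin M h) hs

  -- The value at (hs, x) of the multilinear form polarising the part of degree suc n.
  top : ∀ {n} → Family → Vec ℛ n → ℛ → 𝔸
  top M hs x = sum K (λ v → fun (lins M hs (p ^ v)) (x ↑ (p ^ v)))

  ev-top : ∀ Λ M → Bnd Λ → Agree 1 Λ M → ∀ x → ev Λ x ≡ fun (Λ 0) 𝟏 +ᴬ top M [] x
  ev-top Λ M b (dg , ag) x = trans (sum-p-powers 0 (λ j → fun (Λ j) (x ↑ j)) off (λ j K≤j → b j K≤j _))
      (cong (fun (Λ 0) 𝟏 +ᴬ_) (sum-cong K (λ v → ag (p ^ v) (ds-p^ v) _)))
    where
    off : ∀ j → j ≢ 0 → (∀ v → j ≢ p ^ v) → fun (Λ j) (x ↑ j) ≡ 0ᴬ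
    off j j≢0 nv with ds j in eq
    ... | zero = contradiction (ds≡0 j eq) j≢0
    ... | suc zero = let (v , e) = ds≡1 j eq in contradiction e (nv v)
    ... | suc (suc m) = dg j (subst (1 <_) (sym eq) (s≤s (s≤s z≤n))) _

  lin-cong : ∀ {M M′} h → (∀ i → M i ≗ M′ i) → ∀ i → lin M h i ≗ lin M′ h i
  lin-cong h e i x = sum-cong K (λ v → cong (bin (i + p ^ v) i ·_) (e (i + p ^ v) _))

  lins-cong : ∀ {n M M′} (hs : Vec ℛ n) → (∀ i → M i ≗ M′ i) → ∀ i → lins M hs i ≗ lins M′ hs i
  lins-cong [] e = e
  lins-cong {M = M} {M′} (h ∷ hs) e = lins-cong hs (lin-cong {M} {M′} h e)

  lin-⊖ : ∀ M M′ h i → lin (λ l → M l +ᴴ (-ᴴ M′ l)) h i ≗ (lin M h i +ᴴ (-ᴴ lin M′ h i))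
  lin-⊖ M M′ h i x = AG.∙-cancelʳ (fun (lin M′ h i) x) _ _ (trans (sym (sum-∙ K _ _))
      (trans (sum-cong K (λ v → trans (sym (A×.×-distrib-+ _ _ (bin (i + p ^ v) i))) (cong (bin (i + p ^ v) i ·_) (cancel-middle _ _))))
      (sym (cancel-middle _ _))))

  lins-⊖ : ∀ {n} M M′ (hs : Vec ℛ n) i → lins (λ l → M l +ᴴ (-ᴴ M′ l)) hs i ≗ (lins M hs i +ᴴ (-ᴴ lins M′ hs i))
  lins-⊖ M M′ [] i x = refl
  lins-⊖ M M′ (h ∷ hs) i x = trans (lins-cong hs (lin-⊖ M M′ h) i x) (lins-⊖ (lin M h) (lin M′ h) hs i x)

  fun-⊝ : ∀ μ x y → fun μ (x ⊝ y) ≡ fun μ x +ᴬ -ᴬ fun μ y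
  fun-⊝ μ x y = trans (homo μ x (⊖ y)) (cong (fun μ x +ᴬ_) (fun-⊖ μ y))

  lin-h-⊖ : ∀ M h h′ i → lin M (h ⊝ h′) i ≗ (lin M h i +ᴴ (-ᴴ lin M h′ i))
  lin-h-⊖ M h h′ i x = AG.∙-cancelʳ (fun (lin M h′ i) x) _ _ (trans (sym (sum-∙ K _ _))
      (trans (sum-cong K (λ v → trans (sym (A×.×-distrib-+ _ _ (bin (i + p ^ v) i))) (cong (bin (i + p ^ v) i ·_) (pt v))))
      (sym (cancel-middle _ _))))
    where
    flip : ∀ (μ : Hom) y → fun μ (y ⊗ x) ≡ fun (μ ∙ x) y
    flip μ y = cong-fun μ (R.*-comm y x)
    pt : ∀ v → fun (M (i + p ^ v)) ((h ⊝ h′) ↑ (p ^ v) ⊗ x) +ᴬ fun (M (i + p ^ v)) (h′ ↑ (p ^ v) ⊗ x) ≡ fun (M (i + p ^ v)) (h ↑ (p ^ v) ⊗ x)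
    pt v = let μ = M (i + p ^ v) in
      trans (cong₂ _+ᴬ_ (trans (flip μ _) (trans (fun-⊝ (Fr v (μ ∙ x)) h h′) refl)) (flip μ _))
            (trans (cancel-middle _ _) (sym (flip μ _)))

  top-⊖ : ∀ {n} M M′ (hs : Vec ℛ n) x → top (λ l → M l +ᴴ (-ᴴ M′ l)) hs x ≡ top M hs x +ᴬ -ᴬ top M′ hs x
  top-⊖ M M′ hs x = AG.∙-cancelʳ (top M′ hs x) _ _ (trans (sym (sum-∙ K _ _))
      (trans (sum-cong K (λ v → trans (cong (_+ᴬ fun (lins M′ hs (p ^ v)) (x ↑ (p ^ v))) (lins-⊖ M M′ hs (p ^ v) (x ↑ (p ^ v)))) (cancel-middle _ _)))
      (sym (cancel-middle _ _))))

  top-cong : ∀ {n M M′} (hs : Vec ℛ n) → (∀ i → M i ≗ M′ i) → ∀ x → top M hs x ≡ top M′ hs x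
  top-cong hs e x = sum-cong K (λ v → lins-cong hs e (p ^ v) _)

  lin-sum : ∀ m (P : ℕ → Family) (c : ℕ → ℛ) h i →
            lin (λ l → sumᴴ m (λ w → P w l ∙ c w)) h i ≗ sumᴴ m (λ w → lin (P w) h i ∙ c w)
  lin-sum m P c h i x = trans (sum-cong K (λ v → sym (sum-· m (bin (i + p ^ v) i) _)))
    (trans (sum-swap K m _) (sum-cong m (λ w → sum-cong K (λ v → cong (bin (i + p ^ v) i ·_) (cong-fun (P w (i + p ^ v)) (swap v w))))))
    where
    swap : ∀ v w → c w ⊗ (h ↑ (p ^ v) ⊗ x) ≃ h ↑ (p ^ v) ⊗ (c w ⊗ x)
    swap v w = R.trans (R.sym (R.*-assoc _ _ x)) (R.trans (R.*-congʳ (R.*-comm _ _)) (R.*-assoc _ _ x))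

  lins-sum : ∀ {n} m (P : ℕ → Family) (c : ℕ → ℛ) (hs : Vec ℛ n) i →
             lins (λ l → sumᴴ m (λ w → P w l ∙ c w)) hs i ≗ sumᴴ m (λ w → lins (P w) hs i ∙ c w)
  lins-sum m P c [] i x = refl
  lins-sum m P c (h ∷ hs) i x = trans (lins-cong hs (lin-sum m P c h) i x) (lins-sum m (λ w → lin (P w) h) c hs i x)

  -- The operators (h ↦ t^(p^e) h) - (x ↦ t^(p^e′) x) act on the monomial h^(p^w) x^(p^v) by this factor,
  -- which vanishes exactly when e + w = e′ + v; the pairs harmless to w = σ, v = 0 are kept.
  fac₁ : ℕ → ℕ × ℕ → ℕ → ℕ → ℛ
  fac₁ σ (e , e′) w v with e + σ ≟ e′
  ... | yes _ = 𝟏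
  ... | no _ = t ↑ (p ^ (e + w)) ⊝ t ↑ (p ^ (e′ + v))

  fac : ℕ → List (ℕ × ℕ) → ℕ → ℕ → ℛ
  fac σ [] w v = 𝟏
  fac σ (e ∷ es) w v = fac₁ σ e w v ⊗ fac σ es w v

  costB costN : List (ℕ × ℕ) → ℕ
  costB es = sumℕ (map (λ e → p ^ proj₁ e) es)
  costN es = sumℕ (map (λ e → p ^ proj₂ e) es)

  two : (ℕ → ℕ → Hom) → ℕ → ℛ → 𝔸
  two Z b x = sum K (λ w → sum K (λ v → fun (Z w v) (t ↑ (b * p ^ w) ⊗ x ↑ (p ^ v))))

  -- The pairs are used up one at a time. The operator of (e , e′) evaluates the hypothesis at b +
  -- p^e and at t^(p^e′) x, so the admissible ranges shrink by `costB` and `costN`.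
  eliminate : ∀ σ es Z B N →
    (∀ b x → b ≤ B + costB es → G (N + costN es) x → two Z b x ≡ 0ᴬ) →
    ∀ b x → b ≤ B → G N x → two (λ w v → Z w v ∙ fac σ es w v) b x ≡ 0ᴬ
  eliminate σ [] Z B N hyp b x b≤B gx = trans
    (sum-cong K (λ w → sum-cong K (λ v → cong-fun (Z w v) (R.*-identityˡ _))))
    (hyp b x (subst (b ≤_) (sym (+-identityʳ B)) b≤B) (subst (λ z → G z x) (sym (+-identityʳ N)) gx))
  eliminate σ ((e , e′) ∷ es) Z B N hyp b x b≤B gx = trans
    (sum-cong K (λ w → sum-cong K (λ v → cong-fun (Z w v) (R.*-assoc (fac₁ σ (e , e′) w v) (fac σ es w v) _))))
    (eliminate σ es (λ w v → Z w v ∙ fac₁ σ (e , e′) w v) B N hyp′ b x b≤B gx)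
    where
    hyp′ : ∀ b x → b ≤ B + costB es → G (N + costN es) x → two (λ w v → Z w v ∙ fac₁ σ (e , e′) w v) b x ≡ 0ᴬ
    hyp′ b x b≤ gx with e + σ ≟ e′
    ... | yes _ = trans (sum-cong K (λ w → sum-cong K (λ v → cong-fun (Z w v) (R.*-identityˡ _))))
          (hyp b x (≤-trans b≤ (+-monoʳ-≤ B (m≤n+m (costB es) (p ^ e)))) (G-mono (+-monoʳ-≤ N (m≤n+m (costN es) (p ^ e′))) gx))
    ... | no _ = trans
          (AG.∙-cancelʳ (two Z b (t ↑ (p ^ e′) ⊗ x)) _ _ (trans (trans (sym (sum-∙ K _ _)) (sum-cong K (λ w → trans (sym (sum-∙ K _ _)) (sum-cong K (pt w)))))
            (sym (cancel-middle _ _))))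
          (sub-zero
            (hyp (b + p ^ e) x (subst (b + p ^ e ≤_) (trans (+-assoc B (costB es) (p ^ e)) (cong (B +_) (+-comm (costB es) (p ^ e)))) (+-monoˡ-≤ (p ^ e) b≤))
              (G-mono (+-monoʳ-≤ N (m≤n+m (costN es) (p ^ e′))) gx))
            (hyp b (t ↑ (p ^ e′) ⊗ x) (≤-trans b≤ (+-monoʳ-≤ B (m≤n+m (costB es) (p ^ e))))
              (subst (λ z → G z (t ↑ (p ^ e′) ⊗ x)) (rot (p ^ e′) N (costN es)) (G-t^ (p ^ e′) gx))))
      where
      rot : ∀ a n c → a + (n + c) ≡ n + (a + c)
      rot a n c = trans (sym (+-assoc a n c)) (trans (cong (_+ c) (+-comm a n)) (+-assoc n a c))
      G-t^ : ∀ a {n x} → G n x → G (a + n) (t ↑ a ⊗ x)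
      G-t^ zero g = G-cong (R.sym (R.*-identityˡ _)) g
      G-t^ (suc a) g = G-cong (R.sym (R.*-assoc t (t ↑ a) _)) (G-t (G-t^ a g))
      pt : ∀ w v → fun (Z w v) ((t ↑ (p ^ (e + w)) ⊝ t ↑ (p ^ (e′ + v))) ⊗ (t ↑ (b * p ^ w) ⊗ x ↑ (p ^ v)))
             +ᴬ fun (Z w v) (t ↑ (b * p ^ w) ⊗ (t ↑ (p ^ e′) ⊗ x) ↑ (p ^ v))
           ≡ fun (Z w v) (t ↑ ((b + p ^ e) * p ^ w) ⊗ x ↑ (p ^ v))
      pt w v = trans (cong₂ _+ᴬ_ (trans (cong-fun (Z w v) (R.distribʳ _ _ _)) (homo (Z w v) _ _)) refl)
        (trans (A.assoc _ _ _) (trans (cong₂ _+ᴬ_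
          (cong-fun (Z w v) (R.trans (R.sym (R.*-assoc _ _ _)) (R.*-congʳ (R.trans (R.sym (ℛ^.^-homo-* t (p ^ (e + w)) (b * p ^ w)))
            (≡⇒≃ (cong (t ↑_) (trans (cong (_+ b * p ^ w) (^-distribˡ-+-* p e w)) (trans (+-comm (p ^ e * p ^ w) _) (sym (*-distribʳ-+ (p ^ w) b (p ^ e)))))))))))
          (trans (sym (homo (Z w v) _ _)) (fun-0 (Z w v) zeroish)))
        (A.identityʳ _)))
        where
        move-t : t ↑ (b * p ^ w) ⊗ (t ↑ (p ^ e′) ⊗ x) ↑ (p ^ v) ≃ t ↑ (p ^ (e′ + v)) ⊗ (t ↑ (b * p ^ w) ⊗ x ↑ (p ^ v))
        move-t = R.trans (R.*-congˡ (R.trans (ℛ^.^-distrib-* (t ↑ (p ^ e′)) x (p ^ v))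
            (R.*-congʳ (R.trans (ℛ^.^-assocʳ t (p ^ e′) (p ^ v)) (≡⇒≃ (cong (t ↑_) (sym (^-distribˡ-+-* p e′ v))))))))
          (R.trans (R.sym (R.*-assoc _ _ _)) (R.trans (R.*-congʳ (R.*-comm _ _)) (R.*-assoc _ _ _)))
        zeroish : (⊖ t ↑ (p ^ (e′ + v))) ⊗ (t ↑ (b * p ^ w) ⊗ x ↑ (p ^ v)) ⊕ t ↑ (b * p ^ w) ⊗ (t ↑ (p ^ e′) ⊗ x) ↑ (p ^ v) ≃ 𝟎
        zeroish = R.trans (R.+-congˡ move-t) (R.trans (R.sym (R.distribʳ _ _ _))
          (R.trans (R.*-congʳ (R.-‿inverseˡ _)) (R.zeroˡ _)))

  pairs : List (ℕ × ℕ)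
  pairs = cartesianProduct (upTo K) (upTo K)

  cB cN : ℕ
  cB = costB pairs
  cN = costN pairs

  fac-zero : ∀ σ es {e e′ w v} → (e , e′) ∈ es → e + σ ≢ e′ → e + w ≡ e′ + v → fac σ es w v ≃ 𝟎
  fac-zero σ (_ ∷ es) {e} {e′} {w} {v} (here refl) ne eq with e + σ ≟ e′
  ... | yes e≡ = contradiction e≡ ne
  ... | no _ = R.trans (R.*-congʳ (R.trans (R.+-congʳ (≡⇒≃ (cong (λ z → t ↑ (p ^ z)) eq))) (R.-‿inverseʳ _))) (R.zeroˡ _)
  fac-zero σ (_ ∷ es) (there m) ne eq = R.trans (R.*-congˡ (fac-zero σ es m ne eq)) (R.zeroʳ _)

  -- The pair (v , w) does it, because v + w = w + v; its factor has been replaced by 𝟏 only if w =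
  -- σ + v.
  fac-kills : ∀ σ w v → w < K → v < K → w ≢ σ + v → fac σ pairs w v ≃ 𝟎
  fac-kills σ w v w<K v<K ne = fac-zero σ pairs {v} {w} (∈-cartesianProduct⁺ (∈-upTo⁺ v<K) (∈-upTo⁺ w<K))
    (λ e → ne (trans (sym e) (+-comm v σ))) (+-comm v w)

  fac-nonzero : ∀ σ es → ¬ fac σ es σ 0 ≃ 𝟎
  fac-nonzero σ [] = 𝟏≄𝟎
  fac-nonzero σ ((e , e′) ∷ es) = domain first (fac-nonzero σ es)
    where
    first : ¬ fac₁ σ (e , e′) σ 0 ≃ 𝟎
    first with e + σ ≟ e′
    ... | yes _ = 𝟏≄𝟎
    ... | no ne = t-powers (λ eq → ne (trans (p^-injective eq) (+-identityʳ e′)))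

  -- An order of stripping digit units from the exponent, each time with a binomial coefficient
  -- prime to p. The final 1 is left to the last variable x.
  data Chain : ∀ {n} → Vec ℕ n → ℕ → Set where
    [] : Chain [] 1
    cons : ∀ {n j σ} {σs : Vec ℕ n} → σ < K → j ≼ j + p ^ σ → Chain σs j → Chain (σ ∷ σs) (j + p ^ σ)

  -- All intermediate exponents remain prime to p, so the last one, of digit sum one, is 1 and not a
  -- higher power of p.
  chain : ∀ n j → ¬ (p ∣ j) → ds j ≡ suc n → j < K → Σ (Vec ℕ n) λ σs → Chain σs j
  chain zero j p∤j e j<K with ds≡1 j e
  ... | zero , refl = [] , []
  ... | suc v , refl = contradiction (m∣m*n (p ^ v)) p∤j
  chain (suc n) j p∤j e j<K with remove-digit-free j p∤j (subst (2 ≤_) (sym e) (s≤s (s≤s z≤n)))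
  ... | σ , j′ , refl , l , p∤j′ with chain n j′ p∤j′
          (suc-injective (trans (sym (trans (ds-+ {j′} (p ^ σ) l) (trans (cong (ds j′ +_) (ds-p^ σ)) (+-comm (ds j′) 1)))) e))
          (≤-<-trans (m≤m+n j′ _) j<K)
  ...   | σs , ch = σ ∷ σs , cons (<-trans (n<p^n σ) (≤-<-trans (m≤n+m _ j′) j<K)) l ch

  scale : ∀ {n} → Vec ℕ n → Vec ℛ n → Vec ℛ n
  scale = zipWith (λ b h → t ↑ b ⊗ h)

  -- `top` with a separate family for each twist v of x, as the factors brought in by an elimination
  -- depend on v.
  topᵛ : ∀ {n} → (ℕ → Family) → Vec ℛ n → ℛ → 𝔸
  topᵛ Λ hs x = sum K (λ v → fun (lins (Λ v) hs (p ^ v)) (x ↑ (p ^ v)))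

  factor : ∀ {n} → Vec ℕ n → Vec ℛ n → ℛ
  factor [] [] = 𝟏
  factor (σ ∷ σs) (h ∷ hs) = h ↑ (p ^ σ) ⊗ (fac σ pairs σ 0 ⊗ factor σs hs)

  -- Elimination between the first variable and x leaves the twists w = σ + v. For v ≥ 1 they read
  -- the coefficient at p^v (j + p^σ), which vanishes by assumption, so the assumption passes to the
  -- shorter chain. For v = 0 the remaining binomial coefficient is prime to p and cancels.
  isolate : ∀ {n j} {σs : Vec ℕ n} → 1 ≤ K → Chain σs j → (hs : Vec ℛ n) (Λ : ℕ → Family) →
    (∀ v → 1 ≤ v → v < K → Λ v (p ^ v * j) ≗ 0ᴴ) → ∀ N →
    (∀ bs x → All (_≤ cB) bs → G (N + n * cN) x → topᵛ Λ (scale bs hs) x ≡ 0ᴬ) →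
    ∀ x → G N x → fun (Λ 0 j) (factor σs hs ⊗ x) ≡ 0ᴬ
  isolate 1≤K [] [] Λ off N hyp x gx = trans (cong-fun (Λ 0 1) (R.trans (R.*-identityˡ x) (R.sym (R.*-identityʳ x))))
    (trans (sym (sum-single K 0 _ (inj₁ 1≤K) (λ v v<K v≢0 → trans (cong (λ z → fun (Λ v z) (x ↑ (p ^ v))) (sym (*-identityʳ (p ^ v))))
        (off v (n≢0⇒n>0 v≢0) v<K _))))
      (hyp [] x [] (subst (λ z → G z x) (sym (+-identityʳ N)) gx)))
  isolate {suc n} 1≤K (cons {j = j} {σ} {σs} σ<K l ch) (h ∷ hs) Λ off N hyp x gx = torsion-free l
      (trans (sym last) (isolate 1≤K ch hs Λ′ off′ N hyp′ x gx))
    where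
    P : ℕ → ℕ → Family
    P v w i = bin (i + p ^ w) i ·ᴴ (Λ v (i + p ^ w) ∙ (h ↑ (p ^ w)))
    Λ′ : ℕ → Family
    Λ′ v i = sumᴴ K (λ w → P v w i ∙ fac σ pairs w v)
    killed : ∀ v w i y → w < K → v < K → w ≢ σ + v → fun (P v w i ∙ fac σ pairs w v) y ≡ 0ᴬ
    killed v w i y w<K v<K ne = fun-0 (P v w i) (R.trans (R.*-congʳ (fac-kills σ w v w<K v<K ne)) (R.zeroˡ y))
    off′ : ∀ v → 1 ≤ v → v < K → Λ′ v (p ^ v * j) ≗ 0ᴴ
    off′ v 1≤v v<K y = sum-ε K go
      where
      go : ∀ w → w < K → fun (P v w (p ^ v * j) ∙ fac σ pairs w v) y ≡ 0ᴬ
      go w w<K with w ≟ σ + v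
      ... | no ne = killed v w (p ^ v * j) y w<K v<K ne
      ... | yes refl = trans (cong (bin (p ^ v * j + p ^ w) (p ^ v * j) ·_)
              (trans (cong (λ z → fun (Λ v z) (h ↑ (p ^ w) ⊗ (fac σ pairs w v ⊗ y))) idx) (off v 1≤v v<K _))) (·-0 (bin (p ^ v * j + p ^ w) (p ^ v * j)))
        where
        idx : p ^ v * j + p ^ (σ + v) ≡ p ^ v * (j + p ^ σ)
        idx = trans (cong (p ^ v * j +_) (trans (^-distribˡ-+-* p σ v) (*-comm (p ^ σ) (p ^ v)))) (sym (*-distribˡ-+ (p ^ v) j (p ^ σ)))
    last : fun (Λ′ 0 j) (factor σs hs ⊗ x) ≡ bin (j + p ^ σ) j · fun (Λ 0 (j + p ^ σ)) (factor (σ ∷ σs) (h ∷ hs) ⊗ x)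
    last = trans (sum-single K σ _ (inj₁ σ<K) (λ w w<K w≢σ → killed 0 w j _ w<K 1≤K (λ e → w≢σ (trans e (+-identityʳ σ)))))
      (cong (bin (j + p ^ σ) j ·_) (cong-fun (Λ 0 (j + p ^ σ))
        (R.sym (R.trans (R.*-assoc _ _ x) (R.*-congˡ (R.*-assoc _ _ x))))))
    hyp′ : ∀ bs x → All (_≤ cB) bs → G (N + n * cN) x → topᵛ Λ′ (scale bs hs) x ≡ 0ᴬ
    hyp′ bs x bs≤ gx = trans expand (eliminate σ pairs Z 0 (N + n * cN) small 0 x z≤n gx)
      where
      hs″ = scale bs hs
      Z : ℕ → ℕ → Hom
      Z w v = lins (P v w) hs″ (p ^ v)
      expand : topᵛ Λ′ hs″ x ≡ two (λ w v → Z w v ∙ fac σ pairs w v) 0 x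
      expand = trans (sum-cong K (λ v → lins-sum K (P v) (λ w → fac σ pairs w v) hs″ (p ^ v) _))
        (trans (sum-swap K K _) (sum-cong K (λ w → sum-cong K (λ v → cong-fun (Z w v) (R.*-congˡ (R.sym (R.*-identityˡ _)))))))
      small : ∀ b y → b ≤ 0 + cB → G (N + n * cN + cN) y → two Z b y ≡ 0ᴬ
      small b y b≤ gy = trans (sym (trans (sum-cong K (λ v → trans (lins-cong hs″ (scaled v) (p ^ v) _)
            (lins-sum K (P v) (λ w → t ↑ (b * p ^ w)) hs″ (p ^ v) _))) (sum-swap K K _)))
          (hyp (b ∷ bs) y (b≤ ∷ bs≤) (subst (λ z → G z y) (trans (+-assoc N (n * cN) cN) (cong (N +_) (+-comm (n * cN) cN))) gy))
        where
        scaled : ∀ v i → lin (Λ v) (t ↑ b ⊗ h) i ≗ sumᴴ K (λ w → P v w i ∙ (t ↑ (b * p ^ w)))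
        scaled v i z = sum-cong K (λ w → cong (bin (i + p ^ w) i ·_) (cong-fun (Λ v (i + p ^ w))
          (R.trans (R.*-congʳ (R.trans (ℛ^.^-distrib-* (t ↑ b) h (p ^ w)) (R.trans (R.*-comm _ _) (R.*-congˡ (ℛ^.^-assocʳ t b (p ^ w))))))
            (R.*-assoc _ _ z))))

  factor-nonzero : ∀ {n} (σs : Vec ℕ n) hs → All (λ h → ¬ h ≃ 𝟎) hs → ¬ factor σs hs ≃ 𝟎
  factor-nonzero [] [] [] = 𝟏≄𝟎
  factor-nonzero (σ ∷ σs) (h ∷ hs) (h≄0 ∷ r) = domain (↑-nonzero (p ^ σ)) (domain (fac-nonzero σ pairs) (factor-nonzero σs hs r))
    where
    ↑-nonzero : ∀ n → ¬ h ↑ n ≃ 𝟎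
    ↑-nonzero zero = 𝟏≄𝟎
    ↑-nonzero (suc n) = domain h≄0 (↑-nonzero n)

-- Weyl differencing: from bias to many degenerate tuples.

module WeylDifferencing {q p : ℕ} (S : Setting q p) (K : ℕ) where
  open import Data.Nat
  open import Data.Nat.Properties
  open import Data.Integer using (+_)
  open import Data.List using (cartesianProductWith)
  open import Data.Vec using (Vec; []; _∷_)

  open Polarisation S K public

  1<q : 1 < q
  1<q = <-≤-trans 1<p p≤q

  infix 9 Q^_
  Q^_ : ℕ → ℤ
  Q^ n = + (q ^ n)

  Q^-+ : ∀ m n → Q^ (m + n) ≡ Q^ m ℤ.* Q^ n
  Q^-+ m n = trans (cong +_ (^-distribˡ-+-* q m n)) (ℤ.pos-* (q ^ m) (q ^ n))

  Q^>0 : ∀ n → 0ℤ ℤ.< Q^ n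
  Q^>0 n = ℤ.+<+ (m^n>0 q {{>-nonZero (<-trans (s≤s z≤n) 1<q)}} n)

  Q^≥0 : ∀ n → 0ℤ ℤ.≤ Q^ n
  Q^≥0 n = 0≤ⁿ (q ^ n)

  Q^1 : Q^ 1 ≡ + q
  Q^1 = cong +_ (*-identityʳ q)

  2≤Q : + 2 ℤ.≤ + q
  2≤Q = ℤ.+≤+ 1<q

  length-Gs : ∀ n → + length (Gs n) ≡ Q^ n
  length-Gs n = cong +_ (Gs-length n)

  0<p : 0 < p
  0<p = <-trans (s≤s z≤n) 1<p

  κ-0 : κ 0ᴬ ≡ + p ℤ.- 1ℤ
  κ-0 = trans (cong (λ z → + p ℤ.* z ℤ.- 1ℤ) (𝟙-yes refl (0ᴬ ≟ᴬ 0ᴬ))) (cong (ℤ._- 1ℤ) (ℤ.*-identityʳ (+ p)))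

  κ≤q : ∀ a → κ a ℤ.≤ + q
  κ≤q a = ℤ.≤-trans (ℤ.+-monoˡ-≤ (ℤ.- 1ℤ) (*-monoˡ (+ p) (0≤ⁿ p) (𝟙-≤1 (a ≟ᴬ 0ᴬ))))
    (ℤ.≤-trans (ℤ.i≤j⇒i-k≤j 1ℤ (ℤ.≤-reflexive (ℤ.*-identityʳ (+ p))) ) (ℤ.+≤+ p≤q))

  Sₓ : ℕ → (ℛ → 𝔸) → ℤ
  Sₓ N f = ∑ (Gs N) (λ x → κ (f x))

  Resp : (ℛ → 𝔸) → Set
  Resp f = ∀ {x y} → x ≃ y → f x ≡ f y

  S-cong : ∀ N {f g} → (∀ x → f x ≡ g x) → Sₓ N f ≡ Sₓ N g
  S-cong N e = ∑-cong (Gs N) (λ x → cong κ (e x))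

  S-shift : ∀ N {f z} → Resp f → G N z → Sₓ N (λ x → f (x ⊕ z)) ≡ Sₓ N f
  S-shift N {f} {z} r gz = Gs-shift N z gz (λ x → κ (f x)) (λ e → cong κ (r e))

  S≤ : ∀ N f → Sₓ N f ℤ.≤ + q ℤ.* Q^ N
  S≤ N f = ℤ.≤-trans (∑-mono (Gs N) (λ x → κ≤q (f x))) (ℤ.≤-reflexive
    (trans (∑-const (Gs N) (+ q)) (trans (cong (ℤ._* + q) (length-Gs N)) (ℤ.*-comm (Q^ N) (+ q)))))

  -- Averaging over the translates by the multiples of z replaces κ by its sum over the whole group,
  -- which is zero.
  S-affine : ∀ N (ψ : Hom) c z → G N z → fun ψ z ≢ 0ᴬ → Sₓ N (λ x → c +ᴬ fun ψ x) ≡ 0ℤ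
  S-affine N ψ c z gz ψz≢0 = ℤ.*-cancelˡ-≡ (+ p) _ _ {{ℤ.≢-nonZero (λ e → >⇒≢ 0<p (ℤ.+-injective e))}} (begin
    + p ℤ.* Sₓ N (λ x → c +ᴬ fun ψ x)
      ≡⟨ sumℤ-const p _ ⟨
    sumℤ p (λ _ → Sₓ N (λ x → c +ᴬ fun ψ x))
      ≡⟨ sumℤ-cong p shifts ⟨
    sumℤ p (λ i → Sₓ N (λ x → (c +ᴬ fun ψ x) +ᴬ i · u))
      ≡⟨ sumℤ-∑ p (Gs N) _ ⟩
    ∑ (Gs N) (λ x → sumℤ p (λ i → κ ((c +ᴬ fun ψ x) +ᴬ i · u)))
      ≡⟨ ∑-cong (Gs N) (λ x → κ-sum ψz≢0 (c +ᴬ fun ψ x)) ⟩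
    ∑ (Gs N) (λ _ → 0ℤ)
      ≡⟨ ∑-0 (Gs N) ⟩
    0ℤ
      ≡⟨ ℤ.*-zeroʳ (+ p) ⟨
    + p ℤ.* 0ℤ ∎)
    where
    open Relation.Binary.PropositionalEquality.≡-Reasoning
    u = fun ψ z
    shifts : ∀ i → Sₓ N (λ x → (c +ᴬ fun ψ x) +ᴬ i · u) ≡ Sₓ N (λ x → c +ᴬ fun ψ x)
    shifts zero = S-cong N (λ x → A.identityʳ _)
    shifts (suc i) = trans (S-cong N (λ x → trans (A.assoc c _ _) (trans (cong (c +ᴬ_)
        (trans (sym (A.assoc _ u _)) (cong (_+ᴬ i · u) (sym (homo ψ x z))))) (sym (A.assoc c _ _)))))
      (trans (S-shift N {λ x → (c +ᴬ fun ψ x) +ᴬ i · u} (λ e → cong (λ w → (c +ᴬ w) +ᴬ i · u) (cong-fun ψ e)) gz) (shifts i))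

  ∂ : ℛ → (ℛ → 𝔸) → ℛ → 𝔸
  ∂ h f x = f (x ⊕ h) +ᴬ -ᴬ f x

  -- The sum is averaged over shifts by h before Cauchy-Schwarz is applied. The square belonging to
  -- c = 0 is then enlarged to the sum of squares over all c, where the Gram identity turns products
  -- of values of κ into κ of a difference.
  van-der-corput : ∀ C N f → Resp f → C ≤ N →
    Q^ C ℤ.* (Sₓ N f ℤ.* Sₓ N f) ℤ.≤ (+ p ℤ.* Q^ N) ℤ.* ∑ (Gs C) (λ h → Sₓ N (∂ h f))
  van-der-corput C N f r C≤N = *-cancelˡ (Q^ C) (Q^>0 C) (subst₂ ℤ._≤_ lhs rhs
      (ℤ.≤-trans (cauchy-schwarz X (F 0ᴬ)) (*-monoˡ (+ length X) (0≤ⁿ _) (∑-mono X square))))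
    where
    X = Gs N
    H = Gs C
    D = ∑ H (λ h → Sₓ N (∂ h f))
    F : 𝔸 → ℛ → ℤ
    F c x = ∑ H (λ h → κ (f (x ⊕ h) +ᴬ -ᴬ c))
    gH : ∀ h → h ∈ H → G N h
    gH h m = G-mono C≤N (Gs-G C h m)
    sumF : ∑ X (F 0ᴬ) ≡ Q^ C ℤ.* Sₓ N f
    sumF = trans (∑-swap X H _) (trans (∑-cong∈ H (λ h m → trans
        (∑-cong X (λ x → cong κ (trans (cong (f (x ⊕ h) +ᴬ_) AG.ε⁻¹≈ε) (A.identityʳ _)))) (S-shift N r (gH h m))))
      (trans (∑-const H _) (cong (ℤ._* Sₓ N f) (length-Gs C))))
    rot : ∀ a b → (a ℤ.* b) ℤ.* (a ℤ.* b) ≡ a ℤ.* (a ℤ.* (b ℤ.* b))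
    rot = solve-∀
    lhs : ∑ X (F 0ᴬ) ℤ.* ∑ X (F 0ᴬ) ≡ Q^ C ℤ.* (Q^ C ℤ.* (Sₓ N f ℤ.* Sₓ N f))
    lhs = trans (cong₂ ℤ._*_ sumF sumF) (rot (Q^ C) (Sₓ N f))
    square : ∀ x → F 0ᴬ x ℤ.* F 0ᴬ x ℤ.≤ ∑ points (λ c → F c x ℤ.* F c x)
    square x = ∈⇒≤∑ points (λ c → F c x ℤ.* F c x) (λ c → sq≥0 (F c x)) 0∈points
    gram : ∀ x → ∑ points (λ c → F c x ℤ.* F c x) ≡ + p ℤ.* ∑ H (λ h → ∑ H (λ h′ → κ (f (x ⊕ h) +ᴬ -ᴬ f (x ⊕ h′))))
    gram x = trans (∑-cong points (λ c → sym (∑-∑-* H H _ _)))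
      (trans (∑-swap points H _) (trans (∑-cong H (λ h → trans (∑-swap points H _)
        (trans (∑-cong H (λ h′ → κ-gram (f (x ⊕ h)) (f (x ⊕ h′)))) (∑-*ˡ H (+ p) _)))) (∑-*ˡ H (+ p) _)))
    neg-add : ∀ x h h′ → (x ⊕ (⊖ h′)) ⊕ h ≃ x ⊕ (h ⊕ (⊖ h′))
    neg-add x h h′ = R.trans (R.+-assoc x (⊖ h′) h) (R.+-congˡ (R.+-comm (⊖ h′) h))
    back : ∀ x h′ → (x ⊕ (⊖ h′)) ⊕ h′ ≃ x
    back x h′ = R.trans (R.+-assoc x (⊖ h′) h′) (R.trans (R.+-congˡ (R.-‿inverseˡ h′)) (R.+-identityʳ x))
    -- Translating x by - h′ leaves only h - h′, which runs through `Gs C` along with h.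
    inner : ∀ h′ → h′ ∈ H → ∑ H (λ h → ∑ X (λ x → κ (f (x ⊕ h) +ᴬ -ᴬ f (x ⊕ h′)))) ≡ D
    inner h′ m = trans (∑-cong H (λ h → trans
        (sym (S-shift N {λ x → f (x ⊕ h) +ᴬ -ᴬ f (x ⊕ h′)} (λ e → cong₂ (λ a b → a +ᴬ -ᴬ b) (r (R.+-congʳ e)) (r (R.+-congʳ e))) (G-⊖ (gH h′ m))))
        (S-cong N (λ x → cong₂ (λ a b → a +ᴬ -ᴬ b) (r (neg-add x h h′)) (r (back x h′))))))
      (Gs-shift C (⊖ h′) (G-⊖ (Gs-G C h′ m)) (λ h → Sₓ N (∂ h f)) (λ e → S-cong N (λ x → cong (_+ᴬ -ᴬ f x) (r (R.+-congˡ e)))))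
    rhs : + length X ℤ.* ∑ X (λ x → ∑ points (λ c → F c x ℤ.* F c x)) ≡ Q^ C ℤ.* ((+ p ℤ.* Q^ N) ℤ.* D)
    rhs = trans (cong₂ ℤ._*_ (length-Gs N) (trans (∑-cong X gram) (trans (∑-*ˡ X (+ p) _) (cong (+ p ℤ.*_)
        (trans (∑-cong X (λ x → ∑-swap H H _)) (trans (∑-swap X H _) (trans (∑-cong∈ H (λ h′ m → trans (∑-swap X H _) (inner h′ m)))
          (trans (∑-const H D) (cong (ℤ._* D) (length-Gs C))))))))))
      (rot′ (Q^ N) (+ p) (Q^ C) D)
      where
      rot′ : ∀ a b c d → a ℤ.* (b ℤ.* (c ℤ.* d)) ≡ c ℤ.* ((b ℤ.* a) ℤ.* d)
      rot′ = solve-∀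

  -- This is |S| ≥ q^(N - c), squared because sums of κ may be negative.
  Biased : ℕ → ℕ → (ℛ → 𝔸) → Set
  Biased c N f = Q^ N ℤ.* Q^ N ℤ.≤ (Q^ c ℤ.* Q^ c) ℤ.* (Sₓ N f ℤ.* Sₓ N f)

  sq-mono : ∀ {a b} → 0ℤ ℤ.≤ a → a ℤ.≤ b → a ℤ.* a ℤ.≤ b ℤ.* b
  sq-mono {a} {b} 0≤a a≤b = ℤ.≤-trans (*-monoˡ a 0≤a a≤b) (subst₂ ℤ._≤_ (ℤ.*-comm b a) refl (*-monoˡ b (ℤ.≤-trans 0≤a a≤b) a≤b))

  -- By `van-der-corput` the sums of the differences by h are on average at least Q^ N / loss c.
  loss : ℕ → ℤ
  loss c = (Q^ c ℤ.* Q^ c) ℤ.* + p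

  loss≥0 : ∀ c → 0ℤ ℤ.≤ loss c
  loss≥0 c = *-nonneg (*-nonneg (Q^≥0 c) (Q^≥0 c)) (0≤ⁿ p)

  q*loss≤ : ∀ c → + q ℤ.* loss c ℤ.≤ Q^ (2 + 2 * c)
  q*loss≤ c = ℤ.≤-trans (*-monoˡ (+ q) (0≤ⁿ q) (*-monoˡ (Q^ c ℤ.* Q^ c) (*-nonneg (Q^≥0 c) (Q^≥0 c)) (ℤ.+≤+ p≤q)))
    (ℤ.≤-reflexive (sym (trans (Q^-+ 2 (2 * c)) (trans (cong₂ ℤ._*_ (trans (Q^-+ 1 1) (cong₂ ℤ._*_ Q^1 Q^1))
      (trans (cong Q^_ (cong (λ z → c + z) (+-identityʳ c))) (Q^-+ c c))) (rot (+ q) (Q^ c))))))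
    where
    rot : ∀ a b → (a ℤ.* a) ℤ.* (b ℤ.* b) ≡ a ℤ.* ((b ℤ.* b) ℤ.* a)
    rot = solve-∀

  pop? : ∀ c N f h → Dec (Q^ N ℤ.≤ + q ℤ.* loss c ℤ.* Sₓ N (∂ h f))
  pop? c N f h = Q^ N ℤ.≤? + q ℤ.* loss c ℤ.* Sₓ N (∂ h f)

  pop-Biased : ∀ c N g → Q^ N ℤ.≤ + q ℤ.* loss c ℤ.* Sₓ N g → Biased (2 + 2 * c) N g
  pop-Biased c N g le = ℤ.≤-trans (sq-mono (Q^≥0 N) le)
    (≤-substˡ (rot (+ q ℤ.* loss c) (Sₓ N g))
      (subst₂ ℤ._≤_ (ℤ.*-comm (Sₓ N g ℤ.* Sₓ N g) _) (ℤ.*-comm (Sₓ N g ℤ.* Sₓ N g) _)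
        (*-monoˡ (Sₓ N g ℤ.* Sₓ N g) (sq≥0 (Sₓ N g)) (sq-mono (*-nonneg (0≤ⁿ q) (loss≥0 c)) (q*loss≤ c)))))
    where
    rot : ∀ a b → (a ℤ.* a) ℤ.* (b ℤ.* b) ≡ (a ℤ.* b) ℤ.* (a ℤ.* b)
    rot = solve-∀

  -- The exponent 3 + 2c comes from `popular`: its factor is q * loss c * q, the second q being the
  -- bound on κ, and q * loss c is at most q^(2 + 2c).
  many-popular : ∀ c C N f → Resp f → C ≤ N → Biased c N f →
    Q^ C ℤ.≤ Q^ (3 + 2 * c) ℤ.* ∑ (Gs C) (λ h → 𝟙 (pop? c N f h))
  many-popular c C N f r C≤N bias = ℤ.≤-trans
      (≤-substˡ (length-Gs C) (popular (Gs C) (λ h → Sₓ N (∂ h f)) (+ q) (loss c) (+ q) (Q^ N)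
        2≤Q (loss≥0 c) (0≤ⁿ q) (Q^>0 N) (λ h _ → S≤ N (∂ h f)) big))
      (subst₂ ℤ._≤_ (ℤ.*-comm cnt _) (ℤ.*-comm cnt _) (*-monoˡ cnt (∑-nonneg (Gs C) (λ h → 𝟙-nonneg (pop? c N f h)))
        (ℤ.≤-trans (subst₂ ℤ._≤_ (ℤ.*-comm (+ q) _) refl (*-monoˡ (+ q) (0≤ⁿ q) (q*loss≤ c)))
          (ℤ.≤-reflexive (sym (trans (Q^-+ 1 (2 + 2 * c)) (cong (ℤ._* Q^ (2 + 2 * c)) Q^1)))))))
    where
    cnt = ∑ (Gs C) (λ h → 𝟙 (pop? c N f h))
    D = ∑ (Gs C) (λ h → Sₓ N (∂ h f))
    big : + length (Gs C) ℤ.* Q^ N ℤ.≤ loss c ℤ.* D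
    big = subst (λ z → z ℤ.* Q^ N ℤ.≤ loss c ℤ.* D) (sym (length-Gs C)) (*-cancelˡ (Q^ N) (Q^>0 N)
      (ℤ.≤-trans (≤-substˡ (r₁ (Q^ C) (Q^ N)) (*-monoˡ (Q^ C) (Q^≥0 C) bias))
        (subst₂ ℤ._≤_ (r₂ (Q^ c ℤ.* Q^ c) (Q^ C) (Sₓ N f ℤ.* Sₓ N f)) (r₃ (Q^ c ℤ.* Q^ c) (+ p) (Q^ N) D)
          (*-monoˡ (Q^ c ℤ.* Q^ c) (*-nonneg (Q^≥0 c) (Q^≥0 c)) (van-der-corput C N f r C≤N)))))
      where
      r₁ : ∀ a b → a ℤ.* (b ℤ.* b) ≡ b ℤ.* (a ℤ.* b)
      r₁ = solve-∀
      r₂ : ∀ a b c → a ℤ.* (b ℤ.* c) ≡ b ℤ.* (a ℤ.* c)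
      r₂ = solve-∀
      r₃ : ∀ a b c d → a ℤ.* ((b ℤ.* c) ℤ.* d) ≡ c ℤ.* ((a ℤ.* b) ℤ.* d)
      r₃ = solve-∀

  HV : ℕ → ∀ n → List (Vec ℛ n)
  HV C zero = [] ∷ []
  HV C (suc n) = cartesianProductWith _∷_ (Gs C) (HV C n)

  Degenerate : ∀ {n} → ℕ → Family → Vec ℛ n → Set
  Degenerate N M hs = ∀ x → x ∈ Gs N → top M hs x ≡ 0ᴬ

  degenerate? : ∀ {n} N M (hs : Vec ℛ n) → Dec (Degenerate N M hs)
  degenerate? N M hs with ∑-find (λ x → ¬? (top M hs x ≟ᴬ 0ᴬ)) (Gs N)
  ... | yes (x , m , ne) = no (λ h → ne (h x m))
  ... | no none = yes (λ x m → dec x m)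
    where
    dec : ∀ x → x ∈ Gs N → top M hs x ≡ 0ᴬ
    dec x m with top M hs x ≟ᴬ 0ᴬ
    ... | yes e = e
    ... | no ne = contradiction (x , m , ne) none

  topᴴ : ∀ {n} → Family → Vec ℛ n → Hom
  topᴴ M hs = sumᴴ K (λ v → Fr v (lins M hs (p ^ v)))

  -- Each differencing costs 3 + 2c in density and turns the bias exponent c into 2 + 2c.
  lossₙ : ℕ → ℕ → ℕ
  lossₙ zero c = 0
  lossₙ (suc n) c = 3 + 2 * c + lossₙ n (2 + 2 * c)

  S-zero⇒unbiased : ∀ {c N f} → Sₓ N f ≡ 0ℤ → ¬ Biased c N f
  S-zero⇒unbiased {c} {N} {f} e b = ℤ.<⇒≱ (*-pos (Q^>0 N) (Q^>0 N))
    (subst (Q^ N ℤ.* Q^ N ℤ.≤_) (trans (cong (λ z → (Q^ c ℤ.* Q^ c) ℤ.* (z ℤ.* z)) e) (ℤ.*-zeroʳ (Q^ c ℤ.* Q^ c))) b)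

  -- In degree one the map is a constant plus an additive map, whose sum is zero unless the additive
  -- part vanishes on all of `Gs N`. Here bias becomes degeneracy; in higher degree every popular
  -- difference is biased again.
  weyl : ∀ n c C N Λ M → Bnd Λ → Agree (suc n) Λ M → C ≤ N → Biased c N (ev Λ) →
         Q^ (n * C) ℤ.≤ Q^ (lossₙ n c) ℤ.* ∑ (HV C n) (λ hs → 𝟙 (degenerate? N M hs))
  weyl zero c C N Λ M b ag C≤N bias = ℤ.≤-reflexive (sym (trans (ℤ.*-identityˡ _) (trans (ℤ.+-identityʳ _) (𝟙-yes deg₀ (degenerate? N M [])))))
    where
    deg₀ : Degenerate N M []
    deg₀ x m with top M [] x ≟ᴬ 0ᴬ
    ... | yes e = e
    ... | no ne = contradiction bias (S-zero⇒unbiased {c} {N} (trans (S-cong N (ev-top Λ M b ag))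
          (S-affine N (topᴴ M []) (fun (Λ 0) 𝟏) x (Gs-G N x m) ne)))
  weyl (suc n) c C N Λ M b ag C≤N bias = subst₂ ℤ._≤_ (sym (Q^-+ C (n * C)))
      (trans (cong (Q^ (3 + 2 * c) ℤ.*_) (trans (∑-*ˡ (Gs C) (Q^ (lossₙ n (2 + 2 * c))) (λ h → ∑ (HV C n) (λ hs → 𝟙 (degenerate? N M (h ∷ hs))))) (cong (Q^ (lossₙ n (2 + 2 * c)) ℤ.*_) (sym (∑-cart _∷_ (Gs C) (HV C n) (λ hs → 𝟙 (degenerate? N M hs)))))))
        (trans (sym (ℤ.*-assoc (Q^ (3 + 2 * c)) (Q^ (lossₙ n (2 + 2 * c))) (∑ (HV C (suc n)) (λ hs → 𝟙 (degenerate? N M hs))))) (cong (ℤ._* ∑ (HV C (suc n)) (λ hs → 𝟙 (degenerate? N M hs))) (sym (Q^-+ (3 + 2 * c) (lossₙ n (2 + 2 * c)))))))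
      (ℤ.≤-trans (subst₂ ℤ._≤_ (ℤ.*-comm (Q^ (n * C)) (Q^ C)) (rot (Q^ (n * C)) (Q^ (3 + 2 * c)) cnt)
          (*-monoˡ (Q^ (n * C)) (Q^≥0 (n * C)) (many-popular c C N (ev Λ) (ev-cong Λ) C≤N bias)))
        (*-monoˡ (Q^ (3 + 2 * c)) (Q^≥0 (3 + 2 * c)) (≤-substˡ (∑-*ˡ (Gs C) (Q^ (n * C)) (λ h → 𝟙 (pop? c N (ev Λ) h))) (∑-mono (Gs C) each))))
    where
    cnt = ∑ (Gs C) (λ h → 𝟙 (pop? c N (ev Λ) h))
    rot : ∀ a b d → a ℤ.* (b ℤ.* d) ≡ b ℤ.* (a ℤ.* d)
    rot = solve-∀
    each : ∀ h → Q^ (n * C) ℤ.* 𝟙 (pop? c N (ev Λ) h) ℤ.≤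
                 Q^ (lossₙ n (2 + 2 * c)) ℤ.* ∑ (HV C n) (λ hs → 𝟙 (degenerate? N M (h ∷ hs)))
    each h with pop? c N (ev Λ) h
    ... | no _ = ≤-substˡ (sym (ℤ.*-zeroʳ (Q^ (n * C)))) (*-nonneg (Q^≥0 (lossₙ n (2 + 2 * c))) (∑-nonneg (HV C n) (λ hs → 𝟙-nonneg (degenerate? N M (h ∷ hs)))))
    ... | yes le = ℤ.≤-trans (ℤ.≤-reflexive (ℤ.*-identityʳ _))
          (ℤ.≤-trans (weyl n (2 + 2 * c) C N (d h Λ) (lin M h) (d-Bnd h Λ b) (d-Agree h Λ M (suc n) b ag) C≤N
              (subst (λ s → Q^ N ℤ.* Q^ N ℤ.≤ (Q^ (2 + 2 * c) ℤ.* Q^ (2 + 2 * c)) ℤ.* (s ℤ.* s)) (S-cong N (λ x → sym (ev-d Λ h x)))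
                (pop-Biased c N (∂ h (ev Λ)) le)))
            (*-monoˡ (Q^ (lossₙ n (2 + 2 * c))) (Q^≥0 (lossₙ n (2 + 2 * c))) (∑-mono (HV C n) (λ hs →
              𝟙-mono (λ x → x) (degenerate? N (lin M h) hs) (degenerate? N M (h ∷ hs))))))

-- Small nonzero points and boxes in dense multi-subgroups.

module DenseSubgroups {q p : ℕ} (S : Setting q p) (K : ℕ) where
  open import Data.Nat
  open import Data.Nat.Properties
  open import Data.Integer using (+_)
  open import Data.Unit using (⊤; tt)
  open import Data.Vec using (Vec; []; _∷_)
  open import Data.Vec.Relation.Unary.All using (All; []; _∷_)

  open WeylDifferencing S K public

  record Sub (U : ℛ → Set) : Set where
    field
      resp : ∀ {x y} → x ≃ y → U x → U y
      diff : ∀ {x y} → U x → U y → U (x ⊝ y)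

  t^-G : ∀ a {n x} → G n x → G (a + n) (t ↑ a ⊗ x)
  t^-G zero g = G-cong (R.sym (R.*-identityˡ _)) g
  t^-G (suc a) g = G-cong (R.sym (R.*-assoc t (t ↑ a) _)) (G-t (t^-G a g))

  pos-of : ∀ {X Y} {Z : ℤ} → 0ℤ ℤ.< X → 0ℤ ℤ.≤ Y → X ℤ.≤ Y ℤ.* Z → 0ℤ ℤ.< Z
  pos-of {X} {Y} {Z} 0<X 0≤Y le with 0ℤ ℤ.<? Z
  ... | yes h = h
  ... | no nh = contradiction (ℤ.<-≤-trans 0<X (ℤ.≤-trans le (ℤ.≤-trans (*-monoˡ Y 0≤Y (ℤ.≮⇒≥ nh)) (ℤ.≤-reflexive (ℤ.*-zeroʳ Y))))) (ℤ.<-irrefl refl)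

  count : ∀ {U : ℛ → Set} → ℕ → (∀ x → Dec (U x)) → ℤ
  count C U? = ∑ (Gs C) (λ x → 𝟙 (U? x))

  -- Pairs (x , u) in V × U are counted by the value u + t^a x in `Gs C`. Some value y is taken
  -- often, and subtracting one of its solutions from the others gives elements x of V with t^a x in
  -- U.
  intersect : ∀ {U V} (U? : ∀ x → Dec (U x)) (V? : ∀ x → Dec (V x)) → Sub U → Sub V →
    ∀ C C′ e k a → a + C′ ≤ C → Q^ C ℤ.≤ Q^ e ℤ.* count C U? → Q^ C′ ℤ.≤ Q^ k ℤ.* count C′ V? →
    Q^ C′ ℤ.≤ Q^ (k + e) ℤ.* count C′ (λ x → V? x ×-dec U? (t ↑ a ⊗ x))
  intersect {U} {V} U? V? sU sV C C′ e k a aC′≤C hU hV =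
    let (y , _ , le) = pigeonhole (Gs C) w P 0<P (ℤ.≤-reflexive (sym total))
        le′ = subst (λ z → P ℤ.≤ z ℤ.* w y) (length-Gs C) le
        (x₀ , x₀∈ , vx₀ , ux₀) = 𝟙-∑>0 (λ x → V? x ×-dec U? (y ⊝ t ↑ a ⊗ x)) (Gs C′) (pos-of 0<P (Q^≥0 C) le′)
    in ℤ.≤-trans
        (*-cancelˡ (Q^ C) (Q^>0 C) (ℤ.≤-trans (ℤ.≤-trans (subst₂ ℤ._≤_ (ℤ.*-comm (Q^ C′) (Q^ C)) refl (*-monoˡ (Q^ C′) (Q^≥0 C′) hU))
            (subst₂ ℤ._≤_ (ℤ.*-comm (Q^ e ℤ.* cU) (Q^ C′)) (rot₁ (Q^ e) cU (Q^ k) cV) (*-monoˡ (Q^ e ℤ.* cU) (*-nonneg (Q^≥0 e) cU≥0) hV)))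
          (subst₂ ℤ._≤_ refl (trans (rot₂ (Q^ k) (Q^ e) (Q^ C) (w y)) (cong (λ z → Q^ C ℤ.* (z ℤ.* w y)) (sym (Q^-+ k e))))
            (*-monoˡ (Q^ k ℤ.* Q^ e) (*-nonneg (Q^≥0 k) (Q^≥0 e)) le′))))
        (*-monoˡ (Q^ (k + e)) (Q^≥0 (k + e)) (ℤ.≤-trans (∑-mono (Gs C′) (λ x → 𝟙-mono
              (λ { (vx , ux) → Sub.diff sV vx vx₀ , Sub.resp sU (recenter y x x₀) (Sub.diff sU ux₀ ux) })
              (V? x ×-dec U? (y ⊝ t ↑ a ⊗ x)) (V? (x ⊕ ⊖ x₀) ×-dec U? (t ↑ a ⊗ (x ⊕ ⊖ x₀)))))
            (ℤ.≤-reflexive (Gs-shift C′ (⊖ x₀) (G-⊖ (Gs-G C′ x₀ x₀∈)) (λ x → 𝟙 (V? x ×-dec U? (t ↑ a ⊗ x)))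
              (λ {x} {y} e → 𝟙-cong (λ { (v , u) → Sub.resp sV e v , Sub.resp sU (R.*-congˡ e) u })
                          (λ { (v , u) → Sub.resp sV (R.sym e) v , Sub.resp sU (R.*-congˡ (R.sym e)) u })
                          (V? x ×-dec U? (t ↑ a ⊗ x)) (V? y ×-dec U? (t ↑ a ⊗ y)))))))
    where
    cU = count C U?
    cV = count C′ V?
    cU≥0 : 0ℤ ℤ.≤ cU
    cU≥0 = ∑-nonneg (Gs C) (λ x → 𝟙-nonneg (U? x))
    w : ℛ → ℤ
    w y = ∑ (Gs C′) (λ x → 𝟙 (V? x ×-dec U? (y ⊝ t ↑ a ⊗ x)))
    P = cV ℤ.* cU
    0<P : 0ℤ ℤ.< P
    0<P = *-pos (pos-of (Q^>0 C′) (Q^≥0 k) hV) (pos-of (Q^>0 C) (Q^≥0 e) hU)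
    rot₁ : ∀ e u k v → (e ℤ.* u) ℤ.* (k ℤ.* v) ≡ (k ℤ.* e) ℤ.* (v ℤ.* u)
    rot₁ = solve-∀
    rot₂ : ∀ k e c w → (k ℤ.* e) ℤ.* (c ℤ.* w) ≡ c ℤ.* ((k ℤ.* e) ℤ.* w)
    rot₂ = solve-∀
    total : ∑ (Gs C) w ≡ P
    total = trans (∑-swap (Gs C) (Gs C′) _) (trans (ℤ.≤-antisym (∑-mono∈ (Gs C′) (λ x m → ℤ.≤-reflexive (one x m))) (∑-mono∈ (Gs C′) (λ x m → ℤ.≤-reflexive (sym (one x m)))))
        (∑-*ʳ (Gs C′) (λ x → 𝟙 (V? x)) cU))
      where
      one : ∀ x → x ∈ Gs C′ → ∑ (Gs C) (λ y → 𝟙 (V? x ×-dec U? (y ⊝ t ↑ a ⊗ x))) ≡ 𝟙 (V? x) ℤ.* cU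
      one x m = trans (∑-cong (Gs C) (λ y → 𝟙-× (V? x) (U? (y ⊝ t ↑ a ⊗ x))))
        (trans (∑-*ˡ (Gs C) (𝟙 (V? x)) _) (cong (𝟙 (V? x) ℤ.*_)
          (Gs-shift C (⊖ (t ↑ a ⊗ x)) (G-⊖ (G-mono aC′≤C (t^-G a (Gs-G C′ x m)))) (λ y → 𝟙 (U? y))
            (λ {x} {y} e → 𝟙-cong (Sub.resp sU e) (Sub.resp sU (R.sym e)) (U? x) (U? y)))))
    recenter : ∀ y x x₀ → (y ⊝ t ↑ a ⊗ x₀) ⊝ (y ⊝ t ↑ a ⊗ x) ≃ t ↑ a ⊗ (x ⊕ ⊖ x₀)
    recenter y x x₀ = R.trans (R.+-congˡ (neg-sub y (t ↑ a ⊗ x))) (R.trans (R.+-congʳ (R.+-comm y _)) (R.trans (R.+-assoc _ y _)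
        (R.trans (R.+-congˡ (R.trans (R.sym (R.+-assoc y (⊖ y) _)) (R.trans (R.+-congʳ (R.-‿inverseʳ y)) (R.+-identityˡ _))))
          (R.trans (R.+-comm _ _) (R.trans (R.+-congˡ (RP.-‿distribʳ-* _ _)) (R.sym (R.distribˡ _ _ _)))))))
      where
      import Algebra.Properties.Ring R.ring as RP
      neg-sub : ∀ a b → ⊖ (a ⊝ b) ≃ ⊖ a ⊕ b
      neg-sub a b = R.trans (R.sym (RP.-‿+-comm a (⊖ b))) (R.+-congˡ (RP.-‿involutive b))

  Box : (ℛ → Set) → ℕ → ℛ → Set
  Box U b x = ∀ i → i < b → U (t ↑ i ⊗ x)

  box? : ∀ {U} → (∀ x → Dec (U x)) → ∀ b x → Dec (Box U b x)
  box? U? b x = map′ (λ f i → f {i}) (λ f {i} → f i) (allUpTo? (λ i → U? (t ↑ i ⊗ x)) b)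

  Box-Sub : ∀ {U} b → Sub U → Sub (Box U b)
  Box-Sub b s = record
    { resp = λ e h i i<b → Sub.resp s (R.*-congˡ e) (h i i<b)
    ; diff = λ h k i i<b → Sub.resp s (R.trans (R.+-congˡ (RP.-‿distribʳ-* _ _)) (R.sym (R.distribˡ _ _ _))) (Sub.diff s (h i i<b) (k i i<b)) }
    where import Algebra.Properties.Ring R.ring as RP

  box-count : ∀ {U} (U? : ∀ x → Dec (U x)) → Sub U → ∀ C C′ e B → B + C′ ≤ C → Q^ C ℤ.≤ Q^ e ℤ.* count C U? →
    ∀ b → b ≤ suc B → Q^ C′ ℤ.≤ Q^ (b * e) ℤ.* count C′ (box? U? b)
  box-count U? s C C′ e B B+C′≤C h zero _ = ℤ.≤-reflexive (sym (trans (ℤ.*-identityˡ _) (trans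
    (∑-cong (Gs C′) (λ x → 𝟙-yes (λ _ ()) (box? U? 0 x))) (trans (∑-const (Gs C′) 1ℤ) (trans (ℤ.*-identityʳ _) (length-Gs C′))))))
  box-count {U} U? s C C′ e B B+C′≤C h (suc b) b<B = ℤ.≤-trans
    (subst (λ z → Q^ C′ ℤ.≤ Q^ z ℤ.* count C′ (λ x → box? U? b x ×-dec U? (t ↑ b ⊗ x))) (+-comm (b * e) e)
      (intersect U? (box? U? b) s (Box-Sub b s) C C′ e (b * e) b (≤-trans (+-monoˡ-≤ C′ (s≤s⁻¹ b<B)) B+C′≤C) h
        (box-count U? s C C′ e B B+C′≤C h b (≤-trans (n≤1+n b) b<B))))
    (*-monoˡ (Q^ (e + b * e)) (Q^≥0 (e + b * e)) (∑-mono (Gs C′) (λ x → 𝟙-mono (extend x) (box? U? b x ×-dec U? (t ↑ b ⊗ x)) (box? U? (suc b) x))))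
    where
    extend : ∀ x → Box U b x × U (t ↑ b ⊗ x) → Box U (suc b) x
    extend x (v , u) i i<sb with i ≟ b
    ... | yes refl = u
    ... | no ne = v i (≤∧≢⇒< (s≤s⁻¹ i<sb) ne)

  -- Intersecting B + 1 times costs (B + 1) e in the exponent; one degree more leaves at least q > 1
  -- elements, so not only zero.
  box-point : ∀ {U} (U? : ∀ x → Dec (U x)) → Sub U → ∀ C e B → B + suc (suc B * e) ≤ C → Q^ C ℤ.≤ Q^ e ℤ.* count C U? →
    Σ ℛ λ x → x ∈ Gs (suc (suc B * e)) × (¬ x ≃ 𝟎) × Box U (suc B) x
  box-point U? s C e B le h with ∑-find (λ x → ¬? (x ≃0?) ×-dec box? U? (suc B) x) (Gs (suc (suc B * e)))
  ... | yes r = r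
  ... | no none = contradiction (ℤ.<-≤-trans (ℤ.+<+ 1<q) (ℤ.≤-trans q≤ few)) (ℤ.<-irrefl refl)
    where
    C′ = suc (suc B * e)
    q≤ : + q ℤ.≤ count C′ (box? U? (suc B))
    q≤ = *-cancelˡ (Q^ (suc B * e)) (Q^>0 (suc B * e))
      (≤-substˡ (trans (ℤ.pos-* q _) (ℤ.*-comm (+ q) _)) (box-count U? s C C′ e B le h (suc B) ≤-refl))
    few : count C′ (box? U? (suc B)) ℤ.≤ 1ℤ
    few = ℤ.≤-trans (∑-mono∈ (Gs C′) each) (ℤ.≤-reflexive (Gs-zero C′))
      where
      each : ∀ x → x ∈ Gs C′ → 𝟙 (box? U? (suc B) x) ℤ.≤ 𝟙 (x ≃0?)
      each x m with x ≃0?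
      ... | yes _ = 𝟙-≤1 (box? U? (suc B) x)
      ... | no nz = ℤ.≤-reflexive (𝟙-no (λ b → none (x , m , nz , b)) (box? U? (suc B) x))

  -- A subgroup in each coordinate while the others are fixed, as is natural for the zero set of a
  -- multilinear form, which is not closed under joint differences.
  MultiSub : ∀ {n} → (Vec ℛ n → Set) → Set
  MultiSub {zero} Z = ⊤
  MultiSub {suc n} Z = (∀ hs → Sub (λ h → Z (h ∷ hs))) × (∀ h → MultiSub (λ hs → Z (h ∷ hs)))

  MultiSub-∀ : ∀ {n} {I : Set} (P : I → Set) {Z : I → Vec ℛ n → Set} → (∀ i → MultiSub (Z i)) → MultiSub (λ hs → ∀ i → P i → Z i hs)
  MultiSub-∀ {zero} P m = tt
  MultiSub-∀ {suc n} P m = (λ hs → record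
      { resp = λ e z i pi → Sub.resp (proj₁ (m i) hs) e (z i pi)
      ; diff = λ z w i pi → Sub.diff (proj₁ (m i) hs) (z i pi) (w i pi) })
    , λ h → MultiSub-∀ P (λ i → proj₂ (m i) h)

  -- The room that `box-point` asks for in one coordinate, plus that for the remaining ones, at a
  -- density reduced by the q^C′ candidates for this coordinate and by q^(c + 1) from popularity.
  size : ℕ → ℕ → ℕ → ℕ
  size B zero c = 0
  size B (suc n) c = B + suc (suc B * suc c) + size B n (suc (suc B * suc c) + suc c)

  length-HV : ∀ C n → + length (HV C n) ≡ Q^ (n * C)
  length-HV C n = trans (sym (trans (∑-const (HV C n) 1ℤ) (ℤ.*-identityʳ _))) (ones n)
    where
    ones : ∀ n → ∑ (HV C n) (λ _ → 1ℤ) ≡ Q^ (n * C)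
    ones zero = refl
    ones (suc n) = trans (∑-cart _∷_ (Gs C) (HV C n) _) (trans (∑-const (Gs C) _) (trans (cong₂ ℤ._*_ (length-Gs C) (ones n)) (sym (Q^-+ C (n * C)))))

  -- For many hs the fibre of first coordinates is dense and so contains a small nonzero h with its
  -- box. There are only q^C′ such h, hence one serves many hs, and the tuples that it serves form a
  -- dense set of the same kind.
  dense-box : ∀ B n c C {Z : Vec ℛ n → Set} (Z? : ∀ hs → Dec (Z hs)) → MultiSub Z → size B n c ≤ C →
    Q^ (n * C) ℤ.≤ Q^ c ℤ.* ∑ (HV C n) (λ hs → 𝟙 (Z? hs)) →
    Σ (Vec ℛ n) λ hs → All (λ h → ¬ h ≃ 𝟎) hs × All (G C) hs × (∀ bs → All (_≤ B) bs → Z (scale bs hs))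
  dense-box B zero c C Z? ms _ h with 𝟙-∑>0 Z? (HV C 0) (pos-of (Q^>0 0) (Q^≥0 c) h)
  ... | [] , _ , z = [] , [] , [] , λ { [] _ → z }
  dense-box B (suc n) c C {Z} Z? ms sz h =
    let (h₁ , h₁∈ , le) = pigeonhole (Gs C′) (λ h → Q^ (suc c) ℤ.* w′ h) (Q^ (n * C)) (Q^>0 (n * C)) big′
        le′ : Q^ (n * C) ℤ.≤ Q^ (C′ + suc c) ℤ.* w′ h₁
        le′ = subst (Q^ (n * C) ℤ.≤_) (trans (cong (ℤ._* (Q^ (suc c) ℤ.* w′ h₁)) (length-Gs C′)) (trans (sym (ℤ.*-assoc (Q^ C′) (Q^ (suc c)) (w′ h₁)))
                (cong (ℤ._* w′ h₁) (sym (Q^-+ C′ (suc c)))))) le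
        (_ , _ , nz , _) = 𝟙-∑>0 (λ hs → ¬? (h₁ ≃0?) ×-dec Z′? h₁ hs) (HV C n) (pos-of (Q^>0 (n * C)) (Q^≥0 (C′ + suc c)) le′)
        (hs , hs≄0 , hsG , z) = dense-box B n (C′ + suc c) C (Z′? h₁) (MultiSub-∀ (_< suc B) (λ i → proj₂ ms (t ↑ i ⊗ h₁)))
              (≤-trans (m≤n+m _ (B + C′)) sz)
              (ℤ.≤-trans le′ (*-monoˡ (Q^ (C′ + suc c)) (Q^≥0 (C′ + suc c)) (∑-mono (HV C n) (λ hs → 𝟙-mono proj₂ (¬? (h₁ ≃0?) ×-dec Z′? h₁ hs) (Z′? h₁ hs)))))
    in h₁ ∷ hs , nz ∷ hs≄0 , G-mono (≤-trans (m≤n+m C′ B) BC′≤C) (Gs-G C′ h₁ h₁∈) ∷ hsG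
       , λ { (b ∷ bs) (b≤B ∷ bs≤B) → z bs bs≤B b (s≤s b≤B) }
    where
    C′ = suc (suc B * suc c)
    BC′≤C : B + C′ ≤ C
    BC′≤C = ≤-trans (m≤m+n (B + C′) _) sz
    Z′? : ∀ h hs → Dec (Box (λ h → Z (h ∷ hs)) (suc B) h)
    Z′? h hs = box? (λ h → Z? (h ∷ hs)) (suc B) h
    w : Vec ℛ n → ℤ
    w hs = ∑ (Gs C) (λ h → 𝟙 (Z? (h ∷ hs)))
    w′ : ℛ → ℤ
    w′ h = ∑ (HV C n) (λ hs → 𝟙 (¬? (h ≃0?) ×-dec Z′? h hs))
    pop : Vec ℛ n → ℤ
    pop hs = 𝟙 (Q^ C ℤ.≤? + q ℤ.* Q^ c ℤ.* w hs)
    w≤ : ∀ hs → w hs ℤ.≤ 1ℤ ℤ.* Q^ C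
    w≤ hs = ℤ.≤-trans (∑-mono (Gs C) (λ h → 𝟙-≤1 (Z? (h ∷ hs)))) (ℤ.≤-reflexive
      (trans (∑-const (Gs C) 1ℤ) (trans (ℤ.*-comm _ 1ℤ) (cong (1ℤ ℤ.*_) (length-Gs C)))))
    bigw : + length (HV C n) ℤ.* Q^ C ℤ.≤ Q^ c ℤ.* ∑ (HV C n) w
    bigw = subst₂ ℤ._≤_ (trans (Q^-+ C (n * C)) (trans (ℤ.*-comm (Q^ C) _) (cong (ℤ._* Q^ C) (sym (length-HV C n)))))
      (cong (Q^ c ℤ.*_) (trans (∑-cart _∷_ (Gs C) (HV C n) (λ hs → 𝟙 (Z? hs))) (∑-swap (Gs C) (HV C n) (λ h hs → 𝟙 (Z? (h ∷ hs)))))) h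
    qQ : + q ℤ.* Q^ c ≡ Q^ (suc c)
    qQ = sym (ℤ.pos-* q (q ^ c))
    each : ∀ hs → pop hs ℤ.≤ ∑ (Gs C′) (λ h → 𝟙 (¬? (h ≃0?) ×-dec Z′? h hs))
    each hs with Q^ C ℤ.≤? + q ℤ.* Q^ c ℤ.* w hs
    ... | no _ = ∑-nonneg (Gs C′) (λ h → 𝟙-nonneg (¬? (h ≃0?) ×-dec Z′? h hs))
    ... | yes le = let (x , x∈ , nz , bx) = box-point (λ h → Z? (h ∷ hs)) (proj₁ ms hs) C (suc c) B BC′≤C
                                               (subst (λ z → Q^ C ℤ.≤ z ℤ.* w hs) qQ le)
                   in ≤-substˡ (𝟙-yes (nz , bx) (¬? (x ≃0?) ×-dec Z′? x hs))
                        (∈⇒≤∑ (Gs C′) (λ h → 𝟙 (¬? (h ≃0?) ×-dec Z′? h hs)) (λ h → 𝟙-nonneg (¬? (h ≃0?) ×-dec Z′? h hs)) x∈)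
    big′ : Q^ (n * C) ℤ.≤ ∑ (Gs C′) (λ h → Q^ (suc c) ℤ.* w′ h)
    big′ = subst₂ ℤ._≤_ (length-HV C n) (sym (trans (∑-*ˡ (Gs C′) (Q^ (suc c)) w′) (cong (Q^ (suc c) ℤ.*_) (∑-swap (Gs C′) (HV C n) (λ h hs → 𝟙 (¬? (h ≃0?) ×-dec Z′? h hs))))))
      (ℤ.≤-trans (popular (HV C n) w (+ q) (Q^ c) 1ℤ (Q^ C) 2≤Q (Q^≥0 c) (0≤ⁿ 1) (Q^>0 C) (λ hs _ → w≤ hs) bigw)
        (subst₂ ℤ._≤_ (cong (ℤ._* ∑ (HV C n) pop) (sym (trans (ℤ.*-identityʳ _) qQ))) refl
          (*-monoˡ (Q^ (suc c)) (Q^≥0 (suc c)) (∑-mono (HV C n) each))))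

  Degenerate-MultiSub : ∀ {n} N M → MultiSub {n} (Degenerate N M)
  Degenerate-MultiSub {zero} N M = tt
  Degenerate-MultiSub {suc n} N M = (λ hs → record
      { resp = λ e z x m → trans (top-cong hs (λ i y → sum-cong K (λ v → cong (bin (i + p ^ v) i ·_)
                 (cong-fun (M (i + p ^ v)) (R.*-congʳ (↑-cong (p ^ v) (R.sym e)))))) x) (z x m)
      ; diff = λ {h} {h′} z w x m → trans (top-cong hs (lin-h-⊖ M h h′) x)
                 (trans (top-⊖ (lin M h) (lin M h′) hs x) (sub-zero (z x m) (w x m))) })
    , λ h → Degenerate-MultiSub N (lin M h)

-- Bookkeeping of linear bounds.

module LinearBounds where
  open import Data.Nat
  open import Data.Nat.Properties

  -- The bound is in terms of suc c, which absorbs additive constants and makes the class closed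
  -- under composition.
  Linear : (ℕ → ℕ) → Set
  Linear f = Σ ℕ λ a → ∀ c → f c ≤ a * suc c

  linear-const : ∀ m → Linear (λ _ → m)
  linear-const m = m , λ c → m≤m*n m (suc c)

  linear-id : Linear (λ c → c)
  linear-id = 1 , λ c → ≤-trans (n≤1+n c) (≤-reflexive (sym (*-identityˡ (suc c))))

  linear-+ : ∀ {f g} → Linear f → Linear g → Linear (λ c → f c + g c)
  linear-+ (a , h) (b , k) = a + b , λ c → ≤-trans (+-mono-≤ (h c) (k c)) (≤-reflexive (sym (*-distribʳ-+ (suc c) a b)))

  linear-* : ∀ m {f} → Linear f → Linear (λ c → m * f c)
  linear-* m (a , h) = m * a , λ c → ≤-trans (*-monoʳ-≤ m (h c)) (≤-reflexive (sym (*-assoc m a (suc c))))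

  linear-∘ : ∀ {f g} → Linear f → Linear g → Linear (λ c → f (g c))
  linear-∘ (a , h) (b , k) = a * suc b , λ c → ≤-trans (h _) (≤-trans
    (*-monoʳ-≤ a (s≤s (≤-trans (k c) (m≤n+m (b * suc c) c)))) (≤-reflexive (sym (*-assoc a (suc b) (suc c)))))

  linear-suc : ∀ {f} → Linear f → Linear (λ c → suc (f c))
  linear-suc h = linear-+ (linear-const 1) h

open LinearBounds

module Proportional (τ : ℕ) (1≤τ : 1 ≤ τ) where
  open import Data.Nat
  open import Data.Nat.Properties

  infix 4 _≲_
  infixl 6 _⊞_
  infixr 7 _⊠_

  -- The rate x of a quantity X relative to τ. Proofs follow the expression that defines X, so
  -- constants can be written down as the same expression in the rates.
  record _≲_ (X x : ℕ) : Set where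
    constructor mk
    field le : X ≤ x * τ

  _⊞_ : ∀ {X Y x y} → X ≲ x → Y ≲ y → X + Y ≲ x + y
  _⊞_ {x = x} {y} (mk h) (mk k) = mk (≤-trans (+-mono-≤ h k) (≤-reflexive (sym (*-distribʳ-+ τ x y))))

  _⊠_ : ∀ m {X x} → X ≲ x → m * X ≲ m * x
  _⊠_ m {x = x} (mk h) = mk (≤-trans (*-monoʳ-≤ m h) (≤-reflexive (sym (*-assoc m x τ))))

  const : ∀ m → m ≲ m
  const m = mk (m≤m*n m τ {{>-nonZero 1≤τ}})

-- The inverse theorem: a biased family has coefficients annihilated by small polynomials.

module InverseTheorem {q p : ℕ} (S : Setting q p) (K : ℕ) (1≤K : 1 ≤ K) where
  open import Data.Nat
  open import Data.Nat.Properties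
  open import Data.Nat.Divisibility
  open import Data.Vec using (Vec; []; _∷_)
  open import Data.Vec.Relation.Unary.All using (All; []; _∷_)

  open DenseSubgroups S K public

  linear-loss : ∀ n → Linear (lossₙ n)
  linear-loss zero = linear-const 0
  linear-loss (suc n) = linear-+ (linear-+ (linear-const 3) (linear-* 2 linear-id))
    (linear-∘ (linear-loss n) (linear-+ (linear-const 2) (linear-* 2 linear-id)))

  linear-size : ∀ B n → Linear (size B n)
  linear-size B zero = linear-const 0
  linear-size B (suc n) = linear-+ (linear-+ (linear-const B) C′)
    (linear-∘ (linear-size B n) (linear-+ C′ (linear-suc linear-id)))
    where C′ = linear-suc (linear-* (suc B) (linear-suc linear-id))

  G-↑ : ∀ j {m x} → G m x → G (suc (j * m)) (x ↑ j)
  G-↑ zero g = G-𝟏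
  G-↑ (suc j) {m} g = G-mono (≤-reflexive (+-suc m (j * m))) (G-⊗ g (G-↑ j g))

  ↑-nonzero : ∀ n {x} → ¬ x ≃ 𝟎 → ¬ x ↑ n ≃ 𝟎
  ↑-nonzero zero nz = 𝟏≄𝟎
  ↑-nonzero (suc n) nz = domain nz (↑-nonzero n nz)

  t↑-G : ∀ a → G (suc a) (t ↑ a)
  t↑-G a = G-cong (R.*-identityʳ _) (subst (λ n → G n (t ↑ a ⊗ 𝟏)) (+-comm a 1) (t^-G a G-𝟏))

  fac-G : ∀ σ es w v → Σ ℕ λ m → G m (fac σ es w v)
  fac-G σ [] w v = 1 , G-𝟏
  fac-G σ ((e , e′) ∷ es) w v with fac-G σ es w v | e + σ ≟ e′
  ... | m , g | yes _ = 1 + m , G-⊗ G-𝟏 g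
  ... | m , g | no _ = suc (p ^ (e + w) + p ^ (e′ + v)) + m
      , G-⊗ (G-⊕ (G-mono (s≤s (m≤m+n _ _)) (t↑-G (p ^ (e + w)))) (G-⊖ (G-mono (s≤s (m≤n+m _ _)) (t↑-G (p ^ (e′ + v)))))) g

  factor-G : ∀ {n} (σs : Vec ℕ n) → Σ ℕ λ a → ∀ C hs → All (G C) hs → G (a * suc C) (factor σs hs)
  factor-G [] = 1 , λ { C [] [] → G-mono (s≤s z≤n) G-𝟏 }
  factor-G (σ ∷ σs) with fac-G σ pairs σ 0 | factor-G σs
  ... | m , gm | a , ga = proj₁ bd , λ { C (h ∷ hs) (g ∷ gs) → G-mono (proj₂ bd C) (G-⊗ (G-↑ (p ^ σ) g) (G-⊗ gm (ga C hs gs))) }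
    where
    bd : Linear (λ C → suc (p ^ σ * C) + (m + a * suc C))
    bd = linear-+ (linear-suc (linear-* (p ^ σ) linear-id)) (linear-+ (linear-const m) (linear-* a (linear-suc linear-id)))

  BoxDegenerate : ∀ {n} → Family → Vec ℛ n → ℕ → Set
  BoxDegenerate Λ hs N = ∀ bs x → All (_≤ cB) bs → G N x → top Λ (scale bs hs) x ≡ 0ᴬ

  -- The polynomial g is tied to the tuple hs and serves all Λ that degenerate there. N₂ is the
  -- window on which annihilation is wanted, and `a` the room granted to the other factors of g,
  -- which are absorbed into the argument.
  Kills : ∀ n → ℕ → Vec ℛ n → ℕ → ℛ → ℕ → Set
  Kills n C hs a g j = ∀ Λ N N₂ → Free Λ → BoxDegenerate Λ hs N → N₂ + a * suc C + n * cN ≤ N →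
    ¬ (p ∣ j) → ds j ≡ suc n → ∀ x → G N₂ x → fun (Λ j) (g ⊗ x) ≡ 0ᴬ

  kill-one : ∀ n j → j < K → Σ ℕ λ a → ∀ C hs → All (λ h → ¬ h ≃ 𝟎) hs → All (G C) hs →
    Σ ℛ λ g → (¬ g ≃ 𝟎) × G (a * suc C) g × Kills n C hs 0 g j
  kill-one n j j<K with p ∣? j | ds j ≟ suc n
  ... | yes d | _ = 1 , λ C hs _ _ → 𝟏 , 𝟏≄𝟎 , G-mono (s≤s z≤n) G-𝟏 , λ _ _ _ _ _ _ p∤j → contradiction d p∤j
  ... | no _ | no ne = 1 , λ C hs _ _ → 𝟏 , 𝟏≄𝟎 , G-mono (s≤s z≤n) G-𝟏 , λ _ _ _ _ _ _ _ e → contradiction e ne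
  ... | no p∤j | yes e with chain n j p∤j e j<K
  ...   | σs , ch with factor-G σs
  ...     | a , ga = a , λ C hs nz gs → factor σs hs , factor-nonzero σs hs nz , ga C hs gs
          , λ Λ N N₂ free box le _ _ → isolate 1≤K ch hs (λ _ → Λ)
              (λ { (suc v) _ _ → free (p ^ suc v * j) (1≤ v) (∣m⇒∣m*n j (m∣m*n (p ^ v))) }) N₂
              (λ bs x b gx → box bs x b (G-mono (subst (λ z → z + n * cN ≤ N) (+-identityʳ N₂) le) gx))
    where
    1≤j : 1 ≤ j
    1≤j = n≢0⇒n>0 (λ { refl → p∤j (p ∣0) })
    1≤ : ∀ v → 1 ≤ p ^ suc v * j
    1≤ v = *-mono-≤ (p^v>0 (suc v)) 1≤j

  kill-all : ∀ n k → k ≤ K → Σ ℕ λ a → ∀ C hs → All (λ h → ¬ h ≃ 𝟎) hs → All (G C) hs →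
    Σ ℛ λ g → (¬ g ≃ 𝟎) × G (a * suc C) g × (∀ j → j < k → Kills n C hs a g j)
  kill-all n zero _ = 1 , λ C hs _ _ → 𝟏 , 𝟏≄𝟎 , G-mono (s≤s z≤n) G-𝟏 , λ _ ()
  kill-all n (suc k) k<K with kill-all n k (≤-trans (n≤1+n k) k<K) | kill-one n k k<K
  ... | a , all | b , one = a + b , λ C hs nz gs →
      let (g , g≄0 , gG , gk) = all C hs nz gs
          (f , f≄0 , fG , fk) = one C hs nz gs
      in g ⊗ f , domain g≄0 f≄0 , subst (λ z → G z (g ⊗ f)) (sym (*-distribʳ-+ (suc C) a b)) (G-⊗ gG fG)
       , λ j j<sk Λ N N₂ free box le p∤j e x gx → step C hs g gG gk f fG fk j j<sk Λ N N₂ free box le p∤j e x gx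
    where
    step : ∀ C hs g → G (a * suc C) g → (∀ j → j < k → Kills n C hs a g j) → ∀ f → G (b * suc C) f → Kills n C hs 0 f k →
           ∀ j → j < suc k → Kills n C hs (a + b) (g ⊗ f) j
    step C hs g gG gk f fG fk j j<sk Λ N N₂ free box le p∤j e x gx with j ≟ k
    ... | yes refl = trans (cong-fun (Λ j) (R.trans (R.*-congʳ (R.*-comm g f)) (R.*-assoc f g x)))
          (fk Λ N (a * suc C + N₂) free box (≤-trans (+-monoˡ-≤ (n * cN) (≤-trans (≤-reflexive (+-identityʳ _))
              (subst (_≤ N₂ + (a + b) * suc C) (+-comm N₂ (a * suc C)) (+-monoʳ-≤ N₂ (*-monoˡ-≤ (suc C) (m≤m+n a b)))))) le)
            p∤j e (g ⊗ x) (G-⊗ gG gx))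
    ... | no ne = trans (cong-fun (Λ j) (R.*-assoc g f x))
          (gk j (≤∧≢⇒< (s≤s⁻¹ j<sk) ne) Λ N (b * suc C + N₂) free box
            (≤-trans (+-monoˡ-≤ (n * cN) (≤-reflexive (rot (b * suc C) N₂ (a * suc C)))) (subst (λ z → N₂ + z + n * cN ≤ N) (*-distribʳ-+ (suc C) a b) le))
            p∤j e (f ⊗ x) (G-⊗ fG gx))
      where
      rot : ∀ x y z → x + y + z ≡ y + (z + x)
      rot x y z = trans (cong (_+ z) (+-comm x y)) (trans (+-assoc y x z) (cong (y +_) (+-comm x z)))

  -- The sums over the progressions r + g y, with r in `Gs N`, add up to Q^ N₁ times the full sum.
  -- As `Biased` concerns squares, Cauchy-Schwarz is needed to find one progression that is as
  -- biased as the average.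
  restrict-biased : ∀ c N N₁ m g f → Resp f → G m g → m + N₁ ≤ N → Biased c N f →
    Σ ℛ λ r → Biased c N₁ (λ y → f (r ⊕ g ⊗ y))
  restrict-biased c N N₁ m g f rf gG le bias = r , *-cancelˡ (Q^ N ℤ.* Q^ N) (*-pos (Q^>0 N) (Q^>0 N))
      (ℤ.≤-trans (subst₂ ℤ._≤_ (ℤ.*-comm (Q^ N₁ ℤ.* Q^ N₁) _) refl (*-monoˡ (Q^ N₁ ℤ.* Q^ N₁) Q₁≥0 bias))
        (subst₂ ℤ._≤_ (rot₁ (Q^ c ℤ.* Q^ c) (Q^ N₁) (Sₓ N f)) (rot₂ (Q^ c ℤ.* Q^ c) (Q^ N) (T r ℤ.* T r)) (*-monoˡ (Q^ c ℤ.* Q^ c) (*-nonneg (Q^≥0 c) (Q^≥0 c)) at-r)))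
    where
    T : ℛ → ℤ
    T x = Sₓ N₁ (λ y → f (x ⊕ g ⊗ y))
    X = Gs N
    s = Q^ N₁ ℤ.* Sₓ N f
    Q₁≥0 = *-nonneg (Q^≥0 N₁) (Q^≥0 N₁)
    rot₁ : ∀ a b c → a ℤ.* ((b ℤ.* c) ℤ.* (b ℤ.* c)) ≡ (b ℤ.* b) ℤ.* (a ℤ.* (c ℤ.* c))
    rot₁ = solve-∀
    rot₂ : ∀ a b c → a ℤ.* (b ℤ.* (b ℤ.* c)) ≡ (b ℤ.* b) ℤ.* (a ℤ.* c)
    rot₂ = solve-∀
    total : ∑ X T ≡ s
    total = trans (∑-swap X (Gs N₁) _) (trans (∑-cong∈ (Gs N₁) (λ y y∈ → S-shift N rf (G-mono le (G-⊗ gG (Gs-G N₁ y y∈)))))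
      (trans (∑-const (Gs N₁) _) (cong (ℤ._* Sₓ N f) (length-Gs N₁))))
    sq : s ℤ.* s ℤ.≤ ∑ X (λ x → Q^ N ℤ.* (T x ℤ.* T x))
    sq = subst₂ ℤ._≤_ (cong₂ ℤ._*_ total total) (trans (cong (ℤ._* ∑ X (λ x → T x ℤ.* T x)) (length-Gs N)) (sym (∑-*ˡ X (Q^ N) _))) (cauchy-schwarz X T)
    S²>0 : 0ℤ ℤ.< Sₓ N f ℤ.* Sₓ N f
    S²>0 = pos-of (*-pos (Q^>0 N) (Q^>0 N)) (*-nonneg (Q^≥0 c) (Q^≥0 c)) bias
    rot₃ : ∀ b c → (b ℤ.* b) ℤ.* (c ℤ.* c) ≡ (b ℤ.* c) ℤ.* (b ℤ.* c)
    rot₃ = solve-∀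
    found : Σ ℛ λ r → r ∈ X × s ℤ.* s ℤ.≤ ℤ.+ length X ℤ.* (Q^ N ℤ.* (T r ℤ.* T r))
    found = pigeonhole X (λ x → Q^ N ℤ.* (T x ℤ.* T x)) (s ℤ.* s)
      (subst (0ℤ ℤ.<_) (rot₃ (Q^ N₁) (Sₓ N f)) (*-pos (*-pos (Q^>0 N₁) (Q^>0 N₁)) S²>0)) sq
    r = proj₁ found
    at-r : s ℤ.* s ℤ.≤ Q^ N ℤ.* (Q^ N ℤ.* (T r ℤ.* T r))
    at-r = subst (λ z → s ℤ.* s ℤ.≤ z ℤ.* (Q^ N ℤ.* (T r ℤ.* T r))) (length-Gs N) (proj₂ (proj₂ found))

  -- At a nonzero coefficient in top degree p^v i ≼ j forces j = p^v i, and `Free` leaves only v =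
  -- 0.
  top-Good : ∀ Λ n i → Free Λ → Deg Λ (suc n) → ds i ≡ suc n → 1 ≤ i → Good Λ i
  top-Good Λ n i free deg e 1≤i j v l j≢i with suc n <? ds j
  ... | yes h = deg j h
  ... | no nh with ≼-ds≡ {p ^ v * i} {j} l (≤-trans (≮⇒≥ nh) (≤-reflexive (trans (sym e) (sym (ds-p^* v i)))))
    where
    ds-p^* : ∀ v i → ds (p ^ v * i) ≡ ds i
    ds-p^* zero i = cong ds (*-identityˡ i)
    ds-p^* (suc v) i = trans (cong ds (trans (*-assoc p (p ^ v) i) (*-comm p _))) (trans (ds-*p (p ^ v * i)) (ds-p^* v i))
  top-Good Λ n i free deg e 1≤i j zero l j≢i | no nh | refl = contradiction (*-identityˡ i) j≢i
  top-Good Λ n i free deg e 1≤i j (suc v) l j≢i | no nh | refl =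
    free (p ^ suc v * i) (*-mono-≤ (p^v>0 (suc v)) 1≤i) (∣m⇒∣m*n i (m∣m*n (p ^ v)))

  cut : ℕ → Family → Family
  cut n Λ i with ds i ≟ n
  ... | yes _ = 0ᴴ
  ... | no _ = Λ i

  cut-zero : ∀ n Λ i → Λ i ≗ 0ᴴ → cut n Λ i ≗ 0ᴴ
  cut-zero n Λ i z x with ds i ≟ n
  ... | yes _ = refl
  ... | no _ = z x

  cut-keep : ∀ n Λ i → ds i ≢ n → cut n Λ i ≗ Λ i
  cut-keep n Λ i ne x with ds i ≟ n
  ... | yes e = contradiction e ne
  ... | no _ = refl

  cut-top : ∀ n Λ i → ds i ≡ n → cut n Λ i ≗ 0ᴴ
  cut-top n Λ i e x with ds i ≟ n
  ... | yes _ = refl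
  ... | no ne = contradiction e ne

  cut-Deg : ∀ n Λ → Deg Λ (suc n) → Deg (cut (suc n) Λ) n
  cut-Deg n Λ dg i n<i x with ds i ≟ suc n
  ... | yes _ = refl
  ... | no ne = dg i (≤∧≢⇒< n<i (λ e → ne (sym e))) x

  Conclusion : Family → ℕ → ℕ → ℕ → Set
  Conclusion Λ k m N₂ = Σ ℛ λ g → (¬ g ≃ 𝟎) × G m g × (∀ x → G N₂ x → fun (Λ k) (g ⊗ x) ≡ 0ᴬ)

  trivial : ∀ Λ k m N₂ → 1 ≤ m → Λ k ≗ 0ᴴ → Conclusion Λ k m N₂
  trivial Λ k m N₂ 1≤m z = 𝟏 , 𝟏≄𝟎 , G-mono 1≤m G-𝟏 , λ x _ → z _

  -- The constant `a` precedes Λ, c and N: in the application c is itself proportional to N.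
  Inverse : ℕ → ℕ → Set
  Inverse s a = ∀ Λ c N N₂ k → Bnd Λ → Free Λ → Deg Λ s → Good Λ k → ¬ (p ∣ k) →
    Biased c N (ev Λ) → a * (suc c + N₂) ≤ N → Conclusion Λ k (a * suc c) N₂

  weyl-box : ∀ n c N Λ → Bnd Λ → Deg Λ (suc n) → size cB n (lossₙ n c) ≤ N → Biased c N (ev Λ) →
    Σ (Vec ℛ n) λ hs → All (λ h → ¬ h ≃ 𝟎) hs × All (G (size cB n (lossₙ n c))) hs × BoxDegenerate Λ hs N
  weyl-box n c N Λ bnd deg C≤N bias =
    let C = size cB n (lossₙ n c)
        (hs , nz , gs , box) = dense-box cB n (lossₙ n c) C (degenerate? N Λ) (Degenerate-MultiSub N Λ) ≤-refl
                                 (weyl n c C N Λ Λ bnd (deg , λ _ _ _ → refl) C≤N bias)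
    in hs , nz , gs , λ bs x bs≤ gx → let (y , y∈ , x≃y) = Gs-complete N x gx in
         trans (cong-fun (topᴴ Λ (scale bs hs)) x≃y) (box bs bs≤ y y∈)

  module Step (n a′ : ℕ) (IH : Inverse n a′) (Cₙ : ℕ → ℕ) (A : ℕ) (Cₙ≤ : ∀ c → Cₙ c ≤ A * suc c)
    (boxes : ∀ c N Λ → Bnd Λ → Deg Λ (suc n) → Cₙ c ≤ N → Biased c N (ev Λ) →
      Σ (Vec ℛ n) λ hs → All (λ h → ¬ h ≃ 𝟎) hs × All (G (Cₙ c)) hs × BoxDegenerate Λ hs N)
    (aT : ℕ)
    (killers : ∀ C hs → All (λ h → ¬ h ≃ 𝟎) hs → All (G C) hs →
      Σ ℛ λ g → (¬ g ≃ 𝟎) × G (aT * suc C) g × (∀ j → j < K → Kills n C hs aT g j))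
    (m : ℕ) (m≡ : m ≡ n * cN) where

    gs : ℕ → ℕ
    gs c = aT * suc (Cₙ c)

    A₁ : ℕ
    A₁ = aT * suc A

    gs≤ : ∀ c → gs c ≤ A₁ * suc c
    gs≤ c = ≤-trans (*-monoʳ-≤ aT (s≤s (≤-trans (Cₙ≤ c) (m≤n+m (A * suc c) c)))) (≤-reflexive (sym (*-assoc aT (suc A) (suc c))))

    -- `a₀` is the left side of `need≤` with each quantity replaced by its rate; the summand added
    -- in `a` bounds the degree of g ^ k times the annihilator from the lower degree.
    a₀ a : ℕ
    a₀ = (A + 1) + ((2 + K * A₁ + K * a′) + (A₁ + m)) + (A₁ + a′)
    a = a₀ + (1 + K * A₁ + a′)

    module Sizes (c N₂ N : ℕ) (aN : a * (suc c + N₂) ≤ N) where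
      -- N₁ is the length that the induction hypothesis asks for, and Nₜ bounds the degree of g ^ (i
      -- - 1) y ^ i for y in `G N₁`.
      τ N₁ Nₜ : ℕ
      τ = suc c + N₂
      N₁ = a′ * τ
      Nₜ = 2 + K * gs c + K * N₁

      need≤ : (Cₙ c + N₂) + (Nₜ + (gs c + m)) + (gs c + N₁) ≤ N
      need≤ = ≤-trans (_≲_.le total) (≤-trans (*-monoˡ-≤ τ (m≤m+n a₀ (1 + K * A₁ + a′))) aN)
        where
        open Proportional τ (s≤s z≤n)
        grow : ∀ x → x * suc c ≤ x * τ
        grow x = *-monoʳ-≤ x (m≤m+n (suc c) N₂)
        CT : Cₙ c ≲ A
        CT = mk (≤-trans (Cₙ≤ c) (grow A))
        gsT : gs c ≲ A₁
        gsT = mk (≤-trans (gs≤ c) (grow A₁))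
        N₂T : N₂ ≲ 1
        N₂T = mk (≤-trans (m≤n+m N₂ (suc c)) (≤-reflexive (sym (*-identityˡ τ))))
        N₁T : N₁ ≲ a′
        N₁T = mk ≤-refl
        total : (Cₙ c + N₂) + (Nₜ + (gs c + m)) + (gs c + N₁) ≲ a₀
        total = ((CT ⊞ N₂T) ⊞ (((const 2 ⊞ (K ⊠ gsT)) ⊞ (K ⊠ N₁T)) ⊞ (gsT ⊞ const m))) ⊞ (gsT ⊞ N₁T)

      C≤N : Cₙ c ≤ N
      C≤N = ≤-trans (≤-trans (m≤m+n _ N₂) (≤-trans (m≤m+n _ (Nₜ + (gs c + m))) (m≤m+n _ (gs c + N₁)))) need≤

      gs+N₁≤N : gs c + N₁ ≤ N
      gs+N₁≤N = ≤-trans (m≤n+m (gs c + N₁) (Cₙ c + N₂ + (Nₜ + (gs c + m)))) need≤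

      fits : ∀ X → X ≤ Nₜ ⊎ X ≤ N₂ → X + gs c + n * cN ≤ N
      fits X h = ≤-trans (≤-reflexive (trans (cong (X + gs c +_) (sym m≡)) (+-assoc X (gs c) m))) (≤-trans (split′ h) (≤-trans (m≤m+n _ (gs c + N₁)) need≤))
        where
        split′ : X ≤ Nₜ ⊎ X ≤ N₂ → X + (gs c + m) ≤ (Cₙ c + N₂) + (Nₜ + (gs c + m))
        split′ (inj₁ le) = ≤-trans (+-monoˡ-≤ (gs c + m) le) (m≤n+m _ (Cₙ c + N₂))
        split′ (inj₂ le) = +-mono-≤ (≤-trans le (m≤n+m N₂ (Cₙ c))) (m≤n+m (gs c + m) Nₜ)

    final≤ : ∀ c k → k ≤ K → suc (k * gs c) + a′ * suc c ≤ a * suc c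
    final≤ c k k≤K = ≤-trans (+-mono-≤ (+-mono-≤ (m≤m*n 1 (suc c)) (≤-trans (*-monoˡ-≤ (gs c) k≤K) (≤-trans (*-monoʳ-≤ K (gs≤ c)) (≤-reflexive (sym (*-assoc K A₁ (suc c)))))))
        (≤-refl {a′ * suc c}))
      (≤-trans (≤-reflexive (trans (cong (_+ a′ * suc c) (sym (*-distribʳ-+ (suc c) 1 (K * A₁)))) (sym (*-distribʳ-+ (suc c) (1 + K * A₁) a′))))
        (*-monoˡ-≤ (suc c) (m≤n+m (1 + K * A₁ + a′) a₀)))

    gs≤a : ∀ c → gs c ≤ a * suc c
    gs≤a c = ≤-trans (gs≤ c) (*-monoˡ-≤ (suc c) (≤-trans (m≤m+n A₁ a′) (≤-trans (m≤n+m (A₁ + a′) ((A + 1) + ((2 + K * A₁ + K * a′) + (A₁ + m)))) (m≤m+n a₀ (1 + K * A₁ + a′)))))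

    module Given (Λ : Family) (c N N₂ : ℕ) (bnd : Bnd Λ) (free : Free Λ) (deg : Deg Λ (suc n)) (bias : Biased c N (ev Λ))
      (aN : a * (suc c + N₂) ≤ N) (hs : Vec ℛ n) (box : BoxDegenerate Λ hs N)
      (g : ℛ) (g≄0 : ¬ g ≃ 𝟎) (gG : G (gs c) g) (kills : ∀ j → j < K → Kills n (Cₙ c) hs aT g j) where
      open Sizes c N₂ N aN

      restricted : Σ ℛ λ r → Biased c N₁ (λ y → ev Λ (r ⊕ g ⊗ y))
      restricted = restrict-biased c N N₁ (gs c) g (ev Λ) (ev-cong Λ) gG gs+N₁≤N bias

      r : ℛ
      r = proj₁ restricted

      normal : Normal (res r g Λ) 0
      normal = normalise (res r g Λ) (res-Bnd Λ r g)

      Λ₂ Λ₃ : Family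
      Λ₂ = Normal.fam normal
      Λ₃ = cut (suc n) Λ₂

      Λ₂-free : Free Λ₂
      Λ₂-free j 1≤j = Normal.free normal j 1≤j z≤n

      Λ₂-good : ∀ i → ¬ (p ∣ i) → Good Λ i → Good Λ₂ i × (Λ₂ i ≗ (Λ i ∙ (g ↑ i)))
      Λ₂-good i p∤i gd = let (g₂ , e) = Normal.good normal i p∤i (res-Good Λ r g i gd) in
        g₂ , λ x → trans (e x) (res-good Λ r g i bnd gd x)

      -- The value is that of Λ i at g ^ i y ^ i: one factor g annihilates, and g ^ (i - 1) y ^ i
      -- stays in the window. Only values at short y vanish, not the map Λ₂ i, but bias on `Gs N₁`
      -- sees no more than those values, so the top degree may be cut.
      top-vanishes : ∀ y → G N₁ y → ∀ i → i < K → ds i ≡ suc n → fun (Λ₂ i) (y ↑ i) ≡ 0ᴬ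
      top-vanishes y gy zero _ ()
      top-vanishes y gy (suc i) i<K e = go (p ∣? suc i)
        where
        bound : suc (i * gs c) + suc (suc i * N₁) ≤ Nₜ
        bound = ≤-trans (≤-reflexive (cong suc (+-suc (i * gs c) (suc i * N₁))))
          (s≤s (s≤s (+-mono-≤ (*-monoˡ-≤ (gs c) (≤-trans (n≤1+n i) (<⇒≤ i<K))) (*-monoˡ-≤ N₁ (<⇒≤ i<K)))))
        go : Dec (p ∣ suc i) → fun (Λ₂ (suc i)) (y ↑ suc i) ≡ 0ᴬ
        go (yes d) = Λ₂-free (suc i) (s≤s z≤n) d _
        go (no p∤i) = trans (proj₂ (Λ₂-good (suc i) p∤i (top-Good Λ n (suc i) free deg e (s≤s z≤n))) (y ↑ suc i))
          (trans (cong-fun (Λ (suc i)) (R.*-assoc g (g ↑ i) (y ↑ suc i)))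
            (kills (suc i) i<K Λ N Nₜ free box (fits Nₜ (inj₁ ≤-refl)) p∤i e _ (G-mono bound (G-⊗ (G-↑ i gG) (G-↑ (suc i) gy)))))

      same : ∀ y → y ∈ Gs N₁ → ev Λ (r ⊕ g ⊗ y) ≡ ev Λ₃ y
      same y y∈ = trans (ev-res Λ r g y) (trans (sym (Normal.same normal y)) (sum-cong< K pt))
        where
        pt : ∀ i → i < K → fun (Λ₂ i) (y ↑ i) ≡ fun (Λ₃ i) (y ↑ i)
        pt i i<K = go (ds i ≟ suc n)
          where
          go : Dec (ds i ≡ suc n) → fun (Λ₂ i) (y ↑ i) ≡ fun (Λ₃ i) (y ↑ i)
          go (yes e) = trans (top-vanishes y (Gs-G N₁ y y∈) i i<K e) (sym (cut-top (suc n) Λ₂ i e (y ↑ i)))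
          go (no ne) = sym (cut-keep (suc n) Λ₂ i ne (y ↑ i))

      bias₃ : Biased c N₁ (ev Λ₃)
      bias₃ = subst (λ s → Q^ N₁ ℤ.* Q^ N₁ ℤ.≤ (Q^ c ℤ.* Q^ c) ℤ.* (s ℤ.* s)) (∑-cong∈ (Gs N₁) (λ y m → cong κ (same y m))) (proj₂ restricted)

      descend : ∀ k → k < K → ¬ (p ∣ k) → Good Λ k → ds k ≢ suc n → Conclusion Λ k (a * suc c) N₂
      descend k k<K p∤k good ds≢ = g ↑ k ⊗ g′ , domain (↑-nonzero k g≄0) (proj₁ (proj₂ ih)) , G-mono (final≤ c k (<⇒≤ k<K)) (G-⊗ (G-↑ k gG) (proj₁ (proj₂ (proj₂ ih))))
          , λ x gx → trans (cong-fun (Λ k) (R.*-assoc _ _ x)) (trans (sym (proj₂ Λ₂k (g′ ⊗ x)))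
            (trans (sym (cut-keep (suc n) Λ₂ k ds≢ (g′ ⊗ x))) (proj₂ (proj₂ (proj₂ ih)) x gx)))
        where
        Λ₂k : Good Λ₂ k × (Λ₂ k ≗ (Λ k ∙ (g ↑ k)))
        Λ₂k = Λ₂-good k p∤k good
        ih : Conclusion Λ₃ k (a′ * suc c) N₂
        ih = IH Λ₃ c N₁ N₂ k
          (λ j K≤j → cut-zero (suc n) Λ₂ j (Normal.bnd normal j K≤j))
          (λ j 1≤j d → cut-zero (suc n) Λ₂ j (Λ₂-free j 1≤j d))
          (cut-Deg n Λ₂ (Normal.deg normal (suc n) (res-Deg Λ r g (suc n) deg)))
          (λ j v l j≢k → cut-zero (suc n) Λ₂ j (proj₁ Λ₂k j v l j≢k))
          p∤k bias₃ ≤-refl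
        g′ : ℛ
        g′ = proj₁ ih

      conclude : ∀ k → k < K → ¬ (p ∣ k) → Good Λ k → Dec (ds k ≡ suc n) → Conclusion Λ k (a * suc c) N₂
      conclude k k<K p∤k good (yes e) = g , g≄0 , G-mono (gs≤a c) gG
        , kills k k<K Λ N N₂ free box (fits N₂ (inj₂ ≤-refl)) p∤k e
      conclude k k<K p∤k good (no ds≢) = descend k k<K p∤k good ds≢

    inverse : Inverse (suc n) a
    inverse Λ c N N₂ k bnd free deg good p∤k bias aN = go (k <? K)
      where
      go : Dec (k < K) → Conclusion Λ k (a * suc c) N₂
      go (no k≮K) = trivial Λ k _ N₂ (≤-trans (s≤s z≤n) (final≤ c 0 z≤n)) (bnd k (≮⇒≥ k≮K))
      go (yes k<K) =
        let (hs , nz , gsG , box) = boxes c N Λ bnd deg (Sizes.C≤N c N₂ N aN) bias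
            (g , g≄0 , gG , kills) = killers (Cₙ c) hs nz gsG
        in Given.conclude Λ c N N₂ bnd free deg bias aN hs box g g≄0 gG kills k k<K p∤k good (ds k ≟ suc n)

  inverse-theorem : ∀ s → Σ ℕ λ a → Inverse s a
  -- Degree 0 leaves only the constant term, and k is positive since p does not divide it.
  inverse-theorem zero = 1 , λ Λ c N N₂ k bnd free deg good p∤k _ _ →
    trivial Λ k _ N₂ (s≤s z≤n) (deg k (ds-pos {k} (n≢0⇒n>0 (λ { refl → p∤k (p ∣0) }))))
  inverse-theorem (suc n) = S.a , S.inverse
    where
    ih = inverse-theorem n
    lin-C = linear-∘ (linear-size cB n) (linear-loss n)
    killing = kill-all n K ≤-refl
    module S = Step n (proj₁ ih) (proj₂ ih) (λ c → size cB n (lossₙ n c)) (proj₁ lin-C) (proj₂ lin-C) (weyl-box n)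
      (proj₁ killing) (proj₂ killing) (n * cN) refl

-- A biased multiplier, and the inverse theorem on a progression.

module BiasedMultiplier {q p : ℕ} (S : Setting q p) (K : ℕ) (1≤K : 1 ≤ K) where
  open import Data.Nat
  open import Data.Nat.Properties
  open import Data.Nat.Divisibility

  open InverseTheorem S K 1≤K public

  κ-0≥1 : 1ℤ ℤ.≤ κ 0ᴬ
  κ-0≥1 = subst (1ℤ ℤ.≤_) (sym κ-0) (ℤ.≤-trans (ℤ.+≤+ {1} (≤-refl)) (ℤ.+-monoˡ-≤ (ℤ.- 1ℤ) (ℤ.+≤+ {2} 1<p)))

  -- If no value ψ y vanishes, then Σ_m Σ_y κ (ψ y m) = 0, so the term m = 0 is compensated by a biased one.
  biased-multiplier : ∀ M N (ψ : ℛ → Hom) → (∀ y → y ∈ Gs N → Σ ℛ λ z → G M z × fun (ψ y) z ≢ 0ᴬ) →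
    Σ ℛ λ m → G M m × (¬ m ≃ 𝟎) × Biased M N (λ y → fun (ψ y) m)
  biased-multiplier M N ψ nz with ∑-find (λ m → ¬? (m ≃0?) ×-dec (Q^ N ℤ.* Q^ N ℤ.≤? (Q^ M ℤ.* Q^ M) ℤ.* (Sm m ℤ.* Sm m))) (Gs M)
    where
    Sm : ℛ → ℤ
    Sm m = Sₓ N (λ y → fun (ψ y) m)
  ... | yes (m , m∈ , m≄0 , b) = m , Gs-G M m m∈ , m≄0 , b
  ... | no none = contradiction (ℤ.≤-trans (ℤ.≤-reflexive (sym lower)) (ℤ.≤-trans (∑-mono∈ (Gs M) each) (ℤ.≤-reflexive upper))) (ℤ.<⇒≱ (Q^>0 N))
    where
    Sm : ℛ → ℤ
    Sm m = Sₓ N (λ y → fun (ψ y) m)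
    total : ∑ (Gs M) Sm ≡ 0ℤ
    total = trans (∑-swap (Gs M) (Gs N) _) (trans (∑-cong∈ (Gs N) zero-sum) (∑-0 (Gs N)))
      where
      zero-sum : ∀ y → y ∈ Gs N → ∑ (Gs M) (λ m → κ (fun (ψ y) m)) ≡ 0ℤ
      zero-sum y y∈ = let (z , gz , ne) = nz y y∈ in
        trans (S-cong M (λ m → sym (A.identityˡ _))) (S-affine M (ψ y) 0ᴬ z gz ne)
    upper : ∑ (Gs M) (λ m → Q^ M ℤ.* Sm m) ≡ 0ℤ
    upper = trans (∑-*ˡ (Gs M) (Q^ M) Sm) (trans (cong (Q^ M ℤ.*_) total) (ℤ.*-zeroʳ (Q^ M)))
    -- X is chosen so that X [ m = 0 ] - Q^ N equals Q^ M * Q^ N at m = 0 and - Q^ N elsewhere.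
    -- These are lower bounds for Q^ M * Sm m if no nonzero m is biased, and they sum to Q^ N > 0.
    X = Q^ M ℤ.* Q^ N ℤ.+ Q^ N
    lower : ∑ (Gs M) (λ m → X ℤ.* 𝟙 (m ≃0?) ℤ.+ ℤ.- Q^ N) ≡ Q^ N
    lower = trans (∑-+ (Gs M) _ _) (trans (cong₂ ℤ._+_ (trans (∑-*ˡ (Gs M) X _) (cong (X ℤ.*_) (Gs-zero M)))
        (trans (∑-const (Gs M) _) (cong (ℤ._* (ℤ.- Q^ N)) (length-Gs M)))) (fin (Q^ M) (Q^ N)))
      where
      fin : ∀ a b → (a ℤ.* b ℤ.+ b) ℤ.* 1ℤ ℤ.+ a ℤ.* (ℤ.- b) ≡ b
      fin = solve-∀
    each : ∀ m → m ∈ Gs M → X ℤ.* 𝟙 (m ≃0?) ℤ.+ ℤ.- Q^ N ℤ.≤ Q^ M ℤ.* Sm m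
    each m m∈ with m ≃0?
    ... | yes z = ≤-substˡ (fin (Q^ M) (Q^ N)) (*-monoˡ (Q^ M) (Q^≥0 M) (≤-substˡ (trans (∑-const (Gs N) 1ℤ) (trans (ℤ.*-identityʳ _) (length-Gs N)))
              (∑-mono (Gs N) (λ y → subst (λ w → 1ℤ ℤ.≤ κ w) (sym (fun-0 (ψ y) z)) κ-0≥1))))
      where
      fin : ∀ a b → a ℤ.* b ≡ (a ℤ.* b ℤ.+ b) ℤ.* 1ℤ ℤ.+ ℤ.- b
      fin = solve-∀
    ... | no nz = ≤-substˡ (sym (trans (cong (ℤ._+ ℤ.- Q^ N) (ℤ.*-zeroʳ X)) (ℤ.+-identityˡ _))) bound
      where
      v = Q^ M ℤ.* Sm m
      bound : ℤ.- Q^ N ℤ.≤ v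
      bound with ℤ.- Q^ N ℤ.≤? v
      ... | yes le = le
      ... | no nle = contradiction (m , m∈ , nz , subst (Q^ N ℤ.* Q^ N ℤ.≤_) (sq (Q^ M) (Sm m)) (sq-mono (Q^≥0 N)
              (subst (ℤ._≤ ℤ.- v) (ℤ.neg-involutive (Q^ N)) (ℤ.neg-mono-≤ (ℤ.<⇒≤ (ℤ.≰⇒> nle)))))) none
        where
        sq : ∀ a b → (ℤ.- (a ℤ.* b)) ℤ.* (ℤ.- (a ℤ.* b)) ≡ (a ℤ.* a) ℤ.* (b ℤ.* b)
        sq = solve-∀

  Bnd-Deg : ∀ Λ → Bnd Λ → Deg Λ K
  Bnd-Deg Λ bnd j K<ds = bnd j (<⇒≤ (<-≤-trans K<ds (ds≤ j)))

  inverse-constant : ℕ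
  inverse-constant = proj₁ (inverse-theorem K)

  -- Substituting r + d y multiplies the coefficient at a good k by d ^ k. This factor is the only
  -- trace of d in the conclusion, which keeps the constant uniform in d.
  inverse-progression : ∀ Λ c N N₂ k r d → Bnd Λ → Good Λ k → ¬ (p ∣ k) → Biased c N (λ y → ev Λ (r ⊕ d ⊗ y)) →
    inverse-constant * (suc c + N₂) ≤ N →
    Σ ℛ λ g → (¬ g ≃ 𝟎) × G (inverse-constant * suc c) g × (∀ x → G N₂ x → fun (Λ k) (d ↑ k ⊗ (g ⊗ x)) ≡ 0ᴬ)
  inverse-progression Λ c N N₂ k r d bnd good p∤k bias le =
    let (g , g≄0 , gG , kill) = proj₂ (inverse-theorem K) Λ₂ c N N₂ k (Normal.bnd N₁) (λ j 1≤j → Normal.free N₁ j 1≤j z≤n)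
          (Bnd-Deg Λ₂ (Normal.bnd N₁)) (proj₁ good₂) p∤k bias₂ le
    in g , g≄0 , gG , λ x gx → trans (sym (trans (proj₂ good₂ (g ⊗ x)) (res-good Λ r d k bnd good (g ⊗ x)))) (kill x gx)
    where
    N₁ = normalise (res r d Λ) (res-Bnd Λ r d)
    Λ₂ = Normal.fam N₁
    good₂ = Normal.good N₁ k p∤k (res-Good Λ r d k good)
    bias₂ : Biased c N (ev Λ₂)
    bias₂ = subst (λ s → Q^ N ℤ.* Q^ N ℤ.≤ (Q^ c ℤ.* Q^ c) ℤ.* (s ℤ.* s))
      (S-cong N (λ y → trans (ev-res Λ r d y) (sym (Normal.same N₁ y)))) bias

  Kill : Hom → ℕ → ℛ → Set
  Kill τ N g = ∀ x → G N x → fun τ (g ⊗ x) ≡ 0ᴬ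

  -- The product works for each r because the other factors go into the argument, at the price of a
  -- shorter window.
  common-multiple : ∀ (τ : ℕ → Hom) b N N₂ k → k * suc b + N ≤ N₂ →
    (∀ r → r < k → Σ ℛ λ g → (¬ g ≃ 𝟎) × G b g × Kill (τ r) N₂ g) →
    Σ ℛ λ g → (¬ g ≃ 𝟎) × G (suc (k * b)) g × (∀ r → r < k → Kill (τ r) N g)
  common-multiple τ b N N₂ zero _ _ = 𝟏 , 𝟏≄𝟎 , G-𝟏 , λ _ ()
  common-multiple τ b N N₂ (suc k) le h =
    let (f , f≄0 , fG , fk) = h k ≤-refl
        (g , g≄0 , gG , gk) = common-multiple τ b (b + N) N₂ k (≤-trans (≤-reflexive (rot (k * suc b) b N)) (≤-trans (+-monoˡ-≤ N (n≤1+n (b + k * suc b))) le)) (λ r r<k → h r (m<n⇒m<1+n r<k))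
    in g ⊗ f , domain g≄0 f≄0 , G-mono (≤-reflexive (cong suc (+-comm (k * b) b))) (G-⊗ gG fG) , λ r r<sk x gx → go f fG fk g gG gk r r<sk x gx
    where
    rot : ∀ a b c → a + (b + c) ≡ b + a + c
    rot a b c = trans (sym (+-assoc a b c)) (cong (_+ c) (+-comm a b))
    go : ∀ f → G b f → Kill (τ k) N₂ f → ∀ g → G (suc (k * b)) g → (∀ r → r < k → Kill (τ r) (b + N) g) →
         ∀ r → r < suc k → ∀ x → G N x → fun (τ r) ((g ⊗ f) ⊗ x) ≡ 0ᴬ
    go f fG fk g gG gk r r<sk x gx with r ≟ k
    ... | no ne = trans (cong-fun (τ r) (R.*-assoc g f x)) (gk r (≤∧≢⇒< (s≤s⁻¹ r<sk) ne) (f ⊗ x) (G-⊗ fG gx))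
    ... | yes refl = trans (cong-fun (τ r) (R.trans (R.*-congʳ (R.*-comm g f)) (R.*-assoc f g x))) (fk (g ⊗ x) (G-mono fits (G-⊗ gG gx)))
      where
      fits : suc (k * b) + N ≤ N₂
      fits = ≤-trans (+-monoˡ-≤ N (s≤s (≤-trans (*-monoʳ-≤ k (n≤1+n b)) (m≤n+m (k * suc b) b)))) le

-- The prime field inside 𝔽_q and a functional onto it.

module FieldFacts {q : ℕ} (𝔽 : FiniteField q) where
  open import Data.Nat.DivMod using (_%_; _/_; m%n<n; m≡m%n+[m/n]*n)
  open import Data.Nat.Divisibility using (_∣_; divides; m%n≡0⇒n∣m)
  open import Data.Nat.Coprimality using (prime⇒coprime; coprime-Bézout)
  open import Data.Nat.GCD using (module Bézout)
  open import Data.Integer using (+_)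
  open import Data.Fin using (toℕ)
  open import Data.List using (replicate; _++_; map; allFin)
  import Data.List.Properties as List
  open import Data.List.Membership.Propositional.Properties using (∈-map⁺; ∈-allFin)
  open import Function.Bundles using (Inverse)
  open import Axiom.UniquenessOfIdentityProofs using (module Decidable⇒UIP)

  open FiniteField 𝔽 public renaming (Carrier to F; _+_ to infixl 6 _+F_; _*_ to infixl 7 _*F_; -_ to infix 8 -F_; 0# to 0F; 1# to 1F)
  open Over 𝔽 using (IsCharacteristic; _·1)

  Fring : CommutativeRing 0ℓ 0ℓ
  Fring = record { isCommutativeRing = isCommutativeRing }

  module F = CommutativeRing Fring
  module FP = RingP F.ring
  module F^ = Exp F.commutativeSemiring
  open F^ using () renaming (_^_ to infixr 8 _^F_) public
  module F× = Mult (AbelianGroup.commutativeMonoid F.+-abelianGroup)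
  open F× using () renaming (_×_ to infixr 8 _×F_) public

  open Inverse enum using (to; from; strictlyInverseʳ; strictlyInverseˡ) public

  to-injective : ∀ {x y} → to x ≡ to y → x ≡ y
  to-injective {x} {y} e = trans (sym (strictlyInverseʳ x)) (trans (cong from e) (strictlyInverseʳ y))

  infix 4 _≟F_
  _≟F_ : (x y : F) → Dec (x ≡ y)
  x ≟F y = map′ to-injective (cong to) (to x Fin.≟ to y)

  Fs : List F
  Fs = map from (allFin q)

  ∈Fs : ∀ x → x ∈ Fs
  ∈Fs x = subst (_∈ Fs) (strictlyInverseʳ x) (∈-map⁺ from (∈-allFin (to x)))

  length-Fs : length Fs ≡ q
  length-Fs = trans (List.length-map from (allFin q)) (List.length-tabulate (λ x → x))

  *-cancel : ∀ {x y} → x *F y ≡ 0F → x ≢ 0F → y ≡ 0F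
  *-cancel {x} {y} e x≢0 = let (x⁻ , h) = inverse x x≢0 in
    trans (sym (F.*-identityˡ y)) (trans (cong (_*F y) (trans (sym h) (F.*-comm x x⁻))) (trans (F.*-assoc x⁻ x y) (trans (cong (x⁻ *F_) e) (F.zeroʳ x⁻))))

  *-nonzero : ∀ {x y} → x ≢ 0F → y ≢ 0F → x *F y ≢ 0F
  *-nonzero x≢0 y≢0 e = y≢0 (*-cancel e x≢0)

  -≡0⇒≡ : ∀ {x y} → x +F -F y ≡ 0F → x ≡ y
  -≡0⇒≡ {x} {y} e = trans (sym (F.+-identityʳ x)) (trans (cong (x +F_) (sym (F.-‿inverseˡ y)))
    (trans (sym (F.+-assoc x (-F y) y)) (trans (cong (_+F y) e) (F.+-identityˡ y))))

  ≡⇒-≡0 : ∀ {x y} → x ≡ y → x +F -F y ≡ 0F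
  ≡⇒-≡0 {x} refl = F.-‿inverseʳ x

  ×F-* : ∀ n x → n ×F x ≡ (n ×F 1F) *F x
  ×F-* zero x = sym (F.zeroˡ x)
  ×F-* (suc n) x = trans (cong₂ _+F_ (sym (F.*-identityˡ x)) (×F-* n x)) (sym (F.distribʳ x 1F (n ×F 1F)))

  eval : List F → F → F
  eval [] x = 0F
  eval (c ∷ cs) x = c +F x *F eval cs x

  -- Horner's scheme: the values at a of the tails of a coefficient list. `quotient cs a` is the
  -- quotient of c ∷ cs by X - a.
  quotient : List F → F → List F
  quotient [] a = []
  quotient (c ∷ cs) a = eval (c ∷ cs) a ∷ quotient cs a

  quotient-length : ∀ cs a → length (quotient cs a) ≡ length cs
  quotient-length [] a = refl
  quotient-length (c ∷ cs) a = cong suc (quotient-length cs a)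

  factor-theorem : ∀ c cs a x → eval (c ∷ cs) x ≡ eval (c ∷ cs) a +F (x +F -F a) *F eval (quotient cs a) x
  factor-theorem c [] a x = trans (cong (c +F_) (trans (F.zeroʳ x) (sym (F.zeroʳ a)))) (sym (trans (cong (eval (c ∷ []) a +F_) (F.zeroʳ _)) (F.+-identityʳ _)))
  factor-theorem c (c′ ∷ cs) a x = sym (begin
    (c +F a *F e a) +F (x +F -F a) *F (e a +F x *F E)
      ≡⟨ F.+-assoc c _ _ ⟩
    c +F (a *F e a +F (x +F -F a) *F (e a +F x *F E))
      ≡⟨ cong (c +F_) (cong (a *F e a +F_) (F.distribˡ (x +F -F a) (e a) (x *F E))) ⟩
    c +F (a *F e a +F ((x +F -F a) *F e a +F (x +F -F a) *F (x *F E)))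
      ≡⟨ cong (c +F_) (F.+-assoc _ _ _) ⟨
    c +F (a *F e a +F (x +F -F a) *F e a +F (x +F -F a) *F (x *F E))
      ≡⟨ cong (λ z → c +F (z +F (x +F -F a) *F (x *F E))) (F.distribʳ (e a) a (x +F -F a)) ⟨
    c +F ((a +F (x +F -F a)) *F e a +F (x +F -F a) *F (x *F E))
      ≡⟨ cong₂ (λ z w → c +F (z *F e a +F w)) a+x-a (trans (sym (F.*-assoc _ x E)) (trans (cong (_*F E) (F.*-comm _ x)) (F.*-assoc x _ E))) ⟩
    c +F (x *F e a +F x *F ((x +F -F a) *F E))
      ≡⟨ cong (c +F_) (F.distribˡ x (e a) _) ⟨
    c +F x *F (e a +F (x +F -F a) *F E)
      ≡⟨ cong (λ z → c +F x *F z) (factor-theorem c′ cs a x) ⟨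
    c +F x *F e x ∎)
    where
    open Relation.Binary.PropositionalEquality.≡-Reasoning
    e = eval (c′ ∷ cs)
    E = eval (quotient cs a) x
    a+x-a : a +F (x +F -F a) ≡ x
    a+x-a = trans (F.+-comm a _) (trans (F.+-assoc x _ a) (trans (cong (x +F_) (F.-‿inverseˡ a)) (F.+-identityʳ x)))

  data Lead : List F → Set where
    end : ∀ {c} → c ≢ 0F → Lead (c ∷ [])
    skip : ∀ {c c′ cs} → Lead (c′ ∷ cs) → Lead (c ∷ c′ ∷ cs)

  quotient-Lead : ∀ {cs} a → Lead cs → Lead (quotient cs a)
  quotient-Lead a (end {c} c≢0) = end (λ e → c≢0 (trans (sym (trans (cong (c +F_) (F.zeroʳ a)) (F.+-identityʳ c))) e))
  quotient-Lead a (skip l) = skip (quotient-Lead a l)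

  -- The length exceeds the degree by one, so that many distinct roots are one too many.
  root-bound : ∀ n {cs} → length cs ≡ n → Lead cs → (r : ℕ → F) → (∀ {i j} → i < length cs → j < length cs → i ≢ j → r i ≢ r j) →
               ¬ (∀ i → i < length cs → eval cs (r i) ≡ 0F)
  root-bound n _ (end {c} c≢0) r _ z = c≢0 (trans (sym (trans (cong (c +F_) (F.zeroʳ (r 0))) (F.+-identityʳ c))) (z 0 (s≤s z≤n)))
  root-bound (suc n) e (skip {c} {c′} {cs} l) r dis z = root-bound n (trans (quotient-length (c′ ∷ cs) (r 0)) (ℕ.suc-injective e)) (quotient-Lead (r 0) l) (λ i → r (suc i))
    (λ i< j< ne → dis (s≤s (len i<)) (s≤s (len j<)) (λ e → ne (ℕ.suc-injective e)))
    (λ i i< → *-cancel {r (suc i) +F -F r 0} (trans (sym (F.+-identityˡ _)) (trans (F.+-congʳ (sym (z 0 (s≤s z≤n))))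
        (trans (sym (factor-theorem c (c′ ∷ cs) (r 0) (r (suc i)))) (z (suc i) (s≤s (len i<))))))
      (λ e → dis (s≤s (len i<)) (s≤s z≤n) (λ ()) (-≡0⇒≡ e)))
    where
    len : ∀ {i} → i < length (quotient (c′ ∷ cs) (r 0)) → i < length (c′ ∷ cs)
    len {i} = subst (i <_) (quotient-length (c′ ∷ cs) (r 0))

  module Char (p : ℕ) (isChar : IsCharacteristic p) where
    p-prime = proj₁ isChar
    open Lucas p p-prime using (1<p; p≢0)

    ·1≡× : ∀ n → n ·1 ≡ n ×F 1F
    ·1≡× zero = refl
    ·1≡× (suc n) = cong (1F +F_) (·1≡× n)

    p·1 : p ×F 1F ≡ 0F
    p·1 = trans (sym (·1≡× p)) (proj₂ isChar)

    torsionF : ∀ x → p ×F x ≡ 0F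
    torsionF x = trans (×F-* p x) (trans (cong (_*F x) p·1) (F.zeroˡ x))

    open AdditiveMaps p p-prime Fring (AbelianGroup.isAbelianGroup F.+-abelianGroup) torsionF
      using (∣⇒·≡0; frobenius) renaming (Hom to HomF)

    idF : HomF
    idF = record { fun = λ x → x ; cong-fun = λ e → e ; homo = λ _ _ → refl }

    frobF : ∀ x y → (x +F y) ^F p ≡ x ^F p +F y ^F p
    frobF = frobenius idF

    multiple : ∀ m → (m ℕ.* p) ×F 1F ≡ 0F
    multiple m = ∣⇒·≡0 1F (divides m refl)

    small-unit : ∀ n → 0 < n → n < p → n ×F 1F ≢ 0F
    small-unit n@(suc _) _ n<p e with coprime-Bézout (prime⇒coprime p-prime n<p)
    ... | Bézout.+- x y eq = 0≢1 (sym (trans (sym (F.+-identityʳ 1F)) (trans (cong (1F +F_) (sym (annihilates y)))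
            (trans (cong (_×F 1F) eq) (trans (×F-assoc x p) (trans (cong (x ×F_) p·1) (×F-0 x)))))))
      where
      ×F-0 : ∀ n → n ×F 0F ≡ 0F
      ×F-0 zero = refl
      ×F-0 (suc n) = trans (F.+-identityˡ _) (×F-0 n)
      ×F-assoc : ∀ m n → (m ℕ.* n) ×F 1F ≡ m ×F (n ×F 1F)
      ×F-assoc m n = sym (F×.×-assocˡ 1F m n)
      annihilates : ∀ y → (y ℕ.* n) ×F 1F ≡ 0F
      annihilates y = trans (×F-assoc y n) (trans (cong (y ×F_) e) (×F-0 y))
    ... | Bézout.-+ x y eq = 0≢1 (sym (trans (sym (F.+-identityʳ 1F)) (trans (cong (1F +F_) (sym (multiple x)))
            (trans (cong (_×F 1F) eq) (trans (sym (F×.×-assocˡ 1F y n)) (trans (cong (y ×F_) e) (×F-0 y)))))))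
      where
      ×F-0 : ∀ n → n ×F 0F ≡ 0F
      ×F-0 zero = refl
      ×F-0 (suc n) = trans (F.+-identityˡ _) (×F-0 n)

    unit : ∀ n → ¬ (p ∣ n) → n ×F 1F ≢ 0F
    unit n p∤n e = small-unit (n % p) (ℕ.n≢0⇒n>0 (λ z → p∤n (m%n≡0⇒n∣m n p z))) (m%n<n n p)
      (trans (sym (F.+-identityʳ _)) (trans (cong ((n % p) ×F 1F +F_) (sym (multiple (n / p))))
        (trans (sym (F×.×-homo-+ 1F (n % p) ((n / p) ℕ.* p))) (trans (cong (_×F 1F) (sym (m≡m%n+[m/n]*n n p))) e))))

    ×1-injective-≤ : ∀ {i j} → i ≤ j → j < p → i ×F 1F ≡ j ×F 1F → i ≡ j
    ×1-injective-≤ {i} {j} i≤j j<p e with j ℕ.∸ i in eq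
    ... | zero = ℕ.≤-antisym i≤j (ℕ.m∸n≡0⇒m≤n eq)
    ... | suc d = contradiction
          (FP.+-cancelˡ (i ×F 1F) _ _ (trans (sym (F×.×-homo-+ 1F i (suc d)))
            (trans (cong (_×F 1F) (trans (cong (i ℕ.+_) (sym eq)) (ℕ.m+[n∸m]≡n i≤j))) (trans (sym e) (sym (F.+-identityʳ _))))))
          (small-unit (suc d) (s≤s z≤n) (subst (_< p) eq (ℕ.≤-<-trans (ℕ.m∸n≤m j i) j<p)))

    ×1-injective : ∀ {i j} → i < p → j < p → i ×F 1F ≡ j ×F 1F → i ≡ j
    ×1-injective {i} {j} i<p j<p e with ℕ.≤-total i j
    ... | inj₁ le = ×1-injective-≤ le j<p e
    ... | inj₂ ge = sym (×1-injective-≤ ge i<p (sym e))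

    p≤q : p ≤ q
    p≤q = Fin.injective⇒≤ {f = λ (i : Fin p) → to (toℕ i ×F 1F)} (λ {i} {j} e →
      Fin.toℕ-injective (×1-injective (Fin.toℕ<n i) (Fin.toℕ<n j) (to-injective e)))

    1^ : ∀ n → 1F ^F n ≡ 1F
    1^ zero = refl
    1^ (suc n) = trans (F.*-identityˡ _) (1^ n)

    0^p : 0F ^F p ≡ 0F
    0^p = go p (ℕ.<-trans (s≤s z≤n) 1<p)
      where
      go : ∀ n → 0 < n → 0F ^F n ≡ 0F
      go (suc n) _ = F.zeroˡ _

    neg-^p : ∀ x → (-F x) ^F p ≡ -F (x ^F p)
    neg-^p x = neg-unique (x ^F p) ((-F x) ^F p) (trans (sym (frobF x (-F x))) (trans (cong (_^F p) (F.-‿inverseʳ x)) 0^p))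
      where open import Algebra.Properties.AbelianGroup F.+-abelianGroup using () renaming (inverseʳ-unique to neg-unique)

    Fix : F → Set
    Fix w = w ^F p ≡ w

    fix-× : ∀ i → Fix (i ×F 1F)
    fix-× zero = 0^p
    fix-× (suc i) = trans (frobF 1F (i ×F 1F)) (cong₂ _+F_ (1^ p) (fix-× i))

    -- The coefficients of X^p - X, where m = p - 2.
    artin-schreier : ℕ → List F
    artin-schreier m = 0F ∷ -F 1F ∷ replicate m 0F ++ 1F ∷ []

    eval-monomial : ∀ m x → eval (replicate m 0F ++ 1F ∷ []) x ≡ x ^F m
    eval-monomial zero x = trans (cong (1F +F_) (F.zeroʳ x)) (F.+-identityʳ 1F)
    eval-monomial (suc m) x = trans (F.+-identityˡ _) (cong (x *F_) (eval-monomial m x))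

    eval-artin-schreier : ∀ m x → eval (artin-schreier m) x ≡ x ^F suc (suc m) +F -F x
    eval-artin-schreier m x = trans (F.+-identityˡ _) (trans (cong (λ z → x *F (-F 1F +F x *F z)) (eval-monomial m x))
      (trans (F.distribˡ x _ _) (trans (F.+-comm _ _) (cong (x *F (x *F x ^F m) +F_) (trans (F.*-comm x (-F 1F)) (FP.-1*x≈-x x))))))

    Lead-artin-schreier : ∀ m → Lead (artin-schreier m)
    Lead-artin-schreier m = skip (go m)
      where
      go′ : ∀ m c → Lead (c ∷ replicate m 0F ++ 1F ∷ [])
      go′ zero c = skip (end (λ e → 0≢1 (sym e)))
      go′ (suc m) c = skip (go′ m 0F)
      go : ∀ m → Lead (-F 1F ∷ replicate m 0F ++ 1F ∷ [])
      go m = go′ m (-F 1F)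

    length-artin-schreier : ∀ m → length (artin-schreier m) ≡ suc (suc (suc m))
    length-artin-schreier m = cong (λ z → suc (suc z)) (trans (List.length-++ (replicate m 0F)) (trans (cong (ℕ._+ 1) (List.length-replicate m)) (ℕ.+-comm m 1)))

    -- Otherwise w and the p multiples of 1 would be p + 1 distinct roots of X^p - X.
    fix⇒× : ∀ w → Fix w → Σ ℕ λ i → i < p × w ≡ i ×F 1F
    fix⇒× w fw with ℕ.anyUpTo? (λ i → w ≟F i ×F 1F) p
    ... | yes r = r
    ... | no none = contradiction roots (root-bound _ refl (Lead-artin-schreier m) r distinct)
      where
      m = p ℕ.∸ 2
      p≡ : suc (suc m) ≡ p
      p≡ = ℕ.m+[n∸m]≡n 1<p
      len≡ : length (artin-schreier m) ≡ suc p
      len≡ = trans (length-artin-schreier m) (cong suc p≡)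
      r : ℕ → F
      r zero = w
      r (suc i) = i ×F 1F
      fixes : ∀ i → Fix (r i)
      fixes zero = fw
      fixes (suc i) = fix-× i
      below : ∀ {i} → suc i < length (artin-schreier m) → i < p
      below l = ℕ.s≤s⁻¹ (ℕ.≤-trans l (ℕ.≤-reflexive len≡))
      distinct : ∀ {i j} → i < length (artin-schreier m) → j < length (artin-schreier m) → i ≢ j → r i ≢ r j
      distinct {zero} {zero} _ _ ne = contradiction refl ne
      distinct {zero} {suc j} _ j< _ e = none (j , below j< , e)
      distinct {suc i} {zero} i< _ _ e = none (i , below i< , sym e)
      distinct {suc i} {suc j} i< j< ne e = ne (cong suc (×1-injective (below i<) (below j<) e))
      roots : ∀ i → i < length (artin-schreier m) → eval (artin-schreier m) (r i) ≡ 0F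
      roots i _ = trans (eval-artin-schreier m (r i)) (≡⇒-≡0 (trans (cong (r i ^F_) p≡) (fixes i)))

    -- An additive functional with values in the prime field, obtained from the identity by repeatedly
    -- applying X^p - c^(p-1) X, which kills the line spanned by c.
    record Additive : Set where
      field
        act : F → F
        add : ∀ x y → act (x +F y) ≡ act x +F act y

    open Additive

    additive-0 : ∀ ψ → act ψ 0F ≡ 0F
    additive-0 ψ = FP.+-cancelʳ (act ψ 0F) _ _ (trans (sym (add ψ 0F 0F)) (trans (cong (act ψ) (F.+-identityˡ 0F)) (sym (F.+-identityˡ _))))

    shrink : F → Additive → Additive
    shrink c ψ = record
      { act = λ x → act ψ x ^F p +F -F (c ^F (p ℕ.∸ 1) *F act ψ x)
      ; add = λ x y → trans (cong₂ (λ a b → a +F -F b)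
                 (trans (cong (_^F p) (add ψ x y)) (frobF (act ψ x) (act ψ y)))
                 (trans (cong (c ^F (p ℕ.∸ 1) *F_) (add ψ x y)) (F.distribˡ _ _ _)))
               (trans (cong (act ψ x ^F p +F act ψ y ^F p +F_) (sym (FP.-‿+-comm _ _))) (interchange _ _ _ _)) }
      where open FinSum (CommutativeRing.+-isCommutativeMonoid Fring) using (interchange)

    c^p : ∀ c → c ^F (p ℕ.∸ 1) *F c ≡ c ^F p
    c^p c = trans (F.*-comm _ c) (cong (c ^F_) (ℕ.m+[n∸m]≡n {1} (ℕ.<⇒≤ 1<p)))

    -- Such a ψ divided by its value c is fixed by Frobenius, that is, takes values in the prime
    -- field.
    SemiFix : Set
    SemiFix = Σ Additive λ ψ → Σ F λ c → c ≢ 0F × Σ F (λ y → act ψ y ≡ c) × (∀ x → act ψ x ^F p ≡ c ^F (p ℕ.∸ 1) *F act ψ x)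

    -- The list holds the elements not yet known to be killed. If shrinking at c = ψ y gives zero, ψ
    -- is as wanted; if not, the shrunk map is still nonzero and kills y as well. The list cannot
    -- run out, since some element is never killed.
    search : ∀ ys ψ → Σ F (λ x → act ψ x ≢ 0F) → (∀ x → x ∈ ys ⊎ act ψ x ≡ 0F) → SemiFix
    search [] ψ (x , nz) killed with killed x
    ... | inj₂ z = contradiction z nz
    search (y ∷ ys) ψ nz killed with act ψ y ≟F 0F
    ... | yes z = search ys ψ nz killed′
      where
      killed′ : ∀ x → x ∈ ys ⊎ act ψ x ≡ 0F
      killed′ x with killed x
      ... | inj₁ (here refl) = inj₂ z
      ... | inj₁ (there m) = inj₁ m
      ... | inj₂ e = inj₂ e
    ... | no c≢0 with ∑-find (λ x → ¬? (act (shrink (act ψ y) ψ) x ≟F 0F)) Fs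
    ...   | no none = ψ , act ψ y , c≢0 , (y , refl) , λ x → -≡0⇒≡ (decide x)
      where
      decide : ∀ x → act (shrink (act ψ y) ψ) x ≡ 0F
      decide x with act (shrink (act ψ y) ψ) x ≟F 0F
      ... | yes e = e
      ... | no ne = contradiction (x , ∈Fs x , ne) none
    ...   | yes (x , _ , ne) = search ys (shrink (act ψ y) ψ) (x , ne) killed′
      where
      c = act ψ y
      killed′ : ∀ x → x ∈ ys ⊎ act (shrink c ψ) x ≡ 0F
      killed′ x with killed x
      ... | inj₁ (here refl) = inj₂ (≡⇒-≡0 (sym (c^p c)))
      ... | inj₁ (there m) = inj₁ m
      ... | inj₂ e = inj₂ (≡⇒-≡0 (trans (cong (_^F p) e) (trans 0^p (sym (trans (cong (c ^F (p ℕ.∸ 1) *F_) e) (F.zeroʳ _))))))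

    semifix : SemiFix
    semifix = search Fs (record { act = λ x → x ; add = λ _ _ → refl }) (1F , λ e → 0≢1 (sym e)) (λ x → inj₁ (∈Fs x))

    𝔸 : Set
    𝔸 = Σ F Fix

    𝔸-≡ : {a b : 𝔸} → proj₁ a ≡ proj₁ b → a ≡ b
    𝔸-≡ {_ , x} {_ , y} refl = cong (_ ,_) (Decidable⇒UIP.≡-irrelevant _≟F_ x y)

    infixl 6 _+𝔸_
    infix 8 -𝔸_
    _+𝔸_ : 𝔸 → 𝔸 → 𝔸
    (a , x) +𝔸 (b , y) = a +F b , trans (frobF a b) (cong₂ _+F_ x y)

    0𝔸 1𝔸 : 𝔸
    0𝔸 = 0F , 0^p
    1𝔸 = 1F , 1^ p

    -𝔸_ : 𝔸 → 𝔸
    -𝔸 (a , x) = -F a , trans (neg-^p a) (cong -F_ x)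

    𝔸-isAbelianGroup : IsAbelianGroup _≡_ _+𝔸_ 0𝔸 -𝔸_
    𝔸-isAbelianGroup = record
      { isGroup = record
        { isMonoid = record
          { isSemigroup = record
            { isMagma = record { isEquivalence = isEquivalence ; ∙-cong = cong₂ _+𝔸_ }
            ; assoc = λ a b c → 𝔸-≡ (F.+-assoc (proj₁ a) (proj₁ b) (proj₁ c)) }
          ; identity = (λ a → 𝔸-≡ (F.+-identityˡ (proj₁ a))) , (λ a → 𝔸-≡ (F.+-identityʳ (proj₁ a))) }
        ; inverse = (λ a → 𝔸-≡ (F.-‿inverseˡ (proj₁ a))) , (λ a → 𝔸-≡ (F.-‿inverseʳ (proj₁ a)))
        ; ⁻¹-cong = cong -𝔸_ }
      ; comm = λ a b → 𝔸-≡ (F.+-comm (proj₁ a) (proj₁ b)) }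

    χ : F → 𝔸
    χ x = act ψ x *F c⁻ , (begin
        (act ψ x *F c⁻) ^F p                        ≡⟨ F^.^-distrib-* (act ψ x) c⁻ p ⟩
        act ψ x ^F p *F c⁻ ^F p                     ≡⟨ cong (_*F c⁻ ^F p) (sf x) ⟩
        c ^F (p ℕ.∸ 1) *F act ψ x *F c⁻ ^F p        ≡⟨ cong (c ^F (p ℕ.∸ 1) *F act ψ x *F_) (c^p c⁻) ⟨
        c ^F (p ℕ.∸ 1) *F act ψ x *F (c⁻ ^F (p ℕ.∸ 1) *F c⁻) ≡⟨ rearr _ _ _ _ ⟩
        (c ^F (p ℕ.∸ 1) *F c⁻ ^F (p ℕ.∸ 1)) *F (act ψ x *F c⁻) ≡⟨ cong (_*F (act ψ x *F c⁻)) (trans (sym (F^.^-distrib-* c c⁻ (p ℕ.∸ 1))) (trans (cong (_^F (p ℕ.∸ 1)) cc⁻) (1^ (p ℕ.∸ 1)))) ⟩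
        1F *F (act ψ x *F c⁻)                       ≡⟨ F.*-identityˡ _ ⟩
        act ψ x *F c⁻ ∎)
      where
      open Relation.Binary.PropositionalEquality.≡-Reasoning
      ψ = proj₁ semifix
      c = proj₁ (proj₂ semifix)
      sf = proj₂ (proj₂ (proj₂ (proj₂ semifix)))
      c⁻ = proj₁ (inverse c (proj₁ (proj₂ (proj₂ semifix))))
      cc⁻ = proj₂ (inverse c (proj₁ (proj₂ (proj₂ semifix))))
      rearr : ∀ a b d e → a *F b *F (d *F e) ≡ a *F d *F (b *F e)
      rearr = FinSum.interchange F.*-isCommutativeMonoid

    χ-+ : ∀ x y → χ (x +F y) ≡ χ x +𝔸 χ y
    χ-+ x y = 𝔸-≡ (trans (F.*-congʳ (add (proj₁ semifix) x y)) (F.distribʳ _ _ _))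

    χ-0 : χ 0F ≡ 0𝔸
    χ-0 = 𝔸-≡ (trans (F.*-congʳ (additive-0 (proj₁ semifix))) (F.zeroˡ _))

    χ-nontrivial : Σ F λ y → χ y ≢ 0𝔸
    χ-nontrivial = let (_ , c , c≢0 , (y , e) , _) = semifix in
      y , λ z → 0≢1 (trans (sym (cong proj₁ z)) (trans (F.*-congʳ e) (proj₂ (inverse c c≢0))))

    _≟𝔸_ : (a b : 𝔸) → Dec (a ≡ b)
    a ≟𝔸 b = map′ 𝔸-≡ (cong proj₁) (proj₁ a ≟F proj₁ b)

    𝔸-group : AbelianGroup 0ℓ 0ℓ
    𝔸-group = record { isAbelianGroup = 𝔸-isAbelianGroup }

    open Mult (AbelianGroup.commutativeMonoid 𝔸-group) using () renaming (_×_ to infixr 8 _×𝔸_)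
    module A = AbelianGroup 𝔸-group
    open import Algebra.Properties.AbelianGroup 𝔸-group using () renaming (⁻¹-involutive to neg-neg; ε⁻¹≈ε to neg-0; inverseʳ-unique to -𝔸-unique)

    proj-× : ∀ n a → proj₁ (n ×𝔸 a) ≡ n ×F proj₁ a
    proj-× zero a = refl
    proj-× (suc n) a = cong (proj₁ a +F_) (proj-× n a)

    torsion : ∀ a → p ×𝔸 a ≡ 0𝔸
    torsion a = 𝔸-≡ (trans (proj-× p a) (torsionF (proj₁ a)))

    torsion-free : ∀ {n a} → ¬ (p ∣ n) → n ×𝔸 a ≡ 0𝔸 → a ≡ 0𝔸
    torsion-free {n} {a} p∤n e = 𝔸-≡ (*-cancel (trans (sym (trans (proj-× n a) (×F-* n (proj₁ a)))) (cong proj₁ e)) (unit n p∤n))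

    κ : 𝔸 → ℤ
    κ a = + p ℤ.* 𝟙 (a ≟𝔸 0𝔸) ℤ.- 1ℤ

    sumℤ-* : ∀ n c f → sumℤ n (λ i → c ℤ.* f i) ≡ c ℤ.* sumℤ n f
    sumℤ-* zero c f = sym (ℤ.*-zeroʳ c)
    sumℤ-* (suc n) c f = trans (cong (ℤ._+ c ℤ.* f n) (sumℤ-* n c f)) (sym (ℤ.*-distribˡ-+ c _ (f n)))

    sum-indicator : ∀ (a : ℕ → 𝔸) i → i < p → a i ≡ 0𝔸 → (∀ j → j < p → a j ≡ 0𝔸 → j ≡ i) → sumℤ p (λ j → 𝟙 (a j ≟𝔸 0𝔸)) ≡ 1ℤ
    sum-indicator a i i<p z uniq = trans (sumℤ-single p i _ (inj₁ i<p) (λ j j<p j≢i → 𝟙-no (λ e → j≢i (uniq j j<p e)) (a j ≟𝔸 0𝔸))) (𝟙-yes z (a i ≟𝔸 0𝔸))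

    -- The term w + i u is zero for exactly one i < p, namely the one representing - w / u, which
    -- lies in the prime field.
    κ-sum : ∀ {u} → u ≢ 0𝔸 → ∀ w → sumℤ p (λ i → κ (w +𝔸 i ×𝔸 u)) ≡ 0ℤ
    κ-sum {u} u≢0 w = trans (sumℤ-+ p (λ i → + p ℤ.* δ i) (λ _ → ℤ.- 1ℤ))
        (trans (cong₂ ℤ._+_ (trans (sumℤ-* p (+ p) δ) (cong (+ p ℤ.*_) (sum-indicator (λ i → w +𝔸 i ×𝔸 u) i i<p hit uniq))) (sumℤ-const p (ℤ.- 1ℤ)))
          (trans (sym (ℤ.*-distribˡ-+ (+ p) 1ℤ (ℤ.- 1ℤ))) (ℤ.*-zeroʳ (+ p))))
      where
      δ : ℕ → ℤ
      δ i = 𝟙 ((w +𝔸 i ×𝔸 u) ≟𝔸 0𝔸)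
      u≢0F : proj₁ u ≢ 0F
      u≢0F e = u≢0 (𝔸-≡ e)
      u⁻ = proj₁ (inverse (proj₁ u) u≢0F)
      uu⁻ = proj₂ (inverse (proj₁ u) u≢0F)
      fix-u⁻ : Fix u⁻
      fix-u⁻ = -≡0⇒≡ (*-cancel {proj₁ u} (trans (F.distribˡ _ _ _) (trans (cong₂ _+F_
          (trans (cong (_*F u⁻ ^F p) (sym (proj₂ u))) (trans (sym (F^.^-distrib-* (proj₁ u) u⁻ p)) (trans (cong (_^F p) uu⁻) (1^ p))))
          (trans (sym (FP.-‿distribʳ-* _ _)) (cong -F_ uu⁻))) (F.-‿inverseʳ 1F))) u≢0F)
      v : F
      v = proj₁ (-𝔸 w) *F u⁻
      found = fix⇒× v (trans (F^.^-distrib-* _ _ p) (cong₂ _*F_ (proj₂ (-𝔸 w)) fix-u⁻))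
      i = proj₁ found
      i<p = proj₁ (proj₂ found)
      hit : w +𝔸 i ×𝔸 u ≡ 0𝔸
      hit = 𝔸-≡ (trans (cong (proj₁ w +F_) (trans (proj-× i u) (trans (×F-* i (proj₁ u)) (trans (cong (_*F proj₁ u) (sym (proj₂ (proj₂ found))))
        (trans (F.*-assoc _ u⁻ _) (trans (cong (proj₁ (-𝔸 w) *F_) (trans (F.*-comm u⁻ _) uu⁻)) (F.*-identityʳ _))))))) (F.-‿inverseʳ (proj₁ w)))
      uniq : ∀ j → j < p → w +𝔸 j ×𝔸 u ≡ 0𝔸 → j ≡ i
      uniq j j<p e = ×1-injective j<p i<p (-≡0⇒≡ (*-cancel {proj₁ u} (trans (F.*-comm (proj₁ u) _) (trans (F.distribʳ _ _ _)
        (trans (cong₂ _+F_ refl (sym (FP.-‿distribˡ-* _ _))) (≡⇒-≡0 (trans (sym (×F-* j (proj₁ u))) (trans (trans (sym (proj-× j u)) (trans (cong proj₁ same) (proj-× i u))) (×F-* i (proj₁ u)))))))) u≢0F))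
        where
        same : j ×𝔸 u ≡ i ×𝔸 u
        same = trans (-𝔸-unique w _ e) (sym (-𝔸-unique w _ hit))

    pointsTo : ℕ → List 𝔸
    pointsTo zero = []
    pointsTo (suc n) = n ×𝔸 1𝔸 ∷ pointsTo n

    ∑-points : ∀ n f → ∑ (pointsTo n) f ≡ sumℤ n (λ i → f (i ×𝔸 1𝔸))
    ∑-points zero f = refl
    ∑-points (suc n) f = trans (ℤ.+-comm (f (n ×𝔸 1𝔸)) _) (cong (ℤ._+ f (n ×𝔸 1𝔸)) (∑-points n f))

    0∈points : 0𝔸 ∈ pointsTo p
    0∈points = go p (ℕ.<-trans (s≤s z≤n) 1<p)
      where
      go : ∀ n → 0 < n → 0𝔸 ∈ pointsTo n
      go (suc zero) _ = here refl
      go (suc (suc n)) _ = there (go (suc n) (s≤s z≤n))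

    -- After expansion each indicator is 1 at exactly one point, and the product of the two
    -- indicators sums to the indicator of a = b.
    κ-gram : ∀ a b → ∑ (pointsTo p) (λ c → κ (a +𝔸 -𝔸 c) ℤ.* κ (b +𝔸 -𝔸 c)) ≡ + p ℤ.* κ (a +𝔸 -𝔸 b)
    κ-gram a b = begin
      ∑ (pointsTo p) (λ c → κ (a +𝔸 -𝔸 c) ℤ.* κ (b +𝔸 -𝔸 c))
        ≡⟨ ∑-points p _ ⟩
      sumℤ p (λ i → (P ℤ.* δ a i ℤ.- 1ℤ) ℤ.* (P ℤ.* δ b i ℤ.- 1ℤ))
        ≡⟨ sumℤ-cong p (λ i → expand P (δ a i) (δ b i)) ⟩
      sumℤ p (λ i → (P ℤ.* P) ℤ.* (δ a i ℤ.* δ b i) ℤ.+ ((ℤ.- P) ℤ.* δ a i ℤ.+ ((ℤ.- P) ℤ.* δ b i ℤ.+ 1ℤ)))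
        ≡⟨ trans (sumℤ-+ p _ _) (cong₂ ℤ._+_ (sumℤ-* p (P ℤ.* P) _) (trans (sumℤ-+ p _ _) (cong₂ ℤ._+_ (sumℤ-* p (ℤ.- P) (δ a))
             (trans (sumℤ-+ p _ _) (cong₂ ℤ._+_ (sumℤ-* p (ℤ.- P) (δ b)) (sumℤ-const p 1ℤ)))))) ⟩
      (P ℤ.* P) ℤ.* sumℤ p (λ i → δ a i ℤ.* δ b i) ℤ.+ ((ℤ.- P) ℤ.* sumℤ p (δ a) ℤ.+ ((ℤ.- P) ℤ.* sumℤ p (δ b) ℤ.+ P ℤ.* 1ℤ))
        ≡⟨ cong₂ (λ x y → (P ℤ.* P) ℤ.* x ℤ.+ y) both (cong₂ (λ x y → (ℤ.- P) ℤ.* x ℤ.+ ((ℤ.- P) ℤ.* y ℤ.+ P ℤ.* 1ℤ)) (one a) (one b)) ⟩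
      (P ℤ.* P) ℤ.* D ℤ.+ ((ℤ.- P) ℤ.* 1ℤ ℤ.+ ((ℤ.- P) ℤ.* 1ℤ ℤ.+ P ℤ.* 1ℤ))
        ≡⟨ collect P D ⟩
      P ℤ.* κ (a +𝔸 -𝔸 b) ∎
      where
      open Relation.Binary.PropositionalEquality.≡-Reasoning
      P = + p
      D = 𝟙 ((a +𝔸 -𝔸 b) ≟𝔸 0𝔸)
      δ : 𝔸 → ℕ → ℤ
      δ x i = 𝟙 ((x +𝔸 -𝔸 (i ×𝔸 1𝔸)) ≟𝔸 0𝔸)
      expand : ∀ P x y → (P ℤ.* x ℤ.- 1ℤ) ℤ.* (P ℤ.* y ℤ.- 1ℤ) ≡ (P ℤ.* P) ℤ.* (x ℤ.* y) ℤ.+ ((ℤ.- P) ℤ.* x ℤ.+ ((ℤ.- P) ℤ.* y ℤ.+ 1ℤ))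
      expand = solve-∀
      collect : ∀ P D → (P ℤ.* P) ℤ.* D ℤ.+ ((ℤ.- P) ℤ.* 1ℤ ℤ.+ ((ℤ.- P) ℤ.* 1ℤ ℤ.+ P ℤ.* 1ℤ)) ≡ P ℤ.* (P ℤ.* D ℤ.- 1ℤ)
      collect = solve-∀
      index : ∀ x → Σ ℕ λ i → i < p × x ≡ i ×𝔸 1𝔸
      index x = let (i , i<p , e) = fix⇒× (proj₁ x) (proj₂ x) in i , i<p , 𝔸-≡ (trans e (sym (proj-× i 1𝔸)))
      diff-0 : ∀ {x y} → x +𝔸 -𝔸 y ≡ 0𝔸 → x ≡ y
      diff-0 e = 𝔸-≡ (-≡0⇒≡ (cong proj₁ e))
      uniq : ∀ x i → i < p → x ≡ i ×𝔸 1𝔸 → ∀ j → j < p → x +𝔸 -𝔸 (j ×𝔸 1𝔸) ≡ 0𝔸 → j ≡ i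
      uniq x i i<p e j j<p z = ×1-injective j<p i<p (trans (sym (proj-× j 1𝔸)) (trans (cong proj₁ (trans (sym (diff-0 z)) e)) (proj-× i 1𝔸)))
      one : ∀ x → sumℤ p (δ x) ≡ 1ℤ
      one x = let (i , i<p , e) = index x in
        sum-indicator (λ i → x +𝔸 -𝔸 (i ×𝔸 1𝔸)) i i<p (trans (cong (λ z → x +𝔸 -𝔸 z) (sym e)) (A.inverseʳ x)) (uniq x i i<p e)
      both : sumℤ p (λ i → δ a i ℤ.* δ b i) ≡ D
      both = let (i , i<p , e) = index a in
        trans (sumℤ-single p i _ (inj₁ i<p) (λ j j<p j≢i → trans (cong (ℤ._* δ b j) (𝟙-no (λ z → j≢i (uniq a i i<p e j j<p z)) (_ ≟𝔸 0𝔸))) (ℤ.*-zeroˡ (δ b j))))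
          (trans (cong (ℤ._* δ b i) (𝟙-yes (trans (cong (λ z → a +𝔸 -𝔸 z) (sym e)) (A.inverseʳ a)) ((a +𝔸 -𝔸 (i ×𝔸 1𝔸)) ≟𝔸 0𝔸))) (trans (ℤ.*-identityˡ (δ b i))
            (𝟙-cong (λ z → trans (cong (λ w → a +𝔸 -𝔸 w) (trans (diff-0 z) (sym e))) (A.inverseʳ a))
                    (λ z → trans (cong (λ w → b +𝔸 -𝔸 w) (trans (sym e) (diff-0 z))) (A.inverseʳ b)) (_ ≟𝔸 0𝔸) (_ ≟𝔸 0𝔸))))

    abstract
      primeTarget : Target p
      primeTarget = record
        { 𝔸 = 𝔸
        ; _+ᴬ_ = _+𝔸_
        ; 0ᴬ = 0𝔸
        ; -ᴬ_ = -𝔸_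
        ; isAbelianGroup = 𝔸-isAbelianGroup
        ; _≟ᴬ_ = _≟𝔸_
        ; torsion = torsion
        ; torsion-free = λ {n} {a} → torsion-free {n} {a}
        ; κ-sum = κ-sum
        ; points = pointsTo p
        ; κ-gram = κ-gram
        ; 0∈points = 0∈points }

      functional : F → Target.𝔸 primeTarget
      functional = χ

      functional-+ : ∀ x y → functional (x +F y) ≡ Target._+ᴬ_ primeTarget (functional x) (functional y)
      functional-+ = χ-+

      functional-0 : functional 0F ≡ Target.0ᴬ primeTarget
      functional-0 = χ-0

      functional-nontrivial : Σ F λ y → functional y ≢ Target.0ᴬ primeTarget
      functional-nontrivial = χ-nontrivial

-- The ring 𝔽_q[t] with its enumeration by degree, as a `Setting`.

module Polynomials {q : ℕ} (𝔽 : FiniteField q) where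
  open import Data.Nat using (_∸_)
  open import Data.Integer using (+_)
  open import Data.List using (cartesianProductWith)
  open import Data.List.Membership.Propositional.Properties using (∈-cartesianProductWith⁺; ∈-cartesianProductWith⁻)
  import Data.List.Relation.Unary.All as All
  open import Data.List.Relation.Unary.AllPairs using (_∷_)
  open import Data.List.Relation.Unary.Unique.Propositional using (Unique)
  open import Data.List.Relation.Unary.Unique.Propositional.Properties using (allFin⁺; map⁺)

  open FieldFacts 𝔽 public
  open Over 𝔽 public using (PolyFn; _≈ᶠ_; 0ᶠ; 1ᶠ; _+ᶠ_; _-ᶠ_; _*ᶠ_; _^ᶠ_; Poly; coeff; bound; vanish; _≈_; sumTo; IsDeg; NonZero; IsCharacteristic; CongMod; InG; evalU; evalBound)

  module FS = FinSum (CommutativeRing.+-isCommutativeMonoid Fring)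

  sumTo≡sum : ∀ n f → sumTo n f ≡ FS.sum n f
  sumTo≡sum zero f = refl
  sumTo≡sum (suc n) f = cong (_+F f n) (sumTo≡sum n f)

  tl : PolyFn → PolyFn
  tl a i = a (suc i)

  *ᶠ-sum : ∀ a b i → (a *ᶠ b) i ≡ FS.sum (suc i) (λ k → a k *F b (i ∸ k))
  *ᶠ-sum a b i = sumTo≡sum (suc i) _

  *ᶠ-0 : ∀ a b → (a *ᶠ b) 0 ≡ a 0 *F b 0
  *ᶠ-0 a b = F.+-identityˡ _

  -- This recursion and its mirror image `*ᶠ-last` carry the ring laws: induction on the index
  -- replaces the reindexing of double sums.
  *ᶠ-head : ∀ a b i → (a *ᶠ b) (suc i) ≡ a 0 *F b (suc i) +F (tl a *ᶠ b) i
  *ᶠ-head a b i = trans (*ᶠ-sum a b (suc i)) (trans (FS.sum-head (suc i) _) (cong (a 0 *F b (suc i) +F_) (sym (*ᶠ-sum (tl a) b i))))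

  *ᶠ-last : ∀ a b i → (a *ᶠ b) (suc i) ≡ (a *ᶠ tl b) i +F a (suc i) *F b 0
  *ᶠ-last a b i = trans (*ᶠ-sum a b (suc i)) (cong₂ _+F_
    (trans (FS.sum-cong< (suc i) (λ k k<si → cong (λ z → a k *F b z) (ℕ.+-∸-assoc 1 (ℕ.s≤s⁻¹ k<si)))) (sym (*ᶠ-sum a (tl b) i)))
    (cong (λ z → a (suc i) *F b z) (ℕ.n∸n≡0 i)))

  *ᶠ-cong : ∀ {a a′ b b′} → a ≈ᶠ a′ → b ≈ᶠ b′ → (a *ᶠ b) ≈ᶠ (a′ *ᶠ b′)
  *ᶠ-cong {a} {a′} {b} {b′} e f i = trans (*ᶠ-sum a b i) (trans (FS.sum-cong (suc i) (λ k → cong₂ _*F_ (e k) (f (i ∸ k)))) (sym (*ᶠ-sum a′ b′ i)))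

  *ᶠ-comm : ∀ a b → (a *ᶠ b) ≈ᶠ (b *ᶠ a)
  *ᶠ-comm a b zero = trans (*ᶠ-0 a b) (trans (F.*-comm _ _) (sym (*ᶠ-0 b a)))
  *ᶠ-comm a b (suc i) = trans (*ᶠ-head a b i) (trans (F.+-comm _ _) (trans (cong₂ _+F_ (*ᶠ-comm (tl a) b i) (F.*-comm _ _)) (sym (*ᶠ-last b a i))))

  *ᶠ-distribʳ : ∀ c a b → ((a +ᶠ b) *ᶠ c) ≈ᶠ ((a *ᶠ c) +ᶠ (b *ᶠ c))
  *ᶠ-distribʳ c a b i = trans (*ᶠ-sum (a +ᶠ b) c i) (trans (FS.sum-cong (suc i) (λ k → F.distribʳ (c (i ∸ k)) (a k) (b k)))
    (trans (FS.sum-∙ (suc i) _ _) (sym (cong₂ _+F_ (*ᶠ-sum a c i) (*ᶠ-sum b c i)))))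

  *ᶠ-scale : ∀ s a b i → ((λ k → s *F a k) *ᶠ b) i ≡ s *F (a *ᶠ b) i
  *ᶠ-scale s a b zero = trans (*ᶠ-0 (λ k → s *F a k) b) (trans (F.*-assoc s _ _) (cong (s *F_) (sym (*ᶠ-0 a b))))
  *ᶠ-scale s a b (suc i) = trans (*ᶠ-head (λ k → s *F a k) b i) (trans (cong₂ _+F_ (F.*-assoc s _ _) (*ᶠ-scale s (tl a) b i))
    (trans (sym (F.distribˡ s _ _)) (cong (s *F_) (sym (*ᶠ-head a b i)))))

  *ᶠ-assoc : ∀ a b c → ((a *ᶠ b) *ᶠ c) ≈ᶠ (a *ᶠ (b *ᶠ c))
  *ᶠ-assoc a b c zero = trans (*ᶠ-0 (a *ᶠ b) c) (trans (cong (_*F c 0) (*ᶠ-0 a b)) (trans (F.*-assoc _ _ _)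
    (trans (cong (a 0 *F_) (sym (*ᶠ-0 b c))) (sym (*ᶠ-0 a (b *ᶠ c))))))
  *ᶠ-assoc a b c (suc i) = begin
    ((a *ᶠ b) *ᶠ c) (suc i)
      ≡⟨ *ᶠ-head (a *ᶠ b) c i ⟩
    (a *ᶠ b) 0 *F c (suc i) +F (tl (a *ᶠ b) *ᶠ c) i
      ≡⟨ cong₂ _+F_ (trans (cong (_*F c (suc i)) (*ᶠ-0 a b)) (F.*-assoc _ _ _))
           (trans (*ᶠ-cong {tl (a *ᶠ b)} {(λ k → a 0 *F tl b k) +ᶠ (tl a *ᶠ b)} {c} (*ᶠ-head a b) (λ _ → refl) i)
             (trans (*ᶠ-distribʳ c (λ k → a 0 *F tl b k) (tl a *ᶠ b) i) (cong₂ _+F_ (*ᶠ-scale (a 0) (tl b) c i) (*ᶠ-assoc (tl a) b c i)))) ⟩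
    a 0 *F (b 0 *F c (suc i)) +F (a 0 *F (tl b *ᶠ c) i +F (tl a *ᶠ (b *ᶠ c)) i)
      ≡⟨ F.+-assoc _ _ _ ⟨
    (a 0 *F (b 0 *F c (suc i)) +F a 0 *F (tl b *ᶠ c) i) +F (tl a *ᶠ (b *ᶠ c)) i
      ≡⟨ cong (_+F (tl a *ᶠ (b *ᶠ c)) i) (trans (sym (F.distribˡ (a 0) _ _)) (cong (a 0 *F_) (sym (*ᶠ-head b c i)))) ⟩
    a 0 *F (b *ᶠ c) (suc i) +F (tl a *ᶠ (b *ᶠ c)) i
      ≡⟨ *ᶠ-head a (b *ᶠ c) i ⟨
    (a *ᶠ (b *ᶠ c)) (suc i) ∎
    where open Relation.Binary.PropositionalEquality.≡-Reasoning

  0ᶠ-*ᶠ : ∀ a → (0ᶠ *ᶠ a) ≈ᶠ 0ᶠ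
  0ᶠ-*ᶠ a i = trans (*ᶠ-sum 0ᶠ a i) (FS.sum-ε (suc i) (λ k _ → F.zeroˡ _))

  1ᶠ-*ᶠ : ∀ a → (1ᶠ *ᶠ a) ≈ᶠ a
  1ᶠ-*ᶠ a zero = trans (*ᶠ-0 1ᶠ a) (F.*-identityˡ _)
  1ᶠ-*ᶠ a (suc i) = trans (*ᶠ-head 1ᶠ a i) (trans (cong₂ _+F_ (F.*-identityˡ _) (0ᶠ-*ᶠ a i)) (F.+-identityʳ _))

  Vanishes : PolyFn → ℕ → Set
  Vanishes a n = ∀ i → n ≤ i → a i ≡ 0F

  *ᶠ-vanish : ∀ {a b m n} → Vanishes a m → Vanishes b n → Vanishes (a *ᶠ b) (m ℕ.+ n)
  *ᶠ-vanish {a} {b} {m} {n} va vb i le = trans (*ᶠ-sum a b i) (FS.sum-ε (suc i) term)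
    where
    term : ∀ k → k < suc i → a k *F b (i ∸ k) ≡ 0F
    term k _ with m ℕ.≤? k
    ... | yes m≤k = trans (cong (_*F b (i ∸ k)) (va k m≤k)) (F.zeroˡ _)
    ... | no m≰k = trans (cong (a k *F_) (vb (i ∸ k) (ℕ.≤-trans (ℕ.≤-reflexive (sym (ℕ.m+n∸m≡n m n)))
            (ℕ.≤-trans (ℕ.∸-monoˡ-≤ m le) (ℕ.∸-monoʳ-≤ i (ℕ.<⇒≤ (ℕ.≰⇒> m≰k))))))) (F.zeroʳ _)

  infixl 6 _+P_
  infixl 7 _*P_
  _+P_ _*P_ : Poly → Poly → Poly
  a +P b = record { coeff = coeff a +ᶠ coeff b ; bound = bound a ℕ.⊔ bound b
    ; vanish = λ i le → trans (cong₂ _+F_ (vanish a i (ℕ.≤-trans (ℕ.m≤m⊔n _ _) le)) (vanish b i (ℕ.≤-trans (ℕ.m≤n⊔m (bound a) _) le))) (F.+-identityˡ 0F) }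
  a *P b = record { coeff = coeff a *ᶠ coeff b ; bound = bound a ℕ.+ bound b
    ; vanish = *ᶠ-vanish (vanish a) (vanish b) }

  -P_ : Poly → Poly
  -P a = record { coeff = λ i → -F coeff a i ; bound = bound a ; vanish = λ i le → trans (cong -F_ (vanish a i le)) FP.-0#≈0# }

  monomial : F → ℕ → Poly
  monomial c n = record { coeff = mono n ; bound = suc n ; vanish = zeros n }
    where
    mono : ℕ → PolyFn
    mono zero zero = c
    mono zero (suc i) = 0F
    mono (suc n) zero = 0F
    mono (suc n) (suc i) = mono n i
    zeros : ∀ n i → suc n ≤ i → mono n i ≡ 0F
    zeros zero (suc i) _ = refl
    zeros (suc n) (suc i) (s≤s le) = zeros n i le

  monomial-≡ : ∀ c n → coeff (monomial c n) n ≡ c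
  monomial-≡ c zero = refl
  monomial-≡ c (suc n) = monomial-≡ c n

  monomial-≢ : ∀ c n i → i ≢ n → coeff (monomial c n) i ≡ 0F
  monomial-≢ c zero zero ne = contradiction refl ne
  monomial-≢ c zero (suc i) ne = refl
  monomial-≢ c (suc n) zero ne = refl
  monomial-≢ c (suc n) (suc i) ne = monomial-≢ c n i (λ e → ne (cong suc e))

  0P 1P tP : Poly
  0P = record { coeff = 0ᶠ ; bound = 0 ; vanish = λ _ _ → refl }
  1P = record { coeff = 1ᶠ ; bound = 1 ; vanish = λ { (suc i) _ → refl } }
  tP = monomial 1F 1

  polyRing : CommutativeRing 0ℓ 0ℓ
  polyRing = record
    { Carrier = Poly ; _≈_ = _≈_ ; _+_ = _+P_ ; _*_ = _*P_ ; -_ = -P_ ; 0# = 0P ; 1# = 1P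
    ; isCommutativeRing = record
      { isRing = record
        { +-isAbelianGroup = record
          { isGroup = record
            { isMonoid = record
              { isSemigroup = record
                { isMagma = record
                  { isEquivalence = record { refl = λ _ → refl ; sym = λ e i → sym (e i) ; trans = λ e f i → trans (e i) (f i) }
                  ; ∙-cong = λ e f i → cong₂ _+F_ (e i) (f i) }
                ; assoc = λ a b c i → F.+-assoc _ _ _ }
              ; identity = (λ a i → F.+-identityˡ _) , (λ a i → F.+-identityʳ _) }
            ; inverse = (λ a i → F.-‿inverseˡ _) , (λ a i → F.-‿inverseʳ _)
            ; ⁻¹-cong = λ e i → cong -F_ (e i) }
          ; comm = λ a b i → F.+-comm _ _ }
        ; *-cong = λ {a} {b} {c} {d} e f → *ᶠ-cong {coeff a} {coeff b} {coeff c} {coeff d} e f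
        ; *-assoc = λ a b c → *ᶠ-assoc (coeff a) (coeff b) (coeff c)
        ; *-identity = (λ a → 1ᶠ-*ᶠ (coeff a)) , (λ a i → trans (*ᶠ-comm (coeff a) 1ᶠ i) (1ᶠ-*ᶠ (coeff a) i))
        ; distrib = (λ a b c i → trans (*ᶠ-comm (coeff a) (coeff b +ᶠ coeff c) i) (trans (*ᶠ-distribʳ (coeff a) (coeff b) (coeff c) i)
                       (cong₂ _+F_ (*ᶠ-comm (coeff b) (coeff a) i) (*ᶠ-comm (coeff c) (coeff a) i))))
                  , (λ a b c → *ᶠ-distribʳ (coeff a) (coeff b) (coeff c)) }
      ; *-comm = λ a b → *ᶠ-comm (coeff a) (coeff b) } }

  module P = CommutativeRing polyRing
  open Exp P.commutativeSemiring using () renaming (_^_ to infixr 8 _^P_) public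

  zero? : ∀ a → Dec (a ≈ 0P)
  zero? a = map′ (λ h i → decide (λ i → h {i}) i (i ℕ.<? bound a)) (λ e {i} _ → e i) (ℕ.allUpTo? (λ i → coeff a i ≟F 0F) (bound a))
    where
    decide : (∀ i → i < bound a → coeff a i ≡ 0F) → ∀ i → Dec (i < bound a) → coeff a i ≡ 0F
    decide h i (yes l) = h i l
    decide h i (no nl) = vanish a i (ℕ.≮⇒≥ nl)

  GP : ℕ → Poly → Set
  GP n a = Vanishes (coeff a) n

  degree : ∀ a n → ¬ a ≈ 0P → GP n a → Σ ℕ λ k → k < n × IsDeg a k
  degree a zero a≄0 g = contradiction (λ i → g i z≤n) a≄0
  degree a (suc n) a≄0 g with coeff a n ≟F 0F
  ... | no ne = n , ℕ.n<1+n n , ne , g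
  ... | yes e = let (k , k<n , d) = degree a n a≄0 lower in k , ℕ.m<n⇒m<1+n k<n , d
    where
    lower : GP n a
    lower i n≤i with n ℕ.≟ i
    ... | yes refl = e
    ... | no ne = g i (ℕ.≤∧≢⇒< n≤i ne)

  *P-lead : ∀ a b k l → IsDeg a k → IsDeg b l → coeff (a *P b) (k ℕ.+ l) ≡ coeff a k *F coeff b l
  *P-lead a b k l (_ , va) (_ , vb) = trans (*ᶠ-sum (coeff a) (coeff b) (k ℕ.+ l))
      (trans (FS.sum-single (suc (k ℕ.+ l)) k _ (inj₁ (s≤s (ℕ.m≤m+n k l))) off) (cong (λ z → coeff a k *F coeff b z) (ℕ.m+n∸m≡n k l)))
    where
    off : ∀ i → i < suc (k ℕ.+ l) → i ≢ k → coeff a i *F coeff b (k ℕ.+ l ∸ i) ≡ 0F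
    off i i< i≢k with k ℕ.<? i
    ... | yes k<i = trans (cong (_*F coeff b (k ℕ.+ l ∸ i)) (va i k<i)) (F.zeroˡ _)
    ... | no k≮i = trans (cong (coeff a i *F_) (vb _ (ℕ.≤-trans (ℕ.≤-reflexive (cong suc (sym (ℕ.m+n∸m≡n k l))))
            (ℕ.∸-monoʳ-< (ℕ.≤∧≢⇒< (ℕ.≮⇒≥ k≮i) i≢k) (ℕ.m≤m+n k l))))) (F.zeroʳ _)

  domainP : ∀ {a b} → ¬ a ≈ 0P → ¬ b ≈ 0P → ¬ (a *P b) ≈ 0P
  domainP {a} {b} a≄0 b≄0 e =
    let (k , _ , da) = degree a (bound a) a≄0 (vanish a)
        (l , _ , db) = degree b (bound b) b≄0 (vanish b)
    in *-nonzero (proj₁ da) (proj₁ db) (trans (sym (*P-lead a b k l da db)) (e (k ℕ.+ l)))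

  GP-cancel : ∀ {n} a b → ¬ b ≈ 0P → GP n (a *P b) → GP n a
  GP-cancel {n} a b b≄0 g with zero? a
  ... | yes z = λ i _ → z i
  ... | no a≄0 =
    let (k , _ , da) = degree a (bound a) a≄0 (vanish a)
        (l , _ , db) = degree b (bound b) b≄0 (vanish b)
        kl<n : k ℕ.+ l < n
        kl<n = ℕ.≰⇒> (λ le → *-nonzero (proj₁ da) (proj₁ db) (trans (sym (*P-lead a b k l da db)) (g (k ℕ.+ l) le)))
    in λ i n≤i → proj₂ da i (ℕ.<-≤-trans (ℕ.≤-<-trans (ℕ.m≤m+n k l) kl<n) n≤i)

  tP-0 : ∀ a → coeff (tP *P a) 0 ≡ 0F
  tP-0 a = trans (*ᶠ-0 (coeff tP) (coeff a)) (F.zeroˡ _)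

  tP-suc : ∀ a i → coeff (tP *P a) (suc i) ≡ coeff a i
  tP-suc a i = trans (*ᶠ-head (coeff tP) (coeff a) i) (trans (cong₂ _+F_ (F.zeroˡ _)
    (trans (*ᶠ-cong {b = coeff a} {b′ = coeff a} tl-t (λ _ → refl) i) (1ᶠ-*ᶠ (coeff a) i))) (F.+-identityˡ _))
    where
    tl-t : tl (coeff tP) ≈ᶠ 1ᶠ
    tl-t zero = refl
    tl-t (suc i) = refl

  tP^ : ∀ a i → coeff (tP ^P a) i ≡ coeff (monomial 1F a) i
  tP^ zero zero = refl
  tP^ zero (suc i) = refl
  tP^ (suc a) zero = tP-0 (tP ^P a)
  tP^ (suc a) (suc i) = trans (tP-suc (tP ^P a) i) (tP^ a i)

  Fs-unique : Unique Fs
  Fs-unique = map⁺ (λ {i} {j} e → trans (sym (strictlyInverseˡ i)) (trans (cong to e) (strictlyInverseˡ j))) (allFin⁺ q)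

  ∑-δ : ∀ {l : List F} c (h : F → ℤ) → Unique l → c ∈ l → ∑ l (λ y → 𝟙 (y ≟F c) ℤ.* h y) ≡ h c
  ∑-δ {x ∷ l} .x h (fresh ∷ u) (here refl) = trans (cong₂ ℤ._+_
      (trans (cong (ℤ._* h x) (𝟙-yes refl (x ≟F x))) (ℤ.*-identityˡ (h x)))
      (ℤ.≤-antisym (ℤ.≤-trans (∑-mono∈ l (λ y m → ℤ.≤-reflexive (z y m))) (ℤ.≤-reflexive (∑-0 l)))
                   (ℤ.≤-trans (ℤ.≤-reflexive (sym (∑-0 l))) (∑-mono∈ l (λ y m → ℤ.≤-reflexive (sym (z y m)))))))
      (ℤ.+-identityʳ (h x))
    where
    z : ∀ y → y ∈ l → 𝟙 (y ≟F x) ℤ.* h y ≡ 0ℤ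
    z y m = trans (cong (ℤ._* h y) (𝟙-no (λ e → All.lookup fresh m (sym e)) (y ≟F x))) (ℤ.*-zeroˡ (h y))
  ∑-δ {x ∷ l} c h (fresh ∷ u) (there m) = trans (cong₂ ℤ._+_
      (trans (cong (ℤ._* h x) (𝟙-no (λ e → All.lookup fresh m e) (x ≟F c))) (ℤ.*-zeroˡ (h x))) (∑-δ c h u m)) (ℤ.+-identityˡ (h c))

  Fs-δ : ∀ c h → ∑ Fs (λ y → 𝟙 (y ≟F c) ℤ.* h y) ≡ h c
  Fs-δ c h = ∑-δ c h Fs-unique (∈Fs c)

  -- Double counting with the indicator of y = a + b takes the place of a permutation of the list.
  Fs-shift : ∀ b h → ∑ Fs (λ a → h (a +F b)) ≡ ∑ Fs h
  Fs-shift b h = begin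
    ∑ Fs (λ a → h (a +F b))
      ≡⟨ ∑-cong Fs (λ a → Fs-δ (a +F b) h) ⟨
    ∑ Fs (λ a → ∑ Fs (λ y → 𝟙 (y ≟F a +F b) ℤ.* h y))
      ≡⟨ ∑-swap Fs Fs _ ⟩
    ∑ Fs (λ y → ∑ Fs (λ a → 𝟙 (y ≟F a +F b) ℤ.* h y))
      ≡⟨ ∑-cong Fs (λ y → ∑-cong Fs (λ a → cong (ℤ._* h y) (𝟙-cong (solve y a) (λ e → unsolve y a e) (y ≟F a +F b) (a ≟F y +F -F b)))) ⟩
    ∑ Fs (λ y → ∑ Fs (λ a → 𝟙 (a ≟F y +F -F b) ℤ.* h y))
      ≡⟨ ∑-cong Fs (λ y → Fs-δ (y +F -F b) (λ _ → h y)) ⟩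
    ∑ Fs h ∎
    where
    open Relation.Binary.PropositionalEquality.≡-Reasoning
    solve : ∀ y a → y ≡ a +F b → a ≡ y +F -F b
    solve y a e = sym (trans (cong (_+F -F b) e) (trans (F.+-assoc a b (-F b)) (trans (cong (a +F_) (F.-‿inverseʳ b)) (F.+-identityʳ a))))
    unsolve : ∀ y a → a ≡ y +F -F b → y ≡ a +F b
    unsolve y a e = sym (trans (cong (_+F b) e) (trans (F.+-assoc y (-F b) b) (trans (cong (y +F_) (F.-‿inverseˡ b)) (F.+-identityʳ y))))

  -- With the top coefficient as the outer variable, a translation splits into one of 𝔽_q and one in
  -- lower degree.
  GsP : ℕ → List Poly
  GsP zero = 0P ∷ []
  GsP (suc n) = cartesianProductWith (λ a x → x +P monomial a n) Fs (GsP n)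

  GsP-length : ∀ n → length (GsP n) ≡ q ℕ.^ n
  GsP-length zero = refl
  GsP-length (suc n) = ℤ.+-injective (begin
    + length (GsP (suc n))                     ≡⟨ ones (GsP (suc n)) ⟨
    ∑ (GsP (suc n)) (λ _ → 1ℤ)                 ≡⟨ ∑-cart (λ a x → x +P monomial a n) Fs (GsP n) (λ _ → 1ℤ) ⟩
    ∑ Fs (λ _ → ∑ (GsP n) (λ _ → 1ℤ))          ≡⟨ ∑-const Fs _ ⟩
    + length Fs ℤ.* ∑ (GsP n) (λ _ → 1ℤ)       ≡⟨ cong₂ ℤ._*_ (cong +_ length-Fs) (trans (ones (GsP n)) (cong +_ (GsP-length n))) ⟩
    + q ℤ.* + (q ℕ.^ n)                        ≡⟨ ℤ.pos-* q (q ℕ.^ n) ⟨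
    + (q ℕ.^ suc n) ∎)
    where
    open Relation.Binary.PropositionalEquality.≡-Reasoning
    ones : ∀ (l : List Poly) → ∑ l (λ _ → 1ℤ) ≡ + length l
    ones l = trans (∑-const l 1ℤ) (ℤ.*-identityʳ _)

  GP-mono : ∀ {m n a} → m ≤ n → GP m a → GP n a
  GP-mono m≤n g i n≤i = g i (ℕ.≤-trans m≤n n≤i)

  GP-+ : ∀ {n a b} → GP n a → GP n b → GP n (a +P b)
  GP-+ g h i le = trans (cong₂ _+F_ (g i le) (h i le)) (F.+-identityˡ 0F)

  GP-monomial : ∀ c n → GP (suc n) (monomial c n)
  GP-monomial c n = vanish (monomial c n)

  GsP-G : ∀ n x → x ∈ GsP n → GP n x
  GsP-G zero x (here refl) = λ _ _ → refl
  GsP-G (suc n) x m with ∈-cartesianProductWith⁻ (λ a x → x +P monomial a n) Fs (GsP n) m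
  ... | a , y , _ , y∈ , refl = GP-+ {suc n} {y} {monomial a n} (GP-mono {a = y} (ℕ.n≤1+n n) (GsP-G n y y∈)) (GP-monomial a n)

  chop : ℕ → Poly → Poly
  chop n x = x +P (-P monomial (coeff x n) n)

  chop-G : ∀ n x → GP (suc n) x → GP n (chop n x)
  chop-G n x g i n≤i with i ℕ.≟ n
  ... | yes refl = ≡⇒-≡0 (sym (monomial-≡ (coeff x n) n))
  ... | no ne = trans (cong₂ _+F_ (g i (ℕ.≤∧≢⇒< n≤i (λ e → ne (sym e)))) (trans (cong -F_ (monomial-≢ (coeff x n) n i ne)) FP.-0#≈0#)) (F.+-identityˡ 0F)

  chop-≈ : ∀ n x → x ≈ (chop n x +P monomial (coeff x n) n)
  chop-≈ n x i = sym (trans (F.+-assoc _ _ _) (trans (cong (coeff x i +F_) (F.-‿inverseˡ _)) (F.+-identityʳ _)))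

  GsP-complete : ∀ n x → GP n x → Σ Poly λ y → y ∈ GsP n × x ≈ y
  GsP-complete zero x g = 0P , here refl , λ i → g i z≤n
  GsP-complete (suc n) x g =
    let (y , y∈ , e) = GsP-complete n (chop n x) (chop-G n x g)
    in y +P monomial (coeff x n) n , ∈-cartesianProductWith⁺ (λ a x → x +P monomial a n) (∈Fs (coeff x n)) y∈
       , λ i → trans (chop-≈ n x i) (cong (_+F coeff (monomial (coeff x n) n) i) (e i))

  monomial-+ : ∀ a b n i → coeff (monomial (a +F b) n) i ≡ coeff (monomial a n) i +F coeff (monomial b n) i
  monomial-+ a b n i with i ℕ.≟ n
  ... | yes refl = trans (monomial-≡ (a +F b) n) (sym (cong₂ _+F_ (monomial-≡ a n) (monomial-≡ b n)))
  ... | no ne = trans (monomial-≢ (a +F b) n i ne) (sym (trans (cong₂ _+F_ (monomial-≢ a n i ne) (monomial-≢ b n i ne)) (F.+-identityˡ 0F)))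

  GsP-shift : ∀ n z → GP n z → (f : Poly → ℤ) → (∀ {x y} → x ≈ y → f x ≡ f y) → ∑ (GsP n) (λ x → f (x +P z)) ≡ ∑ (GsP n) f
  GsP-shift zero z g f r = cong (ℤ._+ 0ℤ) (r (λ i → trans (F.+-identityˡ _) (g i z≤n)))
  GsP-shift (suc n) z g f r = begin
    ∑ (GsP (suc n)) (λ x → f (x +P z))
      ≡⟨ ∑-cart (λ a x → x +P monomial a n) Fs (GsP n) _ ⟩
    ∑ Fs (λ a → ∑ (GsP n) (λ x → f ((x +P monomial a n) +P z)))
      ≡⟨ ∑-cong Fs (λ a → ∑-cong (GsP n) (λ x → r (regroup a x))) ⟩
    ∑ Fs (λ a → ∑ (GsP n) (λ x → f ((x +P chop n z) +P monomial (a +F coeff z n) n)))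
      ≡⟨ ∑-cong Fs (λ a → GsP-shift n (chop n z) (chop-G n z g) (λ x → f (x +P monomial (a +F coeff z n) n)) (λ e → r (λ i → cong (_+F _) (e i)))) ⟩
    ∑ Fs (λ a → ∑ (GsP n) (λ x → f (x +P monomial (a +F coeff z n) n)))
      ≡⟨ Fs-shift (coeff z n) (λ a → ∑ (GsP n) (λ x → f (x +P monomial a n))) ⟩
    ∑ Fs (λ a → ∑ (GsP n) (λ x → f (x +P monomial a n)))
      ≡⟨ ∑-cart (λ a x → x +P monomial a n) Fs (GsP n) f ⟨
    ∑ (GsP (suc n)) f ∎
    where
    open Relation.Binary.PropositionalEquality.≡-Reasoning
    regroup : ∀ a x → ((x +P monomial a n) +P z) ≈ ((x +P chop n z) +P monomial (a +F coeff z n) n)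
    regroup a x i = trans (cong (coeff x i +F coeff (monomial a n) i +F_) (chop-≈ n z i))
      (trans (FS.interchange _ _ _ _) (cong (coeff x i +F coeff (chop n z) i +F_) (sym (monomial-+ a (coeff z n) n i))))

  GsP-zero : ∀ n → ∑ (GsP n) (λ x → 𝟙 (zero? x)) ≡ 1ℤ
  GsP-zero zero = cong (ℤ._+ 0ℤ) (𝟙-yes (λ _ → refl) (zero? 0P))
  GsP-zero (suc n) = begin
    ∑ (GsP (suc n)) (λ x → 𝟙 (zero? x))
      ≡⟨ ∑-cart (λ a x → x +P monomial a n) Fs (GsP n) _ ⟩
    ∑ Fs (λ a → ∑ (GsP n) (λ x → 𝟙 (zero? (x +P monomial a n))))
      ≡⟨ ∑-cong Fs inner ⟩
    ∑ Fs (λ a → 𝟙 (a ≟F 0F) ℤ.* 1ℤ)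
      ≡⟨ Fs-δ 0F (λ _ → 1ℤ) ⟩
    1ℤ ∎
    where
    open Relation.Binary.PropositionalEquality.≡-Reasoning
    inner : ∀ a → ∑ (GsP n) (λ x → 𝟙 (zero? (x +P monomial a n))) ≡ 𝟙 (a ≟F 0F) ℤ.* 1ℤ
    inner a with a ≟F 0F
    ... | yes refl = trans (∑-cong (GsP n) (λ x → 𝟙-cong (λ e i → trans (sym (trans (cong (coeff x i +F_) (mono0 i)) (F.+-identityʳ _))) (e i))
                        (λ e i → trans (cong₂ _+F_ (e i) (mono0 i)) (F.+-identityˡ 0F)) (zero? (x +P monomial 0F n)) (zero? x))) (GsP-zero n)
      where
      mono0 : ∀ i → coeff (monomial 0F n) i ≡ 0F
      mono0 i with i ℕ.≟ n
      ... | yes refl = monomial-≡ 0F n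
      ... | no ne = monomial-≢ 0F n i ne
    ... | no a≢0 = trans (ℤ.≤-antisym (∑-mono∈ (GsP n) (λ x m → ℤ.≤-reflexive (none x m))) (∑-mono∈ (GsP n) (λ x m → ℤ.≤-reflexive (sym (none x m))))) (∑-0 (GsP n))
      where
      none : ∀ x → x ∈ GsP n → 𝟙 (zero? (x +P monomial a n)) ≡ 0ℤ
      none x m = 𝟙-no (λ e → a≢0 (trans (sym (monomial-≡ a n)) (trans (sym (F.+-identityˡ _)) (trans (cong (_+F _) (sym (GsP-G n x m n ℕ.≤-refl))) (e n))))) (zero? (x +P monomial a n))

  polySetting : ∀ p → IsCharacteristic p → Setting q p
  polySetting p ic = record
    { p-prime = proj₁ ic
    ; p≤q = C.p≤q
    ; R = polyRing
    ; t = tP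
    ; _≃0? = zero?
    ; domain = λ {a} {b} → domainP {a} {b}
    ; 𝟏≄𝟎 = λ e → 0≢1 (sym (e 0))
    ; t-powers = λ {a} {b} ne e → 0≢1 (trans (sym (e a)) (trans (cong₂ (λ x y → x +F -F y) (trans (tP^ a a) (monomial-≡ 1F a)) (trans (tP^ b a) (monomial-≢ 1F b a ne)))
                   (trans (cong (1F +F_) FP.-0#≈0#) (F.+-identityʳ 1F))))
    ; G = GP
    ; G-cong = λ e g i le → trans (sym (e i)) (g i le)
    ; G-mono = λ {m} {n} {x} → GP-mono {m} {n} {x}
    ; G-⊕ = λ {n} {x} {y} → GP-+ {n} {x} {y}
    ; G-⊖ = λ g i le → trans (cong -F_ (g i le)) FP.-0#≈0#
    ; G-⊗ = *ᶠ-vanish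
    ; G-𝟏 = vanish 1P
    ; G-t = λ { {n} {x} g (suc i) (s≤s le) → trans (tP-suc x i) (g i le) }
    ; Gs = GsP
    ; Gs-length = GsP-length
    ; Gs-G = GsP-G
    ; Gs-complete = GsP-complete
    ; Gs-shift = GsP-shift
    ; Gs-zero = GsP-zero
    ; target = C.primeTarget }
    where module C = Char p ic

-- Elimination without fractions over a domain.

module SpanningColumns (R : CommutativeRing 0ℓ 0ℓ) where
  open import Data.Fin using (zero; suc)

  open CommutativeRing R hiding (zero) renaming (refl to ≈-refl; sym to ≈-sym; trans to ≈-trans)
  open RingP ring using (-‿distribʳ-*; -‿distribˡ-*; -0#≈0#)

  ∑ᶠ : ∀ {L} → (Fin L → Carrier) → Carrier
  ∑ᶠ {zero} f = 0#
  ∑ᶠ {suc L} f = f zero + ∑ᶠ (λ j → f (suc j))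

  ∑ᶠ-cong : ∀ {L} {f g : Fin L → Carrier} → (∀ j → f j ≈ g j) → ∑ᶠ f ≈ ∑ᶠ g
  ∑ᶠ-cong {zero} e = ≈-refl
  ∑ᶠ-cong {suc L} e = +-cong (e zero) (∑ᶠ-cong (λ j → e (suc j)))

  ∑ᶠ-0 : ∀ {L} {f : Fin L → Carrier} → (∀ j → f j ≈ 0#) → ∑ᶠ f ≈ 0#
  ∑ᶠ-0 {zero} e = ≈-refl
  ∑ᶠ-0 {suc L} e = ≈-trans (+-cong (e zero) (∑ᶠ-0 (λ j → e (suc j)))) (+-identityˡ 0#)

  Vector : ℕ → Set
  Vector L = Fin L → Carrier

  unit : ∀ {L} → Carrier → Fin L → Vector L
  unit E i j with i Fin.≟ j
  ... | yes _ = E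
  ... | no _ = 0#

  unit-same : ∀ {L} E (i : Fin L) → unit E i i ≈ E
  unit-same E i with i Fin.≟ i
  ... | yes _ = ≈-refl
  ... | no n = contradiction refl n

  unit-diff : ∀ {L} E {i j : Fin L} → i ≢ j → unit E i j ≈ 0#
  unit-diff E {i} {j} ne with i Fin.≟ j
  ... | yes e = contradiction e ne
  ... | no _ = ≈-refl

  unit-suc : ∀ {L} E (i j : Fin L) → unit E (suc i) (suc j) ≈ unit E i j
  unit-suc E i j = go (i Fin.≟ j)
    where
    go : Dec (i ≡ j) → unit E (suc i) (suc j) ≈ unit E i j
    go (yes refl) = ≈-trans (unit-same E (suc i)) (≈-sym (unit-same E i))
    go (no ne) = ≈-trans (unit-diff E (λ e → ne (Fin.suc-injective e))) (≈-sym (unit-diff E ne))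

  ∑ᶠ-unit : ∀ {L} E (e : Vector L) j → ∑ᶠ (λ i → e i * unit E i j) ≈ e j * E
  ∑ᶠ-unit {suc L} E e zero = ≈-trans (+-cong (*-congˡ (unit-same {suc L} E zero)) (∑ᶠ-0 {L} {λ i → e (suc i) * unit E (suc i) zero} (λ i → ≈-trans (*-congˡ (unit-diff E {suc i} {zero} (λ ()))) (zeroʳ _)))) (+-identityʳ _)
  ∑ᶠ-unit {suc L} E e (suc j) = ≈-trans (+-cong (≈-trans (*-congˡ (unit-diff E {zero} {suc j} (λ ()))) (zeroʳ _))
      (≈-trans (∑ᶠ-cong {L} {λ i → e (suc i) * unit E (suc i) (suc j)} {λ i → e (suc i) * unit E i j} (λ i → *-congˡ (unit-suc E i j))) (∑ᶠ-unit E (λ i → e (suc i)) j))) (+-identityˡ _)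

  -- Inductive, so that the cost in degree of forming a combination can be read off its derivation,
  -- as `span-kill` does.
  data Span {L} (cols : ℕ → Vector L) (B : ℕ) : Vector L → Set where
    column : ∀ r → r < B → Span cols B (cols r)
    null : Span cols B (λ _ → 0#)
    plus : ∀ {v w} → Span cols B v → Span cols B w → Span cols B (λ j → v j + w j)
    times : ∀ a {v} → Span cols B v → Span cols B (λ j → a * v j)
    respects : ∀ {v w} → (∀ j → v j ≈ w j) → Span cols B v → Span cols B w

  span-sum : ∀ {L M} {cols : ℕ → Vector L} {B} (v : Fin M → Vector L) → (∀ i → Span cols B (v i)) → Span cols B (λ j → ∑ᶠ (λ i → v i j))
  span-sum {M = zero} v s = null
  span-sum {M = suc M} v s = plus (s zero) (span-sum (λ i → v (suc i)) (λ i → s (suc i)))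

  lift : ∀ {L} {cols : ℕ → Vector (suc L)} {B u} → Span (λ r j → cols r (suc j)) B u →
         Σ (Vector (suc L)) λ w → Span cols B w × (∀ j → w (suc j) ≈ u j)
  lift {cols = cols} (column r r<B) = cols r , column r r<B , λ _ → ≈-refl
  lift null = (λ _ → 0#) , null , λ _ → ≈-refl
  lift (plus s t) = let (v , sv , ev) = lift s ; (w , sw , ew) = lift t in
    (λ j → v j + w j) , plus sv sw , λ j → +-cong (ev j) (ew j)
  lift (times a s) = let (v , sv , ev) = lift s in (λ j → a * v j) , times a sv , λ j → *-congˡ (ev j)
  lift (respects e s) = let (v , sv , ev) = lift s in v , sv , λ j → ≈-trans (ev j) (e j)

  Dependent : ∀ {L} → (ℕ → Vector L) → ℕ → Set
  Dependent {L} cols B = Σ (Vector L) λ a → (Σ (Fin L) λ j → ¬ a j ≈ 0#) × (∀ r → r < B → ∑ᶠ (λ j → a j * cols r j) ≈ 0#)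

  module _ (zero? : ∀ x → Dec (x ≈ 0#)) (1≉0 : ¬ 1# ≈ 0#) (domain : ∀ {x y} → ¬ x ≈ 0# → ¬ y ≈ 0# → ¬ x * y ≈ 0#) where

    -- Row 0 is treated last. Let w i be combinations of columns whose tails are E times the unit
    -- vectors; then E times a column, less its tail entries times the w i, vanishes outside row 0.
    -- If its entry z in row 0 is zero for every column, this is a relation between the rows. If
    -- not, z is a new pivot, and E * z takes the place of E.
    dependent-or-spanning : ∀ {L} (cols : ℕ → Vector L) B →
      Dependent cols B ⊎ Σ Carrier λ E → (¬ E ≈ 0#) × (∀ i → Span cols B (unit E i))
    dependent-or-spanning {zero} cols B = inj₂ (1# , 1≉0 , λ ())
    dependent-or-spanning {suc L} cols B with dependent-or-spanning (λ r j → cols r (suc j)) B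
    ... | inj₁ (a , (j , aj≉0) , rel) = inj₁ ((λ { zero → 0# ; (suc j) → a j }) , (suc j , aj≉0)
            , λ r r<B → ≈-trans (+-cong (zeroˡ _) (rel r r<B)) (+-identityˡ 0#))
    ... | inj₂ (E , E≉0 , sp) with ℕ.anyUpTo? (λ r → ¬? (zero? (z r))) B
      where
      y : Fin L → Carrier
      y i = proj₁ (lift {cols = cols} (sp i)) zero
      z : ℕ → Carrier
      z r = E * cols r zero + ∑ᶠ (λ i → (- cols r (suc i)) * y i)
    ...   | no none = inj₁ ((λ { zero → E ; (suc i) → - y i }) , (zero , E≉0) , λ r r<B →
              ≈-trans (+-congˡ (∑ᶠ-cong {L} {λ i → (- y i) * cols r (suc i)} {λ i → (- cols r (suc i)) * y i} (λ i → ≈-trans (≈-sym (-‿distribˡ-* _ _)) (≈-trans (-‿cong (*-comm _ _)) (-‿distribˡ-* _ _))))) (vanishes r r<B))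
      where
      y : Fin L → Carrier
      y i = proj₁ (lift {cols = cols} (sp i)) zero
      z : ℕ → Carrier
      z r = E * cols r zero + ∑ᶠ (λ i → (- cols r (suc i)) * y i)
      vanishes : ∀ r → r < B → z r ≈ 0#
      vanishes r r<B with zero? (z r)
      ... | yes e = e
      ... | no ne = contradiction (r , r<B , ne) none
    ...   | yes (r , r<B , z≉0) = inj₂ (E * z , domain E≉0 z≉0 , spans)
      where
      w : Fin L → Vector (suc L)
      w i = proj₁ (lift {cols = cols} (sp i))
      w-span : ∀ i → Span cols B (w i)
      w-span i = proj₁ (proj₂ (lift {cols = cols} (sp i)))
      w-tail : ∀ i j → w i (suc j) ≈ unit E i j
      w-tail i = proj₂ (proj₂ (lift {cols = cols} (sp i)))
      y : Fin L → Carrier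
      y i = w i zero
      z = E * cols r zero + ∑ᶠ (λ i → (- cols r (suc i)) * y i)
      Z : Vector (suc L)
      Z j = E * cols r j + ∑ᶠ (λ i → (- cols r (suc i)) * w i j)
      Z-span : Span cols B Z
      Z-span = plus (times E (column r r<B)) (span-sum (λ i j → (- cols r (suc i)) * w i j) (λ i → times (- cols r (suc i)) (w-span i)))
      Z-tail : ∀ j → Z (suc j) ≈ 0#
      Z-tail j = ≈-trans (+-congˡ (≈-trans (∑ᶠ-cong {L} {λ i → (- cols r (suc i)) * w i (suc j)} {λ i → (- cols r (suc i)) * unit E i j} (λ i → *-congˡ (w-tail i j))) (∑ᶠ-unit E (λ i → - cols r (suc i)) j)))
        (≈-trans (+-cong (*-comm _ _) (≈-sym (-‿distribˡ-* _ _))) (-‿inverseʳ _))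
      spans : ∀ i → Span cols B (unit (E * z) i)
      spans zero = respects (λ { zero → ≈-refl ; (suc j) → ≈-trans (*-congˡ (Z-tail j)) (zeroʳ E) }) (times E Z-span)
      spans (suc i) = respects
        (λ { zero → ≈-trans (+-congˡ (≈-trans (≈-sym (-‿distribˡ-* _ _)) (-‿cong (*-comm _ _)))) (-‿inverseʳ _)
           ; (suc j) → ≈-trans (+-cong (≈-trans (*-congˡ (w-tail i j)) (z*unit i j)) (≈-trans (*-congˡ (Z-tail j)) (zeroʳ _)))
                         (≈-trans (+-identityʳ _) (≈-sym (unit-suc (E * z) i j))) })
        (plus (times z (w-span i)) (times (- y i) Z-span))
        where
        z*unit : ∀ i j → z * unit E i j ≈ unit (E * z) i j
        z*unit i j with i Fin.≟ j
        ... | yes _ = *-comm z E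
        ... | no _ = zeroʳ z

module FiniteBounds where
  open import Data.Fin using (zero; suc)

  ∈⇒≤maxL : ∀ l {r} → r ∈ l → r ≤ maxL l
  ∈⇒≤maxL (x ∷ l) (here refl) = ℕ.m≤m⊔n x (maxL l)
  ∈⇒≤maxL (x ∷ l) (there m) = ℕ.≤-trans (∈⇒≤maxL l m) (ℕ.m≤n⊔m x (maxL l))

  maxL-lub : ∀ l b → (∀ r → r ∈ l → r ≤ b) → maxL l ≤ b
  maxL-lub [] b h = z≤n
  maxL-lub (x ∷ l) b h = ℕ.⊔-lub (h x (here refl)) (maxL-lub l b (λ r m → h r (there m)))

  fin-bound : ∀ {L} (f : Fin L → ℕ) → Σ ℕ λ b → ∀ j → f j ≤ b
  fin-bound {zero} f = 0 , λ ()
  fin-bound {suc L} f with fin-bound (λ j → f (suc j))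
  ... | b , h = f zero ℕ.+ b , λ { zero → ℕ.m≤m+n _ b ; (suc j) → ℕ.≤-trans (h j) (ℕ.m≤n+m b _) }

  range-bound : ∀ K (f : ℕ → ℕ) → Σ ℕ λ b → ∀ r → r < K → f r ≤ b
  range-bound zero f = 0 , λ _ ()
  range-bound (suc K) f with range-bound K f
  ... | b , h = f K ℕ.+ b , go
    where
    go : ∀ r → r < suc K → f r ≤ f K ℕ.+ b
    go r r<sK with r ℕ.≟ K
    ... | yes refl = ℕ.m≤m+n _ b
    ... | no ne = ℕ.≤-trans (h r (ℕ.≤∧≢⇒< (ℕ.s≤s⁻¹ r<sK) ne)) (ℕ.m≤n+m b _)

open FiniteBounds

-- Coefficients of products with Laurent series; values of the h_j.

module LaurentPairing {q : ℕ} (𝔽 : FiniteField q) where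
  open import Data.Fin using (zero; suc)
  open import Data.Nat using (_⊔_)
  open import Data.Integer using (+_; -[1+_])

  open Polynomials 𝔽 public
  open Over 𝔽 public using (Laurent; lcoeff; mulLP; sumFin; SupportedOn; IsMaxPortion; LinIndepOverK; IsZeroᴷ; Frac; 0ᴷ; _+ᴷ_; _·ᴷ_)
  module LA = SpanningColumns polyRing

  shift-index : ∀ s k → -[1+ s ] ℤ.- + suc k ≡ -[1+ suc s ] ℤ.- + k
  shift-index s zero = cong (λ z → -[1+ suc z ]) (ℕ.+-identityʳ s)
  shift-index s (suc k) = cong (λ z → -[1+ suc z ]) (ℕ.+-suc s k)

  -- The coefficient of t^(-1-s) in β a.
  pair : Laurent → ℕ → Poly → F
  pair β s a = FS.sum (bound a) (λ k → coeff a k *F lcoeff β (-[1+ s ] ℤ.- + k))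

  pair-to : ∀ β s a B → Vanishes (coeff a) B → pair β s a ≡ FS.sum B (λ k → coeff a k *F lcoeff β (-[1+ s ] ℤ.- + k))
  pair-to β s a B v = trans (sym (FS.sum-extend (bound a) (bound a ⊔ B) _ (zeros (vanish a)) (ℕ.m≤m⊔n _ B)))
      (FS.sum-extend B (bound a ⊔ B) _ (zeros v) (ℕ.m≤n⊔m (bound a) B))
    where
    zeros : ∀ {n} → Vanishes (coeff a) n → ∀ k → n ≤ k → coeff a k *F lcoeff β (-[1+ s ] ℤ.- + k) ≡ 0F
    zeros v k le = trans (cong (_*F lcoeff β (-[1+ s ] ℤ.- + k)) (v k le)) (F.zeroˡ _)

  pair-cong : ∀ β s {a b} → a ≈ b → pair β s a ≡ pair β s b
  pair-cong β s {a} {b} e = trans (FS.sum-cong (bound a) (λ k → cong (_*F lcoeff β (-[1+ s ] ℤ.- + k)) (e k)))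
    (sym (pair-to β s b (bound a) (λ i le → trans (sym (e i)) (vanish a i le))))

  pair-+ : ∀ β s a b → pair β s (a +P b) ≡ pair β s a +F pair β s b
  pair-+ β s a b = trans (FS.sum-cong B (λ k → F.distribʳ (lcoeff β (-[1+ s ] ℤ.- + k)) (coeff a k) (coeff b k))) (trans (FS.sum-∙ B _ _)
      (sym (cong₂ _+F_ (pair-to β s a B (λ i le → vanish a i (ℕ.≤-trans (ℕ.m≤m⊔n _ _) le)))
                       (pair-to β s b B (λ i le → vanish b i (ℕ.≤-trans (ℕ.m≤n⊔m (bound a) _) le))))))
    where B = bound a ⊔ bound b

  scaleP : F → Poly → Poly
  scaleP u a = record { coeff = λ i → u *F coeff a i ; bound = bound a ; vanish = λ i le → trans (cong (u *F_) (vanish a i le)) (F.zeroʳ u) }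

  scaleP-G : ∀ {n} u a → GP n a → GP n (scaleP u a)
  scaleP-G u a g i le = trans (cong (u *F_) (g i le)) (F.zeroʳ u)

  scaleP-* : ∀ u a b → (a *P scaleP u b) ≈ scaleP u (a *P b)
  scaleP-* u a b i = trans (*ᶠ-comm (coeff a) (λ k → u *F coeff b k) i) (trans (*ᶠ-scale u (coeff b) (coeff a) i) (cong (u *F_) (*ᶠ-comm (coeff b) (coeff a) i)))

  pair-scale : ∀ β s u a → pair β s (scaleP u a) ≡ u *F pair β s a
  pair-scale β s u a = trans (FS.sum-cong (bound a) (λ k → F.*-assoc u _ _)) (go (bound a))
    where
    go : ∀ n → FS.sum n (λ k → u *F (coeff a k *F lcoeff β (-[1+ s ] ℤ.- + k))) ≡ u *F FS.sum n (λ k → coeff a k *F lcoeff β (-[1+ s ] ℤ.- + k))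
    go zero = sym (F.zeroʳ u)
    go (suc n) = trans (F.+-congʳ (go n)) (sym (F.distribˡ u _ _))

  pair-t : ∀ β s a → pair β s (tP *P a) ≡ pair β (suc s) a
  pair-t β s a = trans (pair-to β s (tP *P a) (suc (bound a)) bd) (trans (FS.sum-head (bound a) _)
      (trans (cong₂ _+F_ (trans (cong (_*F lcoeff β (-[1+ s ] ℤ.- + 0)) (tP-0 a)) (F.zeroˡ _))
        (FS.sum-cong (bound a) (λ k → cong₂ _*F_ (tP-suc a k) (cong (lcoeff β) (shift-index s k))))) (F.+-identityˡ _)))
    where
    bd : Vanishes (coeff (tP *P a)) (suc (bound a))
    bd (suc i) (s≤s le) = trans (tP-suc a i) (vanish a i le)

  -- Reduces all coefficients of the fractional part to the one at t^(-1).
  pair-t^ : ∀ β s i a → pair β s (tP ^P i *P a) ≡ pair β (i ℕ.+ s) a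
  pair-t^ β s zero a = pair-cong β s {1P *P a} {a} (P.*-identityˡ a)
  pair-t^ β s (suc i) a = trans (pair-cong β s {tP ^P suc i *P a} {tP *P (tP ^P i *P a)} (P.*-assoc tP (tP ^P i) a)) (trans (pair-t β s (tP ^P i *P a)) (trans (pair-t^ β (suc s) i a) (cong (λ z → pair β z a) (ℕ.+-suc i s))))

  coeff-^ : ∀ x r → coeff (x ^P r) ≡ coeff x ^ᶠ r
  coeff-^ x zero = refl
  coeff-^ x (suc r) = cong (coeff x *ᶠ_) (coeff-^ x r)

  sumP : ℕ → (ℕ → Poly) → Poly
  sumP zero f = 0P
  sumP (suc n) f = sumP n f +P f n

  coeff-sumP : ∀ n f i → coeff (sumP n f) i ≡ FS.sum n (λ r → coeff (f r) i)
  coeff-sumP zero f i = refl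
  coeff-sumP (suc n) f i = cong (_+F coeff (f n) i) (coeff-sumP n f i)

  sumP-G : ∀ {m} n f → (∀ r → r < n → GP m (f r)) → GP m (sumP n f)
  sumP-G zero f h i le = refl
  sumP-G {m} (suc n) f h = GP-+ {m} {sumP n f} {f n} (sumP-G n f (λ r r<n → h r (ℕ.m<n⇒m<1+n r<n))) (h n ℕ.≤-refl)

  polyValue : ℕ → (ℕ → Poly) → Poly → Poly
  polyValue K c x = sumP K (λ r → c r *P x ^P r)

  evalU-polyValue : ∀ K B c x → (∀ r → B < r → c r ≈ 0P) → B < K → evalU B c x ≈ᶠ coeff (polyValue K c x)
  evalU-polyValue K B c x z B<K i = trans (sumTo≡sum (suc B) _) (trans (FS.sum-cong (suc B) (λ r → cong (λ f → (coeff (c r) *ᶠ f) i) (sym (coeff-^ x r))))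
    (trans (sym (FS.sum-extend (suc B) K _ (λ r B<r → trans (*ᶠ-cong {coeff (c r)} {0ᶠ} {coeff (x ^P r)} {coeff (x ^P r)} (z r B<r) (λ _ → refl) i) (0ᶠ-*ᶠ (coeff (x ^P r)) i)) B<K))
      (sym (coeff-sumP K (λ r → c r *P x ^P r) i))))

  ^P-bound : ∀ a r x → Vanishes (coeff (a *P x ^P r)) (bound a ℕ.+ r ℕ.* bound x)
  ^P-bound a zero x i le = trans (P.*-identityʳ a i) (vanish a i (ℕ.≤-trans (ℕ.≤-reflexive (sym (ℕ.+-identityʳ (bound a)))) le))
  ^P-bound a (suc r) x i le = trans (sym (P.*-assoc a x (x ^P r) i)) (^P-bound (a *P x) r x i (ℕ.≤-trans (ℕ.≤-reflexive (ℕ.+-assoc (bound a) (bound x) (r ℕ.* bound x))) le))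

  evalBound-step : ∀ B c m → evalBound (suc B) c m ≡ evalBound B c m ℕ.+ (bound (c (suc B)) ℕ.+ suc B ℕ.* bound m)
  evalBound-step B c m = refl

  term≤evalBound : ∀ B c m r → r ≤ B → bound (c r) ℕ.+ r ℕ.* bound m ≤ evalBound B c m
  term≤evalBound zero c m .zero z≤n = ℕ.≤-refl
  term≤evalBound (suc B) c m r r≤sB with r ℕ.≟ suc B
  ... | yes refl = ℕ.≤-trans (ℕ.m≤n+m _ (evalBound B c m)) (ℕ.≤-reflexive (sym (evalBound-step B c m)))
  ... | no ne = ℕ.≤-trans (term≤evalBound B c m r (ℕ.s≤s⁻¹ (ℕ.≤∧≢⇒< r≤sB ne))) (ℕ.≤-trans (ℕ.m≤m+n (evalBound B c m) _) (ℕ.≤-reflexive (sym (evalBound-step B c m))))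

  evalU-vanish : ∀ B c x → Vanishes (evalU B c x) (evalBound B c x)
  evalU-vanish B c x i le = trans (sumTo≡sum (suc B) _) (FS.sum-ε (suc B) (λ r r<sB → trans (cong (λ f → (coeff (c r) *ᶠ f) i) (sym (coeff-^ x r)))
    (^P-bound (c r) r x i (ℕ.≤-trans (term≤evalBound B c x r (ℕ.s≤s⁻¹ r<sB)) le))))

  mulLP-pair : ∀ β P a B s → P ≈ᶠ coeff a → Vanishes P B → mulLP β P B -[1+ s ] ≡ pair β s a
  mulLP-pair β P a B s e v = trans (sumTo≡sum B _) (trans (FS.sum-cong B (λ k → cong (_*F lcoeff β (-[1+ s ] ℤ.- + k)) (e k)))
    (sym (pair-to β s a B (λ i le → trans (sym (e i)) (v i le)))))

  sumFin-cong : ∀ {L} {f g : Fin L → F} → (∀ j → f j ≡ g j) → sumFin f ≡ sumFin g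
  sumFin-cong {zero} e = refl
  sumFin-cong {suc L} e = cong₂ _+F_ (e zero) (sumFin-cong (λ j → e (suc j)))

  sumFin-0 : ∀ {L} {f : Fin L → F} → (∀ j → f j ≡ 0F) → sumFin f ≡ 0F
  sumFin-0 {zero} e = refl
  sumFin-0 {suc L} e = trans (cong₂ _+F_ (e zero) (sumFin-0 (λ j → e (suc j)))) (F.+-identityˡ 0F)

  sumFin-+ : ∀ {L} (f g : Fin L → F) → sumFin (λ j → f j +F g j) ≡ sumFin f +F sumFin g
  sumFin-+ {zero} f g = sym (F.+-identityˡ 0F)
  sumFin-+ {suc L} f g = trans (cong (f zero +F g zero +F_) (sumFin-+ (λ j → f (suc j)) (λ j → g (suc j)))) (FS.interchange _ _ _ _)

  sumFin-* : ∀ {L} u (f : Fin L → F) → sumFin (λ j → u *F f j) ≡ u *F sumFin f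
  sumFin-* {zero} u f = sym (F.zeroʳ u)
  sumFin-* {suc L} u f = trans (cong (u *F f zero +F_) (sumFin-* u (λ j → f (suc j)))) (sym (F.distribˡ u _ _))

  sumFin-single : ∀ {L} (f : Fin L → F) i → (∀ j → j ≢ i → f j ≡ 0F) → sumFin f ≡ f i
  sumFin-single {suc L} f zero z = trans (cong (f zero +F_) (sumFin-0 (λ j → z (suc j) (λ ())))) (F.+-identityʳ _)
  sumFin-single {suc L} f (suc i) z = trans (cong₂ _+F_ (z zero (λ ())) (sumFin-single (λ j → f (suc j)) i (λ j ne → z (suc j) (λ e → ne (Fin-suc-injective e))))) (F.+-identityˡ _)
    where open import Data.Fin.Properties using () renaming (suc-injective to Fin-suc-injective)

  -- With unit denominators, a 𝕂-linear combination vanishes iff its numerator does.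
  fraction-sum : ∀ {L} (f : Fin L → PolyFn) (g : Fin L → Poly) → (∀ j → f j ≈ᶠ coeff (g j)) →
    (proj₁ (Data.Vec.Functional.foldr _+ᴷ_ 0ᴷ (λ j → (f j , 1ᶠ))) ≈ᶠ coeff (LA.∑ᶠ g)) ×
    (proj₂ (Data.Vec.Functional.foldr _+ᴷ_ 0ᴷ (λ j → (f j , 1ᶠ))) ≈ᶠ 1ᶠ)
  fraction-sum {zero} f g e = (λ _ → refl) , (λ _ → refl)
  fraction-sum {suc L} f g e with fraction-sum (λ j → f (suc j)) (λ j → g (suc j)) (λ j → e (suc j))
  ... | num , den = (λ i → cong₂ _+F_
          (trans (*ᶠ-cong {f zero} {coeff (g zero)} (e zero) den i) (trans (*ᶠ-comm (coeff (g zero)) 1ᶠ i) (1ᶠ-*ᶠ (coeff (g zero)) i)))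
          (trans (*ᶠ-cong {b = 1ᶠ} {b′ = 1ᶠ} num (λ _ → refl) i) (trans (*ᶠ-comm (coeff (LA.∑ᶠ (λ j → g (suc j)))) 1ᶠ i) (1ᶠ-*ᶠ (coeff (LA.∑ᶠ (λ j → g (suc j)))) i))))
        , (λ i → trans (*ᶠ-cong {1ᶠ} {1ᶠ} (λ _ → refl) den i) (1ᶠ-*ᶠ 1ᶠ i))

  -- A relation over 𝔽_q[t] is one over 𝕂 with unit denominators, so independence leaves only the
  -- spanning alternative.
  independent⇒spanning : ∀ {L} (e : Fin L → ℕ → Poly) K → (∀ j r → K ≤ r → e j r ≈ 0P) → LinIndepOverK L e →
    Σ Poly λ E → (¬ E ≈ 0P) × (∀ i → LA.Span (λ r j → e j r) K (LA.unit E i))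
  independent⇒spanning {L} e K out indep with LA.dependent-or-spanning zero? (λ z → 0≢1 (sym (z 0))) (λ {x} {y} → domainP {x} {y}) (λ r j → e j r) K
  ... | inj₂ r = r

  ... | inj₁ (a , (j , aj≄0) , rel) = contradiction
          (indep a (λ _ → 1P) (λ _ z → 0≢1 (sym (z 0))) (λ r → λ i → trans (proj₁ (fraction-sum (λ j → coeff (a j) *ᶠ coeff (e j r)) (λ j → a j *P e j r) (λ _ _ → refl)) i) (vanishes r i)) j)
          aj≄0
    where
    vanishes : ∀ r → LA.∑ᶠ (λ j → a j *P e j r) ≈ 0P
    vanishes r with r ℕ.<? K
    ... | yes r<K = rel r r<K
    ... | no r≮K = LA.∑ᶠ-0 (λ j → P.trans {a j *P e j r} {a j *P 0P} {0P} (P.*-congˡ {a j} {e j r} {0P} (out j r (ℕ.≮⇒≥ r≮K))) (P.zeroʳ (a j)))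

-- Rational bounds of the form N / (s + 1).

module Reciprocals where
  import Data.Nat.DivMod as ℕ
  open import Data.Integer using (+_; -[1+_])
  import Data.Integer.DivMod as ℤ
  open import Data.Rational using (ℚ; 0ℚ; mkℚ; _*_; -_; _/_; floor; toℚᵘ) renaming (_<_ to _<ℚ_)
  import Data.Rational.Properties as ℚ
  open import Data.Rational.Unnormalised as ℚᵘ using (mkℚᵘ; *≡*; *<*)
  import Data.Rational.Unnormalised.Properties as ℚᵘ

  neg-involutive : ∀ x → - - x ≡ x
  neg-involutive (mkℚ (+ zero) _ _) = refl
  neg-involutive (mkℚ (+ suc _) _ _) = refl
  neg-involutive (mkℚ -[1+ _ ] _ _) = refl

  module _ (s : ℕ) where

    reciprocal : ℚ
    reciprocal = + 1 / suc s

    reciprocal>0 : 0ℚ <ℚ reciprocal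
    reciprocal>0 = ℚ.toℚᵘ-cancel-< (ℚᵘ.<-respʳ-≃ (ℚᵘ.≃-sym (ℚ.toℚᵘ-fromℚᵘ (mkℚᵘ (+ 1) s))) (*<* (ℤ.+<+ (s≤s z≤n))))

    product-≃ : ∀ N → toℚᵘ (reciprocal * (+ N / 1)) ℚᵘ.≃ mkℚᵘ (+ 1) s ℚᵘ.* mkℚᵘ (+ N) 0
    product-≃ N = ℚᵘ.≃-trans (ℚ.toℚᵘ-homo-* reciprocal (+ N / 1))
      (ℚᵘ.*-cong (ℚ.toℚᵘ-fromℚᵘ (mkℚᵘ (+ 1) s)) (ℚ.toℚᵘ-fromℚᵘ (mkℚᵘ (+ N) 0)))

    floor-bound : ∀ x N → toℚᵘ x ℚᵘ.≃ mkℚᵘ (+ 1) s ℚᵘ.* mkℚᵘ (+ N) 0 → floor x ℤ.≤ + (N ℕ./ suc s)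
    floor-bound x@(mkℚ n d-1 _) N (*≡* e) = go (floor x) refl
      where
      go : ∀ f → f ≡ floor x → f ℤ.≤ + (N ℕ./ suc s)
      go -[1+ _ ] _ = ℤ.-≤+
      go (+ f) f≡ = ℤ.+≤+ (subst (ℕ._≤ N ℕ./ suc s) (ℕ.m*n/n≡m f (suc s)) (ℕ./-monoˡ-≤ (suc s) (ℤ.drop‿+≤+ small)))
        where
        below : + f ℤ.* + suc d-1 ℤ.≤ n
        below = subst (λ z → z ℤ.* + suc d-1 ℤ.≤ n) (sym f≡) (ℤ.[n/d]*d≤n n (+ suc d-1))
        scaled : (+ f ℤ.* + suc d-1) ℤ.* + suc s ℤ.≤ + N ℤ.* + suc d-1
        scaled = ℤ.≤-trans (ℤ.*-monoʳ-≤-nonNeg (+ suc s) below) (ℤ.≤-reflexive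
          (trans (cong (λ z → n ℤ.* + z) (sym (ℕ.*-identityʳ (suc s)))) (trans e (cong (ℤ._* + suc d-1) (ℤ.*-identityˡ (+ N))))))
        small : + (f ℕ.* suc s) ℤ.≤ + N
        small = ℤ.*-cancelʳ-≤-pos _ _ (+ suc d-1) (subst (ℤ._≤ + N ℤ.* + suc d-1)
          (trans (ℤ.*-assoc (+ f) _ _) (trans (cong (+ f ℤ.*_) (ℤ.*-comm (+ suc d-1) (+ suc s))) (trans (sym (ℤ.*-assoc (+ f) _ _)) (cong (ℤ._* + suc d-1) (sym (ℤ.pos-* f (suc s))))))) scaled)

    floor-reciprocal : ∀ N → floor (reciprocal * (+ N / 1)) ℤ.≤ + (N ℕ./ suc s)
    floor-reciprocal N = floor-bound (reciprocal * (+ N / 1)) N (product-≃ N)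

    order-bound : ∀ N i → - (reciprocal * (+ N / 1)) <ℚ (-[1+ i ] / 1) → suc i ℕ.* suc s ℕ.< N
    order-bound N i lt = compare (ℚᵘ.<-respˡ-≃ (ℚ.toℚᵘ-fromℚᵘ (mkℚᵘ (+ suc i) 0)) (ℚᵘ.<-respʳ-≃ (product-≃ N) (ℚ.toℚᵘ-mono-< flipped)))
      where
      flipped : (+ suc i / 1) <ℚ reciprocal * (+ N / 1)
      flipped = subst₂ _<ℚ_ (neg-involutive (+ suc i / 1)) (neg-involutive (reciprocal * (+ N / 1))) (ℚ.neg-antimono-< lt)
      compare : mkℚᵘ (+ suc i) 0 ℚᵘ.< mkℚᵘ (+ 1) s ℚᵘ.* mkℚᵘ (+ N) 0 → suc i ℕ.* suc s ℕ.< N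
      compare (*<* h) = ℤ.drop‿+<+ (subst₂ ℤ._<_ (trans (cong (λ z → + suc i ℤ.* + z) (ℕ.*-identityʳ (suc s))) (sym (ℤ.pos-* (suc i) (suc s))))
        (trans (ℤ.*-identityʳ _) (ℤ.*-identityˡ (+ N))) h)

-- Degree bounds for the construction of n: M coefficients have to vanish, deg d < D, and u bounds the degrees
-- that depend only on the h_j.
module Budget (K a M D u : ℕ) where
  b dk DZ H N₅ N₄ N₃ N₂ T : ℕ
  b = suc (a ℕ.* suc M)
  dk = suc (K ℕ.* D)
  DZ = (u ℕ.+ (M ℕ.+ (dk ℕ.+ suc (K ℕ.* b)))) ℕ.+ D
  H = u ℕ.+ suc (K ℕ.* DZ)
  N₅ = M ℕ.+ (H ℕ.+ D)
  N₄ = N₅ ℕ.+ u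
  N₃ = K ℕ.* suc b ℕ.+ N₄
  N₂ = dk ℕ.+ N₃
  T = (a ℕ.* (suc M ℕ.+ N₂) ℕ.+ D) ℕ.+ DZ

module Slope (K a : ℕ) where
  import Data.Nat.DivMod as ℕ

  -- The rates of the quantities in `Budget`: u, M, suc M and D each count as 1.
  xb xdk xDZ xH x₅ x₄ x₃ x₂ xT : ℕ
  xb = 1 ℕ.+ a ℕ.* 1
  xdk = 1 ℕ.+ K ℕ.* 1
  xDZ = (1 ℕ.+ (1 ℕ.+ (xdk ℕ.+ (1 ℕ.+ K ℕ.* xb)))) ℕ.+ 1
  xH = 1 ℕ.+ (1 ℕ.+ K ℕ.* xDZ)
  x₅ = 1 ℕ.+ (xH ℕ.+ 1)
  x₄ = x₅ ℕ.+ 1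
  x₃ = K ℕ.* (1 ℕ.+ xb) ℕ.+ x₄
  x₂ = xdk ℕ.+ x₃
  xT = (a ℕ.* (1 ℕ.+ x₂) ℕ.+ 1) ℕ.+ xDZ

  budget≤ : ∀ M D u → Budget.T K a M D u ≤ xT ℕ.* (suc u ℕ.+ M ℕ.+ D)
  budget≤ M D u = _≲_.le T≲
    where
    open Budget K a M D u
    τ = suc u ℕ.+ M ℕ.+ D
    open Proportional τ (s≤s z≤n)
    leaf : ∀ {X} → X ≤ τ → X ≲ 1
    leaf h = mk (ℕ.≤-trans h (ℕ.≤-reflexive (sym (ℕ.*-identityˡ τ))))
    u≲ : u ≲ 1
    u≲ = leaf (ℕ.≤-trans (ℕ.n≤1+n u) (ℕ.≤-trans (ℕ.m≤m+n (suc u) M) (ℕ.m≤m+n _ D)))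
    sM≲ : suc M ≲ 1
    sM≲ = leaf (ℕ.≤-trans (s≤s (ℕ.m≤n+m M u)) (ℕ.m≤m+n _ D))
    M≲ : M ≲ 1
    M≲ = leaf (ℕ.≤-trans (ℕ.m≤n+m M (suc u)) (ℕ.m≤m+n _ D))
    D≲ : D ≲ 1
    D≲ = leaf (ℕ.m≤n+m D (suc u ℕ.+ M))
    b≲ : b ≲ xb
    b≲ = const 1 ⊞ (a ⊠ sM≲)
    dk≲ : dk ≲ xdk
    dk≲ = const 1 ⊞ (K ⊠ D≲)
    DZ≲ : DZ ≲ xDZ
    DZ≲ = (u≲ ⊞ (M≲ ⊞ (dk≲ ⊞ (const 1 ⊞ (K ⊠ b≲))))) ⊞ D≲
    H≲ : H ≲ xH
    H≲ = u≲ ⊞ (const 1 ⊞ (K ⊠ DZ≲))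
    N₅≲ : N₅ ≲ x₅
    N₅≲ = M≲ ⊞ (H≲ ⊞ D≲)
    N₃≲ : N₃ ≲ x₃
    N₃≲ = (K ⊠ (const 1 ⊞ b≲)) ⊞ (N₅≲ ⊞ u≲)
    T≲ : T ≲ xT
    T≲ = ((a ⊠ (sM≲ ⊞ (dk≲ ⊞ N₃≲))) ⊞ D≲) ⊞ DZ≲

  -- The factor 3 grants each of the summands suc u, M and D a third of N.
  s : ℕ
  s = 3 ℕ.* xT

  enough : ∀ u N → s ℕ.* suc u < N → Budget.T K a (N ℕ./ suc s) (N ℕ./ suc s) u ≤ N
  enough u N h = ℕ.≤-trans (budget≤ M M u) (ℕ.*-cancelˡ-≤ 3 (begin
      3 ℕ.* (xT ℕ.* (suc u ℕ.+ M ℕ.+ M))      ≡⟨ ℕ.*-assoc 3 xT _ ⟨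
      s ℕ.* (suc u ℕ.+ M ℕ.+ M)              ≡⟨ trans (ℕ.*-distribˡ-+ s (suc u ℕ.+ M) M) (cong (ℕ._+ s ℕ.* M) (ℕ.*-distribˡ-+ s (suc u) M)) ⟩
      s ℕ.* suc u ℕ.+ s ℕ.* M ℕ.+ s ℕ.* M    ≤⟨ ℕ.+-mono-≤ (ℕ.+-mono-≤ (ℕ.<⇒≤ h) sM≤N) sM≤N ⟩
      N ℕ.+ N ℕ.+ N                          ≡⟨ trans (ℕ.+-assoc N N N) (cong (λ z → N ℕ.+ (N ℕ.+ z)) (sym (ℕ.+-identityʳ N))) ⟩
      3 ℕ.* N ∎))
    where
    open ℕ.≤-Reasoning
    M = N ℕ./ suc s
    sM≤N : s ℕ.* M ≤ N
    sM≤N = ℕ.≤-trans (ℕ.≤-trans (ℕ.m≤n+m (s ℕ.* M) M) (ℕ.≤-reflexive (ℕ.*-comm (suc s) M))) (ℕ.m/n*n≤m N (suc s))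

-- From a biased multiplier to a common denominator and to n.

module MajorArcs {q : ℕ} (𝔽 : FiniteField q) (p : ℕ) (ic : Over.IsCharacteristic 𝔽 p) (K : ℕ) (1≤K : 1 ≤ K) where
  open import Data.Nat using (_∸_)
  open import Data.Nat.Divisibility using (_∣_)

  open LaurentPairing 𝔽 public
  module C = Char p ic
  module SA = BiasedMultiplier (polySetting p ic) K 1≤K
  open SA using (Hom; fun; cong-fun; homo; _∙_; ev; Bnd; Good; _≼_; Biased; Kill)
  open C using () renaming (functional to χ; functional-+ to χ-+; functional-0 to χ-0; functional-nontrivial to χ-nontrivial)
  open Target C.primeTarget using (𝔸) renaming (_+ᴬ_ to infixl 6 _+𝔸_; 0ᴬ to 0𝔸)

  module System {L : ℕ} (c e : Fin L → ℕ → Poly) where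

    -- The coefficient of t^(-1) in Σ β_j v_j.
    Φ : (Fin L → Laurent) → (Fin L → Poly) → F
    Φ β v = sumFin (λ j → pair (β j) 0 (v j))

    Φ-cong : ∀ β v w → (∀ j → v j ≈ w j) → Φ β v ≡ Φ β w
    Φ-cong β v w h = sumFin-cong (λ j → pair-cong (β j) 0 {v j} {w j} (h j))

    Φ-+ : ∀ β v w → Φ β (λ j → v j +P w j) ≡ Φ β v +F Φ β w
    Φ-+ β v w = trans (sumFin-cong (λ j → pair-+ (β j) 0 (v j) (w j))) (sumFin-+ (λ j → pair (β j) 0 (v j)) (λ j → pair (β j) 0 (w j)))

    Φ-0 : ∀ β v → (∀ j → v j ≈ 0P) → Φ β v ≡ 0F
    Φ-0 β v h = sumFin-0 (λ j → pair-cong (β j) 0 {v j} {0P} (h j))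

    Φ-scale : ∀ β u v → Φ β (λ j → scaleP u (v j)) ≡ u *F Φ β v
    Φ-scale β u v = trans (sumFin-cong (λ j → pair-scale (β j) 0 u (v j))) (sumFin-* u (λ j → pair (β j) 0 (v j)))

    χΦ : (Fin L → Laurent) → (Fin L → Poly) → Hom
    χΦ β v = record
      { fun = λ f → χ (Φ β (λ j → v j *P f))
      ; cong-fun = λ {x} {y} h → cong χ (Φ-cong β (λ j → v j *P x) (λ j → v j *P y) (λ j → P.*-congˡ {v j} {x} {y} h))
      ; homo = λ x y → trans (cong χ (trans (Φ-cong β (λ j → v j *P (x +P y)) (λ j → v j *P x +P v j *P y) (λ j → P.distribˡ (v j) x y)) (Φ-+ β (λ j → v j *P x) (λ j → v j *P y)))) (χ-+ _ _) }

    χΦ-cong : ∀ β v w x → (∀ j → v j ≈ w j) → fun (χΦ β v) x ≡ fun (χΦ β w) x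
    χΦ-cong β v w x h = cong χ (Φ-cong β (λ j → v j *P x) (λ j → w j *P x) (λ j → P.*-congʳ {x} {v j} {w j} (h j)))

    χΦ-zero : ∀ β v x → (∀ j → v j ≈ 0P) → fun (χΦ β v) x ≡ 0𝔸
    χΦ-zero β v x h = trans (cong χ (Φ-0 β (λ j → v j *P x) (λ j → P.trans {v j *P x} {0P *P x} {0P} (P.*-congʳ {x} {v j} {0P} (h j)) (P.zeroˡ x)))) χ-0

    χΦ-∙ : ∀ β v x y → fun (χΦ β v) (x *P y) ≡ fun (χΦ β (λ j → v j *P x)) y
    χΦ-∙ β v x y = cong χ (Φ-cong β (λ j → v j *P (x *P y)) (λ j → (v j *P x) *P y) (λ j → P.sym {(v j *P x) *P y} {v j *P (x *P y)} (P.*-assoc (v j) x y)))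

    -- The argument of the nontrivial χ may be multiplied by any scalar.
    χΦ-detects : ∀ β v n → (∀ x → GP n x → fun (χΦ β v) x ≡ 0𝔸) → ∀ x → GP n x → Φ β (λ j → v j *P x) ≡ 0F
    χΦ-detects β v n h x gx with Φ β (λ j → v j *P x) ≟F 0F
    ... | yes z = z
    ... | no w≢0 = contradiction (trans (cong χ (sym value)) (h (scaleP u x) (scaleP-G u x gx))) (proj₂ χ-nontrivial)
      where
      w = Φ β (λ j → v j *P x)
      y₀ = proj₁ χ-nontrivial
      u = y₀ *F proj₁ (inverse w w≢0)
      value : Φ β (λ j → v j *P scaleP u x) ≡ y₀
      value = trans (Φ-cong β (λ j → v j *P scaleP u x) (λ j → scaleP u (v j *P x)) (λ j → scaleP-* u (v j) x)) (trans (Φ-scale β u (λ j → v j *P x))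
        (trans (F.*-assoc y₀ _ w) (trans (cong (y₀ *F_) (trans (F.*-comm _ w) (proj₂ (inverse w w≢0)))) (F.*-identityʳ y₀))))

    hP : Fin L → Poly → Poly
    hP j x = polyValue K (c j) x

    Ξ : (Fin L → Laurent) → Poly → ℕ → Hom
    Ξ β m r = χΦ β (λ j → m *P c j r)

    ev-Ξ : ∀ β m x → ev (Ξ β m) x ≡ χ (Φ β (λ j → m *P hP j x))
    ev-Ξ β m x = go K
      where
      h : ℕ → Fin L → Poly
      h n j = sumP n (λ r → c j r *P x ^P r)
      last : ℕ → Fin L → Poly
      last n j = c j n *P x ^P n
      go : ∀ n → SA.sum n (λ r → fun (Ξ β m r) (x ^P r)) ≡ χ (Φ β (λ j → m *P h n j))
      go zero = sym (trans (cong χ (Φ-0 β (λ j → m *P 0P) (λ j → P.zeroʳ m))) χ-0)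
      go (suc n) = trans (cong₂ _+𝔸_ (go n) (cong χ (Φ-cong β (λ j → (m *P c j n) *P x ^P n) (λ j → m *P last n j) (λ j → P.*-assoc m (c j n) (x ^P n)))))
        (trans (sym (χ-+ (Φ β (λ j → m *P h n j)) (Φ β (λ j → m *P last n j)))) (cong χ (trans (sym (Φ-+ β (λ j → m *P h n j) (λ j → m *P last n j)))
          (Φ-cong β (λ j → m *P h n j +P m *P last n j) (λ j → m *P (h n j +P last n j)) (λ j → P.sym {m *P (h n j +P last n j)} {m *P h n j +P m *P last n j} (P.distribˡ m (h n j) (last n j)))))))

    columns : ℕ → Fin L → Poly
    columns r j = e j r

    -- A scalar of the combination moves into the argument f and shortens the window by its degree
    -- bound. The cost is fixed before β and w, hence depends on the h_j only.
    span-kill : ∀ {v} → LA.Span columns K v → Σ ℕ λ cost → ∀ β w N N′ →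
      (∀ r → r < K → ∀ f → GP N f → fun (χΦ β (λ j → e j r *P w)) f ≡ 0𝔸) →
      N′ ℕ.+ cost ≤ N → ∀ f → GP N′ f → fun (χΦ β (λ j → v j *P w)) f ≡ 0𝔸
    span-kill (LA.column r r<K) = 0 , λ β w N N′ h le f gf → h r r<K f (GP-mono {N′} {N} {f} (ℕ.≤-trans (ℕ.m≤m+n N′ 0) le) gf)
    span-kill LA.null = 0 , λ β w N N′ h le f gf → χΦ-zero β (λ j → 0P *P w) f (λ j → P.zeroˡ w)
    span-kill (LA.plus {v₁} {v₂} s t) = proj₁ (span-kill s) ℕ.+ proj₁ (span-kill t) , λ β w N N′ h le f gf → trans
        (cong χ (trans (Φ-cong β (λ j → ((v₁ j +P v₂ j) *P w) *P f) (λ j → (v₁ j *P w) *P f +P (v₂ j *P w) *P f) (λ j → P.trans {((v₁ j +P v₂ j) *P w) *P f} {(v₁ j *P w +P v₂ j *P w) *P f} {(v₁ j *P w) *P f +P (v₂ j *P w) *P f}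
                   (P.*-congʳ {f} {(v₁ j +P v₂ j) *P w} {v₁ j *P w +P v₂ j *P w} (P.distribʳ w (v₁ j) (v₂ j))) (P.distribʳ f (v₁ j *P w) (v₂ j *P w))))
                 (Φ-+ β (λ j → (v₁ j *P w) *P f) (λ j → (v₂ j *P w) *P f))))
        (trans (χ-+ (Φ β (λ j → (v₁ j *P w) *P f)) (Φ β (λ j → (v₂ j *P w) *P f)))
          (trans (cong₂ _+𝔸_ (proj₂ (span-kill s) β w N N′ h (ℕ.≤-trans (ℕ.+-monoʳ-≤ N′ (ℕ.m≤m+n (proj₁ (span-kill s)) (proj₁ (span-kill t)))) le) f gf)
                             (proj₂ (span-kill t) β w N N′ h (ℕ.≤-trans (ℕ.+-monoʳ-≤ N′ (ℕ.m≤n+m (proj₁ (span-kill t)) (proj₁ (span-kill s)))) le) f gf)) (SA.A.identityˡ 0𝔸)))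
    span-kill (LA.times a {v} s) = bound a ℕ.+ proj₁ (span-kill s) , λ β w N N′ h le f gf → trans
        (cong χ (Φ-cong β (λ j → ((a *P v j) *P w) *P f) (λ j → (v j *P w) *P (a *P f)) (λ j → P.trans {((a *P v j) *P w) *P f} {((v j *P w) *P a) *P f} {(v j *P w) *P (a *P f)}
          (P.*-congʳ {f} {(a *P v j) *P w} {(v j *P w) *P a} (P.trans {(a *P v j) *P w} {a *P (v j *P w)} {(v j *P w) *P a} (P.*-assoc a (v j) w) (P.*-comm a (v j *P w))))
          (P.*-assoc (v j *P w) a f))))
        (proj₂ (span-kill s) β w N (bound a ℕ.+ N′) h (ℕ.≤-trans (ℕ.≤-reflexive (trans (cong (ℕ._+ proj₁ (span-kill s)) (ℕ.+-comm (bound a) N′)) (ℕ.+-assoc N′ (bound a) (proj₁ (span-kill s))))) le)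
          (a *P f) (*ᶠ-vanish (vanish a) gf))
    span-kill (LA.respects {v} {v′} eq s) = proj₁ (span-kill s) , λ β w N N′ h le f gf →
      trans (χΦ-cong β (λ j → v′ j *P w) (λ j → v j *P w) f (λ j → P.*-congʳ {w} {v′ j} {v j} (λ i → sym (eq j i)))) (proj₂ (span-kill s) β w N N′ h le f gf)

    size-bound : ∀ E → (∀ i → LA.Span columns K (LA.unit E i)) → Σ ℕ λ u → (bound E ≤ u) ×
      (∀ j r → r < K → bound (c j r) ≤ u) ×
      (∀ i β w N N′ → (∀ r → r < K → ∀ f → GP N f → fun (χΦ β (λ j → e j r *P w)) f ≡ 0𝔸) →
        N′ ℕ.+ u ≤ N → ∀ f → GP N′ f → fun (χΦ β (λ j → LA.unit E i j *P w)) f ≡ 0𝔸)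
    size-bound E spans =
      let (b₁ , h₁) = fin-bound (λ i → proj₁ (span-kill (spans i)))
          (b₂ , h₂) = fin-bound (λ j → proj₁ (range-bound K (λ r → bound (c j r))))
      in bound E ℕ.+ b₁ ℕ.+ b₂ , ℕ.≤-trans (ℕ.m≤m+n (bound E) b₁) (ℕ.m≤m+n _ b₂)
       , (λ j r r<K → ℕ.≤-trans (proj₂ (range-bound K (λ r → bound (c j r))) r r<K) (ℕ.≤-trans (h₂ j) (ℕ.m≤n+m b₂ _)))
       , λ i β w N N′ h le f gf → proj₂ (span-kill (spans i)) β w N N′ h
           (ℕ.≤-trans (ℕ.+-monoʳ-≤ N′ (ℕ.≤-trans (h₁ i) (ℕ.≤-trans (ℕ.m≤n+m b₁ (bound E)) (ℕ.m≤m+n _ b₂)))) le) f gf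

    module Endgame (a : ℕ)
      (inv : ∀ Λ c N N₂ k r d → Bnd Λ → Good Λ k → ¬ (p ∣ k) → Biased c N (λ y → ev Λ (r +P d *P y)) → a ℕ.* (suc c ℕ.+ N₂) ≤ N →
        Σ Poly λ g → (¬ g ≈ 0P) × GP (a ℕ.* suc c) g × (∀ x → GP N₂ x → fun (Λ k) (d ^P k *P (g *P x)) ≡ 0𝔸))
      (out : ∀ j r → K ≤ r → c j r ≈ 0P)
      (relevant : ∀ r → (∀ j → e j r ≈ 0P) ⊎ ((∀ j → e j r ≈ c j r) × ¬ (p ∣ r) × (∀ β m → Good (Ξ β m) r)))
      (E : Poly) (E≄0 : ¬ E ≈ 0P) (u : ℕ) (E≤u : bound E ≤ u) (c≤u : ∀ j r → r < K → bound (c j r) ≤ u)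
      (unit-kill : ∀ i β w N N′ → (∀ r → r < K → ∀ f → GP N f → fun (χΦ β (λ j → e j r *P w)) f ≡ 0𝔸) →
        N′ ℕ.+ u ≤ N → ∀ f → GP N′ f → fun (χΦ β (λ j → LA.unit E i j *P w)) f ≡ 0𝔸)
      (rs : Poly → Poly)
      (rs-small : ∀ y → ¬ y ≈ 0P → ∀ k → IsDeg y k → GP k (rs y))
      (rs-compatible : ∀ m y z → ¬ m ≈ 0P → ¬ y ≈ 0P → z ≈ (m *P y) → CongMod (coeff (rs z)) (coeff (rs y)) y)
      (rs-root : ∀ y → ¬ y ≈ 0P → ∀ j → Σ Poly λ c′ → hP j (rs y) ≈ (c′ *P y))
      (M D N : ℕ) (T≤N : Budget.T K a M D u ≤ N) (d : Poly) (d≄0 : ¬ d ≈ 0P) (dG : GP D d) (β : Fin L → Laurent) where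
      open Budget K a M D u

      rd : Poly
      rd = rs d

      rdG : GP D rd
      rdG = let (k , k<D , dk) = degree d D d≄0 dG in GP-mono {k} {D} {rd} (ℕ.<⇒≤ k<D) (rs-small d d≄0 k dk)

      Small : Poly → Set
      Small n = ∀ i → i < M → Φ β (λ j → tP ^P i *P hP j n) ≡ 0F

      small? : ∀ n → Dec (Small n)
      small? n = map′ (λ h i → h {i}) (λ h {i} → h i) (ℕ.allUpTo? (λ i → Φ β (λ j → tP ^P i *P hP j n) ≟F 0F) M)

      Goal : Set
      Goal = Σ Poly λ n → GP N n × CongMod (coeff n) (coeff rd) d × Small n

      N₁ : ℕ
      N₁ = N ∸ D

      D≤N : D ≤ N
      D≤N = ℕ.≤-trans (ℕ.m≤n+m D (a ℕ.* (suc M ℕ.+ N₂))) (ℕ.≤-trans (ℕ.m≤m+n _ DZ) T≤N)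

      inv-fits : a ℕ.* (suc M ℕ.+ N₂) ≤ N₁
      inv-fits = ℕ.m+n≤o⇒m≤o∸n _ (ℕ.≤-trans (ℕ.m≤m+n _ DZ) T≤N)

      DZ≤N : DZ ≤ N
      DZ≤N = ℕ.≤-trans (ℕ.m≤n+m DZ (a ℕ.* (suc M ℕ.+ N₂) ℕ.+ D)) T≤N

      candidate : Poly → Poly
      candidate y = rd +P d *P y

      found : ∀ y → GP N₁ y → Small (candidate y) → Goal
      found y gy sm = candidate y
        , GP-+ {N} {rd} {d *P y} (GP-mono {D} {N} {rd} D≤N rdG) (GP-mono {D ℕ.+ N₁} {N} {d *P y} (ℕ.≤-reflexive (ℕ.m+[n∸m]≡n D≤N)) (*ᶠ-vanish dG gy))
        , (y , λ i → trans (F.+-congʳ (F.+-comm (coeff rd i) _)) (trans (F.+-assoc _ _ _) (trans (cong (coeff (d *P y) i +F_) (F.-‿inverseʳ (coeff rd i))) (trans (F.+-identityʳ _) (*ᶠ-comm (coeff d) (coeff y) i)))))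
        , sm

      ψ : Poly → Hom
      ψ y = record
        { fun = λ m → χ (Φ β (λ j → m *P hP j (candidate y)))
        ; cong-fun = λ {x} {x′} h → cong χ (Φ-cong β (λ j → x *P hP j (candidate y)) (λ j → x′ *P hP j (candidate y)) (λ j → P.*-congʳ {hP j (candidate y)} {x} {x′} h))
        ; homo = λ x x′ → trans (cong χ (trans (Φ-cong β (λ j → (x +P x′) *P hP j (candidate y)) (λ j → x *P hP j (candidate y) +P x′ *P hP j (candidate y)) (λ j → P.distribʳ (hP j (candidate y)) x x′)) (Φ-+ β (λ j → x *P hP j (candidate y)) (λ j → x′ *P hP j (candidate y))))) (χ-+ _ _) }

      module WithMultiplier (m : Poly) (mG : GP M m) (m≄0 : ¬ m ≈ 0P) (bias : Biased M N₁ (λ y → fun (ψ y) m)) where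
        -- d ^ K serves all exponents r < K at once: d ^ r is the factor in the inverse theorem, and
        -- d ^ (K - r) goes into the argument.
        w₀ : Poly
        w₀ = m *P d ^P K

        ^P-nonzero : ∀ r → ¬ (d ^P r) ≈ 0P
        ^P-nonzero r = SA.↑-nonzero r d≄0

        τ : ℕ → Hom
        τ r = χΦ β (λ j → e j r *P w₀)

        bias′ : Biased M N₁ (λ y → ev (Ξ β m) (rd +P d *P y))
        bias′ = subst (λ s → SA.Q^ N₁ ℤ.* SA.Q^ N₁ ℤ.≤ (SA.Q^ M ℤ.* SA.Q^ M) ℤ.* (s ℤ.* s)) (SA.S-cong N₁ (λ y → sym (ev-Ξ β m (candidate y)))) bias

        d^-G : ∀ r → r ≤ K → GP dk (d ^P r)
        d^-G r r≤K = GP-mono {suc (r ℕ.* D)} {dk} {d ^P r} (s≤s (ℕ.*-monoˡ-≤ D r≤K)) (SA.G-↑ r {D} {d} dG)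

        rearrange : ∀ e₀ r g f → r ≤ K → ((e₀ *P w₀) *P (g *P f)) ≈ ((m *P e₀) *P (d ^P r *P (g *P (d ^P (K ∸ r) *P f))))
        rearrange e₀ r g f r≤K = begin
          (e₀ *P (m *P d ^P K)) *P (g *P f)
            ≈⟨ P.*-congʳ {g *P f} {e₀ *P (m *P d ^P K)} {(m *P e₀) *P (d ^P r *P d ^P (K ∸ r))} (P.trans {e₀ *P (m *P d ^P K)} {(e₀ *P m) *P d ^P K} {(m *P e₀) *P (d ^P r *P d ^P (K ∸ r))}
                 (P.sym {(e₀ *P m) *P d ^P K} {e₀ *P (m *P d ^P K)} (P.*-assoc e₀ m (d ^P K)))
                 (P.*-cong {e₀ *P m} {m *P e₀} {d ^P K} {d ^P r *P d ^P (K ∸ r)} (P.*-comm e₀ m)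
                   (P.trans {d ^P K} {d ^P (r ℕ.+ (K ∸ r))} {d ^P r *P d ^P (K ∸ r)} (P.reflexive (cong (d ^P_) (sym (ℕ.m+[n∸m]≡n r≤K)))) (SA.ℛ^.^-homo-* d r (K ∸ r))))) ⟩
          ((m *P e₀) *P (A *P B)) *P (g *P f)
            ≈⟨ P.*-assoc (m *P e₀) (A *P B) (g *P f) ⟩
          (m *P e₀) *P ((A *P B) *P (g *P f))
            ≈⟨ P.*-congˡ {m *P e₀} {(A *P B) *P (g *P f)} {A *P (g *P (B *P f))} (begin
                 (A *P B) *P (g *P f)   ≈⟨ P.*-assoc A B (g *P f) ⟩
                 A *P (B *P (g *P f))   ≈⟨ P.*-congˡ {A} {B *P (g *P f)} {g *P (B *P f)} (begin
                     B *P (g *P f)      ≈⟨ P.*-assoc B g f ⟨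
                     (B *P g) *P f      ≈⟨ P.*-congʳ {f} {B *P g} {g *P B} (P.*-comm B g) ⟩
                     (g *P B) *P f      ≈⟨ P.*-assoc g B f ⟩
                     g *P (B *P f) ∎) ⟩
                 A *P (g *P (B *P f)) ∎) ⟩
          (m *P e₀) *P (A *P (g *P (B *P f))) ∎
          where
          open import Relation.Binary.Reasoning.Setoid P.setoid
          A = d ^P r
          B = d ^P (K ∸ r)

        single : ∀ r → r < K → Σ Poly λ g → (¬ g ≈ 0P) × GP b g × Kill (τ r) N₃ g
        single r r<K with relevant r
        ... | inj₁ e≈0 = 1P , (λ h → 0≢1 (sym (h 0))) , GP-mono {1} {b} {1P} (s≤s z≤n) (vanish 1P)
          , λ f gf → χΦ-zero β (λ j → e j r *P w₀) (1P *P f) (λ j → P.trans {e j r *P w₀} {0P *P w₀} {0P} (P.*-congʳ {w₀} {e j r} {0P} (e≈0 j)) (P.zeroˡ w₀))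
        ... | inj₂ (e≈c , p∤r , good) =
          let (g , g≄0 , gG , kill) = inv (Ξ β m) M N₁ N₂ r rd d bnd (good β m) p∤r bias′ inv-fits
          in g , g≄0 , GP-mono {a ℕ.* suc M} {b} {g} (ℕ.n≤1+n _) gG , λ f gf → trans
               (cong χ (Φ-cong β (λ j → (e j r *P w₀) *P (g *P f)) (λ j → (m *P c j r) *P (d ^P r *P (g *P (d ^P (K ∸ r) *P f)))) (λ j → P.trans {(e j r *P w₀) *P (g *P f)} {(c j r *P w₀) *P (g *P f)} {(m *P c j r) *P (d ^P r *P (g *P (d ^P (K ∸ r) *P f)))}
                  (P.*-congʳ {g *P f} {e j r *P w₀} {c j r *P w₀} (P.*-congʳ {w₀} {e j r} {c j r} (e≈c j))) (rearrange (c j r) r g f (ℕ.<⇒≤ r<K)))))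
               (kill (d ^P (K ∸ r) *P f) (*ᶠ-vanish (d^-G (K ∸ r) (ℕ.m∸n≤m K r)) gf))
          where
          bnd : Bnd (Ξ β m)
          bnd j K≤j x = χΦ-zero β (λ i → m *P c i j) x (λ i → P.trans {m *P c i j} {m *P 0P} {0P} (P.*-congˡ {m} {c i j} {0P} (out i j K≤j)) (P.zeroʳ m))

        common : Σ Poly λ g → (¬ g ≈ 0P) × GP (suc (K ℕ.* b)) g × (∀ r → r < K → Kill (τ r) N₄ g)
        common = SA.common-multiple τ b N₄ N₃ K ℕ.≤-refl single

        g : Poly
        g = proj₁ common

        -- W collects the multiplier m, the power d ^ K, the common annihilator g and the pivot E.
        w₁ W z n : Poly
        w₁ = w₀ *P g
        W = E *P w₁
        z = W *P d
        n = rs z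

        W≄0 : ¬ W ≈ 0P
        W≄0 = domainP {E} {w₁} E≄0 (domainP {w₀} {g} (domainP {m} {d ^P K} m≄0 (^P-nonzero K)) (proj₁ (proj₂ common)))

        z≄0 : ¬ z ≈ 0P
        z≄0 = domainP {W} {d} W≄0 d≄0

        zG : GP DZ z
        zG = *ᶠ-vanish (GP-mono {u ℕ.+ ((M ℕ.+ dk) ℕ.+ suc (K ℕ.* b))} {u ℕ.+ (M ℕ.+ (dk ℕ.+ suc (K ℕ.* b)))} {W}
               (ℕ.≤-reflexive (cong (u ℕ.+_) (ℕ.+-assoc M dk (suc (K ℕ.* b)))))
               (*ᶠ-vanish (GP-mono {bound E} {u} {E} E≤u (vanish E)) (*ᶠ-vanish (*ᶠ-vanish mG (d^-G K ℕ.≤-refl)) (proj₁ (proj₂ (proj₂ common)))))) dG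

        nG : GP DZ n
        nG = let (k , k<DZ , dk) = degree z DZ z≄0 zG in GP-mono {k} {DZ} {n} (ℕ.<⇒≤ k<DZ) (rs-small z z≄0 k dk)

        w₁-kill : ∀ r → r < K → ∀ f → GP N₄ f → fun (χΦ β (λ j → e j r *P w₁)) f ≡ 0𝔸
        w₁-kill r r<K f gf = trans (χΦ-cong β (λ j → e j r *P w₁) (λ j → (e j r *P w₀) *P g) f (λ j → P.sym {(e j r *P w₀) *P g} {e j r *P w₁} (P.*-assoc (e j r) w₀ g)))
          (trans (sym (χΦ-∙ β (λ j → e j r *P w₀) g f)) (proj₂ (proj₂ (proj₂ common)) r r<K f gf))

        -- The coefficients of W β_i at t^(-1), ..., t^(-N₅) vanish. The unit vector singles out one
        -- β_i, and `χΦ-detects` returns from 𝔽_p to 𝔽_q.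
        pair-kill : ∀ i f → GP N₅ f → pair (β i) 0 (W *P f) ≡ 0F
        pair-kill i f gf = trans (sym (trans (sumFin-single (λ j → pair (β j) 0 ((LA.unit E i j *P w₁) *P f)) i off)
              (pair-cong (β i) 0 {(LA.unit E i i *P w₁) *P f} {W *P f} (P.*-congʳ {f} {LA.unit E i i *P w₁} {W} (P.*-congʳ {w₁} {LA.unit E i i} {E} (LA.unit-same E i))))))
            (χΦ-detects β (λ j → LA.unit E i j *P w₁) N₅ (unit-kill i β w₁ N₄ N₅ w₁-kill ℕ.≤-refl) f gf)
          where
          off : ∀ j → j ≢ i → pair (β j) 0 ((LA.unit E i j *P w₁) *P f) ≡ 0F
          off j j≢i = pair-cong (β j) 0 {(LA.unit E i j *P w₁) *P f} {0P} (P.trans {(LA.unit E i j *P w₁) *P f} {(0P *P w₁) *P f} {0P}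
            (P.*-congʳ {f} {LA.unit E i j *P w₁} {0P *P w₁} (P.*-congʳ {w₁} {LA.unit E i j} {0P} (LA.unit-diff E (λ eq → j≢i (sym eq)))))
            (P.trans {(0P *P w₁) *P f} {0P *P f} {0P} (P.*-congʳ {f} {0P *P w₁} {0P} (P.zeroˡ w₁)) (P.zeroˡ f)))

        hP-G : ∀ j → GP H (hP j n)
        hP-G j = sumP-G {H} K (λ r → c j r *P n ^P r) (λ r r<K → GP-mono {u ℕ.+ suc (r ℕ.* DZ)} {H} {c j r *P n ^P r}
          (ℕ.+-monoʳ-≤ u (s≤s (ℕ.*-monoˡ-≤ DZ (ℕ.<⇒≤ r<K))))
          (*ᶠ-vanish (GP-mono {bound (c j r)} {u} {c j r} (c≤u j r r<K) (vanish (c j r))) (SA.G-↑ r {DZ} {n} nG)))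

        small : Small n
        small i i<M = sumFin-0 (λ j → term j)
          where
          term : ∀ j → pair (β j) 0 (tP ^P i *P hP j n) ≡ 0F
          term j = trans (pair-cong (β j) 0 {tP ^P i *P hP j n} {W *P (tP ^P i *P (c′ *P d))} (begin
                tP ^P i *P hP j n            ≈⟨ P.*-congˡ {tP ^P i} {hP j n} {c′ *P (W *P d)} eq ⟩
                tP ^P i *P (c′ *P (W *P d))  ≈⟨ P.*-congˡ {tP ^P i} {c′ *P (W *P d)} {W *P (c′ *P d)} (swap c′ W d) ⟩
                tP ^P i *P (W *P (c′ *P d))  ≈⟨ swap (tP ^P i) W (c′ *P d) ⟩
                W *P (tP ^P i *P (c′ *P d)) ∎))
              (pair-kill j (tP ^P i *P (c′ *P d)) (GP-mono {i ℕ.+ (H ℕ.+ D)} {N₅} {tP ^P i *P (c′ *P d)} (ℕ.+-monoˡ-≤ (H ℕ.+ D) (ℕ.<⇒≤ i<M))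
                (SA.t^-G i {H ℕ.+ D} {c′ *P d} (*ᶠ-vanish c′G dG))))
            where
            open import Relation.Binary.Reasoning.Setoid P.setoid
            c′ = proj₁ (rs-root z z≄0 j)
            eq : hP j n ≈ (c′ *P z)
            eq = proj₂ (rs-root z z≄0 j)
            -- The cofactor has degree at most that of h_j(n), so with t^i and d it fits into N₅.
            c′G : GP H c′
            c′G = GP-cancel {H} c′ z z≄0 (λ l le → trans (sym (eq l)) (hP-G j l le))
            swap : ∀ x y v → (x *P (y *P v)) ≈ (y *P (x *P v))
            swap x y v = P.trans {x *P (y *P v)} {(x *P y) *P v} {y *P (x *P v)} (P.sym {(x *P y) *P v} {x *P (y *P v)} (P.*-assoc x y v))
              (P.trans {(x *P y) *P v} {(y *P x) *P v} {y *P (x *P v)} (P.*-congʳ {v} {x *P y} {y *P x} (P.*-comm x y)) (P.*-assoc y x v))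

        goal : Goal
        goal = n , GP-mono {DZ} {N} {n} DZ≤N nG , rs-compatible W d z W≄0 d≄0 (λ _ → refl) , small

      -- χ might vanish at the nonzero coefficient itself, so the power of t is rescaled to move the
      -- coefficient to y₀.
      nonvanishing : ∀ y → ¬ Small (candidate y) → Σ Poly λ x → GP M x × fun (ψ y) x ≢ 0𝔸
      nonvanishing y ns with ℕ.anyUpTo? (λ i → ¬? (Φ β (λ j → tP ^P i *P hP j (candidate y)) ≟F 0F)) M
      ... | no none = contradiction (λ i i<M → decidable-stable (_ ≟F 0F) (λ ne → none (i , i<M , ne))) ns
      ... | yes (i , i<M , w≢0) = scaleP v (tP ^P i) , scaleP-G v (tP ^P i) tG , λ h → proj₂ χ-nontrivial (trans (cong χ (sym value)) h)
        where
        w = Φ β (λ j → tP ^P i *P hP j (candidate y))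
        y₀ = proj₁ χ-nontrivial
        v = y₀ *F proj₁ (inverse w w≢0)
        tG : GP M (tP ^P i)
        tG l M≤l = trans (tP^ i l) (monomial-≢ 1F i l (λ { refl → ℕ.<⇒≱ i<M M≤l }))
        value : Φ β (λ j → scaleP v (tP ^P i) *P hP j (candidate y)) ≡ y₀
        value = trans (Φ-cong β (λ j → scaleP v (tP ^P i) *P hP j (candidate y)) (λ j → scaleP v (tP ^P i *P hP j (candidate y))) (λ j → *ᶠ-scale v (coeff (tP ^P i)) (coeff (hP j (candidate y))))) (trans (Φ-scale β v (λ j → tP ^P i *P hP j (candidate y)))
          (trans (F.*-assoc y₀ _ w) (trans (cong (y₀ *F_) (trans (F.*-comm _ w) (proj₂ (inverse w w≢0)))) (F.*-identityʳ y₀))))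

      goal : Goal
      goal with ∑-find (λ y → small? (candidate y)) (GsP N₁)
      ... | yes (y , y∈ , sm) = found y (GsP-G N₁ y y∈) sm
      ... | no none = let (m , mG , m≄0 , bias) = SA.biased-multiplier M N₁ ψ (λ y y∈ → nonvanishing y (λ sm → none (y , y∈ , sm)))
                      in WithMultiplier.goal m mG m≄0 bias

open import Data.Integer using (+_)
open import Data.Rational using (ℚ; 0ℚ; _*_; -_; _/_; floor) renaming (_<_ to _<ℚ_)
open Reciprocals

-- The conditions on 𝒦 and the assembly of the theorem.

module Solution {q : ℕ} (𝔽 : FiniteField q) (p : ℕ) (ic : Over.IsCharacteristic 𝔽 p) (𝒦 : List ℕ) where
  import Data.Nat.DivMod as ℕ
  open import Data.Nat.Divisibility using (_∣_; _∣0)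
  open import Data.Integer using (-[1+_])
  import Data.List.Membership.DecPropositional ℕ._≟_ as DecMembership

  K : ℕ
  K = suc (maxL 𝒦)

  open MajorArcs 𝔽 p ic K (s≤s z≤n)
  open SA using (fun; ev; Bnd; Good; Biased)
  open Target C.primeTarget using (0ᴬ)

  abstract
    progression : Σ ℕ λ a → ∀ Λ c N N₂ k r d → Bnd Λ → Good Λ k → ¬ (p ∣ k) → Biased c N (λ y → ev Λ (r +P d *P y)) → a ℕ.* (suc c ℕ.+ N₂) ≤ N →
      Σ Poly λ g → (¬ g ≈ 0P) × GP (a ℕ.* suc c) g × (∀ x → GP N₂ x → fun (Λ k) (d ^P k *P (g *P x)) ≡ 0ᴬ)
    progression = SA.inverse-constant , SA.inverse-progression

  a slope : ℕ
  a = proj₁ progression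
  slope = Slope.s K a

  module Solve (L : ℕ) (𝒦s : Fin L → List ℕ)
    (cover : ∀ r → (r ∈ 𝒦 → Σ (Fin L) λ j → r ∈ 𝒦s j) × (Σ (Fin L) (λ j → r ∈ 𝒦s j) → r ∈ 𝒦))
    (c : Fin L → ℕ → Poly) (supported : ∀ j → SupportedOn (c j) (𝒦s j))
    (e : Fin L → ℕ → Poly) (portion : IsMaxPortion p 𝒦 L 𝒦s c e) (independent : LinIndepOverK L e) where
    open System c e

    _∈?_ : ∀ r l → Dec (r ∈ l)
    r ∈? l = DecMembership._∈?_ r l

    c-zero : ∀ j r → r ≢ 0 → r ∉ 𝒦s j → c j r ≈ 0P
    c-zero j r r≢0 r∉ = proj₂ (proj₂ (supported j)) r r≢0 r∉

    c-zero𝒦 : ∀ j r → r ≢ 0 → r ∉ 𝒦 → c j r ≈ 0P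
    c-zero𝒦 j r r≢0 r∉ = c-zero j r r≢0 (λ m → r∉ (proj₂ (cover r) (j , m)))

    beyond : ∀ {r} → K ≤ r → r ∉ 𝒦
    beyond K≤r m = ℕ.<⇒≱ (s≤s (∈⇒≤maxL 𝒦 m)) K≤r

    nonzero : ∀ {r} → K ≤ r → r ≢ 0
    nonzero () refl

    c-out : ∀ j r → K ≤ r → c j r ≈ 0P
    c-out j r K≤r = c-zero𝒦 j r (nonzero K≤r) (beyond K≤r)

    e-out : ∀ j r → K ≤ r → e j r ≈ 0P
    e-out j r K≤r = proj₂ (portion j r) (λ { (m , _) → beyond K≤r (proj₂ (cover r) (j , m)) })

    Peak : ℕ → Set
    Peak r = InStar p 𝒦 r × IsMaximalIn p 𝒦 r

    -- `InStar` ranges over all v and is not decided; but apart from membership in a list a peak is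
    -- defined by negations, so its double negation suffices.
    peak-stable : ∀ r → ¬ ¬ Peak r → Peak r
    peak-stable r nn =
      (r∈ , (λ p∣r → nn (λ { ((_ , p∤r , _) , _) → p∤r p∣r })) , λ v 1≤v s → nn (λ { ((_ , _ , ns) , _) → ns v 1≤v s }))
      , (r∈ , λ r′ r′∈ ne le → nn (λ { (_ , (_ , mx)) → mx r′ r′∈ ne le }))
      where
      r∈ : r ∈ 𝒦
      r∈ = decidable-stable (r ∈? 𝒦) (λ r∉ → nn (λ { ((m , _) , _) → r∉ m }))

    ≼⇒⪯ : ∀ {i j} → i SA.≼ j → i ⪯[ p ] j
    ≼⇒⪯ {i} {j} h d = h (subst (p ∣_) (sym (bin≡C j i)) d)

    -- Outside 𝒦 the coefficients are zero. For j in 𝒦 the case v = 0 contradicts maximality, and v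
    -- ≥ 1 would put p^v r into S(𝒦), against 𝒦*.
    peak-good : ∀ r → Peak r → ∀ β m → Good (Ξ β m) r
    peak-good r ((r∈ , p∤r , star) , (_ , maximal)) β m j v le j≢r x with j ∈? 𝒦
    ... | no j∉ = χΦ-zero β (λ i → m *P c i j) x (λ i → P.trans {m *P c i j} {m *P 0P} {0P} (P.*-congˡ {m} {c i j} {0P} (c-zero𝒦 i j j≢0 j∉)) (P.zeroʳ m))
      where
      1≤r : 1 ≤ r
      1≤r = ℕ.n≢0⇒n>0 (λ { refl → p∤r (p ∣0) })
      j≢0 : j ≢ 0
      j≢0 refl = ℕ.<⇒≱ (ℕ.≤-trans 1≤r (SA.k≤p^v*k v r)) (SA.≼⇒≤ {p ℕ.^ v ℕ.* r} {0} le)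
    peak-good r ((r∈ , p∤r , star) , (_ , maximal)) β m j zero le j≢r x | yes j∈ =
      contradiction (≼⇒⪯ {r} {j} (subst (SA._≼ j) (ℕ.*-identityˡ r) le)) (maximal j j∈ j≢r)
    peak-good r ((r∈ , p∤r , star) , (_ , maximal)) β m j (suc v) le j≢r x | yes j∈ =
      contradiction (ℕ.≤-trans (ℕ.n≢0⇒n>0 (λ { refl → p∤r (p ∣0) })) (SA.k≤p^v*k (suc v) r) , j , j∈ , ≼⇒⪯ {p ℕ.^ suc v ℕ.* r} {j} le) (star (suc v) (s≤s z≤n))

    -- The distinction is made on the vanishing of column r of e, which is decidable; a nonzero
    -- entry refutes that r is no peak.
    relevant : ∀ r → (∀ j → e j r ≈ 0P) ⊎ ((∀ j → e j r ≈ c j r) × ¬ (p ∣ r) × (∀ β m → Good (Ξ β m) r))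
    relevant r with Fin.any? (λ j → ¬? (zero? (e j r)))
    ... | no none = inj₁ (λ j → decidable-stable (zero? (e j r)) (λ ne → none (j , ne)))
    ... | yes (j₀ , ne) = inj₂ (same , p∤r , peak-good r peak)
      where
      peak : Peak r
      peak = peak-stable r (λ np → ne (proj₂ (portion j₀ r) (λ { (_ , s , m) → np (s , m) })))
      p∤r : ¬ (p ∣ r)
      p∤r = proj₁ (proj₂ (proj₁ peak))
      same : ∀ j → e j r ≈ c j r
      same j with r ∈? 𝒦s j
      ... | yes m = proj₁ (portion j r) (m , proj₁ peak , proj₂ peak)
      ... | no r∉ = λ i → trans (proj₂ (portion j r) (λ { (m , _) → r∉ m }) i) (sym (c-zero j r (λ { refl → p∤r (p ∣0) }) r∉ i))

    spanning : Σ Poly λ E → (¬ E ≈ 0P) × (∀ i → LA.Span columns K (LA.unit E i))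
    spanning = independent⇒spanning e K e-out independent

    E : Poly
    E = proj₁ spanning

    sizes = size-bound E (proj₂ (proj₂ spanning))

    u : ℕ
    u = proj₁ sizes

    top<K : ∀ j → maxL (𝒦s j) < K
    top<K j = s≤s (maxL-lub (𝒦s j) (maxL 𝒦) (λ r m → ∈⇒≤maxL 𝒦 (proj₂ (cover r) (j , m))))

    value : Fin L → Poly → PolyFn
    value j x = evalU (maxL (𝒦s j)) (c j) x

    value≈ : ∀ j x → value j x ≈ᶠ coeff (hP j x)
    value≈ j x = evalU-polyValue K (maxL (𝒦s j)) (c j) x
      (λ r lt → c-zero j r (λ { refl → contradiction lt (λ ()) }) (λ m → ℕ.<⇒≱ lt (∈⇒≤maxL (𝒦s j) m))) (top<K j)

    module At (rs : Poly → Poly)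
      (rs-small : ∀ y → NonZero y → ∀ k → IsDeg y k → InG (rs y) (+ k))
      (rs-compatible : ∀ m y z → NonZero m → NonZero y → coeff z ≈ᶠ (coeff m *ᶠ coeff y) → CongMod (coeff (rs z)) (coeff (rs y)) y)
      (rs-root : ∀ y → NonZero y → ∀ j → CongMod (value j (rs y)) 0ᶠ y)
      (N : ℕ) (N₀<N : suc (slope ℕ.* suc u) < N) (d : Poly) (d≄0 : NonZero d) (dG : InG d (floor (reciprocal slope * (+ N / 1))))
      (β : Fin L → Laurent) where

      M : ℕ
      M = N ℕ./ suc slope

      root : ∀ y → ¬ y ≈ 0P → ∀ j → Σ Poly λ c′ → hP j (rs y) ≈ (c′ *P y)
      root y y≄0 j = let (c′ , h) = rs-root y y≄0 j in
        c′ , λ i → trans (sym (value≈ j (rs y) i)) (trans (sym (trans (cong (value j (rs y) i +F_) FP.-0#≈0#) (F.+-identityʳ _))) (h i))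

      open Endgame a (proj₂ progression) c-out relevant E (proj₁ (proj₂ spanning)) u (proj₁ (proj₂ sizes))
        (proj₁ (proj₂ (proj₂ sizes))) (proj₂ (proj₂ (proj₂ sizes))) rs
        (λ y y≄0 k dk i k≤i → rs-small y y≄0 k dk i (ℤ.+≤+ k≤i)) rs-compatible root
        -- The same M counts the coefficients to be killed and bounds the degree of d, since θ and σ
        -- are the same reciprocal.
        M M N (Slope.enough K a u N (ℕ.<-trans (ℕ.n<1+n _) N₀<N)) d d≄0
        (λ i M≤i → dG i (ℤ.≤-trans (floor-reciprocal slope N) (ℤ.+≤+ M≤i))) β

      α : ∀ n → ℤ → F
      α n i = sumFin (λ j → mulLP (β j) (value j n) (evalBound (maxL (𝒦s j)) (c j) n) i)

      small-order : ∀ n → Small n → ∀ i → i ℤ.< ℤ.0ℤ → - (reciprocal slope * (+ N / 1)) <ℚ (i / 1) → α n i ≡ 0F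
      small-order n sm (+ _) (ℤ.+<+ ()) _
      small-order n sm -[1+ i ] _ lt = trans
        (sumFin-cong (λ j → trans (mulLP-pair (β j) (value j n) (hP j n) (evalBound (maxL (𝒦s j)) (c j) n) i (value≈ j n) (evalU-vanish (maxL (𝒦s j)) (c j) n))
          (sym (trans (pair-t^ (β j) 0 i (hP j n)) (cong (λ z → pair (β j) z (hP j n)) (ℕ.+-identityʳ i))))))
        (sm i (ℕ.≤-trans (ℕ.≤-reflexive (sym (ℕ.m*n/n≡m (suc i) (suc slope)))) (ℕ./-monoˡ-≤ (suc slope) (ℕ.<⇒≤ (order-bound slope N i lt)))))

      result : Σ Poly λ n → InG n (+ N) × CongMod (coeff n) (coeff (rs d)) d ×
        Over.FracOrdLe 𝔽 (α n) (- (reciprocal slope * (+ N / 1)))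
      result = let (n , nG , cong-d , sm) = goal in
        n , (λ i N≤i → nG i (ℤ.drop‿+≤+ N≤i)) , cong-d , small-order n sm

theorem4p1 : ∀ {q} (𝔽 : FiniteField q) → let open Over 𝔽 in
    (p : ℕ) → IsCharacteristic p →
    (𝒦 : List ℕ) →
    Σ ℚ λ θ → 0ℚ <ℚ θ ×
    ((L : ℕ) → 1 ≤ L →
    (𝒦s : Fin L → List ℕ) →
    (∀ r → (r ∈ 𝒦 → Σ (Fin L) λ j → r ∈ 𝒦s j) × (Σ (Fin L) (λ j → r ∈ 𝒦s j) → r ∈ 𝒦)) →
    (c : Fin L → ℕ → Poly) →
    (∀ j → SupportedOn (c j) (𝒦s j)) →
    (∀ g → NonZero g → Σ Poly λ m →
    ∀ i → CongMod (evalU (maxL (𝒦s i)) (c i) m) 0ᶠ g) →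
    Σ (Fin L → ℕ → Poly) (λ e → IsMaxPortion p 𝒦 L 𝒦s c e × LinIndepOverK L e) →
    Σ ℚ λ σ → 0ℚ <ℚ σ × Σ ℕ λ N₀ → 1 ≤ N₀ ×
    ((rs : Poly → Poly) →
    (∀ y → NonZero y → ∀ k → IsDeg y k → InG (rs y) (+ k)) →
    (∀ m y z → NonZero m → NonZero y → coeff z ≈ᶠ (coeff m *ᶠ coeff y) →
    CongMod (coeff (rs z)) (coeff (rs y)) y) →
    (∀ y → NonZero y → ∀ j → CongMod (evalU (maxL (𝒦s j)) (c j) (rs y)) 0ᶠ y) →
    (N : ℕ) → N₀ < N →
    (d : Poly) → NonZero d → InG d (floor (σ * (+ N / 1))) →
    (β : Fin L → Laurent) →
    Σ Poly λ n → InG n (+ N) × CongMod (coeff n) (coeff (rs d)) d ×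
    FracOrdLe
    (λ i → sumFin
    (λ j → mulLP (β j) (evalU (maxL (𝒦s j)) (c j) n)
    (evalBound (maxL (𝒦s j)) (c j) n) i))
    (- (θ * (+ N / 1)))))
theorem4p1 𝔽 p ic 𝒦 = reciprocal slope , reciprocal>0 slope ,
  λ L _ 𝒦s cover c supported _ (e , portion , independent) →
    let open Solve L 𝒦s cover c supported e portion independent in
    -- The h_j enter only through `u`, hence only in the choice of N₀.
    reciprocal slope , reciprocal>0 slope , suc (slope ℕ.* suc u) , s≤s z≤n ,
    λ rs rs-small rs-compatible rs-root N N₀<N d d≄0 dG β →
      At.result rs rs-small rs-compatible rs-root N N₀<N d d≄0 dG β
  where open Solution 𝔽 p ic 𝒦
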